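{- Let $q$ be a power of an odd prime, let $d \geq 2$, and let $t \in \mathbb{F}_q$ with $t \neq 0$. There is a constant $C$ depending only on $d$ such that if $E \subseteq \mathbb{F}_q^d$ satisfies \[ |E| \geq \begin{cases} C q^{7/4} & d=2,\\ C q^{7/3} & d=3,\\ C q^{d-\frac{1}{d-1}} & d\geq 4,\end{cases} \] then the VC-dimension of $\mathcal{H}_t^d(E)$ is equal to $d$.
   Context: For $x \in \mathbb{F}_q^d$ write $\|x\| = x_1^2+\cdots+x_d^2$ (no square root). For $E\subseteq \mathbb{F}_q^d$, $\mathcal{H}_t^d(E) = \{h_{u,v} : (u,v)\in E\times E,\ u\neq v\}$ where $h_{u,v}:E\to\{0,1\}$ is $h_{u,v}(x)=1$ if $\|x-u\|=\|x-v\|=t$ and $h_{u,v}(x)=0$ otherwise. A collection $\mathcal{H}$ of functions $X\to\{0,1\}$ shatters a finite $C\subseteq X$ if the restrictions of functions in $\mathcal{H}$ to $C$ give all functions $C\to\{0,1\}$; the VC-dimension of $\mathcal{H}$ is the maximal size of a set it shatters. -}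

module Defs where

open import Level using (0ℓ)
open import Data.Nat as ℕ using (ℕ; suc; _≤_; _^_)
open import Data.Unit using (⊤)
open import Data.Bool using (Bool; true; false; _∧_)
open import Data.Vec using (Vec; foldr; zipWith)
open import Data.List using (List; length)
open import Data.List.Membership.Propositional using (_∈_)
open import Data.List.Relation.Unary.Unique.Propositional using (Unique)
open import Data.Product using (Σ; ∃; ∃-syntax; _×_; _,_)
open import Relation.Nullary using (¬_; Dec; yes; no)
open import Relation.Binary.PropositionalEquality using (_≡_; _≢_)
open import Algebra.Structures using (IsCommutativeRing)

record FiniteField : Set₁ where
  field
    Carrier : Set
    _+_ _*_ : Carrier → Carrier → Carrier
    -_      : Carrier → Carrier
    0# 1#   : Carrier
    isCommutativeRing : IsCommutativeRing _≡_ _+_ _*_ -_ 0# 1#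
    0≢1     : 0# ≢ 1#
    inverse : ∀ x → x ≢ 0# → ∃[ y ] (x * y ≡ 1#)
    _≟_     : (x y : Carrier) → Dec (x ≡ y)
    elements : List Carrier
    elements-unique   : Unique elements
    elements-complete : ∀ x → x ∈ elements

  order : ℕ
  order = length elements

open FiniteField public using () renaming (Carrier to ⟨_⟩; order to order)

module _ (F : FiniteField) where
  open FiniteField F

  Point : ℕ → Set
  Point d = Vec Carrier d

  norm : ∀ {d} → Point d → Carrier
  norm x = foldr _ (λ a s → (a * a) + s) 0# x

  _⊖_ : ∀ {d} → Point d → Point d → Point d
  x ⊖ y = zipWith (λ a b → a + (- b)) x y

  h : ∀ {d} → Carrier → Point d → Point d → Point d → Bool
  h t u v x with norm (x ⊖ u) ≟ t | norm (x ⊖ v) ≟ t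
  ... | yes _ | yes _ = true
  ... | _     | _     = false

  -- A finite subset of F_q^d: a duplicate-free list of points; |E| = length E.
  -- H_t^d(E) shatters C ⊆ E: every function C → {0,1} is the restriction of
  -- some h_{u,v} with u, v ∈ E, u ≠ v.  (Every function C → Bool extends to
  -- Point d → Bool, so quantifying over the latter is equivalent.)
  Shatters : ∀ {d} → Carrier → List (Point d) → List (Point d) → Set
  Shatters t E C =
    (f : Point _ → Bool) →
    ∃[ u ] ∃[ v ] (u ∈ E × v ∈ E × u ≢ v × (∀ x → x ∈ C → h t u v x ≡ f x))

  SubsetOf : ∀ {d} → List (Point d) → List (Point d) → Set
  SubsetOf E C = Unique C × (∀ x → x ∈ C → x ∈ E)

  VCdim≡ : ∀ {d} → Carrier → List (Point d) → ℕ → Set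
  VCdim≡ t E n =
    (∃[ C ] (SubsetOf E C × Shatters t E C × length C ≡ n)) ×
    (∀ C → SubsetOf E C → Shatters t E C → length C ≤ n)

-- |E| ≥ C q^{a/b}  written as  C^b * q^a ≤ |E|^b  (all quantities ≥ 0).
-- d = 2: exponent 7/4; d = 3: 7/3; d ≥ 4: d - 1/(d-1) = (d(d-1)-1)/(d-1).
SizeCondition : (d C q n : ℕ) → Set
SizeCondition 0 C q n = ⊤
SizeCondition 1 C q n = ⊤
SizeCondition 2 C q n = C ^ 4 ℕ.* q ^ 7 ≤ n ^ 4
SizeCondition 3 C q n = C ^ 3 ℕ.* q ^ 7 ≤ n ^ 3
SizeCondition d@(suc (suc (suc (suc _)))) C q n =
  C ^ (d ℕ.∸ 1) ℕ.* q ^ (d ℕ.* (d ℕ.∸ 1) ℕ.∸ 1) ≤ n ^ (d ℕ.∸ 1)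

{-# OPTIONS --safe #-}

-- Upper bound: if C is shattered, then two distinct spheres contain C, so the vectors (1, x) with x in C
-- are orthogonal to a nonzero vector.  If |C| > d they satisfy a relation Σ cᵢ (1, xᵢ) = 0; evaluating it on a
-- sphere through all points of C but one xⱼ with cⱼ ≠ 0 gives a contradiction.
--
-- Lower bound: the number of pairs of E at distance t is close to |E|²/q.  For d = 2 this follows, through the
-- projections onto lines, from the Weil bound for the curves Tr(s + β/s) = c, which Stepanov's method gives over
-- a tower of quadratic extensions; dimension d ≥ 3 is sliced into copies of dimension 3.
-- For d = 2 one applies the estimate to E ∩ (E − a) with ‖a‖ = t to find rhombi, of which all but few have two
-- opposite vertices that form a shattered set.  For d ≥ 3 choose u, v with many common neighbours such that
-- ‖u − v‖ ≠ 0, 4t.  Any further sphere of radius t meets this set of common neighbours in few points, so a random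
-- d-tuple in it has, for every pattern, a point of E that realizes exactly this pattern of distances t, because
-- d − 1 random common neighbours typically still have many common neighbours in E.

module Submission where

open import Defs
open import Algebra.Bundles using (CommutativeRing)
import Algebra.Properties.Ring
import Algebra.Properties.Semiring.Mult
import Algebra.Properties.CommutativeSemiring.Exp
import Algebra.Solver.Ring
import Algebra.Solver.Ring.AlmostCommutativeRing as ACR
open import Data.Maybe using (Maybe; just; nothing)
open import Data.Nat as ℕ using (suc; zero; ℕ)
import Data.Nat.Properties as ℕₚ
open import Data.Nat.Divisibility using (_∣_; divides)
open import Data.Integer as ℤ using (+_; -[1+_]; -_; 0ℤ; 1ℤ; _*_; _+_; _-_; _<_; _≤_; ℤ)
open import Data.Integer.Properties as ℤₚ using (≤-trans; ≤-reflexive; ≤-refl; <-≤-trans; ≤-<-trans; <⇒≤; <-irrefl; ≤-antisym; ≰⇒>; ≮⇒≥; pos-*)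
open import Data.Integer.Tactic.RingSolver using (solve-∀)
open import Data.List as List using (List; []; _∷_; cartesianProductWith; filter; length)
open import Data.List.Membership.Propositional using (_∈_; _∉_; find; lose)
open import Data.Vec as Vec using (Vec; []; _∷_)
open import Data.Fin as Fin using (Fin; suc; zero)
open import Data.Product using (_,_; _×_; proj₁; proj₂; Σ; ∃-syntax)
open import Data.Sum using (_⊎_; inj₁; inj₂)
open import Data.Empty using (⊥; ⊥-elim)
open import Function using (_∘_; id; mk⇔)
open import Relation.Nullary using (Dec; contradiction; no; yes; ¬_)
open import Relation.Nullary.Decidable using (_×-dec_; map′; ¬?; ⌊_⌋)
open import Relation.Binary.PropositionalEquality
open import Data.List.Relation.Unary.Any as Any using (here; there)
open import Data.List.Relation.Unary.Any.Properties using (lookup-index)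
open import Data.List.Membership.Propositional.Properties using (∈-++⁺ˡ; ∈-allFin; ∈-cartesianProductWith⁺; ∈-filter⁺; ∈-filter⁻; ∈-lookup; ∈-map⁺; ∈-map⁻; ∈-tabulate⁻)
open import Data.List.Relation.Unary.All as All using (All)
import Data.List.Relation.Unary.AllPairs as AllPairs
open import Data.List.Relation.Unary.Unique.Propositional using (Unique)
import Data.List.Relation.Unary.Unique.Propositional.Properties as Uniqueₚ
open import Data.List.Relation.Binary.Permutation.Propositional as Perm using (_↭_)
open import Data.List.Relation.Binary.Permutation.Propositional.Properties using (↭-length)
open import Data.List.Membership.Propositional.Properties.WithK using (unique∧set⇒bag)
open import Data.List.Relation.Binary.BagAndSetEquality using (∼bag⇒↭)
import Data.Fin.Properties as Finₚ
import Data.Vec.Properties as Vecₚ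
open import Data.Bool as Bool using (Bool; false; not; true)
open import Algebra.Structures using (IsCommutativeRing)
import Data.List.Properties as Listₚ
open import Data.Nat.DivMod using (m%n<n; m<n*o⇒m/o<n; m≡m%n+[m/n]*n)
import Data.Nat.Tactic.RingSolver as ℕSolver

-- Finite sums of integers

-- No complex characters and no real numbers occur: sets are integer-valued indicators, spectral
-- bounds are bounds for quadratic forms on functions of sum zero, averages are multiplied out, and
-- √q enters through an integer Λ with 4q ≤ Λ² ≤ 16q. The plane is the hard case: circles project to
-- lines with kernels whose norms are Kloosterman sums, so square-root cancellation has to be
-- proved. In dimension 3 the sections of a sphere of any radius, even 0, are counted by elementary
-- means. This is why higher dimensions are sliced into copies of dimension 3: the slices see each
-- other at varying radii. The exponent 7/4 comes from using the planar estimate twice. It is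
-- informative for sets of more than about q^(3/2) points; the sets E ∩ (E - a) have on average
-- |E|²/q² points, and |E|²/q² > q^(3/2) means |E| > q^(7/4). In dimension d ≥ 3 the set is cut down
-- to a fixed constant times q^(d-1) points. With exactly this size the powers of q cancel when
-- tuples with few common neighbours are counted, and an inequality between constants remains.

private variable 𝒜 ℬ : Set

0≤* : ∀ {a b} → 0ℤ ≤ a → 0ℤ ≤ b → 0ℤ ≤ a * b
0≤* {+ m} {+ n} _ _ = subst (0ℤ ≤_) (pos-* m n) (ℤ.+≤+ ℕ.z≤n)

0≤+ : ∀ {a b} → 0ℤ ≤ a → 0ℤ ≤ b → 0ℤ ≤ a + b
0≤+ = ℤₚ.+-mono-≤

0≤n : ∀ {n} → 0ℤ ≤ + n
0≤n = ℤ.+≤+ ℕ.z≤n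

0≤sq : ∀ a → 0ℤ ≤ a * a
0≤sq a with ℤₚ.≤-total 0ℤ a
... | inj₁ p = 0≤* p p
... | inj₂ p = subst (0ℤ ≤_) (lem a) (0≤* (ℤₚ.neg-mono-≤ p) (ℤₚ.neg-mono-≤ p))
  where lem : ∀ a → - a * - a ≡ a * a
        lem = solve-∀

-- The shape of nearly all inequalities below: the ring solver equates the difference of the sides
-- with an expression whose nonnegativity can be read off.
≤-via : ∀ {a b c} → b - a ≡ c → 0ℤ ≤ c → a ≤ b
≤-via p q = ℤₚ.0≤i-j⇒j≤i (subst (0ℤ ≤_) (sym p) q)

diff≥0 : ∀ {a b} → a ≤ b → 0ℤ ≤ b - a
diff≥0 = ℤₚ.i≤j⇒0≤j-i

≤-*ˡ : ∀ {a b c} → 0ℤ ≤ c → a ≤ b → c * a ≤ c * b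
≤-*ˡ {a} {b} {c} p q = ≤-via (lem a b c) (0≤* p (diff≥0 q))
  where lem : ∀ a b c → c * b - c * a ≡ c * (b - a)
        lem = solve-∀

≤-*ʳ : ∀ {a b c} → 0ℤ ≤ c → a ≤ b → a * c ≤ b * c
≤-*ʳ {a} {b} {c} p q = ≤-via (lem a b c) (0≤* p (diff≥0 q))
  where lem : ∀ a b c → b * c - a * c ≡ c * (b - a)
        lem = solve-∀

≤-* : ∀ {a b c d} → 0ℤ ≤ a → 0ℤ ≤ d → a ≤ b → c ≤ d → a * c ≤ b * d
≤-* pa pd p q = ≤-trans (≤-*ˡ pa q) (≤-*ʳ pd p)

<⇒1+≤ : ∀ {a b} → a < b → 1ℤ + a ≤ b
<⇒1+≤ = ℤₚ.i<j⇒suc[i]≤j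

1+≤⇒< : ∀ {a b} → 1ℤ + a ≤ b → a < b
1+≤⇒< = ℤₚ.suc[i]≤j⇒i<j

*>0 : ∀ {a b} → 0ℤ < a → 0ℤ < b → 0ℤ < a * b
*>0 {a} {b} p r = 1+≤⇒< (≤-* {1ℤ} {a} {1ℤ} {b} 0≤n (<⇒≤ r) (<⇒1+≤ p) (<⇒1+≤ r))

^>0 : ∀ {a} → 0ℤ < a → ∀ m → 0ℤ < a ℤ.^ m
^>0 p zero    = ℤ.+<+ (ℕ.s≤s ℕ.z≤n)
^>0 p (suc m) = *>0 p (^>0 p m)

*-cancel-≤ : ∀ {a b c} → 0ℤ < c → c * a ≤ c * b → a ≤ b
*-cancel-≤ {a} {b} {c} p q = ≮⇒≥ λ b<a →
  <-irrefl refl (<-≤-trans (1+≤⇒< (≤-via (lem a b c) (0≤+ (0≤* (<⇒≤ p) (diff≥0 (<⇒1+≤ b<a))) (diff≥0 (<⇒1+≤ p))))) q)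
  where lem : ∀ a b c → c * a - (1ℤ + c * b) ≡ c * (a - (1ℤ + b)) + (c - (1ℤ + 0ℤ))
        lem = solve-∀

∑ : List 𝒜 → (𝒜 → ℤ) → ℤ
∑ []       f = 0ℤ
∑ (x ∷ xs) f = f x + ∑ xs f

∑-cong∈ : ∀ (xs : List 𝒜) {f g : 𝒜 → ℤ} → (∀ x → x ∈ xs → f x ≡ g x) → ∑ xs f ≡ ∑ xs g
∑-cong∈ []       p = refl
∑-cong∈ (x ∷ xs) p = cong₂ _+_ (p x (here refl)) (∑-cong∈ xs λ y q → p y (there q))

∑-cong : ∀ (xs : List 𝒜) {f g : 𝒜 → ℤ} → (∀ x → f x ≡ g x) → ∑ xs f ≡ ∑ xs g
∑-cong xs p = ∑-cong∈ xs λ x _ → p x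

∑-+ : ∀ (xs : List 𝒜) (f g : 𝒜 → ℤ) → ∑ xs (λ x → f x + g x) ≡ ∑ xs f + ∑ xs g
∑-+ []       f g = refl
∑-+ (x ∷ xs) f g = trans (cong (_+_ (f x + g x)) (∑-+ xs f g)) (lem (f x) (g x) _ _)
  where lem : ∀ a b c d → a + b + (c + d) ≡ a + c + (b + d)
        lem = solve-∀

∑-* : ∀ (xs : List 𝒜) (c : ℤ) (f : 𝒜 → ℤ) → ∑ xs (λ x → c * f x) ≡ c * ∑ xs f
∑-* []       c f = sym (ℤₚ.*-zeroʳ c)
∑-* (x ∷ xs) c f = trans (cong (_+_ (c * f x)) (∑-* xs c f)) (sym (ℤₚ.*-distribˡ-+ c (f x) _))

∑-*ʳ : ∀ (xs : List 𝒜) (f : 𝒜 → ℤ) (c : ℤ) → ∑ xs (λ x → f x * c) ≡ ∑ xs f * c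
∑-*ʳ xs f c = trans (∑-cong xs λ x → ℤₚ.*-comm (f x) c) (trans (∑-* xs c f) (ℤₚ.*-comm c _))

∑-0 : ∀ (xs : List 𝒜) → ∑ xs (λ _ → 0ℤ) ≡ 0ℤ
∑-0 []       = refl
∑-0 (x ∷ xs) = trans (ℤₚ.+-identityˡ _) (∑-0 xs)

∑-zero : ∀ (xs : List 𝒜) {f : 𝒜 → ℤ} → (∀ x → f x ≡ 0ℤ) → ∑ xs f ≡ 0ℤ
∑-zero xs p = trans (∑-cong xs p) (∑-0 xs)

∑-- : ∀ (xs : List 𝒜) (f g : 𝒜 → ℤ) → ∑ xs (λ x → f x - g x) ≡ ∑ xs f - ∑ xs g
∑-- []       f g = refl
∑-- (x ∷ xs) f g = trans (cong (_+_ (f x - g x)) (∑-- xs f g)) (lem (f x) (g x) _ _)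
  where lem : ∀ a b c d → a - b + (c - d) ≡ a + c - (b + d)
        lem = solve-∀

∑-const : ∀ (xs : List 𝒜) (c : ℤ) → ∑ xs (λ _ → c) ≡ + length xs * c
∑-const []       c = sym (ℤₚ.*-zeroˡ c)
∑-const (x ∷ xs) c = trans (cong (_+_ c) (∑-const xs c)) (lem c (+ length xs))
  where lem : ∀ c l → c + l * c ≡ (1ℤ + l) * c
        lem = solve-∀

∑-swap : ∀ (xs : List 𝒜) (ys : List ℬ) (f : 𝒜 → ℬ → ℤ) →
         ∑ xs (λ x → ∑ ys (f x)) ≡ ∑ ys (λ y → ∑ xs (λ x → f x y))
∑-swap []       ys f = sym (∑-0 ys)
∑-swap (x ∷ xs) ys f = trans (cong (_+_ (∑ ys (f x))) (∑-swap xs ys f)) (sym (∑-+ ys (f x) _))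

∑-mono∈ : ∀ (xs : List 𝒜) {f g : 𝒜 → ℤ} → (∀ x → x ∈ xs → f x ≤ g x) → ∑ xs f ≤ ∑ xs g
∑-mono∈ []       p = ≤-refl
∑-mono∈ (x ∷ xs) p = ℤₚ.+-mono-≤ (p x (here refl)) (∑-mono∈ xs λ y q → p y (there q))

∑-mono : ∀ (xs : List 𝒜) {f g : 𝒜 → ℤ} → (∀ x → f x ≤ g x) → ∑ xs f ≤ ∑ xs g
∑-mono xs p = ∑-mono∈ xs λ x _ → p x

∑-≥0 : ∀ (xs : List 𝒜) {f : 𝒜 → ℤ} → (∀ x → 0ℤ ≤ f x) → 0ℤ ≤ ∑ xs f
∑-≥0 xs p = ≤-trans (≤-reflexive (sym (∑-0 xs))) (∑-mono xs p)

∑-≤const : ∀ (xs : List 𝒜) {f : 𝒜 → ℤ} {c} → (∀ x → f x ≤ c) → ∑ xs f ≤ + length xs * c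
∑-≤const xs {c = c} p = ≤-trans (∑-mono xs p) (≤-reflexive (∑-const xs c))

-- The probabilistic method: a comparison of totals yields a term for which the comparison holds, so
-- no expectation has to be divided out.
∑-exists : ∀ (xs : List 𝒜) (f g : 𝒜 → ℤ) → ∑ xs f < ∑ xs g → ∃[ x ] (x ∈ xs × f x < g x)
∑-exists []       f g p = contradiction p (<-irrefl refl)
∑-exists (x ∷ xs) f g p with f x ℤₚ.<? g x
... | yes q = x , here refl , q
... | no ¬q with ∑ xs f ℤₚ.<? ∑ xs g
...   | yes r = let (y , m , s) = ∑-exists xs f g r in y , there m , s
...   | no ¬r = contradiction (<-≤-trans p (ℤₚ.+-mono-≤ (≮⇒≥ ¬q) (≮⇒≥ ¬r))) (<-irrefl refl)

∑-term≤ : ∀ (xs : List 𝒜) {f : 𝒜 → ℤ} → (∀ x → 0ℤ ≤ f x) → ∀ {x} → x ∈ xs → f x ≤ ∑ xs f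
∑-term≤ (y ∷ ys) {f} p (here refl) = ≤-trans (≤-reflexive (sym (ℤₚ.+-identityʳ (f y)))) (ℤₚ.+-monoʳ-≤ (f y) (∑-≥0 ys p))
∑-term≤ (y ∷ ys) {f} p {x} (there q) = ≤-trans (≤-reflexive (sym (ℤₚ.+-identityˡ (f x)))) (ℤₚ.+-mono-≤ (p y) (∑-term≤ ys p q))

∑-vanish : ∀ (xs : List 𝒜) {f : 𝒜 → ℤ} → (∀ x → 0ℤ ≤ f x) → ∑ xs f ≤ 0ℤ → ∀ {x} → x ∈ xs → f x ≡ 0ℤ
∑-vanish xs p q {x} m = ≤-antisym (≤-trans (∑-term≤ xs p m) q) (p x)

∑-product : ∀ {C : Set} (h : 𝒜 → ℬ → C) (xs : List 𝒜) (ys : List ℬ) (f : C → ℤ) →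
            ∑ (cartesianProductWith h xs ys) f ≡ ∑ xs (λ x → ∑ ys (λ y → f (h x y)))
∑-product h []       ys f = refl
∑-product h (x ∷ xs) ys f = trans (++-map ys) (cong (_+_ (∑ ys (λ y → f (h x y)))) (∑-product h xs ys f))
  where
  ++-map : ∀ zs {ws} → ∑ (List.map (h x) zs List.++ ws) f ≡ ∑ zs (λ y → f (h x y)) + ∑ ws f
  ++-map []       = sym (ℤₚ.+-identityˡ _)
  ++-map (z ∷ zs) {ws} = trans (cong (_+_ (f (h x z))) (++-map zs {ws})) (sym (ℤₚ.+-assoc (f (h x z)) (∑ zs (λ y → f (h x y))) (∑ ws f)))

∑-** : ∀ (xs : List 𝒜) (ys : List ℬ) (f : 𝒜 → ℤ) (g : ℬ → ℤ) →
       ∑ xs (λ x → ∑ ys (λ y → f x * g y)) ≡ ∑ xs f * ∑ ys g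
∑-** xs ys f g = trans (∑-cong xs λ x → ∑-* ys (f x) g) (∑-*ʳ xs f _)

-- Lagrange's identity: the squares (f x g y - f y g x)², summed over all ordered pairs, add up to
-- twice the difference of the sides.
cauchy-schwarz : ∀ (xs : List 𝒜) (f g : 𝒜 → ℤ) →
  ∑ xs (λ x → f x * g x) * ∑ xs (λ x → f x * g x) ≤ ∑ xs (λ x → f x * f x) * ∑ xs (λ x → g x * g x)
cauchy-schwarz xs f g = *-cancel-≤ {c = + 2} (ℤ.+<+ (ℕ.s≤s ℕ.z≤n)) (≤-via lagrange (∑-≥0 xs λ x → ∑-≥0 xs λ y → 0≤sq (f x * g y - f y * g x)))
  where
  open ≡-Reasoning
  FG = ∑ xs (λ x → f x * g x)
  FF = ∑ xs (λ x → f x * f x)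
  GG = ∑ xs (λ x → g x * g x)
  expand : ∀ a b c d → (a * d - b * c) * (a * d - b * c) ≡ (a * a) * (d * d) + (c * c) * (b * b) - (+ 2 * (a * c)) * (b * d)
  expand = solve-∀
  collect : ∀ p q r → + 2 * (p * q) - + 2 * (r * r) ≡ p * q + q * p - (+ 2 * r) * r
  collect = solve-∀
  lagrange : + 2 * (FF * GG) - + 2 * (FG * FG) ≡ ∑ xs (λ x → ∑ xs (λ y → (f x * g y - f y * g x) * (f x * g y - f y * g x)))
  lagrange = begin
    + 2 * (FF * GG) - + 2 * (FG * FG) ≡⟨ collect FF GG FG ⟩
    FF * GG + GG * FF - (+ 2 * FG) * FG
      ≡⟨ sym (cong₂ _-_ (cong₂ _+_ (∑-** xs xs (λ x → f x * f x) (λ x → g x * g x)) (∑-** xs xs (λ x → g x * g x) (λ x → f x * f x)))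
             (trans (∑-** xs xs (λ x → + 2 * (f x * g x)) (λ x → f x * g x)) (cong (_* FG) (∑-* xs (+ 2) (λ x → f x * g x))))) ⟩
    ∑ xs (λ x → ∑ xs (P x)) + ∑ xs (λ x → ∑ xs (Q x)) - ∑ xs (λ x → ∑ xs (R x))
      ≡⟨ cong (_- ∑ xs (λ x → ∑ xs (R x))) (∑-+ xs (λ x → ∑ xs (P x)) (λ x → ∑ xs (Q x))) ⟨
    ∑ xs (λ x → ∑ xs (P x) + ∑ xs (Q x)) - ∑ xs (λ x → ∑ xs (R x))
      ≡⟨ ∑-- xs (λ x → ∑ xs (P x) + ∑ xs (Q x)) (λ x → ∑ xs (R x)) ⟨
    ∑ xs (λ x → ∑ xs (P x) + ∑ xs (Q x) - ∑ xs (R x))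
      ≡⟨ ∑-cong xs (λ x → trans (cong (_- ∑ xs (R x)) (sym (∑-+ xs (P x) (Q x)))) (sym (∑-- xs (λ y → P x y + Q x y) (R x)))) ⟩
    ∑ xs (λ x → ∑ xs (λ y → P x y + Q x y - R x y))
      ≡⟨ ∑-cong xs (λ x → ∑-cong xs (λ y → sym (expand (f x) (f y) (g x) (g y)))) ⟩
    ∑ xs (λ x → ∑ xs (λ y → (f x * g y - f y * g x) * (f x * g y - f y * g x))) ∎
    where
    P Q R : _ → _ → ℤ
    P x y = (f x * f x) * (g y * g y)
    Q x y = (g x * g x) * (f y * f y)
    R x y = (+ 2 * (f x * g x)) * (f y * g y)

-- Iverson bracket of a decision. The value depends on a chosen decision procedure, so `⟦⟧-cong` is
-- what identifies brackets of equivalent propositions.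
⟦_⟧ : ∀ {P : Set} → Dec P → ℤ
⟦ yes _ ⟧ = 1ℤ
⟦ no _ ⟧ = 0ℤ

module _ {P : Set} where
  ⟦⟧-yes : (d : Dec P) → P → ⟦ d ⟧ ≡ 1ℤ
  ⟦⟧-yes (yes _) _ = refl
  ⟦⟧-yes (no ¬p) p = contradiction p ¬p

  ⟦⟧-no : (d : Dec P) → ¬ P → ⟦ d ⟧ ≡ 0ℤ
  ⟦⟧-no (yes p) ¬p = contradiction p ¬p
  ⟦⟧-no (no _)  _  = refl

  ⟦⟧≥0 : (d : Dec P) → 0ℤ ≤ ⟦ d ⟧
  ⟦⟧≥0 (yes _) = 0≤n
  ⟦⟧≥0 (no _)  = 0≤n

  ⟦⟧≤1 : (d : Dec P) → ⟦ d ⟧ ≤ 1ℤ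
  ⟦⟧≤1 (yes _) = ≤-refl
  ⟦⟧≤1 (no _)  = 0≤n

  ⟦⟧-idem : (d : Dec P) → ⟦ d ⟧ * ⟦ d ⟧ ≡ ⟦ d ⟧
  ⟦⟧-idem (yes _) = refl
  ⟦⟧-idem (no _)  = refl

  ⟦⟧-absorb : (d : Dec P) {x y : ℤ} → (P → x ≡ y) → ⟦ d ⟧ * x ≡ ⟦ d ⟧ * y
  ⟦⟧-absorb (yes p) q = cong (1ℤ *_) (q p)
  ⟦⟧-absorb (no _) {x} {y} q = trans (ℤₚ.*-zeroˡ x) (sym (ℤₚ.*-zeroˡ y))

module _ {P Q : Set} where
  ⟦⟧-cong : (d : Dec P) (e : Dec Q) → (P → Q) → (Q → P) → ⟦ d ⟧ ≡ ⟦ e ⟧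
  ⟦⟧-cong (yes p) e f g = sym (⟦⟧-yes e (f p))
  ⟦⟧-cong (no ¬p) e f g = sym (⟦⟧-no e (¬p ∘ g))

  ⟦⟧-× : (d : Dec P) (e : Dec Q) → ⟦ d ×-dec e ⟧ ≡ ⟦ d ⟧ * ⟦ e ⟧
  ⟦⟧-× (yes _) (yes _) = refl
  ⟦⟧-× (yes _) (no _)  = refl
  ⟦⟧-× (no _)  e       = sym (ℤₚ.*-zeroˡ ⟦ e ⟧)

⟦⟧-¬ : ∀ {P : Set} (d : Dec P) → ⟦ ¬? d ⟧ ≡ 1ℤ - ⟦ d ⟧
⟦⟧-¬ (yes _) = refl
⟦⟧-¬ (no _)  = refl

∑-count : ∀ (xs : List 𝒜) {P : 𝒜 → Set} (P? : ∀ x → Dec (P x)) → + length (filter P? xs) ≡ ∑ xs (λ x → ⟦ P? x ⟧)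
∑-count []       P? = refl
∑-count (x ∷ xs) P? with P? x
... | yes _ = cong (_+_ 1ℤ) (∑-count xs P?)
... | no _  = trans (∑-count xs P?) (sym (ℤₚ.+-identityˡ _))

record Enum (𝒜 : Set) : Set where
  field
    elems    : List 𝒜
    unique   : Unique elems
    complete : ∀ x → x ∈ elems
    _≟_      : (x y : 𝒜) → Dec (x ≡ y)


module _ {𝒜 : Set} (_≟_ : (x y : 𝒜) → Dec (x ≡ y)) where
  ∑-δ∉ : ∀ (xs : List 𝒜) (f : 𝒜 → ℤ) a → a ∉ xs → ∑ xs (λ x → ⟦ x ≟ a ⟧ * f x) ≡ 0ℤ
  ∑-δ∉ xs f a ∉ = trans (∑-cong∈ xs λ x m → trans (cong (_* f x) (⟦⟧-no (x ≟ a) λ { refl → ∉ m })) (ℤₚ.*-zeroˡ (f x))) (∑-0 xs)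

  ∑-δ∈ : ∀ (xs : List 𝒜) (f : 𝒜 → ℤ) a → Unique xs → a ∈ xs → ∑ xs (λ x → ⟦ x ≟ a ⟧ * f x) ≡ f a
  ∑-δ∈ (x ∷ xs) f a (u AllPairs.∷ us) (here refl) =
    trans (cong₂ _+_ (trans (cong (_* f x) (⟦⟧-yes (x ≟ x) refl)) (ℤₚ.*-identityˡ (f x)))
                     (∑-δ∉ xs f x λ m → All.lookup u m refl)) (ℤₚ.+-identityʳ (f x))
  ∑-δ∈ (x ∷ xs) f a (u AllPairs.∷ us) (there m) =
    trans (cong₂ _+_ (trans (cong (_* f x) (⟦⟧-no (x ≟ a) λ { refl → All.lookup u m refl })) (ℤₚ.*-zeroˡ (f x)))
                     (∑-δ∈ xs f a us m)) (ℤₚ.+-identityˡ (f a))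

module Sums {𝒜 : Set} (E : Enum 𝒜) where
  open Enum E

  ∑-δ : ∀ (f : 𝒜 → ℤ) a → ∑ elems (λ x → ⟦ x ≟ a ⟧ * f x) ≡ f a
  ∑-δ f a = ∑-δ∈ _≟_ elems f a unique (complete a)

  ∑-δ′ : ∀ (f : 𝒜 → ℤ) a → ∑ elems (λ x → ⟦ a ≟ x ⟧ * f x) ≡ f a
  ∑-δ′ f a = trans (∑-cong elems λ x → cong (_* f x) (⟦⟧-cong (a ≟ x) (x ≟ a) sym sym)) (∑-δ f a)

  ∑-δ1 : ∀ a → ∑ elems (λ x → ⟦ x ≟ a ⟧) ≡ 1ℤ
  ∑-δ1 a = trans (∑-cong elems λ x → sym (ℤₚ.*-identityʳ _)) (∑-δ (λ _ → 1ℤ) a)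

  ∑-fibre : ∀ (xs : List ℬ) (σ : ℬ → 𝒜) (f : 𝒜 → ℤ) →
            ∑ xs (λ x → f (σ x)) ≡ ∑ elems (λ y → ∑ xs (λ x → ⟦ σ x ≟ y ⟧) * f y)
  ∑-fibre xs σ f = trans (∑-cong xs λ x → sym (∑-δ′ f (σ x)))
                  (trans (∑-swap xs elems _) (∑-cong elems λ y → ∑-*ʳ xs _ (f y)))

∑-bij : ∀ {𝒜 ℬ : Set} (EA : Enum 𝒜) (EB : Enum ℬ) (σ : 𝒜 → ℬ) (τ : ℬ → 𝒜) →
        (∀ x → τ (σ x) ≡ x) → (∀ y → σ (τ y) ≡ y) → ∀ f → ∑ (Enum.elems EA) (λ x → f (σ x)) ≡ ∑ (Enum.elems EB) f
∑-bij EA EB σ τ τσ στ f = trans (Sums.∑-fibre EB (Enum.elems EA) σ f) (∑-cong (Enum.elems EB) λ y →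
  trans (cong (_* f y) (trans (∑-cong (Enum.elems EA) λ x →
    ⟦⟧-cong (Enum._≟_ EB (σ x) y) (Enum._≟_ EA x (τ y)) (λ p → trans (sym (τσ x)) (cong τ p)) (λ p → trans (cong σ p) (στ y)))
    (Sums.∑-δ1 EA (τ y)))) (ℤₚ.*-identityˡ (f y)))

vecs : ∀ k → List 𝒜 → List (Vec 𝒜 k)
vecs zero    xs = [] ∷ []
vecs (suc k) xs = cartesianProductWith _∷_ xs (vecs k xs)

∑-vecs : ∀ k (xs : List 𝒜) (f : Vec 𝒜 (suc k) → ℤ) → ∑ (vecs (suc k) xs) f ≡ ∑ xs (λ x → ∑ (vecs k xs) (λ v → f (x ∷ v)))
∑-vecs k xs f = ∑-product _∷_ xs (vecs k xs) f

vecEnum : Enum 𝒜 → ∀ k → Enum (Vec 𝒜 k)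
vecEnum E k = record { elems = vecs k elems ; unique = uniq k ; complete = comp ; _≟_ = Vecₚ.≡-dec _≟_ }
  where
  open Enum E
  uniq : ∀ k → Unique (vecs k elems)
  uniq zero    = All.[] AllPairs.∷ AllPairs.[]
  uniq (suc k) = Uniqueₚ.cartesianProductWith⁺ _∷_ Vecₚ.∷-injective unique (uniq k)
  comp : ∀ {k} (v : Vec _ k) → v ∈ vecs k elems
  comp []      = here refl
  comp (x ∷ v) = ∈-cartesianProductWith⁺ _∷_ (complete x) (comp v)

∑-vecs-const : ∀ k (xs : List 𝒜) c → ∑ (vecs k xs) (λ _ → c) ≡ (+ length xs) ℤ.^ k * c
∑-vecs-const zero    xs c = trans (ℤₚ.+-identityʳ c) (sym (ℤₚ.*-identityˡ c))
∑-vecs-const (suc k) xs c = trans (∑-vecs k xs _) (trans (∑-cong xs λ _ → ∑-vecs-const k xs c)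
  (trans (∑-const xs _) (sym (ℤₚ.*-assoc (+ length xs) _ c))))

-- Frees an arbitrary coordinate from the others; this is how a random tuple is later read as a
-- shorter random tuple together with one independent point.
∑-insert : ∀ {k} (xs : List 𝒜) (j : Fin (suc k)) (f : Vec 𝒜 (suc k) → ℤ) →
           ∑ (vecs (suc k) xs) f ≡ ∑ (vecs k xs) (λ v → ∑ xs (λ x → f (Vec.insertAt v j x)))
∑-insert {k = k} xs zero f = trans (∑-vecs k xs f) (∑-swap xs (vecs k xs) _)
∑-insert {k = suc k} xs (suc j) f = trans (∑-vecs (suc k) xs f)
  (trans (∑-cong xs λ y → ∑-insert xs j (λ v → f (y ∷ v))) (sym (∑-vecs k xs _)))

-- Finite fields

module Field (F : FiniteField) where
  open FiniteField F public
    using (Carrier; elements; elements-unique; elements-complete; isCommutativeRing; inverse; 0≢1)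
    renaming (_+_ to infixl 6 _⊕_; _*_ to infixl 7 _⊗_; -_ to infix 8 ⊝_; 0# to 𝟘; 1# to 𝟙; _≟_ to infix 4 _≟_; order to card)

  commutativeRing : CommutativeRing _ _
  commutativeRing = record { isCommutativeRing = isCommutativeRing }

  open CommutativeRing commutativeRing public
    using (+-comm; +-assoc; *-comm; *-assoc; *-identityˡ; *-identityʳ; +-identityˡ; +-identityʳ; zeroˡ; zeroʳ; distribˡ; distribʳ; -‿inverseˡ; -‿inverseʳ)
  open Algebra.Properties.Semiring.Mult (CommutativeRing.semiring commutativeRing) public
    using (×1-homo-*; ×-homo-+) renaming (_×_ to infixr 8 _×ₙ_)
  open Algebra.Properties.CommutativeSemiring.Exp (CommutativeRing.commutativeSemiring commutativeRing) public
    using (_^_; ^-homo-*; ^-assocʳ; ^-distrib-*)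
  open Algebra.Properties.Ring (CommutativeRing.ring commutativeRing) public
    using (-‿involutive; -0#≈0#; -‿distribˡ-*; -‿distribʳ-*; -‿+-comm)

  -- Coefficients for the ring solver. Since `fromℤ 1ℤ` is 𝟙 ⊕ 𝟘 and not literally 𝟙, the solver
  -- calls below use only the constant 0 and pass 𝟙 as a variable.
  fromℤ : ℤ → Carrier
  fromℤ (+ n)    = n ×ₙ 𝟙
  fromℤ -[1+ n ] = ⊝ (suc n ×ₙ 𝟙)

  private
    cancel-suc : ∀ o a b → a ⊕ (⊝ b) ≡ (o ⊕ a) ⊕ (⊝ (o ⊕ b))
    cancel-suc o a b = begin
      a ⊕ (⊝ b)               ≡⟨ cong (_⊕ (⊝ b)) (sym (trans (cong (_⊕ a) (-‿inverseˡ o)) (+-identityˡ a))) ⟩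
      ⊝ o ⊕ o ⊕ a ⊕ (⊝ b)     ≡⟨ cong (_⊕ (⊝ b)) (trans (+-assoc (⊝ o) o a) (+-comm (⊝ o) (o ⊕ a))) ⟩
      o ⊕ a ⊕ ⊝ o ⊕ (⊝ b)     ≡⟨ trans (+-assoc (o ⊕ a) (⊝ o) (⊝ b)) (cong (o ⊕ a ⊕_) (-‿+-comm o b)) ⟩
      o ⊕ a ⊕ ⊝ (o ⊕ b)       ∎
      where open ≡-Reasoning

    from-⊖ : ∀ m n → fromℤ (m ℤ.⊖ n) ≡ m ×ₙ 𝟙 ⊕ ⊝ (n ×ₙ 𝟙)
    from-⊖ m zero = sym (trans (cong (m ×ₙ 𝟙 ⊕_) -0#≈0#) (+-identityʳ _))
    from-⊖ zero (suc n) = sym (+-identityˡ _)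
    from-⊖ (suc m) (suc n) = begin
      fromℤ (suc m ℤ.⊖ suc n) ≡⟨ cong fromℤ (ℤₚ.[1+m]⊖[1+n]≡m⊖n m n) ⟩
      fromℤ (m ℤ.⊖ n)         ≡⟨ from-⊖ m n ⟩
      m ×ₙ 𝟙 ⊕ ⊝ (n ×ₙ 𝟙)     ≡⟨ cancel-suc 𝟙 _ _ ⟩
      suc m ×ₙ 𝟙 ⊕ ⊝ (suc n ×ₙ 𝟙) ∎
      where open ≡-Reasoning

    from-neg : ∀ i → fromℤ (- i) ≡ ⊝ fromℤ i
    from-neg (+ zero)  = sym -0#≈0#
    from-neg (+ suc n) = refl
    from-neg -[1+ n ]  = sym (-‿involutive _)

    from-+ : ∀ i j → fromℤ (i + j) ≡ fromℤ i ⊕ fromℤ j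
    from-+ (+ m)    (+ n)    = ×-homo-+ 𝟙 m n
    from-+ (+ m)    -[1+ n ] = from-⊖ m (suc n)
    from-+ -[1+ m ] (+ n)    = trans (from-⊖ n (suc m)) (+-comm _ _)
    from-+ -[1+ m ] -[1+ n ] = trans (cong (λ k → ⊝ (suc k ×ₙ 𝟙)) (sym (ℕₚ.+-suc m n)))
      (trans (cong ⊝_ (×-homo-+ 𝟙 (suc m) (suc n))) (sym (-‿+-comm _ _)))

    from-*⁺ : ∀ m j → fromℤ (+ m * j) ≡ fromℤ (+ m) ⊗ fromℤ j
    from-*⁺ m (+ n)    = trans (cong fromℤ (sym (pos-* m n))) (×1-homo-* m n)
    from-*⁺ m -[1+ n ] = begin
      fromℤ (+ m * -[1+ n ])     ≡⟨ cong fromℤ (sym (ℤₚ.neg-distribʳ-* (+ m) (+ suc n))) ⟩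
      fromℤ (- (+ m * + suc n))  ≡⟨ from-neg (+ m * + suc n) ⟩
      ⊝ fromℤ (+ m * + suc n)    ≡⟨ cong ⊝_ (from-*⁺ m (+ suc n)) ⟩
      ⊝ (fromℤ (+ m) ⊗ fromℤ (+ suc n)) ≡⟨ -‿distribʳ-* _ _ ⟩
      fromℤ (+ m) ⊗ fromℤ -[1+ n ] ∎
      where open ≡-Reasoning

    from-* : ∀ i j → fromℤ (i * j) ≡ fromℤ i ⊗ fromℤ j
    from-* (+ m)    j = from-*⁺ m j
    from-* -[1+ m ] j = begin
      fromℤ (-[1+ m ] * j)     ≡⟨ cong fromℤ (sym (ℤₚ.neg-distribˡ-* (+ suc m) j)) ⟩
      fromℤ (- (+ suc m * j))  ≡⟨ from-neg (+ suc m * j) ⟩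
      ⊝ fromℤ (+ suc m * j)    ≡⟨ cong ⊝_ (from-*⁺ (suc m) j) ⟩
      ⊝ (fromℤ (+ suc m) ⊗ fromℤ j) ≡⟨ -‿distribˡ-* _ _ ⟩
      fromℤ -[1+ m ] ⊗ fromℤ j ∎
      where open ≡-Reasoning

    almost : ACR.AlmostCommutativeRing _ _
    almost = ACR.fromCommutativeRing commutativeRing

    morphism : CommutativeRing.rawRing ℤₚ.+-*-commutativeRing ACR.-Raw-AlmostCommutative⟶ almost
    morphism = record
      { ⟦_⟧ = fromℤ ; +-homo = from-+ ; *-homo = from-* ; -‿homo = from-neg ; 0-homo = refl ; 1-homo = +-identityʳ 𝟙 }

    coeff≟ : ∀ i j → Maybe (fromℤ i ≡ fromℤ j)
    coeff≟ i j with i ℤ.≟ j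
    ... | yes p = just (cong fromℤ p)
    ... | no _  = nothing

  open Algebra.Solver.Ring (CommutativeRing.rawRing ℤₚ.+-*-commutativeRing) almost morphism coeff≟ public
    using (solve; _:=_; _:+_; _:*_; :-_; _:-_; _:^_; con)

  enum : Enum Carrier
  enum = record { elems = elements ; unique = elements-unique ; complete = elements-complete ; _≟_ = _≟_ }
  open Sums enum public

  q : ℤ
  q = + card

  -- Made total by the value 𝟘 at 𝟘. With this value inversion is an odd function everywhere, on
  -- which the symmetry of the Kloosterman operators relies.
  inv : Carrier → Carrier
  inv x with x ≟ 𝟘
  ... | yes _ = 𝟘
  ... | no x≢0 = proj₁ (inverse x x≢0)

  inv-right : ∀ {x} → x ≢ 𝟘 → x ⊗ inv x ≡ 𝟙
  inv-right {x} x≢0 with x ≟ 𝟘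
  ... | yes p = contradiction p x≢0
  ... | no p  = proj₂ (inverse x p)

  inv-left : ∀ {x} → x ≢ 𝟘 → inv x ⊗ x ≡ 𝟙
  inv-left p = trans (*-comm _ _) (inv-right p)

  ⊗-cancelˡ : ∀ {a x y} → a ≢ 𝟘 → a ⊗ x ≡ a ⊗ y → x ≡ y
  ⊗-cancelˡ {a} {x} {y} p e = trans (sym (lem x)) (trans (cong (inv a ⊗_) e) (lem y))
    where lem : ∀ z → inv a ⊗ (a ⊗ z) ≡ z
          lem z = trans (sym (*-assoc (inv a) a z)) (trans (cong (_⊗ z) (inv-left p)) (*-identityˡ z))

  domain : ∀ {a b} → a ⊗ b ≡ 𝟘 → a ≢ 𝟘 → b ≡ 𝟘
  domain {a} e p = ⊗-cancelˡ p (trans e (sym (zeroʳ a)))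

  ⊗-≢0 : ∀ {a b} → a ≢ 𝟘 → b ≢ 𝟘 → a ⊗ b ≢ 𝟘
  ⊗-≢0 p r e = r (domain e p)

  inv-≢0 : ∀ {a} → a ≢ 𝟘 → inv a ≢ 𝟘
  inv-≢0 {a} p e = 0≢1 (trans (sym (zeroʳ a)) (trans (cong (a ⊗_) (sym e)) (inv-right p)))

  ⊝-≢0 : ∀ {a} → a ≢ 𝟘 → ⊝ a ≢ 𝟘
  ⊝-≢0 p e = p (trans (sym (-‿involutive _)) (trans (cong ⊝_ e) -0#≈0#))

  ⊟≡0⇒≡ : ∀ {a b} → a ⊕ ⊝ b ≡ 𝟘 → a ≡ b
  ⊟≡0⇒≡ {a} {b} e = trans (solve 2 (λ a b → a := a :+ :- b :+ b) refl a b) (trans (cong (_⊕ b) e) (+-identityˡ b))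

  ≡⇒⊟≡0 : ∀ {a b} → a ≡ b → a ⊕ ⊝ b ≡ 𝟘
  ≡⇒⊟≡0 {a} refl = -‿inverseʳ a

  ⊕-cancelˡ : ∀ {a x y} → a ⊕ x ≡ a ⊕ y → x ≡ y
  ⊕-cancelˡ {a} {x} {y} e = trans (lem a x) (trans (cong (_⊕ ⊝ a) e) (sym (lem a y)))
    where lem : ∀ a x → x ≡ a ⊕ x ⊕ ⊝ a
          lem = solve 2 (λ a x → x := a :+ x :+ :- a) refl

  sq≡⇒ : ∀ {x y} → x ⊗ x ≡ y ⊗ y → (x ≡ y) ⊎ (x ≡ ⊝ y)
  sq≡⇒ {x} {y} e with x ⊕ ⊝ y ≟ 𝟘
  ... | yes p = inj₁ (⊟≡0⇒≡ p)
  ... | no p  = inj₂ (⊟≡0⇒≡ (trans (cong (x ⊕_) (-‿involutive y)) (domain (trans (lem x y) (≡⇒⊟≡0 e)) p)))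
    where lem : ∀ x y → (x ⊕ ⊝ y) ⊗ (x ⊕ y) ≡ x ⊗ x ⊕ ⊝ (y ⊗ y)
          lem = solve 2 (λ x y → (x :+ :- y) :* (x :+ y) := x :* x :+ :- (y :* y)) refl

  sq≡0⇒ : ∀ {x} → x ⊗ x ≡ 𝟘 → x ≡ 𝟘
  sq≡0⇒ {x} e with x ≟ 𝟘
  ... | yes p = p
  ... | no p  = domain e p

  ∑-shift : ∀ (f : Carrier → ℤ) a → ∑ elements (λ x → f (x ⊕ a)) ≡ ∑ elements f
  ∑-shift f a = ∑-bij enum enum (_⊕ a) (_⊕ ⊝ a)
    (λ x → solve 2 (λ x a → x :+ a :+ :- a := x) refl x a)
    (λ x → solve 2 (λ x a → x :+ :- a :+ a := x) refl x a) f

  ∑-scale : ∀ (f : Carrier → ℤ) {a} → a ≢ 𝟘 → ∑ elements (λ x → f (a ⊗ x)) ≡ ∑ elements f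
  ∑-scale f {a} p = ∑-bij enum enum (a ⊗_) (inv a ⊗_)
    (λ x → trans (sym (*-assoc (inv a) a x)) (trans (cong (_⊗ x) (inv-left p)) (*-identityˡ x)))
    (λ x → trans (sym (*-assoc a (inv a) x)) (trans (cong (_⊗ x) (inv-right p)) (*-identityˡ x))) f

  ∑-negate : ∀ (f : Carrier → ℤ) → ∑ elements (λ x → f (⊝ x)) ≡ ∑ elements f
  ∑-negate f = ∑-bij enum enum ⊝_ ⊝_ -‿involutive -‿involutive f

  1^ : ∀ n → 𝟙 ^ n ≡ 𝟙
  1^ zero    = refl
  1^ (suc n) = trans (*-identityˡ _) (1^ n)

  ^-≢0 : ∀ {x} n → x ≢ 𝟘 → x ^ n ≢ 𝟘
  ^-≢0 zero    p e = 0≢1 (sym e)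
  ^-≢0 (suc n) p e = ^-≢0 n p (domain e p)

  module _ where
    private
      nonzero : List Carrier
      nonzero = filter (λ x → ¬? (x ≟ 𝟘)) elements

      ∏ : List Carrier → Carrier
      ∏ = List.foldr _⊗_ 𝟙

      ∏-↭ : ∀ {xs ys} → xs ↭ ys → ∏ xs ≡ ∏ ys
      ∏-↭ Perm.refl = refl
      ∏-↭ (Perm.prep x p) = cong (x ⊗_) (∏-↭ p)
      ∏-↭ (Perm.swap x y p) = trans (cong (λ z → x ⊗ (y ⊗ z)) (∏-↭ p)) (solve 3 (λ x y z → x :* (y :* z) := y :* (x :* z)) refl x y _)
      ∏-↭ (Perm.trans p r) = trans (∏-↭ p) (∏-↭ r)

      ∏-scale : ∀ a xs → ∏ (List.map (a ⊗_) xs) ≡ a ^ length xs ⊗ ∏ xs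
      ∏-scale a [] = sym (*-identityˡ 𝟙)
      ∏-scale a (x ∷ xs) = trans (cong (a ⊗ x ⊗_) (∏-scale a xs))
        (solve 4 (λ a x p r → a :* x :* (p :* r) := a :* p :* (x :* r)) refl a x (a ^ length xs) (∏ xs))

      ∏-≢0 : ∀ xs → (∀ {x} → x ∈ xs → x ≢ 𝟘) → ∏ xs ≢ 𝟘
      ∏-≢0 [] p e = 0≢1 (sym e)
      ∏-≢0 (x ∷ xs) p = ⊗-≢0 (p (here refl)) (∏-≢0 xs (p ∘ there))

      nz⁻ : ∀ {x} → x ∈ nonzero → x ≢ 𝟘
      nz⁻ m = proj₂ (∈-filter⁻ (λ x → ¬? (x ≟ 𝟘)) {xs = elements} m)

      nz⁺ : ∀ {x} → x ≢ 𝟘 → x ∈ nonzero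
      nz⁺ p = ∈-filter⁺ (λ x → ¬? (x ≟ 𝟘)) (elements-complete _) p

      nz-unique : Unique nonzero
      nz-unique = Uniqueₚ.filter⁺ (λ x → ¬? (x ≟ 𝟘)) elements-unique

      nz-scale : ∀ {a} → a ≢ 𝟘 → List.map (a ⊗_) nonzero ↭ nonzero
      nz-scale {a} p = ∼bag⇒↭ (unique∧set⇒bag (Uniqueₚ.map⁺ (⊗-cancelˡ p) nz-unique) nz-unique (mk⇔ to from))
        where
        to : ∀ {x} → x ∈ List.map (a ⊗_) nonzero → x ∈ nonzero
        to m with y , y∈ , refl ← ∈-map⁻ (a ⊗_) m = nz⁺ (⊗-≢0 p (nz⁻ y∈))
        from : ∀ {x} → x ∈ nonzero → x ∈ List.map (a ⊗_) nonzero
        from {x} m = subst (_∈ List.map (a ⊗_) nonzero) (trans (sym (*-assoc a (inv a) x)) (trans (cong (_⊗ x) (inv-right p)) (*-identityˡ x)))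
          (∈-map⁺ (a ⊗_) (nz⁺ (⊗-≢0 (inv-≢0 p) (nz⁻ m))))

      card≡ : card ≡ suc (length nonzero)
      card≡ = ↭-length (∼bag⇒↭ (unique∧set⇒bag elements-unique (All.tabulate (λ m e → nz⁻ m (sym e)) AllPairs.∷ nz-unique) (mk⇔ to (λ _ → elements-complete _))))
        where
        to : ∀ {x} → x ∈ elements → x ∈ 𝟘 ∷ nonzero
        to {x} _ with x ≟ 𝟘
        ... | yes p = here p
        ... | no p = there (nz⁺ p)

    -- Multiplication by x ≠ 0 permutes the nonzero elements; comparing the products over both
    -- orderings gives x^(q-1) = 1.
    fermat : ∀ x → x ^ card ≡ x
    fermat x with x ≟ 𝟘
    ... | yes refl = trans (cong (𝟘 ^_) card≡) (zeroˡ _)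
    ... | no p = trans (cong (x ^_) card≡) (trans (cong (x ⊗_) unit) (*-identityʳ x))
      where
      unit : x ^ length nonzero ≡ 𝟙
      unit = ⊗-cancelˡ (∏-≢0 nonzero nz⁻) (trans (*-comm _ _) (trans (sym (∏-scale x nonzero)) (trans (∏-↭ (nz-scale p)) (sym (*-identityʳ _)))))

  card>1 : 2 ℕ.≤ card
  card>1 with elements | elements-complete 𝟘 | elements-complete 𝟙
  ... | a ∷ []    | here p | here r = contradiction (trans p (sym r)) 0≢1
  ... | a ∷ b ∷ _ | _      | _      = ℕ.s≤s (ℕ.s≤s ℕ.z≤n)

  module _ (odd : ¬ (2 ∣ card)) where
    private
      pos : Carrier → ℕ
      pos x = Fin.toℕ (Any.index (elements-complete x))

      pos-inj : ∀ {x y} → pos x ≡ pos y → x ≡ y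
      pos-inj {x} {y} e = trans (lookup-index (elements-complete x))
        (trans (cong (List.lookup elements) (Finₚ.toℕ-injective e)) (sym (lookup-index (elements-complete y))))

    odd⇒2≢0 : 𝟙 ⊕ 𝟙 ≢ 𝟘
    odd⇒2≢0 e = odd (divides ℤ.∣ ∑ elements up ∣ (trans (cong ℤ.∣_∣ even) (ℤₚ.abs-* (∑ elements up) (+ 2))))
      where
      -- x ↦ x + 1 would be an involution without fixed points; it moves exactly half of the
      -- elements upwards in the enumeration.
      up : Carrier → ℤ
      up x = ⟦ pos x ℕ.<? pos (x ⊕ 𝟙) ⟧
      back : ∀ x → x ⊕ 𝟙 ⊕ 𝟙 ≡ x
      back x = trans (+-assoc x 𝟙 𝟙) (trans (cong (x ⊕_) e) (+-identityʳ x))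
      split : ∀ x → up x + up (x ⊕ 𝟙) ≡ 1ℤ
      split x with pos x ℕ.<? pos (x ⊕ 𝟙) | pos (x ⊕ 𝟙) ℕ.<? pos (x ⊕ 𝟙 ⊕ 𝟙)
      ... | yes p | yes r = contradiction (subst (λ z → pos (x ⊕ 𝟙) ℕ.< pos z) (back x) r) (ℕₚ.<-asym p)
      ... | yes p | no r  = refl
      ... | no p  | yes r = refl
      ... | no p  | no r  = contradiction (⊕-cancelˡ (trans (pos-inj (ℕₚ.≤-antisym (ℕₚ.≮⇒≥ p) (ℕₚ.≮⇒≥ (subst (λ z → ¬ (pos (x ⊕ 𝟙) ℕ.< pos z)) (back x) r)))) (sym (+-identityʳ x)))) (λ z → 0≢1 (sym z))
      even : q ≡ ∑ elements up * + 2
      even = begin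
        q                                     ≡⟨ sym (ℤₚ.*-identityʳ q) ⟩
        q * 1ℤ                                ≡⟨ sym (∑-const elements 1ℤ) ⟩
        ∑ elements (λ _ → 1ℤ)                 ≡⟨ sym (∑-cong elements split) ⟩
        ∑ elements (λ x → up x + up (x ⊕ 𝟙))  ≡⟨ ∑-+ elements up (λ x → up (x ⊕ 𝟙)) ⟩
        ∑ elements up + ∑ elements (λ x → up (x ⊕ 𝟙)) ≡⟨ cong (_+_ (∑ elements up)) (∑-shift up 𝟙) ⟩
        ∑ elements up + ∑ elements up         ≡⟨ double (∑ elements up) ⟩
        ∑ elements up * + 2 ∎
        where
        open ≡-Reasoning
        double : ∀ a → a + a ≡ a * + 2
        double = solve-∀

  -- This is 1 + χ for the quadratic character χ. All uses of χ go through this count, so that the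
  -- values stay nonnegative and no character has to be constructed.
  ρ : Carrier → ℤ
  ρ a = ∑ elements (λ y → ⟦ y ⊗ y ≟ a ⟧)

  ∑ρ : ∑ elements ρ ≡ q
  ∑ρ = trans (∑-swap elements elements (λ a y → ⟦ y ⊗ y ≟ a ⟧))
       (trans (∑-cong elements (λ y → trans (∑-cong elements (λ a → sym (ℤₚ.*-identityʳ _))) (∑-δ′ (λ _ → 1ℤ) (y ⊗ y))))
       (trans (∑-const elements 1ℤ) (ℤₚ.*-identityʳ q)))

  ρ≥0 : ∀ a → 0ℤ ≤ ρ a
  ρ≥0 a = ∑-≥0 elements λ y → ⟦⟧≥0 (y ⊗ y ≟ a)

  ρ0 : ρ 𝟘 ≡ 1ℤ
  ρ0 = trans (∑-cong elements λ y → ⟦⟧-cong (y ⊗ y ≟ 𝟘) (y ≟ 𝟘) sq≡0⇒ (λ { refl → zeroˡ 𝟘 })) (∑-δ1 𝟘)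

  ρ-nonsquare : ∀ {a} → (∀ y → y ⊗ y ≢ a) → ρ a ≡ 0ℤ
  ρ-nonsquare {a} p = ∑-zero elements λ y → ⟦⟧-no (y ⊗ y ≟ a) (p y)

  square? : ∀ a → (∃[ y ] y ⊗ y ≡ a) ⊎ (∀ y → y ⊗ y ≢ a)
  square? a with Any.any? (λ y → y ⊗ y ≟ a) elements
  ... | yes m = inj₁ (Any.satisfied m)
  ... | no ¬m = inj₂ λ y e → ¬m (lose (elements-complete y) e)

  ρ-square≤ : ∀ y → ρ (y ⊗ y) ≤ + 2
  ρ-square≤ y = begin
    ρ (y ⊗ y) ≤⟨ ∑-mono elements roots ⟩
    ∑ elements (λ z → ⟦ z ≟ y ⟧ + ⟦ z ≟ ⊝ y ⟧) ≡⟨ ∑-+ elements (λ z → ⟦ z ≟ y ⟧) (λ z → ⟦ z ≟ ⊝ y ⟧) ⟩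
    ∑ elements (λ z → ⟦ z ≟ y ⟧) + ∑ elements (λ z → ⟦ z ≟ ⊝ y ⟧) ≡⟨ cong₂ _+_ (∑-δ1 y) (∑-δ1 (⊝ y)) ⟩
    + 2 ∎
    where
    open ℤₚ.≤-Reasoning
    roots : ∀ z → ⟦ z ⊗ z ≟ y ⊗ y ⟧ ≤ ⟦ z ≟ y ⟧ + ⟦ z ≟ ⊝ y ⟧
    roots z with z ⊗ z ≟ y ⊗ y
    ... | no _ = 0≤+ (⟦⟧≥0 (z ≟ y)) (⟦⟧≥0 (z ≟ ⊝ y))
    ... | yes e with sq≡⇒ e
    ...   | inj₁ p = ℤₚ.+-mono-≤ (≤-reflexive (sym (⟦⟧-yes (z ≟ y) p))) (⟦⟧≥0 (z ≟ ⊝ y))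
    ...   | inj₂ p = ℤₚ.+-mono-≤ (⟦⟧≥0 (z ≟ y)) (≤-reflexive (sym (⟦⟧-yes (z ≟ ⊝ y) p)))

  ρ≤2 : ∀ a → ρ a ≤ + 2
  ρ≤2 a with square? a
  ... | inj₁ (y , refl) = ρ-square≤ y
  ... | inj₂ p = ≤-trans (≤-reflexive (ρ-nonsquare p)) 0≤n

  -- The values ρ a + ρ (ν a) are at most 2 and average to 2.
  ρ-twist : ∀ {ν} → (∀ y → y ⊗ y ≢ ν) → ∀ a → ρ a + ρ (ν ⊗ a) ≡ + 2
  ρ-twist {ν} ns a = sym (ℤₚ.i-j≡0⇒i≡j (+ 2) (ρ a + ρ (ν ⊗ a)) (∑-vanish elements (λ b → diff≥0 (bound b)) (≤-reflexive total) (elements-complete a)))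
    where
    ν≢0 : ν ≢ 𝟘
    ν≢0 refl = ns 𝟘 (zeroˡ 𝟘)
    ns-scale : ∀ y → y ≢ 𝟘 → ∀ z → z ⊗ z ≢ ν ⊗ (y ⊗ y)
    ns-scale y y≢0 z e = ns (z ⊗ inv y) (begin
      z ⊗ inv y ⊗ (z ⊗ inv y)     ≡⟨ solve 2 (λ z i → z :* i :* (z :* i) := z :* z :* (i :* i)) refl z (inv y) ⟩
      z ⊗ z ⊗ (inv y ⊗ inv y)     ≡⟨ cong (_⊗ (inv y ⊗ inv y)) e ⟩
      ν ⊗ (y ⊗ y) ⊗ (inv y ⊗ inv y) ≡⟨ solve 3 (λ n y i → n :* (y :* y) :* (i :* i) := n :* ((y :* i) :* (y :* i))) refl ν y (inv y) ⟩
      ν ⊗ ((y ⊗ inv y) ⊗ (y ⊗ inv y)) ≡⟨ cong (λ w → ν ⊗ (w ⊗ w)) (inv-right y≢0) ⟩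
      ν ⊗ (𝟙 ⊗ 𝟙)                 ≡⟨ trans (cong (ν ⊗_) (*-identityˡ 𝟙)) (*-identityʳ ν) ⟩
      ν ∎)
      where
      open ≡-Reasoning
    bound : ∀ b → ρ b + ρ (ν ⊗ b) ≤ + 2
    bound b with square? b
    ... | inj₂ p = ≤-trans (≤-reflexive (trans (cong (_+ ρ (ν ⊗ b)) (ρ-nonsquare p)) (ℤₚ.+-identityˡ _))) (ρ≤2 (ν ⊗ b))
    ... | inj₁ (y , refl) with y ≟ 𝟘
    ...   | no y≢0 = ≤-trans (≤-reflexive (trans (cong (_+_ (ρ (y ⊗ y))) (ρ-nonsquare (ns-scale y y≢0))) (ℤₚ.+-identityʳ _))) (ρ≤2 (y ⊗ y))
    ...   | yes refl = ≤-reflexive (cong₂ _+_ (trans (cong ρ (zeroˡ 𝟘)) ρ0) (trans (cong ρ (trans (cong (ν ⊗_) (zeroˡ 𝟘)) (zeroʳ ν))) ρ0))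
    total : ∑ elements (λ b → + 2 - (ρ b + ρ (ν ⊗ b))) ≡ 0ℤ
    total = trans (∑-- elements (λ _ → + 2) (λ b → ρ b + ρ (ν ⊗ b)))
      (trans (cong₂ _-_ (∑-const elements (+ 2)) (trans (∑-+ elements ρ (λ b → ρ (ν ⊗ b))) (cong₂ _+_ ∑ρ (trans (∑-scale ρ ν≢0) ∑ρ)))) (lem q))
      where lem : ∀ x → x * + 2 - (x + x) ≡ 0ℤ
            lem = solve-∀

  module Odd (2≢0 : 𝟙 ⊕ 𝟙 ≢ 𝟘) where
    ⊝-fixed : ∀ {a} → a ≡ ⊝ a → a ≡ 𝟘
    ⊝-fixed {a} e = domain (trans (lem a) (trans (cong (_⊕ a) e) (-‿inverseˡ a))) 2≢0
      where lem : ∀ a → (𝟙 ⊕ 𝟙) ⊗ a ≡ a ⊕ a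
            lem a = trans (distribʳ a 𝟙 𝟙) (cong₂ _⊕_ (*-identityˡ a) (*-identityˡ a))

    -- Squaring is not injective, so it is not surjective.
    nonsquare : ∃[ ν ] (∀ y → y ⊗ y ≢ ν)
    nonsquare with Any.any? (λ a → ρ a ℤₚ.<? 1ℤ) elements
    ... | yes m = let (a , p) = Any.satisfied m in a , λ y e → <-irrefl refl
            (<-≤-trans p (≤-trans (≤-reflexive (sym (⟦⟧-yes (y ⊗ y ≟ a) e))) (∑-term≤ elements (λ z → ⟦⟧≥0 (z ⊗ z ≟ a)) (elements-complete y))))
    ... | no ¬m = contradiction (≤-trans two (≤-reflexive one)) λ { (ℤ.+≤+ (ℕ.s≤s ())) }
      where
      all≥1 : ∀ a → 0ℤ ≤ ρ a - 1ℤ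
      all≥1 a = diff≥0 (≮⇒≥ λ p → ¬m (lose (elements-complete a) p))
      total : ∑ elements (λ a → ρ a - 1ℤ) ≡ 0ℤ
      total = trans (∑-- elements ρ (λ _ → 1ℤ)) (trans (cong₂ _-_ ∑ρ (trans (∑-const elements 1ℤ) (ℤₚ.*-identityʳ q))) (ℤₚ.+-inverseʳ q))
      one : ρ 𝟙 ≡ 1ℤ
      one = ℤₚ.i-j≡0⇒i≡j (ρ 𝟙) 1ℤ (∑-vanish elements all≥1 (≤-reflexive total) (elements-complete 𝟙))
      two : + 2 ≤ ρ 𝟙
      two = ≤-trans (≤-reflexive (sym (trans (∑-+ elements (λ z → ⟦ z ≟ 𝟙 ⟧) (λ z → ⟦ z ≟ ⊝ 𝟙 ⟧)) (cong₂ _+_ (∑-δ1 𝟙) (∑-δ1 (⊝ 𝟙)))))) (∑-mono elements roots)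
        where
        roots : ∀ z → ⟦ z ≟ 𝟙 ⟧ + ⟦ z ≟ ⊝ 𝟙 ⟧ ≤ ⟦ z ⊗ z ≟ 𝟙 ⟧
        roots z with z ≟ 𝟙 | z ≟ ⊝ 𝟙
        ... | yes refl | yes p = contradiction (sym (⊝-fixed p)) 0≢1
        ... | yes refl | no _ = ≤-reflexive (sym (⟦⟧-yes (𝟙 ⊗ 𝟙 ≟ 𝟙) (*-identityˡ 𝟙)))
        ... | no _ | yes refl = ≤-reflexive (sym (⟦⟧-yes (⊝ 𝟙 ⊗ ⊝ 𝟙 ≟ 𝟙) (trans (solve 1 (λ x → :- x :* :- x := x :* x) refl 𝟙) (*-identityˡ 𝟙))))
        ... | no _ | no _ = ⟦⟧≥0 (z ⊗ z ≟ 𝟙)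

    half : Carrier
    half = inv (𝟙 ⊕ 𝟙)

    half-double : ∀ x → half ⊗ x ⊕ half ⊗ x ≡ x
    half-double x = trans (lem half x) (trans (cong (_⊗ x) (inv-left 2≢0)) (*-identityˡ x))
      where lem : ∀ h x → h ⊗ x ⊕ h ⊗ x ≡ h ⊗ (𝟙 ⊕ 𝟙) ⊗ x
            lem h x = trans (sym (distribˡ h x x)) (trans (cong (h ⊗_) (sym (trans (distribʳ x 𝟙 𝟙) (cong₂ _⊕_ (*-identityˡ x) (*-identityˡ x))))) (sym (*-assoc h (𝟙 ⊕ 𝟙) x)))

    double-≢0 : ∀ {a} → a ≢ 𝟘 → a ⊕ a ≢ 𝟘
    double-≢0 {a} p e = p (domain (trans (trans (distribʳ a 𝟙 𝟙) (cong₂ _⊕_ (*-identityˡ a) (*-identityˡ a))) e) 2≢0)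

-- Linear algebra

module LinearAlgebra (F : FiniteField) where
  open Field F

  private variable d k : ℕ

  dot : Vec Carrier d → Vec Carrier d → Carrier
  dot []      []      = 𝟘
  dot (a ∷ x) (b ∷ y) = a ⊗ b ⊕ dot x y

  infixl 6 _+[_]_
  -- One operation x + a·y covers addition, subtraction (a = -1) and scaling (x = 0), so that a
  -- single family of lemmas serves for all three.
  _+[_]_ : Vec Carrier d → Carrier → Vec Carrier d → Vec Carrier d
  []      +[ a ] []      = []
  (x ∷ u) +[ a ] (y ∷ v) = x ⊕ a ⊗ y ∷ u +[ a ] v

  0ᵛ : Vec Carrier d
  0ᵛ {zero}  = []
  0ᵛ {suc d} = 𝟘 ∷ 0ᵛ

  dots : Vec (Vec Carrier d) k → Vec Carrier d → Vec Carrier k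
  dots []       x = []
  dots (w ∷ ws) x = dot w x ∷ dots ws x

  lincomb : Vec Carrier k → Vec (Vec Carrier d) k → Vec Carrier d
  lincomb []       []       = 0ᵛ
  lincomb (c ∷ cs) (w ∷ ws) = lincomb cs ws +[ c ] w

  dot-comm : ∀ (x y : Vec Carrier d) → dot x y ≡ dot y x
  dot-comm []      []      = refl
  dot-comm (a ∷ x) (b ∷ y) = cong₂ _⊕_ (*-comm a b) (dot-comm x y)

  dot-+ˡ : ∀ (x : Vec Carrier d) a y v → dot (x +[ a ] y) v ≡ dot x v ⊕ a ⊗ dot y v
  dot-+ˡ []      a []      []      = solve 1 (λ a → con 0ℤ := con 0ℤ :+ a :* con 0ℤ) refl a
  dot-+ˡ (x ∷ u) a (y ∷ w) (z ∷ v) = trans (cong ((x ⊕ a ⊗ y) ⊗ z ⊕_) (dot-+ˡ u a w v))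
    (solve 6 (λ x a y z p r → (x :+ a :* y) :* z :+ (p :+ a :* r) := x :* z :+ p :+ a :* (y :* z :+ r)) refl x a y z (dot u v) (dot w v))

  dot-+ʳ : ∀ (v : Vec Carrier d) x a y → dot v (x +[ a ] y) ≡ dot v x ⊕ a ⊗ dot v y
  dot-+ʳ v x a y = trans (dot-comm v _) (trans (dot-+ˡ x a y v) (cong₂ (λ p r → p ⊕ a ⊗ r) (dot-comm x v) (dot-comm y v)))

  dot-0ˡ : ∀ (v : Vec Carrier d) → dot 0ᵛ v ≡ 𝟘
  dot-0ˡ []      = refl
  dot-0ˡ (x ∷ v) = trans (cong₂ _⊕_ (zeroˡ x) (dot-0ˡ v)) (+-identityˡ 𝟘)

  dot-0ʳ : ∀ (v : Vec Carrier d) → dot v 0ᵛ ≡ 𝟘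
  dot-0ʳ v = trans (dot-comm v 0ᵛ) (dot-0ˡ v)

  dots-+ : ∀ (ws : Vec (Vec Carrier d) k) x a y → dots ws (x +[ a ] y) ≡ dots ws x +[ a ] dots ws y
  dots-+ []       x a y = refl
  dots-+ (w ∷ ws) x a y = cong₂ _∷_ (dot-+ʳ w x a y) (dots-+ ws x a y)

  dots-0 : ∀ (ws : Vec (Vec Carrier d) k) → dots ws 0ᵛ ≡ 0ᵛ
  dots-0 []       = refl
  dots-0 (w ∷ ws) = cong₂ _∷_ (dot-0ʳ w) (dots-0 ws)

  dot-lincomb : ∀ (c : Vec Carrier k) (ws : Vec (Vec Carrier d) k) x → dot (lincomb c ws) x ≡ dot c (dots ws x)
  dot-lincomb []       []       x = dot-0ˡ x
  dot-lincomb (c ∷ cs) (w ∷ ws) x = trans (dot-+ˡ (lincomb cs ws) c w x) (trans (cong (_⊕ c ⊗ dot w x) (dot-lincomb cs ws x)) (+-comm _ _))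

  +[]-0 : ∀ (x : Vec Carrier d) a → x +[ a ] 0ᵛ ≡ x
  +[]-0 []      a = refl
  +[]-0 (x ∷ u) a = cong₂ _∷_ (trans (cong (x ⊕_) (zeroʳ a)) (+-identityʳ x)) (+[]-0 u a)

  +[0] : ∀ (x y : Vec Carrier d) → x +[ 𝟘 ] y ≡ x
  +[0] []      []      = refl
  +[0] (x ∷ u) (y ∷ v) = cong₂ _∷_ (trans (cong (x ⊕_) (zeroˡ y)) (+-identityʳ x)) (+[0] u v)

  +[]-assoc : ∀ (x : Vec Carrier d) a b y → x +[ a ] y +[ b ] y ≡ x +[ a ⊕ b ] y
  +[]-assoc []      a b []      = refl
  +[]-assoc (x ∷ u) a b (y ∷ v) = cong₂ _∷_ (solve 4 (λ x a b y → x :+ a :* y :+ b :* y := x :+ (a :+ b) :* y) refl x a b y) (+[]-assoc u a b v)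

  +[]-comm : ∀ (x : Vec Carrier d) a y b z → x +[ a ] y +[ b ] z ≡ x +[ b ] z +[ a ] y
  +[]-comm []      a []      b []      = refl
  +[]-comm (x ∷ u) a (y ∷ v) b (z ∷ w) = cong₂ _∷_ (solve 5 (λ x a y b z → x :+ a :* y :+ b :* z := x :+ b :* z :+ a :* y) refl x a y b z) (+[]-comm u a v b w)

  +[]-cancel : ∀ (x : Vec Carrier d) a y → x +[ a ] y +[ ⊝ a ] y ≡ x
  +[]-cancel x a y = trans (+[]-assoc x a (⊝ a) y) (trans (cong (x +[_] y) (-‿inverseʳ a)) (+[0] x y))

  +[]-cancel′ : ∀ (x : Vec Carrier d) a y → x +[ ⊝ a ] y +[ a ] y ≡ x
  +[]-cancel′ x a y = trans (+[]-assoc x (⊝ a) a y) (trans (cong (x +[_] y) (-‿inverseˡ a)) (+[0] x y))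

  -‿self : ∀ (x : Vec Carrier d) → x +[ ⊝ 𝟙 ] x ≡ 0ᵛ
  -‿self []      = refl
  -‿self (x ∷ u) = cong₂ _∷_ (trans (cong (_⊕ ⊝ 𝟙 ⊗ x) (sym (*-identityˡ x))) (solve 2 (λ o x → o :* x :+ :- o :* x := con 0ℤ) refl 𝟙 x)) (-‿self u)

  -‿zero : ∀ (x y : Vec Carrier d) → x +[ ⊝ 𝟙 ] y ≡ 0ᵛ → x ≡ y
  -‿zero x y e = trans (sym (+[]-cancel′ x 𝟙 y)) (trans (cong (_+[ 𝟙 ] y) (trans e (sym (-‿self y)))) (+[]-cancel′ y 𝟙 y))

  _≟ᵛ_ : (x y : Vec Carrier d) → Dec (x ≡ y)
  _≟ᵛ_ = Vecₚ.≡-dec _≟_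

  points : ∀ d → Enum (Vec Carrier d)
  points = vecEnum enum

  allPoints : ∀ d → List (Vec Carrier d)
  allPoints d = vecs d elements

  ∑-translate : ∀ (f : Vec Carrier d → ℤ) a y → ∑ (allPoints d) (λ x → f (x +[ a ] y)) ≡ ∑ (allPoints d) f
  ∑-translate {d} f a y = ∑-bij (points d) (points d) (_+[ a ] y) (_+[ ⊝ a ] y) (λ x → +[]-cancel x a y) (λ x → +[]-cancel′ x a y) f

  dot-nondegenerate : ∀ (x : Vec Carrier d) → x ≢ 0ᵛ → ∃[ f ] dot x f ≡ 𝟙
  dot-nondegenerate [] p = contradiction refl p
  dot-nondegenerate (a ∷ x) p with a ≟ 𝟘
  ... | no a≢0 = inv a ∷ 0ᵛ , trans (cong₂ _⊕_ (inv-right a≢0) (dot-0ʳ x)) (+-identityʳ 𝟙)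
  ... | yes refl = let (f , e) = dot-nondegenerate x (λ { refl → p refl }) in
    𝟘 ∷ f , trans (cong₂ _⊕_ (zeroˡ 𝟘) e) (+-identityˡ 𝟙)

  Dependent : Vec (Vec Carrier d) k → Set
  Dependent ws = ∃[ c ] (c ≢ 0ᵛ × lincomb c ws ≡ 0ᵛ)

  -- A dual family es with wᵢ · eⱼ = δᵢⱼ, the positive form of linear independence: it provides
  -- explicit solutions of inhomogeneous linear systems.
  Dual : Vec (Vec Carrier d) k → Set
  Dual ws = ∃[ es ] (∀ c → dots ws (lincomb c es) ≡ c)

  private
    adjust : Vec Carrier d → Vec Carrier d → Vec (Vec Carrier d) k → Vec (Vec Carrier d) k
    adjust w z = Vec.map (λ e → e +[ ⊝ dot w e ] z)

    lincomb-adjust : ∀ (w z : Vec Carrier d) (c : Vec Carrier k) es →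
      lincomb c (adjust w z es) ≡ lincomb c es +[ ⊝ dot w (lincomb c es) ] z
    lincomb-adjust w z [] [] = sym (trans (cong (λ a → 0ᵛ +[ a ] z) (trans (cong ⊝_ (dot-0ʳ w)) -0#≈0#)) (+[0] 0ᵛ z))
    lincomb-adjust w z (c ∷ cs) (e ∷ es) = begin
      lincomb cs (adjust w z es) +[ c ] (e +[ ⊝ dot w e ] z) ≡⟨ cong (_+[ c ] (e +[ ⊝ dot w e ] z)) (lincomb-adjust w z cs es) ⟩
      L +[ ⊝ dot w L ] z +[ c ] (e +[ ⊝ dot w e ] z) ≡⟨ merge L (dot w L) z c e (dot w e) ⟩
      L +[ c ] e +[ ⊝ (dot w L ⊕ c ⊗ dot w e) ] z ≡⟨ cong (λ a → L +[ c ] e +[ ⊝ a ] z) (sym (dot-+ʳ w L c e)) ⟩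
      L +[ c ] e +[ ⊝ dot w (L +[ c ] e) ] z ∎
      where
      open ≡-Reasoning
      L = lincomb cs es
      merge : ∀ {d} (L : Vec Carrier d) p z c e r → L +[ ⊝ p ] z +[ c ] (e +[ ⊝ r ] z) ≡ L +[ c ] e +[ ⊝ (p ⊕ c ⊗ r) ] z
      merge [] p [] c [] r = refl
      merge (l ∷ L) p (z ∷ zs) c (e ∷ es) r = cong₂ _∷_
        (solve 6 (λ l p z c e r → l :+ :- p :* z :+ c :* (e :+ :- r :* z) := l :+ c :* e :+ :- (p :+ c :* r) :* z) refl l p z c e r) (merge L p zs c es r)

  -- One Gram-Schmidt step per vector. Subtract from w its expansion Σ (w·eᵢ) wᵢ. If nothing is
  -- left, w is dependent on ws. Otherwise some f pairs to 1 with the rest w′, and z = f - Σ (wᵢ·f)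
  -- eᵢ is orthogonal to ws with w·z = w′·f = 1; correcting each e by -(w·e) z makes it orthogonal
  -- to w.
  dependent-or-dual : ∀ (ws : Vec (Vec Carrier d) k) → Dependent ws ⊎ Dual ws
  dependent-or-dual [] = inj₂ ([] , λ { [] → refl })
  dependent-or-dual (w ∷ ws) with dependent-or-dual ws
  ... | inj₁ (c , c≢0 , e) = inj₁ (𝟘 ∷ c , (λ { refl → c≢0 refl }) , trans (+[0] _ w) e)
  ... | inj₂ (es , dual) with (w +[ ⊝ 𝟙 ] lincomb (dots es w) ws) ≟ᵛ 0ᵛ
  ...   | yes p = inj₁ (⊝ 𝟙 ∷ dots es w , (λ e → ⊝-≢0 (λ z → 0≢1 (sym z)) (cong Vec.head e)) ,
                        trans (cong (_+[ ⊝ 𝟙 ] w) (sym (-‿zero w _ p))) (-‿self w))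
  ...   | no p = inj₂ (z ∷ adjust w z es , law)
    where
    open ≡-Reasoning
    w′ = w +[ ⊝ 𝟙 ] lincomb (dots es w) ws
    f = proj₁ (dot-nondegenerate w′ p)
    z = f +[ ⊝ 𝟙 ] lincomb (dots ws f) es
    ws⊥z : dots ws z ≡ 0ᵛ
    ws⊥z = trans (dots-+ ws f (⊝ 𝟙) _) (trans (cong (dots ws f +[ ⊝ 𝟙 ]_) (dual (dots ws f))) (-‿self (dots ws f)))
    w·z : dot w z ≡ 𝟙
    w·z = begin
      dot w z ≡⟨ dot-+ʳ w f (⊝ 𝟙) _ ⟩
      dot w f ⊕ ⊝ 𝟙 ⊗ dot w (lincomb (dots ws f) es) ≡⟨ cong (λ a → dot w f ⊕ ⊝ 𝟙 ⊗ a) (begin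
        dot w (lincomb (dots ws f) es) ≡⟨ dot-comm w _ ⟩
        dot (lincomb (dots ws f) es) w ≡⟨ dot-lincomb (dots ws f) es w ⟩
        dot (dots ws f) (dots es w)    ≡⟨ dot-comm (dots ws f) _ ⟩
        dot (dots es w) (dots ws f)    ≡⟨ sym (dot-lincomb (dots es w) ws f) ⟩
        dot (lincomb (dots es w) ws) f ∎) ⟩
      dot w f ⊕ ⊝ 𝟙 ⊗ dot (lincomb (dots es w) ws) f ≡⟨ sym (dot-+ˡ w (⊝ 𝟙) _ f) ⟩
      dot w′ f ≡⟨ proj₂ (dot-nondegenerate w′ p) ⟩
      𝟙 ∎
    law : ∀ c → dots (w ∷ ws) (lincomb c (z ∷ adjust w z es)) ≡ c
    law (c ∷ cs) = cong₂ _∷_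
      (begin
        dot w (lincomb cs (adjust w z es) +[ c ] z) ≡⟨ dot-+ʳ w _ c z ⟩
        dot w (lincomb cs (adjust w z es)) ⊕ c ⊗ dot w z ≡⟨ cong₂ (λ a b → dot w a ⊕ c ⊗ b) (lincomb-adjust w z cs es) w·z ⟩
        dot w (L +[ ⊝ dot w L ] z) ⊕ c ⊗ 𝟙 ≡⟨ cong (_⊕ c ⊗ 𝟙) (trans (dot-+ʳ w L _ z) (cong (λ a → dot w L ⊕ ⊝ dot w L ⊗ a) w·z)) ⟩
        dot w L ⊕ ⊝ dot w L ⊗ 𝟙 ⊕ c ⊗ 𝟙 ≡⟨ cong₂ (λ a b → dot w L ⊕ a ⊕ b) (*-identityʳ _) (*-identityʳ c) ⟩
        dot w L ⊕ ⊝ dot w L ⊕ c ≡⟨ trans (cong (_⊕ c) (-‿inverseʳ _)) (+-identityˡ c) ⟩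
        c ∎)
      (begin
        dots ws (lincomb cs (adjust w z es) +[ c ] z) ≡⟨ dots-+ ws _ c z ⟩
        dots ws (lincomb cs (adjust w z es)) +[ c ] dots ws z ≡⟨ trans (cong (dots ws (lincomb cs (adjust w z es)) +[ c ]_) ws⊥z) (+[]-0 _ c) ⟩
        dots ws (lincomb cs (adjust w z es)) ≡⟨ cong (dots ws) (lincomb-adjust w z cs es) ⟩
        dots ws (L +[ ⊝ dot w L ] z) ≡⟨ dots-+ ws L _ z ⟩
        dots ws L +[ ⊝ dot w L ] dots ws z ≡⟨ trans (cong (dots ws L +[ ⊝ dot w L ]_) ws⊥z) (+[]-0 _ _) ⟩
        dots ws L ≡⟨ dual cs ⟩
        cs ∎)
      where L = lincomb cs es

  ∑-fibres : ∀ (ws : Vec (Vec Carrier d) k) →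
    ∑ (allPoints k) (λ c → ∑ (allPoints d) (λ x → ⟦ dots ws x ≟ᵛ c ⟧)) ≡ q ℤ.^ d
  ∑-fibres {d} {k} ws = trans (∑-swap (allPoints k) (allPoints d) _)
    (trans (∑-cong (allPoints d) λ x → trans (∑-cong (allPoints k) λ c → sym (ℤₚ.*-identityʳ _)) (Sums.∑-δ′ (points k) (λ _ → 1ℤ) (dots ws x)))
    (trans (∑-vecs-const d elements 1ℤ) (ℤₚ.*-identityʳ _)))

  -- Any two fibres differ by a translation along `lincomb δ es`, so the q^k fibres share the q^d
  -- points equally. The factor q^k stays on the left to avoid a difference of exponents.
  fibre-size : ∀ (ws : Vec (Vec Carrier d) k) → Dual ws → ∀ c →
    q ℤ.^ k * ∑ (allPoints d) (λ x → ⟦ dots ws x ≟ᵛ c ⟧) ≡ q ℤ.^ d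
  fibre-size {d} {k} ws (es , dual) c = trans (sym (∑-vecs-const k elements (∑ (allPoints d) (λ x → ⟦ dots ws x ≟ᵛ c ⟧))))
    (trans (∑-cong (allPoints k) λ b → same c b) (∑-fibres ws))
    where
    same : ∀ c b → ∑ (allPoints d) (λ x → ⟦ dots ws x ≟ᵛ c ⟧) ≡ ∑ (allPoints d) (λ x → ⟦ dots ws x ≟ᵛ b ⟧)
    same c b = sym (trans (sym (∑-translate (λ x → ⟦ dots ws x ≟ᵛ b ⟧) 𝟙 e)) (∑-cong (allPoints d) λ x →
      ⟦⟧-cong (dots ws (x +[ 𝟙 ] e) ≟ᵛ b) (dots ws x ≟ᵛ c)
        (λ r → begin
          dots ws x                                  ≡⟨ sym (+[]-cancel (dots ws x) 𝟙 δ) ⟩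
          dots ws x +[ 𝟙 ] δ +[ ⊝ 𝟙 ] δ              ≡⟨ cong (_+[ ⊝ 𝟙 ] δ) (trans (sym (shift x)) r) ⟩
          b +[ ⊝ 𝟙 ] δ                               ≡⟨ back b c ⟩
          c ∎)
        (λ r → trans (shift x) (trans (cong (_+[ 𝟙 ] δ) r) (forth c b)))))
      where
      open ≡-Reasoning
      δ = b +[ ⊝ 𝟙 ] c
      e = lincomb δ es
      shift : ∀ x → dots ws (x +[ 𝟙 ] e) ≡ dots ws x +[ 𝟙 ] δ
      shift x = trans (dots-+ ws x 𝟙 e) (cong (dots ws x +[ 𝟙 ]_) (dual δ))
      forth : ∀ {k} (c b : Vec Carrier k) → c +[ 𝟙 ] (b +[ ⊝ 𝟙 ] c) ≡ b
      forth []      []      = refl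
      forth (c ∷ u) (b ∷ v) = cong₂ _∷_ (trans (cong (c ⊕_) (*-identityˡ _)) (trans (cong (λ z → c ⊕ (b ⊕ z)) (trans (sym (-‿distribˡ-* 𝟙 c)) (cong ⊝_ (*-identityˡ c))))
        (solve 2 (λ c b → c :+ (b :+ :- c) := b) refl c b))) (forth u v)
      back : ∀ {k} (b c : Vec Carrier k) → b +[ ⊝ 𝟙 ] (b +[ ⊝ 𝟙 ] c) ≡ c
      back []      []      = refl
      back (b ∷ u) (c ∷ v) = cong₂ _∷_ (trans (cong (b ⊕_) (trans (sym (-‿distribˡ-* 𝟙 _)) (cong ⊝_ (trans (*-identityˡ _) (cong (b ⊕_) (trans (sym (-‿distribˡ-* 𝟙 c)) (cong ⊝_ (*-identityˡ c))))))))
        (solve 2 (λ b c → b :+ :- (b :+ :- c) := c) refl b c)) (back u v)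

  private
    q-pow-≤ : ∀ m n → q ℤ.^ m ≤ q ℤ.^ n → m ℕ.≤ n
    q-pow-≤ m n p = ℕₚ.≮⇒≥ λ n<m → ℕₚ.<⇒≱ (ℕₚ.^-monoʳ-< card card>1 n<m) (ℤₚ.drop‿+≤+ (subst₂ _≤_ (pow m) (pow n) p))
      where
      pow : ∀ m → q ℤ.^ m ≡ + (card ℕ.^ m)
      pow zero    = refl
      pow (suc m) = trans (cong (q *_) (pow m)) (sym (pos-* card (card ℕ.^ m)))

    fibres-≥ : ∀ (ws : Vec (Vec Carrier d) k) c → (∀ b → c ≤ ∑ (allPoints d) (λ x → ⟦ dots ws x ≟ᵛ b ⟧)) → q ℤ.^ k * c ≤ q ℤ.^ d
    fibres-≥ {d} {k} ws c p = ≤-trans (≤-reflexive (sym (∑-vecs-const k elements c)))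
      (≤-trans (∑-mono (allPoints k) p) (≤-reflexive (∑-fibres ws)))

  -- Counting replaces rank: with a dual family all q^k fibres are nonempty, and they are disjoint
  -- subsets of q^d points.
  dual-≤ : ∀ (ws : Vec (Vec Carrier d) k) → Dual ws → k ℕ.≤ d
  dual-≤ {d} {k} ws (es , dual) = q-pow-≤ k d (≤-trans (≤-reflexive (sym (ℤₚ.*-identityʳ _))) (fibres-≥ ws 1ℤ λ b →
    ≤-trans (≤-reflexive (sym (⟦⟧-yes (dots ws (lincomb b es) ≟ᵛ b) (dual b))))
      (∑-term≤ (allPoints d) (λ x → ⟦⟧≥0 (dots ws x ≟ᵛ b)) (Enum.complete (points d) (lincomb b es)))))

  -- Enlarge ws by a vector f with z·f = 1. In a relation, pairing with z kills the coefficient of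
  -- f, and pairing with the dual family kills the others; hence f ∷ ws again has a dual family.
  dual-< : ∀ (ws : Vec (Vec Carrier d) k) → Dual ws → ∀ z → z ≢ 0ᵛ → dots ws z ≡ 0ᵛ → k ℕ.< d
  dual-< {d} {k} ws D@(es , dual) z z≢0 ws⊥z = dual-≤ (f ∷ ws) (lift (dependent-or-dual (f ∷ ws)))
    where
    f = proj₁ (dot-nondegenerate z z≢0)
    lift : Dependent (f ∷ ws) ⊎ Dual (f ∷ ws) → Dual (f ∷ ws)
    lift (inj₂ D′) = D′
    lift (inj₁ (c ∷ cs , c≢0 , e)) = contradiction (cong₂ _∷_ c≡0 cs≡0) c≢0
      where
      open ≡-Reasoning
      c≡0 : c ≡ 𝟘
      c≡0 = begin
        c ≡⟨ sym (*-identityʳ c) ⟩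
        c ⊗ 𝟙 ≡⟨ sym (+-identityʳ _) ⟩
        c ⊗ 𝟙 ⊕ 𝟘 ≡⟨ cong₂ (λ a b → c ⊗ a ⊕ b) (trans (sym (proj₂ (dot-nondegenerate z z≢0))) (dot-comm z f)) (trans (sym (dot-0ʳ cs)) (cong (dot cs) (sym ws⊥z))) ⟩
        dot (c ∷ cs) (dots (f ∷ ws) z) ≡⟨ sym (dot-lincomb (c ∷ cs) (f ∷ ws) z) ⟩
        dot (lincomb (c ∷ cs) (f ∷ ws)) z ≡⟨ cong (λ v → dot v z) e ⟩
        dot 0ᵛ z ≡⟨ dot-0ˡ z ⟩
        𝟘 ∎
      lc≡0 : lincomb cs ws ≡ 0ᵛ
      lc≡0 = trans (sym (+[0] _ f)) (trans (cong (lincomb cs ws +[_] f) (sym c≡0)) e)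
      cs≡0 : cs ≡ 0ᵛ
      cs≡0 with cs ≟ᵛ 0ᵛ
      ... | yes p = p
      ... | no p = contradiction (begin
        𝟘 ≡⟨ sym (dot-0ˡ (lincomb g es)) ⟩
        dot 0ᵛ (lincomb g es) ≡⟨ cong (λ v → dot v (lincomb g es)) (sym lc≡0) ⟩
        dot (lincomb cs ws) (lincomb g es) ≡⟨ dot-lincomb cs ws _ ⟩
        dot cs (dots ws (lincomb g es)) ≡⟨ cong (dot cs) (dual g) ⟩
        dot cs g ≡⟨ proj₂ (dot-nondegenerate cs p) ⟩
        𝟙 ∎) 0≢1
        where g = proj₁ (dot-nondegenerate cs p)

  dependent : ∀ (ws : Vec (Vec Carrier d) k) → d ℕ.< k → Dependent ws
  dependent ws d<k with dependent-or-dual ws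
  ... | inj₁ D = D
  ... | inj₂ D = contradiction (dual-≤ ws D) (ℕₚ.<⇒≱ d<k)

  dependent-⊥ : ∀ (ws : Vec (Vec Carrier d) k) z → z ≢ 0ᵛ → dots ws z ≡ 0ᵛ → d ℕ.≤ k → Dependent ws
  dependent-⊥ ws z z≢0 ws⊥z d≤k with dependent-or-dual ws
  ... | inj₁ D = D
  ... | inj₂ D = contradiction (dual-< ws D z z≢0 ws⊥z) (ℕₚ.≤⇒≯ d≤k)

  -- The coordinates of such a vector are the coefficients of a relation among the d columns, which
  -- live in dimension k < d.
  orthogonal : ∀ (ws : Vec (Vec Carrier d) k) → k ℕ.< d → ∃[ z ] (z ≢ 0ᵛ × dots ws z ≡ 0ᵛ)
  orthogonal ws k<d = let (z , z≢0 , e) = dependent (columns ws) k<d in z , z≢0 , trans (sym (lincomb-columns ws z)) e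
    where
    columns : ∀ {d k} → Vec (Vec Carrier d) k → Vec (Vec Carrier k) d
    columns []       = Vec.replicate _ []
    columns (w ∷ ws) = Vec.zipWith _∷_ w (columns ws)
    lincomb-∷ : ∀ {d k} (z w : Vec Carrier d) (cs : Vec (Vec Carrier k) d) → lincomb z (Vec.zipWith _∷_ w cs) ≡ dot w z ∷ lincomb z cs
    lincomb-∷ []      []      []       = refl
    lincomb-∷ (z ∷ u) (w ∷ v) (c ∷ cs) = trans (cong (_+[ z ] (w ∷ c)) (lincomb-∷ u v cs)) (cong (_∷ (lincomb u cs +[ z ] c)) (trans (+-comm _ _) (cong (_⊕ dot v u) (*-comm z w))))
    lincomb-columns : ∀ {d k} (ws : Vec (Vec Carrier d) k) z → lincomb z (columns ws) ≡ dots ws z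
    lincomb-columns [] z with lincomb z (columns [])
    ... | [] = refl
    lincomb-columns (w ∷ ws) z = trans (lincomb-∷ z w (columns ws)) (cong (dot w z ∷_) (lincomb-columns ws z))

-- Spheres and the upper bound for the VC-dimension

unique-lookup : ∀ {A : Set} {xs : List A} → Unique xs → ∀ i j → List.lookup xs i ≡ List.lookup xs j → i ≡ j
unique-lookup (_ AllPairs.∷ _) zero    zero    e = refl
unique-lookup (x AllPairs.∷ _) zero    (suc j) e = contradiction e (All.lookup x (∈-lookup j))
unique-lookup (x AllPairs.∷ _) (suc i) zero    e = contradiction (sym e) (All.lookup x (∈-lookup i))
unique-lookup (_ AllPairs.∷ u) (suc i) (suc j) e = cong suc (unique-lookup u i j e)

module Geometry (F : FiniteField) where
  open LinearAlgebra F public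
  open Field F

  private variable d : ℕ

  dist : Vec Carrier d → Vec Carrier d → Carrier
  dist x u = norm F (_⊖_ F x u)

  dist-expand : ∀ (x u : Vec Carrier d) → dist x u ≡ dot x x ⊕ dot u u ⊕ ⊝ (dot x u ⊕ dot x u)
  dist-expand []      []      = solve 0 (con 0ℤ := con 0ℤ :+ con 0ℤ :+ :- (con 0ℤ :+ con 0ℤ)) refl
  dist-expand (a ∷ x) (b ∷ u) = trans (cong ((a ⊕ ⊝ b) ⊗ (a ⊕ ⊝ b) ⊕_) (dist-expand x u))
    (solve 5 (λ a b p r s → (a :+ :- b) :* (a :+ :- b) :+ (p :+ r :+ :- (s :+ s))
      := a :* a :+ p :+ (b :* b :+ r) :+ :- (a :* b :+ s :+ (a :* b :+ s))) refl a b (dot x x) (dot u u) (dot x u))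

  dist-sym : ∀ (x u : Vec Carrier d) → dist x u ≡ dist u x
  dist-sym []      []      = refl
  dist-sym (a ∷ x) (b ∷ u) = cong₂ _⊕_ (solve 2 (λ a b → (a :+ :- b) :* (a :+ :- b) := (b :+ :- a) :* (b :+ :- a)) refl a b) (dist-sym x u)

  module _ {t : Carrier} {u v x : Vec Carrier d} where
    h-true : h F t u v x ≡ true → dist x u ≡ t × dist x v ≡ t
    h-true e with norm F (_⊖_ F x u) ≟ t | norm F (_⊖_ F x v) ≟ t
    h-true e | yes p | yes r = p , r
    h-true () | yes p | no r
    h-true () | no p | yes r
    h-true () | no p | no r

    h-true⁻ : dist x u ≡ t → dist x v ≡ t → h F t u v x ≡ true
    h-true⁻ p r with norm F (_⊖_ F x u) ≟ t | norm F (_⊖_ F x v) ≟ t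
    ... | yes _ | yes _ = refl
    ... | no ¬p | _     = contradiction p ¬p
    ... | yes _ | no ¬r = contradiction r ¬r

    h-false⁻ : ¬ (dist x u ≡ t × dist x v ≡ t) → h F t u v x ≡ false
    h-false⁻ n with norm F (_⊖_ F x u) ≟ t | norm F (_⊖_ F x v) ≟ t
    ... | yes p | yes r = contradiction (p , r) n
    ... | yes _ | no _  = refl
    ... | no _  | yes _ = refl
    ... | no _  | no _  = refl

  0+[]-zero : ∀ {a} (y : Vec Carrier d) → a ≢ 𝟘 → 0ᵛ +[ a ] y ≡ 0ᵛ → y ≡ 0ᵛ
  0+[]-zero []      p e = refl
  0+[]-zero (x ∷ y) p e = cong₂ _∷_ (domain (trans (sym (+-identityˡ _)) (cong Vec.head e)) p) (0+[]-zero y p (cong Vec.tail e))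

  nonzero-entry : ∀ (c : Vec Carrier d) → c ≢ 0ᵛ → ∃[ j ] Vec.lookup c j ≢ 𝟘
  nonzero-entry [] p = contradiction refl p
  nonzero-entry (a ∷ c) p with a ≟ 𝟘
  ... | no a≢0 = zero , a≢0
  ... | yes refl = let (j , r) = nonzero-entry c (λ { refl → p refl }) in suc j , r

  dot-single : ∀ (c y : Vec Carrier d) j → (∀ i → i ≢ j → Vec.lookup y i ≡ 𝟘) → dot c y ≡ Vec.lookup c j ⊗ Vec.lookup y j
  dot-single (a ∷ c) (b ∷ y) zero p = trans (cong (a ⊗ b ⊕_) (rest c y (λ i → p (suc i) λ ()))) (+-identityʳ _)
    where
    rest : ∀ {d} (c y : Vec Carrier d) → (∀ i → Vec.lookup y i ≡ 𝟘) → dot c y ≡ 𝟘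
    rest []      []      p = refl
    rest (a ∷ c) (b ∷ y) p = trans (cong₂ _⊕_ (trans (cong (a ⊗_) (p zero)) (zeroʳ a)) (rest c y (p ∘ suc))) (+-identityʳ 𝟘)
  dot-single (a ∷ c) (b ∷ y) (suc j) p = trans (cong₂ _⊕_ (trans (cong (a ⊗_) (p zero λ ())) (zeroʳ a)) (dot-single c y j (λ i n → p (suc i) (n ∘ Finₚ.suc-injective)))) (+-identityˡ _)

  -- On a sphere around u the distance to u′ is an affine function of the point.
  power-difference : ∀ (x u u′ : Vec Carrier d) →
    dot (𝟙 ∷ x) ((dot u′ u′ ⊕ ⊝ dot u u) ∷ (0ᵛ +[ 𝟙 ⊕ 𝟙 ] (u +[ ⊝ 𝟙 ] u′))) ≡ dist x u′ ⊕ ⊝ dist x u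
  power-difference x u u′ = begin
    𝟙 ⊗ (dot u′ u′ ⊕ ⊝ dot u u) ⊕ dot x (0ᵛ +[ 𝟙 ⊕ 𝟙 ] (u +[ ⊝ 𝟙 ] u′))
      ≡⟨ cong₂ _⊕_ (*-identityˡ _) (trans (dot-+ʳ x 0ᵛ (𝟙 ⊕ 𝟙) _) (cong₂ (λ a b → a ⊕ (𝟙 ⊕ 𝟙) ⊗ b) (dot-0ʳ x) (dot-+ʳ x u (⊝ 𝟙) u′))) ⟩
    (dot u′ u′ ⊕ ⊝ dot u u) ⊕ (𝟘 ⊕ (𝟙 ⊕ 𝟙) ⊗ (dot x u ⊕ ⊝ 𝟙 ⊗ dot x u′))
      ≡⟨ cong (λ a → (dot u′ u′ ⊕ ⊝ dot u u) ⊕ a) (trans (+-identityˡ _) (trans (distribʳ _ 𝟙 𝟙) (cong₂ _⊕_ lem lem))) ⟩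
    (dot u′ u′ ⊕ ⊝ dot u u) ⊕ (dot x u ⊕ ⊝ dot x u′ ⊕ (dot x u ⊕ ⊝ dot x u′))
      ≡⟨ solve 5 (λ a b c p r → a :+ :- b :+ (p :+ :- r :+ (p :+ :- r)) := c :+ a :+ :- (r :+ r) :+ :- (c :+ b :+ :- (p :+ p))) refl
           (dot u′ u′) (dot u u) (dot x x) (dot x u) (dot x u′) ⟩
    dot x x ⊕ dot u′ u′ ⊕ ⊝ (dot x u′ ⊕ dot x u′) ⊕ ⊝ (dot x x ⊕ dot u u ⊕ ⊝ (dot x u ⊕ dot x u))
      ≡⟨ sym (cong₂ (λ a b → a ⊕ ⊝ b) (dist-expand x u′) (dist-expand x u)) ⟩
    dist x u′ ⊕ ⊝ dist x u ∎
    where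
    open ≡-Reasoning
    lem : 𝟙 ⊗ (dot x u ⊕ ⊝ 𝟙 ⊗ dot x u′) ≡ dot x u ⊕ ⊝ dot x u′
    lem = trans (*-identityˡ _) (cong (dot x u ⊕_) (trans (sym (-‿distribˡ-* 𝟙 _)) (cong ⊝_ (*-identityˡ _))))

  module UpperBound (2≢0 : 𝟙 ⊕ 𝟙 ≢ 𝟘) (t : Carrier) {E : List (Vec Carrier d)} where
    private
      lift : (C : List (Vec Carrier d)) → Vec (Vec Carrier (suc d)) (length C)
      lift []      = []
      lift (x ∷ C) = (𝟙 ∷ x) ∷ lift C

      dots-lift : ∀ C g → (∀ x → x ∈ C → dot (𝟙 ∷ x) g ≡ 𝟘) → dots (lift C) g ≡ 0ᵛ
      dots-lift []      g p = refl
      dots-lift (x ∷ C) g p = cong₂ _∷_ (p x (here refl)) (dots-lift C g λ y m → p y (there m))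

      lookup-lift : ∀ C g i → Vec.lookup (dots (lift C) g) i ≡ dot (𝟙 ∷ List.lookup C i) g
      lookup-lift (x ∷ C) g zero    = refl
      lookup-lift (x ∷ C) g (suc i) = lookup-lift C g i

      relation : ∀ C g (c : Vec Carrier (length C)) → lincomb c (lift C) ≡ 0ᵛ → ∀ j → Vec.lookup c j ≢ 𝟘 →
                 (∀ i → i ≢ j → dot (𝟙 ∷ List.lookup C i) g ≡ 𝟘) → dot (𝟙 ∷ List.lookup C j) g ≡ 𝟘
      relation C g c e j cⱼ≢0 p = domain (begin
        Vec.lookup c j ⊗ dot (𝟙 ∷ List.lookup C j) g ≡⟨ cong (Vec.lookup c j ⊗_) (sym (lookup-lift C g j)) ⟩
        Vec.lookup c j ⊗ Vec.lookup (dots (lift C) g) j ≡⟨ sym (dot-single c (dots (lift C) g) j λ i i≢j → trans (lookup-lift C g i) (p i i≢j)) ⟩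
        dot c (dots (lift C) g) ≡⟨ sym (dot-lincomb c (lift C) g) ⟩
        dot (lincomb c (lift C)) g ≡⟨ cong (λ y → dot y g) e ⟩
        dot 0ᵛ g ≡⟨ dot-0ˡ g ⟩
        𝟘 ∎) cⱼ≢0
        where open ≡-Reasoning

      gap : Vec Carrier d → Vec Carrier d → Vec Carrier (suc d)
      gap u u′ = (dot u′ u′ ⊕ ⊝ dot u u) ∷ (0ᵛ +[ 𝟙 ⊕ 𝟙 ] (u +[ ⊝ 𝟙 ] u′))

      gap≢0 : ∀ u v → u ≢ v → gap u v ≢ 0ᵛ
      gap≢0 u v u≢v e = u≢v (-‿zero u v (0+[]-zero (u +[ ⊝ 𝟙 ] v) 2≢0 (cong Vec.tail e)))

      on-gap : ∀ u w x → dist x u ≡ t → dist x w ≡ t → dot (𝟙 ∷ x) (gap u w) ≡ 𝟘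
      on-gap u w x p r = trans (power-difference x u w) (≡⇒⊟≡0 (trans r (sym p)))

      off-gap : ∀ u w x → dist x u ≡ t → dot (𝟙 ∷ x) (gap u w) ≡ 𝟘 → dist x w ≡ t
      off-gap u w x p e = trans (⊟≡0⇒≡ (trans (sym (power-difference x u w)) e)) p

      all-but : Vec Carrier d → Vec Carrier d → Bool
      all-but y x = not ⌊ x ≟ᵛ y ⌋

      all-but-self : ∀ y → all-but y y ≡ false
      all-but-self y with y ≟ᵛ y
      ... | yes _ = refl
      ... | no n  = contradiction refl n

      all-but-other : ∀ {y x} → x ≢ y → all-but y x ≡ true
      all-but-other {y} {x} n with x ≟ᵛ y
      ... | yes e = contradiction e n
      ... | no _  = refl

      no-relation : ∀ C → Unique C → Shatters F t E C → ∀ u → (∀ x → x ∈ C → dist x u ≡ t) →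
                    ∀ c → c ≢ 0ᵛ → lincomb c (lift C) ≢ 0ᵛ
      no-relation C C! shatters u on-u c c≢0 e = contra (nonzero-entry c c≢0)
        where
        contra : ¬ (∃[ j ] Vec.lookup c j ≢ 𝟘)
        contra (j , cⱼ≢0) = separate (shatters (all-but xⱼ))
          where
          xⱼ = List.lookup C j
          separate : ¬ (∃[ u′ ] ∃[ v′ ] (u′ ∈ E × v′ ∈ E × u′ ≢ v′ × (∀ x → x ∈ C → h F t u′ v′ x ≡ all-but xⱼ x)))
          -- The value false at xⱼ only says that one of the two spheres misses xⱼ. The relation
          -- applies to each of them and puts xⱼ on both.
          separate (u′ , v′ , _ , _ , _ , H) =
            contradiction (trans (sym (h-true⁻ {u = u′} {v′} {xⱼ} (sphere u′ λ i n → proj₁ (both i n)) (sphere v′ λ i n → proj₂ (both i n))))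
              (trans (H xⱼ (∈-lookup j)) (all-but-self xⱼ))) λ ()
            where
            both : ∀ i → i ≢ j → dist (List.lookup C i) u′ ≡ t × dist (List.lookup C i) v′ ≡ t
            both i i≢j = h-true {u = u′} {v′} {List.lookup C i} (trans (H _ (∈-lookup i)) (all-but-other (i≢j ∘ unique-lookup C! i j)))
            sphere : ∀ w → (∀ i → i ≢ j → dist (List.lookup C i) w ≡ t) → dist xⱼ w ≡ t
            sphere w W = off-gap u w xⱼ (on-u xⱼ (∈-lookup j)) (relation C (gap u w) c e j cⱼ≢0 λ i i≢j → on-gap u w (List.lookup C i) (on-u _ (∈-lookup i)) (W i i≢j))

    vc≤ : ∀ C → SubsetOf F E C → Shatters F t E C → length C ℕ.≤ d
    vc≤ C (C! , _) shatters = ℕₚ.≮⇒≥ λ d< → contra d< (shatters (λ _ → true))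
      where
      contra : d ℕ.< length C → ¬ (∃[ u ] ∃[ v ] (u ∈ E × v ∈ E × u ≢ v × (∀ x → x ∈ C → h F t u v x ≡ true)))
      contra d< (u , v , _ , _ , u≢v , H) =
        -- The lifted points live in dimension d + 1, but in the hyperplane orthogonal to `gap u v`.
        -- This is why d + 1 points, and not d + 2, already force a relation.
        let (c , c≢0 , e) = dependent-⊥ (lift C) (gap u v) (gap≢0 u v u≢v)
              (dots-lift C (gap u v) λ x m → on-gap u v x (proj₁ (on x m)) (proj₂ (on x m))) d<
        in no-relation C C! shatters u (λ x m → proj₁ (on x m)) c c≢0 e
        where
        on : ∀ x → x ∈ C → dist x u ≡ t × dist x v ≡ t
        on x m = h-true {u = u} {v} {x} (H x m)

-- Polynomials and field extensions

module Polynomials (F : FiniteField) where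
  open LinearAlgebra F
  open Field F

  private variable m n : ℕ

  eval : Vec Carrier n → Carrier → Carrier
  eval []      s = 𝟘
  eval (a ∷ c) s = a ⊕ s ⊗ eval c s

  eval-+ : ∀ (c : Vec Carrier n) a b s → eval (c +[ a ] b) s ≡ eval c s ⊕ a ⊗ eval b s
  eval-+ []      a []      s = sym (trans (cong (𝟘 ⊕_) (zeroʳ a)) (+-identityˡ 𝟘))
  eval-+ (x ∷ c) a (y ∷ b) s = trans (cong (λ z → x ⊕ a ⊗ y ⊕ s ⊗ z) (eval-+ c a b s))
    (solve 6 (λ x a y s p r → x :+ a :* y :+ s :* (p :+ a :* r) := x :+ s :* p :+ a :* (y :+ s :* r)) refl x a y s (eval c s) (eval b s))

  eval-0 : ∀ n s → eval (0ᵛ {n}) s ≡ 𝟘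
  eval-0 zero    s = refl
  eval-0 (suc n) s = trans (+-identityˡ _) (trans (cong (s ⊗_) (eval-0 n s)) (zeroʳ s))

  eval-∷ʳ : ∀ (c : Vec Carrier n) l s → eval (c Vec.∷ʳ l) s ≡ eval c s ⊕ l ⊗ s ^ n
  eval-∷ʳ []      l s = trans (cong (l ⊕_) (zeroʳ s)) (trans (+-identityʳ l) (sym (trans (+-identityˡ _) (*-identityʳ l))))
  eval-∷ʳ {suc n} (a ∷ c) l s = trans (cong (λ z → a ⊕ s ⊗ z) (eval-∷ʳ c l s))
    (solve 5 (λ a s e l p → a :+ s :* (e :+ l :* p) := a :+ s :* e :+ l :* (s :* p)) refl a s (eval c s) l (s ^ n))

  -- Poly n f: f is given by a polynomial of degree < n.
  Poly : ℕ → (Carrier → Carrier) → Set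
  Poly n f = Σ (Vec Carrier n) λ c → ∀ s → f s ≡ eval c s

  poly-cong : ∀ {f g} → (∀ s → f s ≡ g s) → Poly n g → Poly n f
  poly-cong e (c , p) = c , λ s → trans (e s) (p s)

  poly-suc : ∀ {f} → Poly n f → Poly (suc n) f
  poly-suc (c , p) = c Vec.∷ʳ 𝟘 , λ s → trans (p s) (sym (trans (eval-∷ʳ c 𝟘 s) (trans (cong (eval c s ⊕_) (zeroˡ _)) (+-identityʳ _))))

  poly-≤ : ∀ {f} → m ℕ.≤ n → Poly m f → Poly n f
  poly-≤ p = go (ℕₚ.≤⇒≤′ p)
    where
    go : ∀ {m n f} → m ℕ.≤′ n → Poly m f → Poly n f
    go (ℕ.≤′-reflexive refl) r = r
    go (ℕ.≤′-step p) r = poly-suc (go p r)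

  poly-0 : Poly n (λ _ → 𝟘)
  poly-0 {n} = 0ᵛ , λ s → sym (eval-0 n s)

  poly-+ : ∀ {f g} → Poly n f → Poly n g → Poly n (λ s → f s ⊕ g s)
  poly-+ (c , p) (d , r) = c +[ 𝟙 ] d , λ s → trans (cong₂ _⊕_ (p s) (trans (r s) (sym (*-identityˡ _)))) (sym (eval-+ c 𝟙 d s))

  poly-scale : ∀ {f} a → Poly n f → Poly n (λ s → a ⊗ f s)
  poly-scale {n} a (c , p) = 0ᵛ +[ a ] c , λ s → trans (cong (a ⊗_) (p s)) (sym (trans (eval-+ 0ᵛ a c s) (trans (cong (_⊕ a ⊗ eval c s) (eval-0 n s)) (+-identityˡ _))))

  poly-shift : ∀ {f} → Poly n f → Poly (suc n) (λ s → s ⊗ f s)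
  poly-shift (c , p) = 𝟘 ∷ c , λ s → trans (cong (s ⊗_) (p s)) (sym (+-identityˡ _))

  poly-* : ∀ {f g} → Poly (suc m) f → Poly n g → Poly (m ℕ.+ n) (λ s → f s ⊗ g s)
  poly-* {zero} {n} {f} {g} (a ∷ [] , p) r = poly-cong (λ s → cong (_⊗ g s) (trans (p s) (trans (cong (a ⊕_) (zeroʳ s)) (+-identityʳ a)))) (poly-scale a r)
  poly-* {suc m} {n} {f} {g} (a ∷ c , p) r = poly-cong (λ s → trans (cong (_⊗ g s) (p s)) (solve 4 (λ a s e g → (a :+ s :* e) :* g := a :* g :+ s :* (e :* g)) refl a s (eval c s) (g s)))
    (poly-+ (poly-≤ (ℕₚ.m≤n+m n (suc m)) (poly-scale a r)) (poly-shift (poly-* (c , λ _ → refl) r)))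

  poly-^ : ∀ n → Poly (suc n) (_^ n)
  poly-^ zero    = 𝟙 ∷ [] , λ s → sym (trans (cong (𝟙 ⊕_) (zeroʳ s)) (+-identityʳ 𝟙))
  poly-^ (suc n) = poly-shift (poly-^ n)

  -- A function on a finite field does not determine a polynomial, so the degree belongs to the
  -- chosen representation. The coefficient l may be 𝟘 here; the degree is n once l ≢ 𝟘 is known.
  Lead : ℕ → Carrier → (Carrier → Carrier) → Set
  Lead n l f = Σ (Carrier → Carrier) λ r → Poly n r × (∀ s → f s ≡ l ⊗ s ^ n ⊕ r s)

  lead-poly : ∀ {l f} → Lead n l f → Poly (suc n) f
  lead-poly {n} {l} (r , p , e) = poly-cong e (poly-+ (poly-scale l (poly-^ n)) (poly-suc p))

  lead-cong : ∀ {l f g} → (∀ s → f s ≡ g s) → Lead n l g → Lead n l f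
  lead-cong e (r , p , e′) = r , p , λ s → trans (e s) (e′ s)

  monic-^ : ∀ n → Lead n 𝟙 (_^ n)
  monic-^ n = (λ _ → 𝟘) , poly-0 , λ s → sym (trans (+-identityʳ _) (*-identityˡ _))

  monic-* : ∀ {f g} → Lead m 𝟙 f → Lead n 𝟙 g → Lead (m ℕ.+ n) 𝟙 (λ s → f s ⊗ g s)
  monic-* {m} {n} {f} {g} (r , p , e) (r′ , p′ , e′) =
    (λ s → (𝟙 ⊗ s ^ m) ⊗ r′ s ⊕ r s ⊗ g s) ,
    poly-+ (poly-* (poly-scale 𝟙 (poly-^ m)) p′) (poly-≤ (ℕₚ.≤-reflexive (ℕₚ.+-comm n m)) (poly-cong (λ s → *-comm _ _) (poly-* (lead-poly (r′ , p′ , e′)) p))) ,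
    λ s → trans (cong₂ _⊗_ (e s) (e′ s)) (trans
      (solve 5 (λ o a b u v → (o :* a :+ u) :* (o :* b :+ v) := (o :* o) :* (a :* b) :+ ((o :* a) :* v :+ u :* (o :* b :+ v))) refl 𝟙 (s ^ m) (s ^ n) (r s) (r′ s))
      (cong₂ _⊕_ (cong₂ _⊗_ (*-identityˡ 𝟙) (sym (^-homo-* s m n))) (cong ((𝟙 ⊗ s ^ m) ⊗ r′ s ⊕_) (cong (r s ⊗_) (sym (e′ s))))))

  private
    -- Horner's scheme, that is, synthetic division by s - z.
    quotient : Vec Carrier (suc n) → Carrier → Vec Carrier n
    quotient (a ∷ [])        z = []
    quotient (a ∷ c@(_ ∷ _)) z = eval c z ∷ quotient c z

    divide : ∀ (c : Vec Carrier (suc n)) z s → eval c s ≡ eval c z ⊕ (s ⊕ ⊝ z) ⊗ eval (quotient c z) s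
    divide (a ∷ []) z s = solve 3 (λ a s z → a :+ s :* con 0ℤ := a :+ z :* con 0ℤ :+ (s :+ :- z) :* con 0ℤ) refl a s z
    divide (a ∷ c@(_ ∷ _)) z s = trans (cong (λ e → a ⊕ s ⊗ e) (divide c z s))
      (solve 5 (λ a s z e p → a :+ s :* (e :+ (s :+ :- z) :* p) := a :+ z :* e :+ (s :+ :- z) :* (e :+ s :* p)) refl a s z (eval c z) (eval (quotient c z) s))

    last-quotient : ∀ (c : Vec Carrier (suc (suc n))) z → Vec.last (quotient c z) ≡ Vec.last c
    last-quotient (a ∷ b ∷ [])        z = trans (cong (b ⊕_) (zeroʳ z)) (+-identityʳ b)
    last-quotient (a ∷ c@(b ∷ e ∷ _)) z = trans (last-∷ (eval c z) (quotient c z)) (trans (last-quotient c z) (sym (last-∷ a c)))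
      where
      last-∷ : ∀ {n} a (v : Vec Carrier (suc n)) → Vec.last (a ∷ v) ≡ Vec.last v
      last-∷ a v with Vec.initLast v
      ... | _ , _ , refl = refl

    roots : ∀ n (c : Vec Carrier (suc n)) → Vec.last c ≢ 𝟘 → ∀ zs → Unique zs → (∀ z → z ∈ zs → eval c z ≡ 𝟘) → length zs ℕ.≤ n
    roots n c l≢0 [] _ _ = ℕ.z≤n
    roots zero (a ∷ []) l≢0 (z ∷ zs) _ p = contradiction (trans (sym (trans (cong (a ⊕_) (zeroʳ z)) (+-identityʳ a))) (p z (here refl))) l≢0
    roots (suc n) c l≢0 (z ∷ zs) (z∉ AllPairs.∷ u) p = ℕ.s≤s (roots n (quotient c z) (λ e → l≢0 (trans (sym (last-quotient c z)) e)) zs u λ y m →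
      domain (trans (sym (trans (cong (_⊕ (y ⊕ ⊝ z) ⊗ eval (quotient c z) y) (p z (here refl))) (+-identityˡ _))) (trans (sym (divide c z y)) (p y (there m))))
        λ e → All.lookup z∉ m (sym (⊟≡0⇒≡ e)))

  root-bound : ∀ {l f} → Lead n l f → l ≢ 𝟘 → ∀ zs → Unique zs → (∀ z → z ∈ zs → f z ≡ 𝟘) → length zs ℕ.≤ n
  root-bound {n} {l} (r , (c , p) , e) l≢0 zs u Z = roots n (c Vec.∷ʳ l) (λ x → l≢0 (trans (sym (Vecₚ.last-∷ʳ l c)) x)) zs u λ z m →
    trans (eval-∷ʳ c l z) (trans (+-comm _ _) (trans (cong (l ⊗ z ^ n ⊕_) (sym (p z))) (trans (sym (e z)) (Z z m))))

  -- The head of the vector belongs to the last function. For functions of increasing degree the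
  -- first nonzero entry therefore supplies the leading term, as `comb-lead` uses.
  comb : Vec Carrier n → (ℕ → Carrier → Carrier) → Carrier → Carrier
  comb []              p s = 𝟘
  comb {suc n} (c ∷ u) p s = comb u p s ⊕ c ⊗ p n s

  comb-poly : ∀ {D p} (u : Vec Carrier n) → (∀ e → Lead (D ℕ.+ e) 𝟙 (p e)) → Poly (D ℕ.+ n) (comb u p)
  comb-poly [] M = poly-0
  comb-poly {suc n} {D} (c ∷ u) M = poly-≤ (ℕₚ.≤-reflexive (sym (ℕₚ.+-suc D n))) (poly-+ (poly-suc (comb-poly u M)) (poly-scale c (lead-poly (M n))))

  comb-lead : ∀ {D p} (u : Vec Carrier n) → (∀ e → Lead (D ℕ.+ e) 𝟙 (p e)) → u ≢ 0ᵛ →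
              ∃[ k ] ∃[ l ] (k ℕ.< D ℕ.+ n × l ≢ 𝟘 × Lead k l (comb u p))
  comb-lead [] M u≢0 = contradiction refl u≢0
  comb-lead {suc n} {D} {p} (c ∷ u) M u≢0 with c ≟ 𝟘
  ... | yes refl = let (k , l , k< , l≢0 , L) = comb-lead u M (λ { refl → u≢0 refl }) in
          k , l , ℕₚ.≤-trans k< (ℕₚ.+-monoʳ-≤ D (ℕₚ.n≤1+n n)) , l≢0 , lead-cong (λ s → trans (cong (comb u p s ⊕_) (zeroˡ _)) (+-identityʳ _)) L
  ... | no c≢0 = D ℕ.+ n , c , ℕₚ.≤-reflexive (sym (ℕₚ.+-suc D n)) , c≢0 , (λ s → comb u p s ⊕ c ⊗ proj₁ (M n) s) ,
          poly-+ (comb-poly u M) (poly-scale c (proj₁ (proj₂ (M n)))) ,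
          λ s → trans (cong (λ z → comb u p s ⊕ c ⊗ z) (trans (proj₂ (proj₂ (M n)) s) (cong (_⊕ proj₁ (M n) s) (*-identityˡ _))))
            (solve 4 (λ u c x r → u :+ c :* (x :+ r) := c :* x :+ (u :+ c :* r)) refl (comb u p s) c (s ^ (D ℕ.+ n)) (proj₁ (M n) s))

  -- More functions than coefficients: some combination vanishes identically.
  comb-vanish : ∀ {D} N (p : ℕ → Carrier → Carrier) → (∀ e → e ℕ.< N → Poly D (p e)) → D ℕ.< N →
                Σ (Vec Carrier N) λ u → u ≢ 0ᵛ × (∀ s → comb u p s ≡ 𝟘)
  comb-vanish {D} N p P D<N = let (u , u≢0 , e) = dependent (coeffs N P) D<N in
    u , u≢0 , λ s → trans (sym (eval-lincomb N P u s)) (trans (cong (λ c → eval c s) e) (eval-0 D s))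
    where
    coeffs : ∀ N → (∀ e → e ℕ.< N → Poly D (p e)) → Vec (Vec Carrier D) N
    coeffs zero    P = []
    coeffs (suc N) P = proj₁ (P N (ℕₚ.n<1+n N)) ∷ coeffs N λ e l → P e (ℕₚ.m≤n⇒m≤1+n l)
    eval-lincomb : ∀ N (P : ∀ e → e ℕ.< N → Poly D (p e)) u s → eval (lincomb u (coeffs N P)) s ≡ comb u p s
    eval-lincomb zero    P []      s = eval-0 D s
    eval-lincomb (suc N) P (c ∷ u) s = trans (eval-+ (lincomb u (coeffs N λ e l → P e (ℕₚ.m≤n⇒m≤1+n l))) c _ s)
      (cong₂ (λ a b → a ⊕ c ⊗ b) (eval-lincomb N (λ e l → P e (ℕₚ.m≤n⇒m≤1+n l)) u s) (sym (proj₂ (P N (ℕₚ.n<1+n N)) s)))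

module PolynomialIdentity (F : FiniteField) where
  open LinearAlgebra F
  open Field F
  open Polynomials F

  poly-zero-or-lead : ∀ n {f} → Poly n f → (∀ s → f s ≡ 𝟘) ⊎ (∃[ k ] ∃[ l ] (k ℕ.< n × l ≢ 𝟘 × Lead k l f))
  poly-zero-or-lead zero ([] , p) = inj₁ p
  poly-zero-or-lead (suc n) {f} (c , p) with Vec.initLast c
  ... | c′ , l , refl with l ≟ 𝟘
  ...   | no l≢0 = inj₂ (n , l , ℕₚ.n<1+n n , l≢0 , eval c′ , (c′ , λ _ → refl) , λ s → trans (p s) (trans (eval-∷ʳ c′ l s) (+-comm _ _)))
  ...   | yes refl with poly-zero-or-lead n {f} (c′ , λ s → trans (p s) (trans (eval-∷ʳ c′ 𝟘 s) (trans (cong (eval c′ s ⊕_) (zeroˡ _)) (+-identityʳ _))))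
  ...     | inj₁ z = inj₁ z
  ...     | inj₂ (k , m , k<n , rest) = inj₂ (k , m , ℕₚ.m≤n⇒m≤1+n k<n , rest)

  poly-identity : ∀ n {f} → Poly n f → ∀ zs → Unique zs → n ℕ.≤ length zs → (∀ z → z ∈ zs → f z ≡ 𝟘) → ∀ s → f s ≡ 𝟘
  poly-identity n P zs u len Z with poly-zero-or-lead n P
  ... | inj₁ p = p
  ... | inj₂ (k , l , k<n , l≢0 , L) = contradiction (root-bound L l≢0 zs u Z) (ℕₚ.<⇒≱ (ℕₚ.<-≤-trans k<n len))

record Embedding (F K : FiniteField) : Set where
  private
    module F = Field F
    module K = Field K
  field
    ι   : ⟨ F ⟩ → ⟨ K ⟩
    ι-+ : ∀ x y → ι (x F.⊕ y) ≡ ι x K.⊕ ι y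
    ι-* : ∀ x y → ι (x F.⊗ y) ≡ ι x K.⊗ ι y
    ι-1 : ι F.𝟙 ≡ K.𝟙

  ι-0 : ι F.𝟘 ≡ K.𝟘
  ι-0 = K.⊕-cancelˡ (trans (sym (ι-+ F.𝟘 F.𝟘)) (trans (cong ι (F.+-identityˡ F.𝟘)) (sym (K.+-identityʳ _))))

  ι-^ : ∀ x n → ι (x F.^ n) ≡ ι x K.^ n
  ι-^ x zero    = ι-1
  ι-^ x (suc n) = trans (ι-* x _) (cong (ι x K.⊗_) (ι-^ x n))

  ι-≢0 : ∀ {x} → x ≢ F.𝟘 → ι x ≢ K.𝟘
  ι-≢0 {x} p e = K.0≢1 (trans (sym (K.zeroˡ _)) (trans (cong (K._⊗ ι (F.inv x)) (sym e)) (trans (sym (ι-* x _)) (trans (cong ι (F.inv-right p)) ι-1))))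

  ι-⊝ : ∀ x → ι (F.⊝ x) ≡ K.⊝ ι x
  ι-⊝ x = K.⊕-cancelˡ (trans (sym (ι-+ x (F.⊝ x))) (trans (cong ι (F.-‿inverseʳ x)) (trans ι-0 (sym (K.-‿inverseʳ (ι x))))))

  ι-injective : ∀ {x y} → ι x ≡ ι y → x ≡ y
  ι-injective {x} {y} e with (x F.⊕ F.⊝ y) F.≟ F.𝟘
  ... | yes p = F.⊟≡0⇒≡ p
  ... | no p  = contradiction (trans (ι-+ x (F.⊝ y)) (trans (cong₂ K._⊕_ e (ι-⊝ y)) (K.-‿inverseʳ (ι y)))) (ι-≢0 p)

  ι-2≢0 : F.𝟙 F.⊕ F.𝟙 ≢ F.𝟘 → K.𝟙 K.⊕ K.𝟙 ≢ K.𝟘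
  ι-2≢0 p e = ι-≢0 p (trans (ι-+ _ _) (trans (cong₂ K._⊕_ ι-1 ι-1) e))

  private
    module P = Polynomials K
    open K using (_⊕_; _⊗_; ⊝_; _^_; 𝟙; 𝟘)

    roots : List ⟨ K ⟩
    roots = List.map ι F.elements

    -- The leading terms cancel. The recursion (s + 1)^(n+1) - s^(n+1) = s·((s + 1)^n - s^n) + (s +
    -- 1)^n shows this without binomial coefficients.
    binomial : ∀ n → P.Poly n (λ s → (s ⊕ 𝟙) ^ n ⊕ ⊝ (s ^ n))
    binomial zero = [] , λ s → K.-‿inverseʳ 𝟙
    binomial (suc n) = P.poly-cong
      (λ s → trans (K.solve 4 (λ s o a b → (s K.:+ o) K.:* a K.:+ K.:- (s K.:* b) K.:= s K.:* (a K.:+ K.:- b) K.:+ o K.:* a) refl s 𝟙 ((s ⊕ 𝟙) ^ n) (s ^ n))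
        (cong (s ⊗ ((s ⊕ 𝟙) ^ n ⊕ ⊝ (s ^ n)) ⊕_) (trans (K.*-identityˡ _) (K.solve 2 (λ a b → a K.:= (a K.:+ K.:- b) K.:+ b) refl ((s ⊕ 𝟙) ^ n) (s ^ n)))))
      (P.poly-+ (P.poly-shift (binomial n)) (P.poly-+ (P.poly-suc (binomial n)) (P.poly-^ n)))

  -- Both sides agree on ι(F), which has q elements, and their difference has degree < q.
  frobenius-1 : ∀ s → (s ⊕ 𝟙) ^ F.card ≡ s ^ F.card ⊕ 𝟙
  frobenius-1 s = K.⊟≡0⇒≡ (trans (K.solve 3 (λ a b o → a K.:+ K.:- (b K.:+ o) K.:= a K.:+ K.:- b K.:+ K.:- o) refl ((s ⊕ 𝟙) ^ F.card) (s ^ F.card) 𝟙)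
    (PolynomialIdentity.poly-identity K F.card difference roots (Uniqueₚ.map⁺ ι-injective F.elements-unique) (ℕₚ.≤-reflexive (sym (Listₚ.length-map ι F.elements))) vanish s))
    where
    difference : P.Poly F.card (λ s → (s ⊕ 𝟙) ^ F.card ⊕ ⊝ (s ^ F.card) ⊕ ⊝ 𝟙)
    difference = P.poly-+ {f = λ s → (s ⊕ 𝟙) ^ F.card ⊕ ⊝ (s ^ F.card)} {g = λ _ → ⊝ 𝟙} (binomial F.card)
      (P.poly-≤ (ℕₚ.≤-trans (ℕₚ.n≤1+n 1) F.card>1) (P.poly-cong {f = λ _ → ⊝ 𝟙} (λ s → sym (K.*-identityʳ (⊝ 𝟙))) (P.poly-scale (⊝ 𝟙) (P.poly-^ 0))))
    vanish : ∀ z → z ∈ roots → (z ⊕ 𝟙) ^ F.card ⊕ ⊝ (z ^ F.card) ⊕ ⊝ 𝟙 ≡ 𝟘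
    vanish z m with a , _ , refl ← ∈-map⁻ ι m = trans (cong₂ (λ x y → x ⊕ ⊝ y ⊕ ⊝ 𝟙)
        (trans (cong (_^ F.card) (trans (cong (ι a ⊕_) (sym ι-1)) (sym (ι-+ a F.𝟙)))) (trans (sym (ι-^ _ F.card)) (trans (cong ι (F.fermat _)) (trans (ι-+ a F.𝟙) (cong (ι a ⊕_) ι-1)))))
        (trans (sym (ι-^ a F.card)) (cong ι (F.fermat a))))
      (K.solve 2 (λ a o → a K.:+ o K.:+ K.:- a K.:+ K.:- o K.:= K.con 0ℤ) refl (ι a) 𝟙)

  -- For y ≠ 0, division by y reduces the claim to `frobenius-1`. The argument works with the order
  -- of F itself instead of its characteristic.
  frobenius-+ : ∀ x y → (x ⊕ y) ^ F.card ≡ x ^ F.card ⊕ y ^ F.card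
  frobenius-+ x y with y K.≟ 𝟘
  ... | yes refl = trans (cong (_^ F.card) (K.+-identityʳ x)) (sym (trans (cong (x ^ F.card ⊕_) 0^) (K.+-identityʳ _)))
    where
    0^ : 𝟘 ^ F.card ≡ 𝟘
    0^ = trans (sym (cong (_^ F.card) ι-0)) (trans (sym (ι-^ F.𝟘 F.card)) (trans (cong ι (F.fermat F.𝟘)) ι-0))
  ... | no y≢0 = begin
    (x ⊕ y) ^ F.card                          ≡⟨ cong (_^ F.card) (sym (ratio x)) ⟩
    (y ⊗ (K.inv y ⊗ x ⊕ 𝟙)) ^ F.card          ≡⟨ K.^-distrib-* y _ F.card ⟩
    y ^ F.card ⊗ (K.inv y ⊗ x ⊕ 𝟙) ^ F.card   ≡⟨ cong (y ^ F.card ⊗_) (frobenius-1 _) ⟩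
    y ^ F.card ⊗ ((K.inv y ⊗ x) ^ F.card ⊕ 𝟙) ≡⟨ trans (K.distribˡ _ _ _) (cong₂ _⊕_ (sym (K.^-distrib-* y _ F.card)) (K.*-identityʳ _)) ⟩
    (y ⊗ (K.inv y ⊗ x)) ^ F.card ⊕ y ^ F.card ≡⟨ cong (λ z → z ^ F.card ⊕ y ^ F.card) (cancel x) ⟩
    x ^ F.card ⊕ y ^ F.card                   ∎
    where
    open ≡-Reasoning
    cancel : ∀ x → y ⊗ (K.inv y ⊗ x) ≡ x
    cancel x = trans (sym (K.*-assoc y _ x)) (trans (cong (_⊗ x) (K.inv-right y≢0)) (K.*-identityˡ x))
    ratio : ∀ x → y ⊗ (K.inv y ⊗ x ⊕ 𝟙) ≡ x ⊕ y
    ratio x = trans (K.distribˡ y _ 𝟙) (cong₂ _⊕_ (cancel x) (K.*-identityʳ y))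

  frobenius^-+ : ∀ m x y → (x ⊕ y) ^ (F.card ℕ.^ m) ≡ x ^ (F.card ℕ.^ m) ⊕ y ^ (F.card ℕ.^ m)
  frobenius^-+ zero x y = trans (K.*-identityʳ _) (sym (cong₂ _⊕_ (K.*-identityʳ x) (K.*-identityʳ y)))
  frobenius^-+ (suc m) x y = begin
    (x ⊕ y) ^ (F.card ℕ.* F.card ℕ.^ m)              ≡⟨ sym (K.^-assocʳ (x ⊕ y) F.card (F.card ℕ.^ m)) ⟩
    ((x ⊕ y) ^ F.card) ^ (F.card ℕ.^ m)              ≡⟨ cong (_^ (F.card ℕ.^ m)) (frobenius-+ x y) ⟩
    (x ^ F.card ⊕ y ^ F.card) ^ (F.card ℕ.^ m)       ≡⟨ frobenius^-+ m _ _ ⟩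
    (x ^ F.card) ^ (F.card ℕ.^ m) ⊕ (y ^ F.card) ^ (F.card ℕ.^ m) ≡⟨ cong₂ _⊕_ (K.^-assocʳ x F.card (F.card ℕ.^ m)) (K.^-assocʳ y F.card (F.card ℕ.^ m)) ⟩
    x ^ (F.card ℕ.* F.card ℕ.^ m) ⊕ y ^ (F.card ℕ.* F.card ℕ.^ m) ∎
    where open ≡-Reasoning

  -- trace polynomial x + x^q + … + x^(q^(m−1))
  H : ℕ → ⟨ K ⟩ → ⟨ K ⟩
  H zero    x = 𝟘
  H (suc m) x = H m x ⊕ x ^ (F.card ℕ.^ m)

  H-+ : ∀ m x y → H m (x ⊕ y) ≡ H m x ⊕ H m y
  H-+ zero    x y = sym (K.+-identityˡ 𝟘)
  H-+ (suc m) x y = trans (cong₂ _⊕_ (H-+ m x y) (frobenius^-+ m x y))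
    (K.solve 4 (λ a b c d → a K.:+ b K.:+ (c K.:+ d) K.:= a K.:+ c K.:+ (b K.:+ d)) refl (H m x) (H m y) _ _)

  -- The exponents q^i with i < m and with i ≥ m are grouped; along a tower of fields this is the
  -- transitivity of the trace.
  H-split : ∀ m n x → H (m ℕ.+ n) x ≡ H m x ⊕ H n (x ^ (F.card ℕ.^ m))
  H-split m zero x = trans (cong (λ k → H k x) (ℕₚ.+-identityʳ m)) (sym (K.+-identityʳ _))
  H-split m (suc n) x = trans (cong (λ k → H k x) (ℕₚ.+-suc m n)) (trans (cong₂ _⊕_ (H-split m n x)
    (trans (cong (x ^_) (ℕₚ.^-distribˡ-+-* F.card m n)) (sym (K.^-assocʳ x (F.card ℕ.^ m) (F.card ℕ.^ n))))) (K.+-assoc _ _ _))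

  H-^ : ∀ m n x → H m (x ^ (F.card ℕ.^ n)) ≡ H m x ^ (F.card ℕ.^ n)
  H-^ zero n x = sym (trans (sym (cong (_^ (F.card ℕ.^ n)) ι-0)) (trans (sym (ι-^ F.𝟘 (F.card ℕ.^ n))) (trans (cong ι (0^ n)) ι-0)))
    where
    0^ : ∀ n → F.𝟘 F.^ (F.card ℕ.^ n) ≡ F.𝟘
    0^ zero    = F.zeroˡ _
    0^ (suc n) = trans (sym (F.^-assocʳ F.𝟘 F.card (F.card ℕ.^ n))) (trans (cong (F._^ (F.card ℕ.^ n)) (F.fermat F.𝟘)) (0^ n))
  H-^ (suc m) n x = trans (cong₂ _⊕_ (H-^ m n x) (trans (K.^-assocʳ x (F.card ℕ.^ n) (F.card ℕ.^ m)) (trans (cong (x ^_) (ℕₚ.*-comm (F.card ℕ.^ n) (F.card ℕ.^ m))) (sym (K.^-assocʳ x (F.card ℕ.^ m) (F.card ℕ.^ n)))))) (sym (frobenius^-+ n _ _))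

module Quadratic (K : FiniteField) (ν : ⟨ K ⟩) (ns : ∀ y → FiniteField._*_ K y y ≢ ν) where
  open Field K

  private
    C : Set
    C = Carrier × Carrier

    _+′_ _*′_ : C → C → C
    (a , b) +′ (c , d) = a ⊕ c , b ⊕ d
    (a , b) *′ (c , d) = a ⊗ c ⊕ ν ⊗ (b ⊗ d) , a ⊗ d ⊕ b ⊗ c

    -′_ : C → C
    -′ (a , b) = ⊝ a , ⊝ b

    0′ 1′ : C
    0′ = 𝟘 , 𝟘
    1′ = 𝟙 , 𝟘

    isCR : IsCommutativeRing _≡_ _+′_ _*′_ -′_ 0′ 1′
    isCR = record
      { isRing = record
        { +-isAbelianGroup = record
          { isGroup = record
            { isMonoid = record
              { isSemigroup = record
                { isMagma = record { isEquivalence = isEquivalence ; ∙-cong = cong₂ _+′_ }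
                ; assoc = λ (a , b) (c , d) (e , f) → cong₂ _,_ (+-assoc a c e) (+-assoc b d f) }
              ; identity = (λ (a , b) → cong₂ _,_ (+-identityˡ a) (+-identityˡ b)) , (λ (a , b) → cong₂ _,_ (+-identityʳ a) (+-identityʳ b)) }
            ; inverse = (λ (a , b) → cong₂ _,_ (-‿inverseˡ a) (-‿inverseˡ b)) , (λ (a , b) → cong₂ _,_ (-‿inverseʳ a) (-‿inverseʳ b))
            ; ⁻¹-cong = cong -′_ }
          ; comm = λ (a , b) (c , d) → cong₂ _,_ (+-comm a c) (+-comm b d) }
        ; *-cong = cong₂ _*′_
        ; *-assoc = λ (a , b) (c , d) (e , f) → cong₂ _,_
            (solve 7 (λ a b c d e f n → (a :* c :+ n :* (b :* d)) :* e :+ n :* ((a :* d :+ b :* c) :* f) := a :* (c :* e :+ n :* (d :* f)) :+ n :* (b :* (c :* f :+ d :* e))) refl a b c d e f ν)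
            (solve 7 (λ a b c d e f n → (a :* c :+ n :* (b :* d)) :* f :+ (a :* d :+ b :* c) :* e := a :* (c :* f :+ d :* e) :+ b :* (c :* e :+ n :* (d :* f))) refl a b c d e f ν)
        ; *-identity = (λ x → trans (comm 1′ x) (idʳ x)) , idʳ
        ; distrib = (λ (a , b) (c , d) (e , f) → cong₂ _,_
              (solve 7 (λ a b c d e f n → a :* (c :+ e) :+ n :* (b :* (d :+ f)) := a :* c :+ n :* (b :* d) :+ (a :* e :+ n :* (b :* f))) refl a b c d e f ν)
              (solve 6 (λ a b c d e f → a :* (d :+ f) :+ b :* (c :+ e) := a :* d :+ b :* c :+ (a :* f :+ b :* e)) refl a b c d e f))
          , (λ (a , b) (c , d) (e , f) → cong₂ _,_
              (solve 7 (λ a b c d e f n → (c :+ e) :* a :+ n :* ((d :+ f) :* b) := c :* a :+ n :* (d :* b) :+ (e :* a :+ n :* (f :* b))) refl a b c d e f ν)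
              (solve 6 (λ a b c d e f → (c :+ e) :* b :+ (d :+ f) :* a := c :* b :+ d :* a :+ (e :* b :+ f :* a)) refl a b c d e f)) }
      ; *-comm = comm }
      where
      comm : ∀ x y → x *′ y ≡ y *′ x
      comm (a , b) (c , d) = cong₂ _,_ (cong₂ (λ p r → p ⊕ ν ⊗ r) (*-comm a c) (*-comm b d)) (trans (+-comm _ _) (cong₂ _⊕_ (*-comm b c) (*-comm a d)))
      idʳ : ∀ x → x *′ 1′ ≡ x
      idʳ (a , b) = cong₂ _,_
        (trans (cong₂ _⊕_ (*-identityʳ a) (trans (cong (ν ⊗_) (zeroʳ b)) (zeroʳ ν))) (+-identityʳ a))
        (trans (cong₂ _⊕_ (zeroʳ a) (*-identityʳ b)) (+-identityˡ b))

  norm-form : Carrier → Carrier → Carrier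
  norm-form a b = a ⊗ a ⊕ ⊝ (ν ⊗ (b ⊗ b))

  -- For b ≠ 0 a zero would make ν the square of a/b. Conjugate over norm is therefore an inverse in
  -- the extension.
  norm-form≢0 : ∀ {a b} → (a , b) ≢ (𝟘 , 𝟘) → norm-form a b ≢ 𝟘
  norm-form≢0 {a} {b} p e with b ≟ 𝟘
  ... | yes refl = p (cong (_, 𝟘) (sq≡0⇒ (trans (solve 2 (λ a n → a :* a := a :* a :+ :- (n :* (con 0ℤ :* con 0ℤ))) refl a ν) e)))
  ... | no b≢0 = ns (a ⊗ inv b) (begin
    a ⊗ inv b ⊗ (a ⊗ inv b)       ≡⟨ solve 2 (λ a i → a :* i :* (a :* i) := a :* a :* (i :* i)) refl a (inv b) ⟩
    a ⊗ a ⊗ (inv b ⊗ inv b)       ≡⟨ cong (_⊗ (inv b ⊗ inv b)) (⊟≡0⇒≡ e) ⟩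
    ν ⊗ (b ⊗ b) ⊗ (inv b ⊗ inv b) ≡⟨ solve 3 (λ n b i → n :* (b :* b) :* (i :* i) := n :* ((b :* i) :* (b :* i))) refl ν b (inv b) ⟩
    ν ⊗ ((b ⊗ inv b) ⊗ (b ⊗ inv b)) ≡⟨ cong (λ z → ν ⊗ (z ⊗ z)) (inv-right b≢0) ⟩
    ν ⊗ (𝟙 ⊗ 𝟙)                   ≡⟨ trans (cong (ν ⊗_) (*-identityˡ 𝟙)) (*-identityʳ ν) ⟩
    ν ∎)
    where open ≡-Reasoning

  extension : FiniteField
  extension = record
    { Carrier = C ; _+_ = _+′_ ; _*_ = _*′_ ; -_ = -′_ ; 0# = 0′ ; 1# = 1′
    ; isCommutativeRing = isCR
    ; 0≢1 = λ e → 0≢1 (cong proj₁ e)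
    ; inverse = λ (a , b) p → (a ⊗ inv (norm-form a b) , ⊝ b ⊗ inv (norm-form a b)) , cong₂ _,_
        (trans (solve 4 (λ a b i n → a :* (a :* i) :+ n :* (b :* (:- b :* i)) := (a :* a :+ :- (n :* (b :* b))) :* i) refl a b (inv (norm-form a b)) ν) (inv-right (norm-form≢0 p)))
        (solve 3 (λ a b i → a :* (:- b :* i) :+ b :* (a :* i) := con 0ℤ) refl a b (inv (norm-form a b)))
    ; _≟_ = λ (a , b) (c , d) → map′ (λ (p , r) → cong₂ _,_ p r) (λ e → cong proj₁ e , cong proj₂ e) (a ≟ c ×-dec b ≟ d)
    ; elements = cartesianProductWith _,_ elements elements
    ; elements-unique = Uniqueₚ.cartesianProductWith⁺ _,_ (λ e → cong proj₁ e , cong proj₂ e) elements-unique elements-unique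
    ; elements-complete = λ (a , b) → ∈-cartesianProductWith⁺ _,_ (elements-complete a) (elements-complete b) }

  private module L = Field extension

  embedding : Embedding K extension
  embedding = record
    { ι = λ a → a , 𝟘
    ; ι-+ = λ a b → cong (a ⊕ b ,_) (sym (+-identityˡ 𝟘))
    ; ι-* = λ a b → cong₂ _,_ (solve 3 (λ a b n → a :* b := a :* b :+ n :* (con 0ℤ :* con 0ℤ)) refl a b ν) (solve 2 (λ a b → con 0ℤ := a :* con 0ℤ :+ con 0ℤ :* b) refl a b)
    ; ι-1 = refl }

  open Embedding embedding using (ι; ι-^; ι-+; ι-*; ι-2≢0)

  ∑-extension : ∀ (f : L.Carrier → ℤ) → ∑ L.elements f ≡ ∑ elements (λ a → ∑ elements (λ b → f (a , b)))
  ∑-extension f = ∑-product _,_ elements elements f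

  card-extension : L.card ≡ card ℕ.* card
  card-extension = ℤₚ.+-injective (begin
    L.q ≡⟨ sym (ℤₚ.*-identityʳ L.q) ⟩
    L.q * 1ℤ ≡⟨ sym (∑-const L.elements 1ℤ) ⟩
    ∑ L.elements (λ _ → 1ℤ) ≡⟨ ∑-extension _ ⟩
    ∑ elements (λ _ → ∑ elements (λ _ → 1ℤ)) ≡⟨ ∑-cong elements (λ _ → ∑-const elements 1ℤ) ⟩
    ∑ elements (λ _ → q * 1ℤ) ≡⟨ ∑-const elements (q * 1ℤ) ⟩
    q * (q * 1ℤ) ≡⟨ cong (q *_) (ℤₚ.*-identityʳ q) ⟩
    q * q ≡⟨ sym (pos-* card card) ⟩
    + (card ℕ.* card) ∎)
    where open ≡-Reasoning

  conj : L.Carrier → L.Carrier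
  conj (a , b) = a , ⊝ b

  private
    √ν : L.Carrier
    √ν = 𝟘 , 𝟙

    √ν² : √ν L.⊗ √ν ≡ ι ν
    √ν² = cong₂ _,_ (trans (+-identityˡ′ (zeroˡ 𝟘)) (trans (cong (ν ⊗_) (*-identityˡ 𝟙)) (*-identityʳ ν))) (trans (+-identityˡ′ (zeroˡ 𝟙)) (zeroʳ 𝟙))
      where
      +-identityˡ′ : ∀ {x y} → x ≡ 𝟘 → x ⊕ y ≡ y
      +-identityˡ′ refl = +-identityˡ _

    decompose : ∀ a b → (a , b) ≡ ι a L.⊕ ι b L.⊗ √ν
    decompose a b = cong₂ _,_
      (sym (trans (cong (a ⊕_) (trans (cong₂ _⊕_ (zeroʳ b) (trans (cong (ν ⊗_) (zeroˡ 𝟙)) (zeroʳ ν))) (+-identityˡ 𝟘))) (+-identityʳ a)))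
      (sym (trans (+-identityˡ _) (trans (cong₂ _⊕_ (*-identityʳ b) (zeroˡ 𝟘)) (+-identityʳ b))))

  -- The image of √ν under x ↦ x^P is ±√ν, and not √ν since X^P − X has only P roots.
  frobenius-conj : ∀ z → z L.^ card ≡ conj z
  frobenius-conj z = trans (split z) (cong₂ _,_ refl refl)
    where
    open Polynomials extension using (root-bound; Lead; poly-≤; poly-scale; poly-^)
    ι^ : ∀ a → ι a L.^ card ≡ ι a
    ι^ a = trans (sym (ι-^ a card)) (cong ι (fermat a))
    image : ∀ a b → (a , b) L.^ card ≡ ι a L.⊕ ι b L.⊗ √ν L.^ card
    image a b = trans (cong (L._^ card) (decompose a b)) (trans (Embedding.frobenius-+ embedding (ι a) _)
      (cong₂ L._⊕_ (ι^ a) (trans (L.^-distrib-* (ι b) √ν card) (cong (L._⊗ √ν L.^ card) (ι^ b)))))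
    square : √ν L.^ card L.⊗ √ν L.^ card ≡ √ν L.⊗ √ν
    square = trans (sym (L.^-distrib-* √ν √ν card)) (trans (cong (L._^ card) √ν²) (trans (ι^ ν) (sym √ν²)))
    lead : Lead card L.𝟙 (λ s → s L.^ card L.⊕ L.⊝ s)
    lead = (λ s → L.⊝ L.𝟙 L.⊗ s L.^ 1) , poly-≤ card>1 (poly-scale (L.⊝ L.𝟙) (poly-^ 1)) ,
      λ s → cong₂ L._⊕_ (sym (L.*-identityˡ _)) (trans (cong L.⊝_ (sym (trans (L.*-identityˡ _) (L.*-identityʳ s)))) (L.-‿distribˡ-* L.𝟙 (s L.^ 1)))
    negated : √ν L.^ card ≡ L.⊝ √ν
    negated with L.sq≡⇒ square
    ... | inj₂ p = p
    ... | inj₁ p = contradiction (root-bound lead (λ e → L.0≢1 (sym e)) L.elements L.elements-unique λ { (a , b) _ →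
            L.≡⇒⊟≡0 (trans (image a b) (trans (cong (λ w → ι a L.⊕ ι b L.⊗ w) p) (sym (decompose a b)))) })
          (ℕₚ.<⇒≱ (subst (card ℕ.<_) (sym card-extension) (ℕₚ.m<m*n card card ⦃ ℕ.>-nonZero (ℕₚ.≤-trans (ℕₚ.n≤1+n 1) card>1) ⦄ card>1)))
    split : ∀ z → z L.^ card ≡ conj z
    split (a , b) = trans (image a b) (trans (cong (λ w → ι a L.⊕ ι b L.⊗ w) negated) (cong₂ _,_
      (trans (cong (a ⊕_) (trans (cong₂ _⊕_ (trans (cong (b ⊗_) -0#≈0#) (zeroʳ b)) (trans (cong (ν ⊗_) (zeroˡ _)) (zeroʳ ν))) (+-identityˡ 𝟘))) (+-identityʳ a))
      (trans (+-identityˡ _) (trans (cong₂ _⊕_ (trans (sym (-‿distribʳ-* b 𝟙)) (cong ⊝_ (*-identityʳ b))) (zeroˡ _)) (+-identityʳ _)))))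

-- The Weil bound

_∘ᴱ_ : ∀ {F K L} → Embedding K L → Embedding F K → Embedding F L
E ∘ᴱ D = record
  { ι = λ x → E.ι (D.ι x)
  ; ι-+ = λ x y → trans (cong E.ι (D.ι-+ x y)) (E.ι-+ _ _)
  ; ι-* = λ x y → trans (cong E.ι (D.ι-* x y)) (E.ι-* _ _)
  ; ι-1 = trans (cong E.ι D.ι-1) E.ι-1 }
  where
  module E = Embedding E
  module D = Embedding D

-- The Stepanov–Bombieri method for the points with Tr(s + β/s) = c.
module Stepanov (F K L : FiniteField) (ε : Embedding F K) (δ : Embedding K L) (m : ℕ)
                (card-K : FiniteField.order K ≡ FiniteField.order F ℕ.^ suc m)
                (card-L : FiniteField.order L ≡ FiniteField.order K ℕ.* FiniteField.order K) (β : ⟨ F ⟩) where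
  private
    module F = Field F
    module K = Field K
    module εL = Embedding (δ ∘ᴱ ε)
  open Field L
  open Polynomials L
  open LinearAlgebra L using (0ᵛ)

  private
    q₀ w P N : ℕ
    q₀ = F.card
    w  = q₀ ℕ.^ m
    P  = K.card
    -- The number of coefficients of the auxiliary polynomial. Here wP would match the main part of
    -- the degrees in `p′-poly`; the surplus 4P exceeds the remaining part w + 4 + P.
    N  = (w ℕ.+ 4) ℕ.* P

    instance
      q₀≢0 : ℕ.NonZero q₀
      q₀≢0 = ℕ.>-nonZero (ℕₚ.≤-trans (ℕₚ.n≤1+n 1) F.card>1)
      w≢0 : ℕ.NonZero w
      w≢0 = ℕₚ.m^n≢0 q₀ m

    m<n*m : ∀ m n → .⦃ ℕ.NonZero m ⦄ → 1 ℕ.< n → m ℕ.< n ℕ.* m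
    m<n*m m n 1<n = ℕₚ.<-≤-trans (ℕₚ.m<m*n m n 1<n) (ℕₚ.≤-reflexive (ℕₚ.*-comm m n))

    b : Carrier
    b = εL.ι β

  g : Carrier → Carrier
  g s = s ⊕ b ⊗ inv s

  -- Half of the trace from L to F of g s: the whole trace is h̃ s + (h̃ s)^P.
  h̃ : Carrier → Carrier
  h̃ s = εL.H (suc m) (g s)

  private
    -- The polynomial left when s^w clears the denominators in the trace polynomial of b/s, up to
    -- the factor b.
    R : ℕ → Carrier → Carrier
    R zero    s = 𝟘
    R (suc k) s = R k s ⊕ s ^ (w ℕ.∸ q₀ ℕ.^ k)

    -- s^w·h̃(s) is a monic polynomial of degree 2w.
    ĥ : Carrier → Carrier
    ĥ s = s ^ w ⊗ εL.H (suc m) s ⊕ b ⊗ R (suc m) s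

    b^ : ∀ i → b ^ (q₀ ℕ.^ i) ≡ b
    b^ i = trans (sym (εL.ι-^ β (q₀ ℕ.^ i))) (cong εL.ι (fermat^ i))
      where
      fermat^ : ∀ i → β F.^ (q₀ ℕ.^ i) ≡ β
      fermat^ zero    = F.*-identityʳ β
      fermat^ (suc i) = trans (sym (F.^-assocʳ β q₀ (q₀ ℕ.^ i))) (trans (cong (F._^ (q₀ ℕ.^ i)) (F.fermat β)) (fermat^ i))

    s^*inv : ∀ {s} → s ≢ 𝟘 → ∀ n → s ^ n ⊗ inv s ^ n ≡ 𝟙
    s^*inv {s} s≢0 n = trans (sym (^-distrib-* s (inv s) n)) (trans (cong (_^ n) (inv-right s≢0)) (1^ n))

    -- As b comes from F, it is fixed by x ↦ x^(q₀^k), so the k-th term (b/s)^(q₀^k) equals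
    -- b·s^(-q₀^k), and q₀^k ≤ w.
    clear : ∀ {s} → s ≢ 𝟘 → ∀ k → k ℕ.≤ suc m → s ^ w ⊗ εL.H k (b ⊗ inv s) ≡ b ⊗ R k s
    clear {s} s≢0 zero _ = trans (zeroʳ _) (sym (zeroʳ b))
    clear {s} s≢0 (suc k) (ℕ.s≤s k≤m) = begin
      s ^ w ⊗ (εL.H k (b ⊗ inv s) ⊕ (b ⊗ inv s) ^ n) ≡⟨ distribˡ _ _ _ ⟩
      s ^ w ⊗ εL.H k (b ⊗ inv s) ⊕ s ^ w ⊗ (b ⊗ inv s) ^ n ≡⟨ cong₂ _⊕_ (clear s≢0 k (ℕₚ.m≤n⇒m≤1+n k≤m)) (begin
        s ^ w ⊗ (b ⊗ inv s) ^ n ≡⟨ cong₂ _⊗_ (trans (cong (s ^_) (sym (ℕₚ.m∸n+n≡m n≤w))) (^-homo-* s (w ℕ.∸ n) n)) (trans (^-distrib-* b (inv s) n) (cong (_⊗ inv s ^ n) (b^ k))) ⟩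
        s ^ (w ℕ.∸ n) ⊗ s ^ n ⊗ (b ⊗ inv s ^ n) ≡⟨ solve 4 (λ x y b z → x :* y :* (b :* z) := b :* x :* (y :* z)) refl _ _ b _ ⟩
        b ⊗ s ^ (w ℕ.∸ n) ⊗ (s ^ n ⊗ inv s ^ n) ≡⟨ trans (cong (b ⊗ s ^ (w ℕ.∸ n) ⊗_) (s^*inv s≢0 n)) (*-identityʳ _) ⟩
        b ⊗ s ^ (w ℕ.∸ n) ∎) ⟩
      b ⊗ R k s ⊕ b ⊗ s ^ (w ℕ.∸ n) ≡⟨ sym (distribˡ b _ _) ⟩
      b ⊗ (R k s ⊕ s ^ (w ℕ.∸ n)) ∎
      where
      open ≡-Reasoning
      n = q₀ ℕ.^ k
      n≤w : n ℕ.≤ w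
      n≤w = ℕₚ.^-monoʳ-≤ q₀ k≤m

    ĥ≡ : ∀ {s} → s ≢ 𝟘 → ĥ s ≡ s ^ w ⊗ h̃ s
    ĥ≡ {s} s≢0 = trans (cong (s ^ w ⊗ εL.H (suc m) s ⊕_) (sym (clear s≢0 (suc m) ℕₚ.≤-refl)))
      (trans (sym (distribˡ _ _ _)) (cong (s ^ w ⊗_) (sym (εL.H-+ (suc m) s (b ⊗ inv s)))))

    H-poly : ∀ k → Poly (q₀ ℕ.^ k) (εL.H k)
    H-poly zero    = poly-0
    H-poly (suc k) = poly-≤ (m<n*m (q₀ ℕ.^ k) q₀ ⦃ ℕₚ.m^n≢0 q₀ k ⦄ F.card>1) (poly-+ (poly-suc (H-poly k)) (poly-^ (q₀ ℕ.^ k)))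

    R-poly : ∀ k → Poly (w ℕ.+ w) (R k)
    R-poly zero    = poly-0
    R-poly (suc k) = poly-+ (R-poly k) (poly-≤ (ℕₚ.+-mono-≤ (ℕ.>-nonZero⁻¹ w) (ℕₚ.m∸n≤m w (q₀ ℕ.^ k))) (poly-^ (w ℕ.∸ q₀ ℕ.^ k)))

    H-lead : Lead w 𝟙 (εL.H (suc m))
    H-lead = εL.H m , H-poly m , λ s → trans (+-comm _ _) (cong (_⊕ εL.H m s) (sym (*-identityˡ _)))

    ĥ-lead : Lead (w ℕ.+ w) 𝟙 ĥ
    ĥ-lead = let (r , p , e) = monic-* (monic-^ w) H-lead in
      (λ s → r s ⊕ b ⊗ R (suc m) s) , poly-+ p (poly-scale b (R-poly (suc m))) ,
      λ s → trans (cong (_⊕ b ⊗ R (suc m) s) (e s)) (+-assoc _ _ _)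

    monic-power : ∀ {f d} k → Lead d 𝟙 f → Lead (k ℕ.* d) 𝟙 (λ s → f s ^ k)
    monic-power zero    M = monic-^ 0
    monic-power (suc k) M = monic-* M (monic-power k M)

    poly-power : ∀ {f d} k → Poly (suc d) f → Poly (suc (k ℕ.* d)) (λ s → f s ^ k)
    poly-power zero    p = poly-^ 0
    poly-power {d = d} (suc k) p = poly-≤ (ℕₚ.≤-reflexive (ℕₚ.+-suc d (k ℕ.* d))) (poly-* p (poly-power k p))

    -- mixed radix digits of e
    i₀ b₀ a₀ r₀ : ℕ → ℕ
    i₀ e = e ℕ.% w
    b₀ e = (e ℕ./ w) ℕ.% q₀
    a₀ e = (e ℕ./ w) ℕ./ q₀
    r₀ e = q₀ ℕ.∸ suc (b₀ e)

    digits : ∀ e → e ≡ i₀ e ℕ.+ (b₀ e ℕ.+ a₀ e ℕ.* q₀) ℕ.* w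
    digits e = trans (m≡m%n+[m/n]*n e w) (cong (λ z → i₀ e ℕ.+ z ℕ.* w) (m≡m%n+[m/n]*n (e ℕ./ w) q₀))

    b₀+r₀ : ∀ e → suc (b₀ e) ℕ.+ r₀ e ≡ q₀
    b₀+r₀ e = ℕₚ.m+[n∸m]≡n (m%n<n (e ℕ./ w) q₀)

    a₀< : ∀ {e} → e ℕ.< N → a₀ e ℕ.< w ℕ.+ 4
    a₀< {e} e<N = m<n*o⇒m/o<n {e ℕ./ w} {w ℕ.+ 4} {q₀} (m<n*o⇒m/o<n {e} {(w ℕ.+ 4) ℕ.* q₀} {w} (ℕₚ.<-≤-trans e<N (ℕₚ.≤-reflexive (trans (cong ((w ℕ.+ 4) ℕ.*_) card-K) (sym (ℕₚ.*-assoc (w ℕ.+ 4) q₀ w))))))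

    D₀ : ℕ
    D₀ = w ℕ.* (q₀ ℕ.∸ 1)

    -- The padding s^(w·r₀) serves two purposes. At every point the total power of s^w becomes w(q₀
    -- - 1), independently of the digit b₀; and the degree becomes D₀ + e, so that distinct e give
    -- distinct degrees and no cancellation occurs in a combination.
    p : ℕ → Carrier → Carrier
    p e s = s ^ i₀ e ⊗ (s ^ (a₀ e ℕ.* P) ⊗ (ĥ s ^ b₀ e ⊗ s ^ (w ℕ.* r₀ e)))

    p-lead : ∀ e → Lead (D₀ ℕ.+ e) 𝟙 (p e)
    p-lead e = subst (λ n → Lead n 𝟙 (p e)) degree
      (monic-* (monic-^ (i₀ e)) (monic-* (monic-^ (a₀ e ℕ.* P)) (monic-* (monic-power (b₀ e) ĥ-lead) (monic-^ (w ℕ.* r₀ e)))))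
      where
      open ≡-Reasoning
      arith : ∀ i a b r w q → i ℕ.+ (a ℕ.* (q ℕ.* w) ℕ.+ (b ℕ.* (w ℕ.+ w) ℕ.+ w ℕ.* r)) ≡ w ℕ.* (b ℕ.+ r) ℕ.+ (i ℕ.+ (b ℕ.+ a ℕ.* q) ℕ.* w)
      arith = ℕSolver.solve-∀
      degree : i₀ e ℕ.+ (a₀ e ℕ.* P ℕ.+ (b₀ e ℕ.* (w ℕ.+ w) ℕ.+ w ℕ.* r₀ e)) ≡ D₀ ℕ.+ e
      degree = begin
        i₀ e ℕ.+ (a₀ e ℕ.* P ℕ.+ (b₀ e ℕ.* (w ℕ.+ w) ℕ.+ w ℕ.* r₀ e)) ≡⟨ cong (λ x → i₀ e ℕ.+ (a₀ e ℕ.* x ℕ.+ (b₀ e ℕ.* (w ℕ.+ w) ℕ.+ w ℕ.* r₀ e))) card-K ⟩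
        i₀ e ℕ.+ (a₀ e ℕ.* (q₀ ℕ.* w) ℕ.+ (b₀ e ℕ.* (w ℕ.+ w) ℕ.+ w ℕ.* r₀ e)) ≡⟨ arith (i₀ e) (a₀ e) (b₀ e) (r₀ e) w q₀ ⟩
        w ℕ.* (b₀ e ℕ.+ r₀ e) ℕ.+ (i₀ e ℕ.+ (b₀ e ℕ.+ a₀ e ℕ.* q₀) ℕ.* w) ≡⟨ cong₂ (λ x y → w ℕ.* (x ℕ.∸ 1) ℕ.+ y) (b₀+r₀ e) (sym (digits e)) ⟩
        D₀ ℕ.+ e ∎

  module _ (c : Carrier) where
    private
      -- What x ↦ x^P makes of p e at a point with h̃ + h̃^P = c, up to the factors of
      -- `p-frobenius`: since x^(P²) = x, the exponents i₀ + a₀P turn into i₀P + a₀, and h̃ turns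
      -- into c - h̃. As i₀ < w, the degree has dropped below N.
      p′ : ℕ → Carrier → Carrier
      p′ e s = s ^ (i₀ e ℕ.* P) ⊗ (s ^ a₀ e ⊗ ((c ⊗ s ^ w ⊕ ⊝ 𝟙 ⊗ ĥ s) ^ b₀ e ⊗ s ^ (w ℕ.* r₀ e)))

      D : ℕ
      D = w ℕ.* P ℕ.+ (w ℕ.+ 4) ℕ.+ P

      p′-poly : ∀ e → e ℕ.< N → Poly D (p′ e)
      p′-poly e e<N = poly-≤ bound (poly-* (poly-^ (i₀ e ℕ.* P)) (poly-* (poly-^ (a₀ e)) (poly-* (poly-power (b₀ e) (poly-+ (poly-≤ (ℕ.s≤s (ℕₚ.m≤m+n w w)) (poly-scale c (poly-^ w))) (poly-scale (⊝ 𝟙) (lead-poly ĥ-lead)))) (poly-^ (w ℕ.* r₀ e)))))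
        where
        open ℕₚ.≤-Reasoning
        arith : ∀ iP a b w r → iP ℕ.+ (a ℕ.+ (b ℕ.* (w ℕ.+ w) ℕ.+ suc (w ℕ.* r))) ≡ iP ℕ.+ suc a ℕ.+ ((b ℕ.+ r) ℕ.* w ℕ.+ b ℕ.* w)
        arith = ℕSolver.solve-∀
        arith′ : ∀ iP P a → iP ℕ.+ a ℕ.+ (P ℕ.+ P) ≡ (P ℕ.+ iP) ℕ.+ a ℕ.+ P
        arith′ = ℕSolver.solve-∀
        b+r≤ : b₀ e ℕ.+ r₀ e ℕ.≤ q₀
        b+r≤ = ℕₚ.≤-trans (ℕₚ.n≤1+n _) (ℕₚ.≤-reflexive (b₀+r₀ e))
        qw≤P : q₀ ℕ.* w ℕ.≤ P
        qw≤P = ℕₚ.≤-reflexive (sym card-K)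
        bound : i₀ e ℕ.* P ℕ.+ (a₀ e ℕ.+ (b₀ e ℕ.* (w ℕ.+ w) ℕ.+ suc (w ℕ.* r₀ e))) ℕ.≤ D
        bound = begin
          i₀ e ℕ.* P ℕ.+ (a₀ e ℕ.+ (b₀ e ℕ.* (w ℕ.+ w) ℕ.+ suc (w ℕ.* r₀ e))) ≡⟨ arith (i₀ e ℕ.* P) (a₀ e) (b₀ e) w (r₀ e) ⟩
          i₀ e ℕ.* P ℕ.+ suc (a₀ e) ℕ.+ ((b₀ e ℕ.+ r₀ e) ℕ.* w ℕ.+ b₀ e ℕ.* w)
            ≤⟨ ℕₚ.+-mono-≤ (ℕₚ.+-monoʳ-≤ (i₀ e ℕ.* P) (a₀< e<N)) (ℕₚ.+-mono-≤ (ℕₚ.≤-trans (ℕₚ.*-monoˡ-≤ w b+r≤) qw≤P)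
                 (ℕₚ.≤-trans (ℕₚ.*-monoˡ-≤ w (ℕₚ.≤-trans (ℕₚ.m≤m+n (b₀ e) (r₀ e)) b+r≤)) qw≤P)) ⟩
          i₀ e ℕ.* P ℕ.+ (w ℕ.+ 4) ℕ.+ (P ℕ.+ P) ≡⟨ arith′ (i₀ e ℕ.* P) P (w ℕ.+ 4) ⟩
          suc (i₀ e) ℕ.* P ℕ.+ (w ℕ.+ 4) ℕ.+ P ≤⟨ ℕₚ.+-monoˡ-≤ P (ℕₚ.+-monoˡ-≤ (w ℕ.+ 4) (ℕₚ.*-monoˡ-≤ P (m%n<n e w))) ⟩
          D ∎

      D<N : D ℕ.< N
      D<N = begin-strict
        w ℕ.* P ℕ.+ (w ℕ.+ 4) ℕ.+ P ≡⟨ arith w P (w ℕ.* P) ⟩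
        w ℕ.* P ℕ.+ (w ℕ.+ P ℕ.+ 4) <⟨ ℕₚ.+-monoʳ-< (w ℕ.* P) (ℕₚ.+-mono-<-≤ (ℕₚ.+-monoˡ-< P w<P) (ℕₚ.*-monoʳ-≤ 2 K.card>1)) ⟩
        w ℕ.* P ℕ.+ (P ℕ.+ P ℕ.+ 2 ℕ.* P) ≡⟨ arith′ w P ⟩
        (w ℕ.+ 4) ℕ.* P ∎
        where
        open ℕₚ.≤-Reasoning
        arith : ∀ w P x → x ℕ.+ (w ℕ.+ 4) ℕ.+ P ≡ x ℕ.+ (w ℕ.+ P ℕ.+ 4)
        arith = ℕSolver.solve-∀
        arith′ : ∀ w P → w ℕ.* P ℕ.+ (P ℕ.+ P ℕ.+ 2 ℕ.* P) ≡ (w ℕ.+ 4) ℕ.* P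
        arith′ = ℕSolver.solve-∀
        w<P : w ℕ.< P
        w<P = ℕₚ.<-≤-trans (m<n*m w q₀ F.card>1) (ℕₚ.≤-reflexive (sym card-K))

      ^P-+ : ∀ x y → (x ⊕ y) ^ P ≡ x ^ P ⊕ y ^ P
      ^P-+ = Embedding.frobenius-+ δ

      ^PP : ∀ x → (x ^ P) ^ P ≡ x
      ^PP x = trans (^-assocʳ x P P) (trans (cong (x ^_) (sym card-L)) (fermat x))

      0^P : 𝟘 ^ P ≡ 𝟘
      0^P with P | K.card>1
      ... | suc _ | _ = zeroˡ _

      swap-^ : ∀ x m n → (x ^ m) ^ n ≡ (x ^ n) ^ m
      swap-^ x m n = trans (^-assocʳ x m n) (trans (cong (x ^_) (ℕₚ.*-comm m n)) (sym (^-assocʳ x n m)))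

      unpower : ∀ {n} (u : Vec Carrier n) → Vec.map (_^ P) u ≡ 0ᵛ → u ≡ 0ᵛ
      unpower []      r = refl
      unpower (x ∷ u) r = cong₂ _∷_ (trans (sym (^PP x)) (trans (cong (_^ P) (cong Vec.head r)) 0^P)) (unpower u (cong Vec.tail r))

      module _ {z : Carrier} (z≢0 : z ≢ 𝟘) (on : h̃ z ⊕ h̃ z ^ P ≡ c) where
        private
          κ = h̃ z
          A = z ^ (w ℕ.* (q₀ ℕ.∸ 1))
          κ^P : κ ^ P ≡ c ⊕ ⊝ κ
          κ^P = trans (solve 2 (λ a b → b := a :+ b :+ :- a) refl κ (κ ^ P)) (cong (_⊕ ⊝ κ) on)

          split-A : ∀ e → z ^ (w ℕ.* b₀ e) ⊗ z ^ (w ℕ.* r₀ e) ≡ A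
          split-A e = trans (sym (^-homo-* z (w ℕ.* b₀ e) (w ℕ.* r₀ e))) (cong (z ^_) (trans (sym (ℕₚ.*-distribˡ-+ w (b₀ e) (r₀ e))) (cong (λ x → w ℕ.* (x ℕ.∸ 1)) (b₀+r₀ e))))

          p-at : ∀ e → p e z ≡ z ^ i₀ e ⊗ ((z ^ P) ^ a₀ e ⊗ (A ⊗ κ ^ b₀ e))
          p-at e = cong₂ (λ x y → z ^ i₀ e ⊗ (x ⊗ y)) (trans (cong (z ^_) (ℕₚ.*-comm (a₀ e) P)) (sym (^-assocʳ z P (a₀ e)))) (begin
            ĥ z ^ b₀ e ⊗ z ^ (w ℕ.* r₀ e) ≡⟨ cong (_⊗ z ^ (w ℕ.* r₀ e)) (trans (cong (_^ b₀ e) (ĥ≡ z≢0)) (trans (^-distrib-* (z ^ w) κ (b₀ e)) (cong (_⊗ κ ^ b₀ e) (^-assocʳ z w (b₀ e))))) ⟩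
            z ^ (w ℕ.* b₀ e) ⊗ κ ^ b₀ e ⊗ z ^ (w ℕ.* r₀ e) ≡⟨ solve 3 (λ x y r → x :* y :* r := x :* r :* y) refl _ _ _ ⟩
            z ^ (w ℕ.* b₀ e) ⊗ z ^ (w ℕ.* r₀ e) ⊗ κ ^ b₀ e ≡⟨ cong (_⊗ κ ^ b₀ e) (split-A e) ⟩
            A ⊗ κ ^ b₀ e ∎)
            where open ≡-Reasoning

          p′-at : ∀ e → p′ e z ≡ (z ^ i₀ e) ^ P ⊗ (z ^ a₀ e ⊗ (A ⊗ (κ ^ P) ^ b₀ e))
          p′-at e = cong₂ (λ x y → x ⊗ (z ^ a₀ e ⊗ y)) (sym (^-assocʳ z (i₀ e) P)) (begin
            (c ⊗ z ^ w ⊕ ⊝ 𝟙 ⊗ ĥ z) ^ b₀ e ⊗ z ^ (w ℕ.* r₀ e) ≡⟨ cong (λ x → x ^ b₀ e ⊗ z ^ (w ℕ.* r₀ e)) (begin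
              c ⊗ z ^ w ⊕ ⊝ 𝟙 ⊗ ĥ z ≡⟨ cong (c ⊗ z ^ w ⊕_) (trans (sym (-‿distribˡ-* 𝟙 _)) (cong ⊝_ (trans (*-identityˡ _) (ĥ≡ z≢0)))) ⟩
              c ⊗ z ^ w ⊕ ⊝ (z ^ w ⊗ κ) ≡⟨ solve 3 (λ c x κ → c :* x :+ :- (x :* κ) := x :* (c :+ :- κ)) refl c (z ^ w) κ ⟩
              z ^ w ⊗ (c ⊕ ⊝ κ) ≡⟨ cong (z ^ w ⊗_) (sym κ^P) ⟩
              z ^ w ⊗ κ ^ P ∎) ⟩
            (z ^ w ⊗ κ ^ P) ^ b₀ e ⊗ z ^ (w ℕ.* r₀ e) ≡⟨ cong (_⊗ z ^ (w ℕ.* r₀ e)) (trans (^-distrib-* (z ^ w) (κ ^ P) (b₀ e)) (cong (_⊗ (κ ^ P) ^ b₀ e) (^-assocʳ z w (b₀ e)))) ⟩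
            z ^ (w ℕ.* b₀ e) ⊗ (κ ^ P) ^ b₀ e ⊗ z ^ (w ℕ.* r₀ e) ≡⟨ solve 3 (λ x y r → x :* y :* r := x :* r :* y) refl _ _ _ ⟩
            z ^ (w ℕ.* b₀ e) ⊗ z ^ (w ℕ.* r₀ e) ⊗ (κ ^ P) ^ b₀ e ≡⟨ cong (_⊗ (κ ^ P) ^ b₀ e) (split-A e) ⟩
            A ⊗ (κ ^ P) ^ b₀ e ∎)
            where open ≡-Reasoning

        -- The common factor A of all p e z becomes A^P under the power map, while p′ e z still
        -- carries A; cross-multiplication avoids a division.
        p-frobenius : ∀ e → A ⊗ p e z ^ P ≡ A ^ P ⊗ p′ e z
        p-frobenius e = begin
          A ⊗ p e z ^ P ≡⟨ cong (λ x → A ⊗ x ^ P) (p-at e) ⟩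
          A ⊗ (z ^ i₀ e ⊗ ((z ^ P) ^ a₀ e ⊗ (A ⊗ κ ^ b₀ e))) ^ P
            ≡⟨ cong (A ⊗_) (trans (^-distrib-* (z ^ i₀ e) _ P) (cong ((z ^ i₀ e) ^ P ⊗_) (trans (^-distrib-* ((z ^ P) ^ a₀ e) _ P) (cong₂ _⊗_ (trans (swap-^ (z ^ P) (a₀ e) P) (cong (_^ a₀ e) (^PP z)))
                 (trans (^-distrib-* A (κ ^ b₀ e) P) (cong (A ^ P ⊗_) (swap-^ κ (b₀ e) P))))))) ⟩
          A ⊗ ((z ^ i₀ e) ^ P ⊗ (z ^ a₀ e ⊗ (A ^ P ⊗ (κ ^ P) ^ b₀ e)))
            ≡⟨ solve 5 (λ A i a B y → A :* (i :* (a :* (B :* y))) := B :* (i :* (a :* (A :* y)))) refl A _ _ (A ^ P) _ ⟩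
          A ^ P ⊗ ((z ^ i₀ e) ^ P ⊗ (z ^ a₀ e ⊗ (A ⊗ (κ ^ P) ^ b₀ e))) ≡⟨ cong (A ^ P ⊗_) (sym (p′-at e)) ⟩
          A ^ P ⊗ p′ e z ∎
          where open ≡-Reasoning

        comb-frobenius : ∀ {n} (u : Vec Carrier n) → A ⊗ comb (Vec.map (_^ P) u) p z ^ P ≡ A ^ P ⊗ comb u p′ z
        comb-frobenius [] = trans (cong (A ⊗_) 0^P) (trans (zeroʳ A) (sym (zeroʳ (A ^ P))))
        comb-frobenius {suc n} (x ∷ u) = begin
          A ⊗ (U ⊕ x ^ P ⊗ p n z) ^ P ≡⟨ cong (A ⊗_) (trans (^P-+ U _) (cong (U ^ P ⊕_) (trans (^-distrib-* (x ^ P) (p n z) P) (cong (_⊗ p n z ^ P) (^PP x))))) ⟩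
          A ⊗ (U ^ P ⊕ x ⊗ p n z ^ P) ≡⟨ solve 4 (λ A U x y → A :* (U :+ x :* y) := A :* U :+ x :* (A :* y)) refl A (U ^ P) x (p n z ^ P) ⟩
          A ⊗ U ^ P ⊕ x ⊗ (A ⊗ p n z ^ P) ≡⟨ cong₂ (λ a b → a ⊕ x ⊗ b) (comb-frobenius u) (p-frobenius n) ⟩
          A ^ P ⊗ comb u p′ z ⊕ x ⊗ (A ^ P ⊗ p′ n z) ≡⟨ solve 4 (λ A U x y → A :* U :+ x :* (A :* y) := A :* (U :+ x :* y)) refl (A ^ P) (comb u p′ z) x (p′ n z) ⟩
          A ^ P ⊗ (comb u p′ z ⊕ x ⊗ p′ n z) ∎
          where
          open ≡-Reasoning
          U = comb (Vec.map (_^ P) u) p z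

        vanishes : ∀ {n} (u : Vec Carrier n) → comb u p′ z ≡ 𝟘 → comb (Vec.map (_^ P) u) p z ≡ 𝟘
        vanishes u e with comb (Vec.map (_^ P) u) p z ≟ 𝟘
        ... | yes r = r
        ... | no r = contradiction (domain (trans (comb-frobenius u) (trans (cong (A ^ P ⊗_) e) (zeroʳ _))) (^-≢0 (w ℕ.* (q₀ ℕ.∸ 1)) z≢0)) (^-≢0 P r)

    -- About |L|/q₀ = wP points are expected, so the excess is of order P = √|L|. A nontrivial
    -- combination Σ uₑ p′ₑ vanishes identically because there are more functions than coefficients.
    -- Then Σ uₑ^P pₑ vanishes at every point of the list, its leading coefficient is not 0, and its
    -- degree is less than D₀ + N.
    stepanov : ∀ zs → Unique zs → (∀ z → z ∈ zs → z ≢ 𝟘 × h̃ z ⊕ h̃ z ^ P ≡ c) → length zs ℕ.≤ (w ℕ.+ 5) ℕ.* P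
    stepanov zs zs! on = conclude (comb-vanish N p′ p′-poly D<N)
      where
      open ℕₚ.≤-Reasoning
      bound : ∀ {u : Vec Carrier N} → (∀ s → comb u p′ s ≡ 𝟘) →
              ∃[ k ] ∃[ l ] (k ℕ.< D₀ ℕ.+ N × l ≢ 𝟘 × Lead k l (comb (Vec.map (_^ P) u) p)) → length zs ℕ.≤ (w ℕ.+ 5) ℕ.* P
      bound {u} e (k , l , k< , l≢0 , lead) = begin
        length zs ≤⟨ root-bound lead l≢0 zs zs! (λ z z∈ → vanishes (proj₁ (on z z∈)) (proj₂ (on z z∈)) u (e z)) ⟩
        k ≤⟨ ℕₚ.<⇒≤ k< ⟩
        w ℕ.* (q₀ ℕ.∸ 1) ℕ.+ N ≤⟨ ℕₚ.+-monoˡ-≤ N (ℕₚ.≤-trans (ℕₚ.*-monoʳ-≤ w (ℕₚ.m∸n≤m q₀ 1)) (ℕₚ.≤-reflexive (trans (ℕₚ.*-comm w q₀) (sym card-K)))) ⟩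
        P ℕ.+ (w ℕ.+ 4) ℕ.* P ≡⟨ cong (ℕ._* P) (sym (ℕₚ.+-suc w 4)) ⟩
        (w ℕ.+ 5) ℕ.* P ∎
      conclude : Σ (Vec Carrier N) (λ u → u ≢ 0ᵛ × (∀ s → comb u p′ s ≡ 𝟘)) → length zs ℕ.≤ (w ℕ.+ 5) ℕ.* P
      conclude (u , u≢0 , e) = bound {u} e (comb-lead (Vec.map (_^ P) u) p-lead (λ r → u≢0 (unpower u r)))

-- Kloosterman operators along a tower of quadratic extensions

record Stage (F : FiniteField) : Set₁ where
  private module F = Field F
  field
    K       : FiniteField
    ε       : Embedding F K
    m       : ℕ
    -- The degree over F is m + 1, so that q^m is the expected number of elements of each trace.
    card-K  : order K ≡ order F ℕ.^ suc m
    tr      : ⟨ K ⟩ → ⟨ F ⟩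
    tr-+    : ∀ x y → tr (FiniteField._+_ K x y) ≡ tr x F.⊕ tr y
    tr-H    : ∀ x → Embedding.ι ε (tr x) ≡ Embedding.H ε (suc m) x
    -- Equidistribution of the trace, in the form in which it is applied: pulling back along the
    -- trace preserves mean zero.
    tr-mean : ∀ ψ → ∑ F.elements ψ ≡ 0ℤ → ∀ x → ∑ (FiniteField.elements K) (λ τ → ψ (x F.⊕ tr τ)) ≡ 0ℤ

module Kloosterman (F : FiniteField) (2≢0 : FiniteField._+_ F (FiniteField.1# F) (FiniteField.1# F) ≢ FiniteField.0# F)
                   (β : ⟨ F ⟩) (β≢0 : β ≢ FiniteField.0# F) where
  private module F = Field F

  module _ (S : Stage F) where
    open Stage S
    private module K = Field K

    g : K.Carrier → K.Carrier
    g s = s K.⊕ Embedding.ι ε β K.⊗ K.inv s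

    unit : K.Carrier → ℤ
    unit s = 1ℤ - ⟦ s K.≟ K.𝟘 ⟧

    -- An additive character ψ would be an eigenfunction whose eigenvalue is a Kloosterman sum over
    -- K. Working with the operator on integer-valued functions replaces complex characters.
    𝒦 : (F.Carrier → ℤ) → F.Carrier → ℤ
    𝒦 ψ x = ∑ K.elements (λ s → unit s * ψ (x F.⊕ tr (g s)))

  module Next (S : Stage F) where
    open Stage S
    open Field K
    private
      module O = Odd (Embedding.ι-2≢0 ε 2≢0)
      ν = proj₁ O.nonsquare
      ns = proj₂ O.nonsquare
      module Q = Quadratic K ν ns
      L = Q.extension
      module L = Field L
      εL = Q.embedding ∘ᴱ ε
      module δ = Embedding Q.embedding
      module εL = Embedding εL
      b = Embedding.ι ε β
      b≢0 : b ≢ 𝟘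
      b≢0 = Embedding.ι-≢0 ε β≢0
      -- The element (a, b) plus its conjugate is 2a, the relative trace to K.
      trL : L.Carrier → F.Carrier
      trL (a , _) = tr (a ⊕ a)

    H-δ : ∀ k x → δ.ι (Embedding.H ε k x) ≡ εL.H k (δ.ι x)
    H-δ zero    x = refl
    H-δ (suc k) x = trans (δ.ι-+ _ _) (cong₂ L._⊕_ (H-δ k x) (δ.ι-^ x (order F ℕ.^ k)))

    trL-H′ : ∀ z → εL.ι (trL z) ≡ εL.H (suc m) z L.⊕ εL.H (suc m) (z L.^ card)
    trL-H′ z@(a , b) = begin
      δ.ι (Embedding.ι ε (tr (a ⊕ a))) ≡⟨ cong δ.ι (tr-H (a ⊕ a)) ⟩
      δ.ι (Embedding.H ε (suc m) (a ⊕ a)) ≡⟨ H-δ (suc m) (a ⊕ a) ⟩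
      εL.H (suc m) (δ.ι (a ⊕ a)) ≡⟨ cong (εL.H (suc m)) (trans (cong (a ⊕ a ,_) (sym (-‿inverseʳ b))) (cong (z L.⊕_) (sym (Q.frobenius-conj z)))) ⟩
      εL.H (suc m) (z L.⊕ z L.^ card) ≡⟨ εL.H-+ (suc m) z _ ⟩
      εL.H (suc m) z L.⊕ εL.H (suc m) (z L.^ card) ∎
      where open ≡-Reasoning

    next : Stage F
    next = record
      { K = L ; ε = εL ; m = m ℕ.+ suc m
      ; card-K = trans Q.card-extension (trans (cong₂ ℕ._*_ card-K card-K) (sym (ℕₚ.^-distribˡ-+-* (order F) (suc m) (suc m))))
      ; tr = trL
      ; tr-+ = λ (a , _) (c , _) → trans (cong tr (solve 2 (λ a c → a :+ c :+ (a :+ c) := a :+ a :+ (c :+ c)) refl a c)) (tr-+ _ _)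
      ; tr-H = λ z → trans (trL-H′ z) (trans (cong (λ P → εL.H (suc m) z L.⊕ εL.H (suc m) (z L.^ P)) card-K) (sym (εL.H-split (suc m) (suc m) z)))
      ; tr-mean = λ ψ mean x → trans (Q.∑-extension (λ z → ψ (x F.⊕ trL z))) (trans (∑-swap elements elements _) (∑-zero elements λ _ →
          trans (∑-cong elements λ a → cong (λ y → ψ (x F.⊕ tr y)) (sym (trans (distribʳ a 𝟙 𝟙) (cong₂ _⊕_ (*-identityˡ a) (*-identityˡ a)))))
            (trans (∑-scale (λ y → ψ (x F.⊕ tr y)) (Embedding.ι-2≢0 ε 2≢0)) (tr-mean ψ mean x)))) }

    stepanov : ∀ c zs → Unique zs → (∀ z → z ∈ zs → z ≢ L.𝟘 × trL (g next z) ≡ c) → length zs ℕ.≤ (order F ℕ.^ m ℕ.+ 5) ℕ.* card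
    stepanov c zs zs! on = Stepanov.stepanov F K L ε Q.embedding m card-K Q.card-extension β (εL.ι c) zs zs! λ z z∈ →
      proj₁ (on z z∈) , trans (cong (εL.H (suc m) (g next z) L.⊕_) (trans (cong (εL.H (suc m) (g next z) L.^_) card-K)
        (trans (sym (εL.H-^ (suc m) (suc m) (g next z))) (cong (λ P → εL.H (suc m) (g next z L.^ P)) (sym card-K)))))
        (trans (sym (trL-H′ (g next z))) (cong εL.ι (proj₂ (on z z∈))))

    card-L : L.card ≡ card ℕ.* card
    card-L = Q.card-extension

    module _ (ψ : F.Carrier → ℤ) (mean : ∑ F.elements ψ ≡ 0ℤ) (x : F.Carrier) where
      private
        -- If s and s′ have sum τ and product n, then s + b/s + s′ + b/s′ = τ(1 + b/n). So the
        -- summands depend on a pair only through τ and n.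
        φ : Carrier → Carrier → Carrier
        φ τ n = τ ⊗ (𝟙 ⊕ b ⊗ inv n)

        Ψ : Carrier → Carrier → ℤ
        Ψ τ n = unit S n * ψ (x F.⊕ tr (φ τ n))

        unit-0 : unit S 𝟘 ≡ 0ℤ
        unit-0 = cong (_-_ 1ℤ) (⟦⟧-yes (𝟘 ≟ 𝟘) refl)

        unit-≢0 : ∀ {s} → s ≢ 𝟘 → unit S s ≡ 1ℤ
        unit-≢0 {s} p = cong (_-_ 1ℤ) (⟦⟧-no (s ≟ 𝟘) p)

        inv-unique : ∀ {a i} → a ⊗ i ≡ 𝟙 → inv a ≡ i
        inv-unique {a} {i} e = ⊗-cancelˡ a≢0 (trans (inv-right a≢0) (sym e))
          where
          a≢0 : a ≢ 𝟘
          a≢0 refl = 0≢1 (trans (sym (zeroˡ i)) e)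

        pair : ∀ s s′ → unit S s * (unit S s′ * ψ (x F.⊕ tr (g S s) F.⊕ tr (g S s′))) ≡ Ψ (s ⊕ s′) (s ⊗ s′)
        pair s s′ = by-cases (s ≟ 𝟘) (s′ ≟ 𝟘)
          where
          open ≡-Reasoning
          vanish : s ⊗ s′ ≡ 𝟘 → 0ℤ ≡ Ψ (s ⊕ s′) (s ⊗ s′)
          vanish e = sym (trans (cong (_* ψ (x F.⊕ tr (φ (s ⊕ s′) (s ⊗ s′)))) (trans (cong (unit S) e) unit-0)) (ℤₚ.*-zeroˡ (ψ (x F.⊕ tr (φ (s ⊕ s′) (s ⊗ s′))))))
          by-cases : Dec (s ≡ 𝟘) → Dec (s′ ≡ 𝟘) → unit S s * (unit S s′ * ψ (x F.⊕ tr (g S s) F.⊕ tr (g S s′))) ≡ Ψ (s ⊕ s′) (s ⊗ s′)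
          by-cases (yes p) _ = trans (trans (cong (_* (unit S s′ * ψ (x F.⊕ tr (g S s) F.⊕ tr (g S s′)))) (trans (cong (unit S) p) unit-0)) (ℤₚ.*-zeroˡ (unit S s′ * ψ (x F.⊕ tr (g S s) F.⊕ tr (g S s′)))))
            (vanish (trans (cong (_⊗ s′) p) (zeroˡ s′)))
          by-cases (no _) (yes p) = trans (trans (cong (unit S s *_) (trans (cong (_* ψ (x F.⊕ tr (g S s) F.⊕ tr (g S s′))) (trans (cong (unit S) p) unit-0)) (ℤₚ.*-zeroˡ (ψ (x F.⊕ tr (g S s) F.⊕ tr (g S s′)))))) (ℤₚ.*-zeroʳ (unit S s)))
            (vanish (trans (cong (s ⊗_) p) (zeroʳ s)))
          by-cases (no s≢0) (no s′≢0) = begin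
            unit S s * (unit S s′ * ψ (x F.⊕ tr (g S s) F.⊕ tr (g S s′))) ≡⟨ cong₂ (λ u v → u * (v * ψ (x F.⊕ tr (g S s) F.⊕ tr (g S s′)))) (unit-≢0 s≢0) (unit-≢0 s′≢0) ⟩
            1ℤ * (1ℤ * ψ (x F.⊕ tr (g S s) F.⊕ tr (g S s′))) ≡⟨ ℤₚ.*-identityˡ _ ⟩
            1ℤ * ψ (x F.⊕ tr (g S s) F.⊕ tr (g S s′)) ≡⟨ cong₂ (λ u y → u * ψ y) (sym (unit-≢0 (⊗-≢0 s≢0 s′≢0))) (trans (F.+-assoc x _ _) (cong (x F.⊕_) (trans (sym (tr-+ _ _)) (cong tr sum)))) ⟩
            Ψ (s ⊕ s′) (s ⊗ s′) ∎
            where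
            inv-product : inv (s ⊗ s′) ≡ inv s ⊗ inv s′
            inv-product = inv-unique (trans (solve 4 (λ s r i j → s :* r :* (i :* j) := s :* i :* (r :* j)) refl s s′ (inv s) (inv s′))
              (trans (cong₂ _⊗_ (inv-right s≢0) (inv-right s′≢0)) (*-identityˡ 𝟙)))
            sum : g S s ⊕ g S s′ ≡ φ (s ⊕ s′) (s ⊗ s′)
            sum = begin
              s ⊕ b ⊗ inv s ⊕ (s′ ⊕ b ⊗ inv s′)
                ≡⟨ cong₂ (λ u v → s ⊕ u ⊕ (s′ ⊕ v)) (trans (sym (*-identityʳ _)) (cong (b ⊗ inv s ⊗_) (sym (inv-right s′≢0)))) (trans (sym (*-identityʳ _)) (cong (b ⊗ inv s′ ⊗_) (sym (inv-right s≢0)))) ⟩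
              s ⊕ b ⊗ inv s ⊗ (s′ ⊗ inv s′) ⊕ (s′ ⊕ b ⊗ inv s′ ⊗ (s ⊗ inv s))
                ≡⟨ solve 5 (λ s r b i j → s :+ b :* i :* (r :* j) :+ (r :+ b :* j :* (s :* i)) := s :+ r :+ (s :+ r) :* (b :* (i :* j))) refl s s′ b (inv s) (inv s′) ⟩
              s ⊕ s′ ⊕ (s ⊕ s′) ⊗ (b ⊗ (inv s ⊗ inv s′)) ≡⟨ cong₂ (λ u v → u ⊕ (s ⊕ s′) ⊗ (b ⊗ v)) (sym (*-identityʳ (s ⊕ s′))) (sym inv-product) ⟩
              (s ⊕ s′) ⊗ 𝟙 ⊕ (s ⊕ s′) ⊗ (b ⊗ inv (s ⊗ s′)) ≡⟨ sym (distribˡ _ _ _) ⟩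
              φ (s ⊕ s′) (s ⊗ s′) ∎

        invL : ∀ a c → (a , c) ≢ L.𝟘 → L.inv (a , c) ≡ (a ⊗ inv (Q.norm-form a c) , ⊝ c ⊗ inv (Q.norm-form a c))
        invL a c p = L.⊗-cancelˡ p (trans (L.inv-right p) (sym (proj₂ (FiniteField.inverse L (a , c) p))))

        single : ∀ a c → unit next (a , c) * ψ (x F.⊕ trL (g next (a , c))) ≡ Ψ (a ⊕ a) (Q.norm-form a c)
        single a c = by-cases ((a , c) L.≟ L.𝟘)
          where
          open ≡-Reasoning
          n = Q.norm-form a c
          by-cases : Dec ((a , c) ≡ L.𝟘) → unit next (a , c) * ψ (x F.⊕ trL (g next (a , c))) ≡ Ψ (a ⊕ a) n
          by-cases (yes p) = trans (trans (cong (_* ψ (x F.⊕ trL (g next (a , c)))) (cong (_-_ 1ℤ) (⟦⟧-yes ((a , c) L.≟ L.𝟘) p))) (ℤₚ.*-zeroˡ (ψ (x F.⊕ trL (g next (a , c))))))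
            (sym (trans (cong (_* ψ (x F.⊕ tr (φ (a ⊕ a) n))) (trans (cong (unit S) n≡0) unit-0)) (ℤₚ.*-zeroˡ (ψ (x F.⊕ tr (φ (a ⊕ a) n))))))
            where
            n≡0 : n ≡ 𝟘
            n≡0 = trans (cong₂ Q.norm-form (cong proj₁ p) (cong proj₂ p)) (trans (cong₂ (λ u v → u ⊕ ⊝ (ν ⊗ v)) (zeroˡ 𝟘) (zeroˡ 𝟘)) (trans (+-identityˡ _) (trans (cong ⊝_ (zeroʳ ν)) -0#≈0#)))
          by-cases (no p) = cong₂ (λ u y → u * ψ (x F.⊕ tr y)) (trans (cong (_-_ 1ℤ) (⟦⟧-no ((a , c) L.≟ L.𝟘) p)) (sym (unit-≢0 (Q.norm-form≢0 p)))) (begin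
            proj₁ (g next (a , c)) ⊕ proj₁ (g next (a , c)) ≡⟨ cong (λ y → y ⊕ y) (begin
              a ⊕ (b ⊗ proj₁ (L.inv (a , c)) ⊕ ν ⊗ (𝟘 ⊗ proj₂ (L.inv (a , c))))
                ≡⟨ cong (a ⊕_) (trans (cong₂ (λ u v → b ⊗ u ⊕ ν ⊗ v) (cong proj₁ (invL a c p)) (zeroˡ _)) (trans (cong (b ⊗ (a ⊗ inv n) ⊕_) (zeroʳ ν)) (+-identityʳ _))) ⟩
              a ⊕ b ⊗ (a ⊗ inv n) ≡⟨ cong₂ _⊕_ (sym (*-identityʳ a)) (solve 3 (λ b a i → b :* (a :* i) := a :* (b :* i)) refl b a (inv n)) ⟩
              a ⊗ 𝟙 ⊕ a ⊗ (b ⊗ inv n) ≡⟨ sym (distribˡ a 𝟙 _) ⟩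
              a ⊗ (𝟙 ⊕ b ⊗ inv n) ∎) ⟩
            a ⊗ (𝟙 ⊕ b ⊗ inv n) ⊕ a ⊗ (𝟙 ⊕ b ⊗ inv n) ≡⟨ sym (distribʳ _ a a) ⟩
            φ (a ⊕ a) n ∎)

        hf = O.half
        hf≢0 : hf ≢ 𝟘
        hf≢0 = inv-≢0 (Embedding.ι-2≢0 ε 2≢0)

        -- Both sums become sums over the discriminant D = τ² − 4n.
        disc : Carrier → Carrier → Carrier
        disc τ D = hf ⊗ hf ⊗ (τ ⊗ τ ⊕ ⊝ D)

        squares : ∑ elements (λ s → unit S s * ∑ elements (λ s′ → unit S s′ * ψ (x F.⊕ tr (g S s) F.⊕ tr (g S s′))))
                ≡ ∑ elements (λ τ → ∑ elements (λ D → ρ D * Ψ τ (disc τ D)))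
        squares = begin
          ∑ elements (λ s → unit S s * ∑ elements (λ s′ → unit S s′ * ψ (x F.⊕ tr (g S s) F.⊕ tr (g S s′))))
            ≡⟨ ∑-cong elements (λ s → trans (sym (∑-* elements (unit S s) _)) (trans (∑-cong elements (pair s)) (sym (∑-shift (λ s′ → Ψ (s ⊕ s′) (s ⊗ s′)) (⊝ s))))) ⟩
          ∑ elements (λ s → ∑ elements (λ τ → Ψ (s ⊕ (τ ⊕ ⊝ s)) (s ⊗ (τ ⊕ ⊝ s)))) ≡⟨ ∑-swap elements elements _ ⟩
          ∑ elements (λ τ → ∑ elements (λ s → Ψ (s ⊕ (τ ⊕ ⊝ s)) (s ⊗ (τ ⊕ ⊝ s)))) ≡⟨ ∑-cong elements (λ τ → begin
            -- Completing the square: with s = (y + τ)/2 the product s(τ - s) is (τ² - y²)/4, so y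
            -- is a square root of the discriminant.
            ∑ elements (λ s → Ψ (s ⊕ (τ ⊕ ⊝ s)) (s ⊗ (τ ⊕ ⊝ s))) ≡⟨ sym (∑-scale (λ s → Ψ (s ⊕ (τ ⊕ ⊝ s)) (s ⊗ (τ ⊕ ⊝ s))) hf≢0) ⟩
            ∑ elements (λ y → Ψ (hf ⊗ y ⊕ (τ ⊕ ⊝ (hf ⊗ y))) (hf ⊗ y ⊗ (τ ⊕ ⊝ (hf ⊗ y)))) ≡⟨ sym (∑-shift (λ y → Ψ (hf ⊗ y ⊕ (τ ⊕ ⊝ (hf ⊗ y))) (hf ⊗ y ⊗ (τ ⊕ ⊝ (hf ⊗ y)))) τ) ⟩
            ∑ elements (λ y → Ψ (hf ⊗ (y ⊕ τ) ⊕ (τ ⊕ ⊝ (hf ⊗ (y ⊕ τ)))) (hf ⊗ (y ⊕ τ) ⊗ (τ ⊕ ⊝ (hf ⊗ (y ⊕ τ)))))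
              ≡⟨ ∑-cong elements (λ y → cong₂ Ψ (solve 2 (λ u τ → u :+ (τ :+ :- u) := τ) refl _ τ)
                   (trans (cong (λ t → hf ⊗ (y ⊕ τ) ⊗ (t ⊕ ⊝ (hf ⊗ (y ⊕ τ)))) (sym (O.half-double τ)))
                     (solve 3 (λ h y τ → h :* (y :+ τ) :* (h :* τ :+ h :* τ :+ :- (h :* (y :+ τ))) := h :* h :* (τ :* τ :+ :- (y :* y))) refl hf y τ))) ⟩
            ∑ elements (λ y → Ψ τ (disc τ (y ⊗ y))) ≡⟨ ∑-fibre elements (λ y → y ⊗ y) (λ D → Ψ τ (disc τ D)) ⟩
            ∑ elements (λ D → ρ D * Ψ τ (disc τ D)) ∎) ⟩
          ∑ elements (λ τ → ∑ elements (λ D → ρ D * Ψ τ (disc τ D))) ∎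
          where open ≡-Reasoning

        -- An element a + c√ν has trace τ = 2a and norm n = a² - νc², hence discriminant ν(2c)². The
        -- y with νy² = D correspond to the square roots νy of νD, which is where ρ (ν ⊗ D) comes
        -- from.
        twisted : 𝒦 next ψ x ≡ ∑ elements (λ τ → ∑ elements (λ D → ρ (ν ⊗ D) * Ψ τ (disc τ D)))
        twisted = begin
          𝒦 next ψ x ≡⟨ Q.∑-extension (λ z → unit next z * ψ (x F.⊕ trL (g next z))) ⟩
          ∑ elements (λ a → ∑ elements (λ c → unit next (a , c) * ψ (x F.⊕ trL (g next (a , c))))) ≡⟨ ∑-cong elements (λ a → ∑-cong elements (single a)) ⟩
          ∑ elements (λ a → ∑ elements (λ c → Ψ (a ⊕ a) (Q.norm-form a c))) ≡⟨ sym (∑-scale (λ a → ∑ elements (λ c → Ψ (a ⊕ a) (Q.norm-form a c))) hf≢0) ⟩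
          ∑ elements (λ τ → ∑ elements (λ c → Ψ (hf ⊗ τ ⊕ hf ⊗ τ) (Q.norm-form (hf ⊗ τ) c))) ≡⟨ ∑-cong elements (λ τ → begin
            ∑ elements (λ c → Ψ (hf ⊗ τ ⊕ hf ⊗ τ) (Q.norm-form (hf ⊗ τ) c)) ≡⟨ sym (∑-scale (λ c → Ψ (hf ⊗ τ ⊕ hf ⊗ τ) (Q.norm-form (hf ⊗ τ) c)) hf≢0) ⟩
            ∑ elements (λ y → Ψ (hf ⊗ τ ⊕ hf ⊗ τ) (Q.norm-form (hf ⊗ τ) (hf ⊗ y)))
              ≡⟨ ∑-cong elements (λ y → cong₂ Ψ (O.half-double τ) (solve 4 (λ h τ y n → h :* τ :* (h :* τ) :+ :- (n :* (h :* y :* (h :* y))) := h :* h :* (τ :* τ :+ :- (n :* (y :* y)))) refl hf τ y ν)) ⟩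
            ∑ elements (λ y → Ψ τ (disc τ (ν ⊗ (y ⊗ y)))) ≡⟨ ∑-fibre elements (λ y → ν ⊗ (y ⊗ y)) (λ D → Ψ τ (disc τ D)) ⟩
            ∑ elements (λ D → ∑ elements (λ y → ⟦ ν ⊗ (y ⊗ y) ≟ D ⟧) * Ψ τ (disc τ D)) ≡⟨ ∑-cong elements (λ D → cong (_* Ψ τ (disc τ D)) (count D)) ⟩
            ∑ elements (λ D → ρ (ν ⊗ D) * Ψ τ (disc τ D)) ∎) ⟩
          ∑ elements (λ τ → ∑ elements (λ D → ρ (ν ⊗ D) * Ψ τ (disc τ D))) ∎
          where
          open ≡-Reasoning
          ν≢0 : ν ≢ 𝟘
          ν≢0 e = ns 𝟘 (trans (zeroˡ 𝟘) (sym e))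
          assoc : ∀ y → ν ⊗ y ⊗ (ν ⊗ y) ≡ ν ⊗ (ν ⊗ (y ⊗ y))
          assoc y = solve 2 (λ n y → n :* y :* (n :* y) := n :* (n :* (y :* y))) refl ν y
          count : ∀ D → ∑ elements (λ y → ⟦ ν ⊗ (y ⊗ y) ≟ D ⟧) ≡ ρ (ν ⊗ D)
          count D = trans (∑-cong elements λ y → ⟦⟧-cong (ν ⊗ (y ⊗ y) ≟ D) (ν ⊗ y ⊗ (ν ⊗ y) ≟ ν ⊗ D)
            (λ e → trans (assoc y) (cong (ν ⊗_) e)) (λ e → ⊗-cancelˡ ν≢0 (trans (sym (assoc y)) e)))
            (∑-scale (λ y → ⟦ y ⊗ y ≟ ν ⊗ D ⟧) ν≢0)

        all-discriminants : ∀ τ → ∑ elements (λ D → Ψ τ (disc τ D)) ≡ ∑ elements (Ψ τ)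
        all-discriminants τ = trans (sym (∑-negate (λ D → Ψ τ (disc τ D)))) (trans (sym (∑-shift (λ D → Ψ τ (disc τ (⊝ D))) (⊝ (τ ⊗ τ))))
          (trans (∑-cong elements λ D → cong (Ψ τ) (solve 3 (λ h τ D → h :* h :* (τ :* τ :+ :- (:- (D :+ :- (τ :* τ)))) := h :* h :* D) refl hf τ D)) (∑-scale (Ψ τ) (⊗-≢0 hf≢0 hf≢0))))

        -- For n ≠ 0 and n ≠ -b the argument τ(1 + b/n) runs through all of K with τ, and `tr-mean`
        -- makes the inner sum vanish. At n = -b the factor is 0 and every τ contributes ψ x.
        total : ∑ elements (λ n → ∑ elements (λ τ → Ψ τ n)) ≡ q * ψ x
        total = trans (∑-cong elements inner) (∑-δ (λ _ → q * ψ x) (⊝ b))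
          where
          open ≡-Reasoning
          factor-zero : ∀ {n} → n ≢ 𝟘 → 𝟙 ⊕ b ⊗ inv n ≡ 𝟘 → n ≡ ⊝ b
          factor-zero {n} n≢0 e = ⊟≡0⇒≡ (begin
            n ⊕ ⊝ ⊝ b ≡⟨ solve 2 (λ n b → n :+ :- :- b := n :+ b) refl n b ⟩
            n ⊕ b ≡⟨ cong₂ _⊕_ (sym (*-identityʳ n)) (sym (trans (solve 3 (λ n b i → n :* (b :* i) := b :* (n :* i)) refl n b (inv n)) (trans (cong (b ⊗_) (inv-right n≢0)) (*-identityʳ b)))) ⟩
            n ⊗ 𝟙 ⊕ n ⊗ (b ⊗ inv n) ≡⟨ sym (distribˡ n 𝟙 _) ⟩
            n ⊗ (𝟙 ⊕ b ⊗ inv n) ≡⟨ trans (cong (n ⊗_) e) (zeroʳ n) ⟩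
            𝟘 ∎)
          factor-at : 𝟙 ⊕ b ⊗ inv (⊝ b) ≡ 𝟘
          factor-at = trans (cong (𝟙 ⊕_) (trans (solve 2 (λ b i → b :* i := :- (:- b :* i)) refl b (inv (⊝ b))) (cong ⊝_ (inv-right (⊝-≢0 b≢0))))) (-‿inverseʳ 𝟙)
          inner : ∀ n → ∑ elements (λ τ → Ψ τ n) ≡ ⟦ n ≟ ⊝ b ⟧ * (q * ψ x)
          inner n = trans (∑-* elements (unit S n) (λ τ → ψ (x F.⊕ tr (φ τ n)))) (by-cases (n ≟ 𝟘) (n ≟ ⊝ b))
            where
            by-cases : Dec (n ≡ 𝟘) → Dec (n ≡ ⊝ b) → unit S n * ∑ elements (λ τ → ψ (x F.⊕ tr (φ τ n))) ≡ ⟦ n ≟ ⊝ b ⟧ * (q * ψ x)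
            by-cases (yes p) _ = trans (trans (cong (_* ∑ elements (λ τ → ψ (x F.⊕ tr (φ τ n)))) (trans (cong (unit S) p) unit-0)) (ℤₚ.*-zeroˡ (∑ elements (λ τ → ψ (x F.⊕ tr (φ τ n))))))
              (sym (trans (cong (_* (q * ψ x)) (⟦⟧-no (n ≟ ⊝ b) λ e → ⊝-≢0 b≢0 (trans (sym e) p))) (ℤₚ.*-zeroˡ (q * ψ x))))
            by-cases (no n≢0) (yes p) = cong₂ _*_ (trans (unit-≢0 n≢0) (sym (⟦⟧-yes (n ≟ ⊝ b) p)))
              (trans (∑-cong elements λ τ → cong ψ (trans (cong (λ y → x F.⊕ tr y) (trans (cong (τ ⊗_) (trans (cong (λ n → 𝟙 ⊕ b ⊗ inv n) p) factor-at)) (zeroʳ τ))) (trans (cong (x F.⊕_) tr-0) (F.+-identityʳ x))))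
                (∑-const elements (ψ x)))
              where
              tr-0 : tr 𝟘 ≡ F.𝟘
              tr-0 = F.⊕-cancelˡ (trans (sym (tr-+ 𝟘 𝟘)) (trans (cong tr (+-identityˡ 𝟘)) (sym (F.+-identityʳ _))))
            by-cases (no n≢0) (no p) = trans (cong (unit S n *_) (trans (∑-cong elements λ τ → cong (λ y → ψ (x F.⊕ tr y)) (*-comm τ _))
                (trans (∑-scale (λ τ → ψ (x F.⊕ tr τ)) (λ e → p (factor-zero n≢0 e))) (tr-mean ψ mean x))))
              (trans (ℤₚ.*-zeroʳ (unit S n)) (sym (trans (cong (_* (q * ψ x)) (⟦⟧-no (n ≟ ⊝ b) p)) (ℤₚ.*-zeroˡ (q * ψ x)))))

      -- The Hasse-Davenport relation S₁² + S₂ = 2q for Kloosterman sums, as an operator identity.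
      -- Pairs in K realize the discriminant D in ρ(D) ways and elements of L in ρ(νD) ways, and
      -- these numbers add up to 2 whatever D is.
      lifting : 𝒦 S (𝒦 S ψ) x + 𝒦 next ψ x ≡ + 2 * (q * ψ x)
      lifting = begin
        𝒦 S (𝒦 S ψ) x + 𝒦 next ψ x ≡⟨ cong₂ _+_ squares twisted ⟩
        ∑ elements (λ τ → ∑ elements (λ D → ρ D * Ψ τ (disc τ D))) + ∑ elements (λ τ → ∑ elements (λ D → ρ (ν ⊗ D) * Ψ τ (disc τ D)))
          ≡⟨ sym (∑-+ elements _ _) ⟩
        ∑ elements (λ τ → ∑ elements (λ D → ρ D * Ψ τ (disc τ D)) + ∑ elements (λ D → ρ (ν ⊗ D) * Ψ τ (disc τ D)))
          ≡⟨ ∑-cong elements (λ τ → begin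
            ∑ elements (λ D → ρ D * Ψ τ (disc τ D)) + ∑ elements (λ D → ρ (ν ⊗ D) * Ψ τ (disc τ D)) ≡⟨ sym (∑-+ elements _ _) ⟩
            ∑ elements (λ D → ρ D * Ψ τ (disc τ D) + ρ (ν ⊗ D) * Ψ τ (disc τ D))
              ≡⟨ ∑-cong elements (λ D → trans (sym (ℤₚ.*-distribʳ-+ (Ψ τ (disc τ D)) (ρ D) (ρ (ν ⊗ D)))) (cong (_* Ψ τ (disc τ D)) (ρ-twist ns D))) ⟩
            ∑ elements (λ D → + 2 * Ψ τ (disc τ D)) ≡⟨ ∑-* elements (+ 2) _ ⟩
            + 2 * ∑ elements (λ D → Ψ τ (disc τ D)) ≡⟨ cong (+ 2 *_) (all-discriminants τ) ⟩
            + 2 * ∑ elements (Ψ τ) ∎) ⟩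
        ∑ elements (λ τ → + 2 * ∑ elements (Ψ τ)) ≡⟨ ∑-* elements (+ 2) _ ⟩
        + 2 * ∑ elements (λ τ → ∑ elements (Ψ τ)) ≡⟨ cong (+ 2 *_) (trans (∑-swap elements elements Ψ) total) ⟩
        + 2 * (q * ψ x) ∎
        where open ≡-Reasoning

-- Growth along the tower and the Weil bound

n≤n² : ∀ n → n ≤ n * n
n≤n² (+ zero)    = ≤-refl
n≤n² n@(+ suc k) = ≤-via (lem n) (0≤* {n} {+ k} 0≤n 0≤n)
  where lem : ∀ n → n * n - n ≡ n * (n - 1ℤ)
        lem = solve-∀
n≤n² n@(-[1+ k ]) = ≤-trans ℤ.-≤+ (0≤sq n)

square-≤ : ∀ {x t} → x ≤ t → - x ≤ t → x * x ≤ t * t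
square-≤ {x} {t} p r = ≤-via (lem x t) (0≤* (diff≥0 p) (diff≥0 r))
  where lem : ∀ x t → t * t - x * x ≡ (t - x) * (t - - x)
        lem = solve-∀

module Weil (F : FiniteField) (2≢0 : FiniteField._+_ F (FiniteField.1# F) (FiniteField.1# F) ≢ FiniteField.0# F)
            (β : ⟨ F ⟩) (β≢0 : β ≢ FiniteField.0# F) where
  open Kloosterman F 2≢0 β β≢0
  open Field F

  base : Stage F
  base = record
    { K = F
    ; ε = record { ι = id ; ι-+ = λ _ _ → refl ; ι-* = λ _ _ → refl ; ι-1 = refl }
    ; m = 0
    ; card-K = sym (ℕₚ.*-identityʳ card)
    ; tr = id
    ; tr-+ = λ _ _ → refl
    ; tr-H = λ x → sym (trans (+-identityˡ _) (*-identityʳ x))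
    ; tr-mean = λ ψ mean x → trans (∑-cong elements λ τ → cong ψ (+-comm x τ)) (trans (∑-shift ψ x) mean) }

  ⟪_∙_⟫ : (Carrier → ℤ) → (Carrier → ℤ) → ℤ
  ⟪ f ∙ g ⟫ = ∑ elements (λ x → f x * g x)

  module _ (S : Stage F) where
    open Stage S
    private
      module K = Field K
      tr-0 : tr K.𝟘 ≡ 𝟘
      tr-0 = ⊕-cancelˡ (trans (sym (tr-+ K.𝟘 K.𝟘)) (trans (cong tr (K.+-identityˡ K.𝟘)) (sym (+-identityʳ _))))

      tr-⊝ : ∀ x → tr (K.⊝ x) ≡ ⊝ tr x
      tr-⊝ x = ⊕-cancelˡ (trans (sym (tr-+ x (K.⊝ x))) (trans (cong tr (K.-‿inverseʳ x)) (trans tr-0 (sym (-‿inverseʳ (tr x))))))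

      inv-⊝ : ∀ s → K.inv (K.⊝ s) ≡ K.⊝ K.inv s
      inv-⊝ s = by-cases (s K.≟ K.𝟘)
        where
        by-cases : Dec (s ≡ K.𝟘) → K.inv (K.⊝ s) ≡ K.⊝ K.inv s
        by-cases (no p) = K.⊗-cancelˡ (K.⊝-≢0 p) (trans (K.inv-right (K.⊝-≢0 p)) (trans (sym (K.inv-right p)) (K.solve 2 (λ a b → a K.:* b K.:= K.:- a K.:* K.:- b) refl s (K.inv s))))
        by-cases (yes refl) = trans (cong K.inv K.-0#≈0#) (trans inv-0 (trans (sym K.-0#≈0#) (cong K.⊝_ (sym inv-0))))
          where
          inv-0 : K.inv K.𝟘 ≡ K.𝟘
          inv-0 with K.𝟘 K.≟ K.𝟘
          ... | yes _ = refl
          ... | no n  = contradiction refl n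

      g-⊝ : ∀ s → tr (g S (K.⊝ s)) ≡ ⊝ tr (g S s)
      g-⊝ s = trans (cong tr (trans (cong (λ i → K.⊝ s K.⊕ _ K.⊗ i) (inv-⊝ s)) (K.solve 3 (λ s b i → K.:- s K.:+ b K.:* K.:- i K.:= K.:- (s K.:+ b K.:* i)) refl s _ (K.inv s)))) (tr-⊝ (g S s))

      unit-⊝ : ∀ s → unit S (K.⊝ s) ≡ unit S s
      unit-⊝ s = cong (_-_ 1ℤ) (⟦⟧-cong (K.⊝ s K.≟ K.𝟘) (s K.≟ K.𝟘) (λ e → trans (sym (K.-‿involutive s)) (trans (cong K.⊝_ e) K.-0#≈0#)) (λ e → trans (cong K.⊝_ e) K.-0#≈0#))

    -- The function s + β/s is odd, so s ↦ -s turns the shift by c into the shift by -c: the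
    -- convolution kernel is even.
    𝒦-symmetric : ∀ f h → ⟪ f ∙ 𝒦 S h ⟫ ≡ ⟪ 𝒦 S f ∙ h ⟫
    𝒦-symmetric f h = begin
      ∑ elements (λ x → f x * 𝒦 S h x) ≡⟨ ∑-cong elements (λ x → sym (∑-* K.elements (f x) _)) ⟩
      ∑ elements (λ x → ∑ K.elements (λ s → f x * (unit S s * h (x ⊕ c s)))) ≡⟨ ∑-swap elements K.elements _ ⟩
      ∑ K.elements (λ s → ∑ elements (λ x → f x * (unit S s * h (x ⊕ c s)))) ≡⟨ ∑-cong K.elements (λ s → sym (∑-shift (λ x → f x * (unit S s * h (x ⊕ c s))) (⊝ c s))) ⟩
      ∑ K.elements (λ s → ∑ elements (λ x → f (x ⊕ ⊝ c s) * (unit S s * h (x ⊕ ⊝ c s ⊕ c s)))) ≡⟨ sym (K.∑-negate (λ s → ∑ elements (λ x → f (x ⊕ ⊝ c s) * (unit S s * h (x ⊕ ⊝ c s ⊕ c s))))) ⟩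
      ∑ K.elements (λ s → ∑ elements (λ x → f (x ⊕ ⊝ c (K.⊝ s)) * (unit S (K.⊝ s) * h (x ⊕ ⊝ c (K.⊝ s) ⊕ c (K.⊝ s)))))
        ≡⟨ ∑-cong K.elements (λ s → ∑-cong elements (λ x → trans
             (cong₂ _*_ (cong f (cong (x ⊕_) (trans (cong ⊝_ (g-⊝ s)) (-‿involutive (c s))))) (cong₂ (λ u y → u * h y) (unit-⊝ s) (solve 2 (λ x c → x :+ :- c :+ c := x) refl x (c (K.⊝ s)))))
             (arrange (f (x ⊕ c s)) (unit S s) (h x)))) ⟩
      ∑ K.elements (λ s → ∑ elements (λ x → unit S s * f (x ⊕ c s) * h x)) ≡⟨ ∑-swap K.elements elements _ ⟩
      ∑ elements (λ x → ∑ K.elements (λ s → unit S s * f (x ⊕ c s) * h x)) ≡⟨ ∑-cong elements (λ x → ∑-*ʳ K.elements _ (h x)) ⟩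
      ∑ elements (λ x → 𝒦 S f x * h x) ∎
      where
      open ≡-Reasoning
      c : K.Carrier → Carrier
      c s = tr (g S s)
      arrange : ∀ a b c → a * (b * c) ≡ b * a * c
      arrange = solve-∀

  energy : Stage F → (Carrier → ℤ) → ℤ
  energy S ψ = ⟪ 𝒦 S ψ ∙ 𝒦 S ψ ⟫

  module _ (ψ : Carrier → ℤ) (mean : ∑ elements ψ ≡ 0ℤ) where
    private
      s = ⟪ ψ ∙ ψ ⟫

      s≥0 : 0ℤ ≤ s
      s≥0 = ∑-≥0 elements λ x → 0≤sq (ψ x)

      -- Integrality lets the square norm bound the values themselves, since |ψ x| ≤ (ψ x)². The
      -- loss is harmless because only growth in the stage matters.
      ψ≤s : ∀ x → ψ x ≤ s
      ψ≤s x = ≤-trans (n≤n² (ψ x)) (∑-term≤ elements (λ x → 0≤sq (ψ x)) (elements-complete x))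

      -ψ≤s : ∀ x → - ψ x ≤ s
      -ψ≤s x = ≤-trans (n≤n² (- ψ x)) (≤-trans (≤-reflexive (lem (ψ x))) (∑-term≤ elements (λ x → 0≤sq (ψ x)) (elements-complete x)))
        where lem : ∀ a → - a * - a ≡ a * a
              lem = solve-∀

    module _ (S : Stage F) where
      open Stage S using (K; m; card-K)
      open Next S
      private
        module K = Field K
        module L = Field (Stage.K next)
        c : L.Carrier → Carrier
        c z = Stage.tr next (g next z)

        count : Carrier → ℤ
        count y = ∑ L.elements (λ z → unit next z * ⟦ c z ≟ y ⟧)

        M w : ℤ
        M = + ((order F ℕ.^ m ℕ.+ 5) ℕ.* K.card)
        w = + (order F ℕ.^ m)

        count≤ : ∀ y → count y ≤ M
        count≤ y = ≤-trans (≤-reflexive (trans (∑-cong L.elements λ z →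
            trans (cong (_* ⟦ c z ≟ y ⟧) (sym (⟦⟧-¬ (z L.≟ L.𝟘)))) (sym (⟦⟧-× (¬? (z L.≟ L.𝟘)) (c z ≟ y)))) (sym (∑-count L.elements P?))))
          (ℤ.+≤+ (stepanov y (filter P? L.elements) (Uniqueₚ.filter⁺ P? L.elements-unique) λ z z∈ → proj₂ (∈-filter⁻ P? {xs = L.elements} z∈)))
          where
          P? : ∀ z → Dec (z ≢ L.𝟘 × c z ≡ y)
          P? z = ¬? (z L.≟ L.𝟘) ×-dec (c z ≟ y)

        q≡ : K.q ≡ q * w
        q≡ = trans (cong +_ card-K) (pos-* card (order F ℕ.^ m))

        M≡ : M ≡ (w + + 5) * K.q
        M≡ = pos-* (order F ℕ.^ m ℕ.+ 5) K.card

        units : ∑ L.elements (unit next) ≡ K.q * K.q - 1ℤ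
        units = trans (∑-- L.elements (λ _ → 1ℤ) (λ z → ⟦ z L.≟ L.𝟘 ⟧)) (cong₂ _-_
          (trans (∑-const L.elements 1ℤ) (trans (ℤₚ.*-identityʳ L.q) (trans (cong +_ card-L) (pos-* K.card K.card)))) (L.∑-δ1 L.𝟘))

        ∑count : ∑ elements count ≡ K.q * K.q - 1ℤ
        ∑count = trans (∑-swap elements L.elements _) (trans (∑-cong L.elements λ z → trans (∑-* elements (unit next z) _)
          (trans (cong (unit next z *_) (trans (∑-cong elements λ y → sym (ℤₚ.*-identityʳ _)) (∑-δ′ (λ _ → 1ℤ) (c z)))) (ℤₚ.*-identityʳ (unit next z)))) units)

        as-counts : ∀ x → 𝒦 next ψ x ≡ ∑ elements (λ y → count y * ψ (x ⊕ y))
        as-counts x = sym (trans (∑-cong elements λ y → sym (∑-*ʳ L.elements _ (ψ (x ⊕ y)))) (trans (∑-swap elements L.elements _)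
          (∑-cong L.elements λ z → trans (∑-cong elements λ y → ℤₚ.*-assoc (unit next z) ⟦ c z ≟ y ⟧ (ψ (x ⊕ y)))
            (trans (∑-* elements (unit next z) _) (cong (unit next z *_) (∑-δ′ (λ y → ψ (x ⊕ y)) (c z)))))))

        -- The upper bound suffices: M − count is a nonnegative weight of total mass 5qP + 1.
        deficit : ∀ x → 𝒦 next ψ x ≡ - ∑ elements (λ y → (M - count y) * ψ (x ⊕ y))
        deficit x = begin
          𝒦 next ψ x ≡⟨ as-counts x ⟩
          ∑ elements (λ y → count y * ψ (x ⊕ y)) ≡⟨ lem (∑ elements (λ y → count y * ψ (x ⊕ y))) M ⟩
          - (M * 0ℤ - ∑ elements (λ y → count y * ψ (x ⊕ y))) ≡⟨ cong (λ a → - (M * a - ∑ elements (λ y → count y * ψ (x ⊕ y)))) (sym (trans (∑-cong elements λ y → cong ψ (+-comm x y)) (trans (∑-shift ψ x) mean))) ⟩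
          - (M * ∑ elements (λ y → ψ (x ⊕ y)) - ∑ elements (λ y → count y * ψ (x ⊕ y))) ≡⟨ cong (λ a → - (a - ∑ elements (λ y → count y * ψ (x ⊕ y)))) (sym (∑-* elements M _)) ⟩
          - (∑ elements (λ y → M * ψ (x ⊕ y)) - ∑ elements (λ y → count y * ψ (x ⊕ y))) ≡⟨ cong -_ (sym (∑-- elements _ _)) ⟩
          - ∑ elements (λ y → M * ψ (x ⊕ y) - count y * ψ (x ⊕ y)) ≡⟨ cong -_ (∑-cong elements λ y → dist M (count y) (ψ (x ⊕ y))) ⟩
          - ∑ elements (λ y → (M - count y) * ψ (x ⊕ y)) ∎
          where
          open ≡-Reasoning
          lem : ∀ a m → a ≡ - (m * 0ℤ - a)
          lem = solve-∀
          dist : ∀ m a p → m * p - a * p ≡ (m - a) * p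
          dist = solve-∀

        -- With P = qw the main term q·wP of the sum of M cancels the P² of the sum of the counts;
        -- the 5P of Stepanov's bound remains, q times.
        mass : ∑ elements (λ y → M - count y) ≡ + 5 * q * K.q + 1ℤ
        mass = trans (∑-- elements (λ _ → M) count) (trans (cong₂ _-_ (∑-const elements M) ∑count)
          (trans (cong₂ (λ a b → q * a - (b * K.q - 1ℤ)) M≡ q≡) (lem q w K.q)))
          where lem : ∀ q w P → q * ((w + + 5) * P) - (q * w * P - 1ℤ) ≡ + 5 * q * P + 1ℤ
                lem = solve-∀

        T : ℤ
        T = (+ 5 * q * K.q + 1ℤ) * s

        pointwise : ∀ x → 𝒦 next ψ x * 𝒦 next ψ x ≤ T * T
        pointwise x = square-≤ (≤-trans (≤-reflexive (trans (deficit x) (sym negated))) (below λ y → -ψ≤s (x ⊕ y)))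
          (≤-trans (≤-reflexive (trans (cong -_ (deficit x)) (ℤₚ.neg-involutive _))) (below λ y → ψ≤s (x ⊕ y)))
          where
          below : ∀ {f : Carrier → ℤ} → (∀ y → f y ≤ s) → ∑ elements (λ y → (M - count y) * f y) ≤ T
          below f≤ = ≤-trans (∑-mono elements λ y → ≤-*ˡ (diff≥0 (count≤ y)) (f≤ y)) (≤-reflexive (trans (∑-*ʳ elements (λ y → M - count y) s) (cong (_* s) mass)))
          negated : ∑ elements (λ y → (M - count y) * - ψ (x ⊕ y)) ≡ - ∑ elements (λ y → (M - count y) * ψ (x ⊕ y))
          negated = trans (∑-cong elements λ y → lem (M - count y) (ψ (x ⊕ y))) (trans (∑-* elements (- 1ℤ) _) (ℤₚ.-1*i≡-i _))
            where lem : ∀ a b → a * - b ≡ - 1ℤ * (a * b)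
                  lem = solve-∀

      -- A crude bound whose point is the shape: a constant times |L|, where the constant depends on
      -- q and ψ but not on the stage.
      energy-bound : energy next ψ ≤ + 36 * (q * q * q) * (s * s) * L.q
      energy-bound = ≤-trans (∑-≤const elements pointwise) (≤-via certificate
        (0≤* (0≤* (0≤n {card}) (0≤sq s)) (0≤* (0≤+ (0≤* {+ 11 * q} {K.q} (0≤* {+ 11} {q} 0≤n 0≤n) 0≤n) (0≤n {1})) (diff≥0 one≤))))
        where
        one≤ : 1ℤ ≤ q * K.q
        one≤ = ≤-* {1ℤ} {q} {1ℤ} {K.q} 0≤n 0≤n (ℤ.+≤+ (ℕₚ.≤-trans (ℕₚ.n≤1+n 1) card>1)) (ℤ.+≤+ (ℕₚ.≤-trans (ℕₚ.n≤1+n 1) K.card>1))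
        lem : ∀ q P s → + 36 * (q * q * q) * (s * s) * (P * P) - q * ((+ 5 * q * P + 1ℤ) * s * ((+ 5 * q * P + 1ℤ) * s)) ≡ q * (s * s) * ((+ 11 * q * P + 1ℤ) * (q * P - 1ℤ))
        lem = solve-∀
        certificate : + 36 * (q * q * q) * (s * s) * L.q - q * (T * T) ≡ q * (s * s) * ((+ 11 * q * K.q + 1ℤ) * (q * K.q - 1ℤ))
        certificate = trans (cong (λ a → + 36 * (q * q * q) * (s * s) * a - q * (T * T)) (trans (cong +_ card-L) (pos-* K.card K.card))) (lem q K.q s)

      -- By `lifting`, 𝒦 next is 2P - 𝒦². For an eigenvalue λ this means (2P - λ²)² - 4P² = λ²(λ² -
      -- 4P) ≥ 4P(λ² - 4P) as soon as λ² ≥ 4P. For a general ψ the same inequality follows by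
      -- Cauchy-Schwarz from the symmetry of 𝒦.
      excess-grows : 0ℤ < s → 0ℤ ≤ energy S ψ - + 4 * K.q * s → + 4 * K.q * (energy S ψ - + 4 * K.q * s) ≤ energy next ψ - + 4 * L.q * s
      excess-grows s>0 X≥0 = *-cancel-≤ s>0 (≤-via certificate (0≤+ (0≤* X≥0 X≥0) (diff≥0 schwarz)))
        where
        open ≡-Reasoning
        KK = 𝒦 S (𝒦 S ψ)
        A = energy S ψ
        X = A - + 4 * K.q * s
        V = ⟪ KK ∙ KK ⟫
        schwarz : A * A ≤ s * V
        schwarz = ≤-trans (≤-reflexive (cong₂ _*_ (sym (𝒦-symmetric S ψ (𝒦 S ψ))) (sym (𝒦-symmetric S ψ (𝒦 S ψ))))) (cauchy-schwarz elements ψ KK)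
        expand : ∀ a b c → (+ 2 * (a * b) - c) * (+ 2 * (a * b) - c) ≡ + 4 * a * a * (b * b) - + 4 * a * (b * c) + c * c
        expand = solve-∀
        solve-for : ∀ {a b c} → a + b ≡ c → b ≡ c - a
        solve-for {a} {b} refl = lem a b
          where lem : ∀ a b → b ≡ a + b - a
                lem = solve-∀
        energy-next : energy next ψ ≡ + 4 * K.q * K.q * s - + 4 * K.q * A + V
        energy-next = begin
          energy next ψ ≡⟨ ∑-cong elements (λ x → trans (cong₂ _*_ (solve-for (lifting ψ mean x)) (solve-for (lifting ψ mean x))) (expand K.q (ψ x) (KK x))) ⟩
          ∑ elements (λ x → + 4 * K.q * K.q * (ψ x * ψ x) - + 4 * K.q * (ψ x * KK x) + KK x * KK x)
            ≡⟨ trans (∑-+ elements _ _) (cong (_+ V) (trans (∑-- elements _ _) (cong₂ _-_ (∑-* elements (+ 4 * K.q * K.q) _) (∑-* elements (+ 4 * K.q) _)))) ⟩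
          + 4 * K.q * K.q * s - + 4 * K.q * ⟪ ψ ∙ KK ⟫ + V ≡⟨ cong (λ a → + 4 * K.q * K.q * s - + 4 * K.q * a + V) (𝒦-symmetric S ψ (𝒦 S ψ)) ⟩
          + 4 * K.q * K.q * s - + 4 * K.q * A + V ∎
        lem : ∀ s P A V → s * (+ 4 * P * P * s - + 4 * P * A + V - + 4 * (P * P) * s) - s * (+ 4 * P * (A - + 4 * P * s)) ≡ (A - + 4 * P * s) * (A - + 4 * P * s) + (s * V - A * A)
        lem = solve-∀
        certificate : s * (energy next ψ - + 4 * L.q * s) - s * (+ 4 * K.q * X) ≡ X * X + (s * V - A * A)
        certificate = trans (cong₂ (λ a b → s * (a - + 4 * b * s) - s * (+ 4 * K.q * X)) energy-next (trans (cong +_ card-L) (pos-* K.card K.card))) (lem s K.q A V)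

    private
      stage : ℕ → Stage F
      stage zero    = base
      stage (suc n) = Next.next (stage n)

      Q : ℕ → ℤ
      Q n = + order (Stage.K (stage n))

      Q-suc : ∀ n → Q (suc n) ≡ Q n * Q n
      Q-suc n = trans (cong +_ (Next.card-L (stage n))) (pos-* (order (Stage.K (stage n))) (order (Stage.K (stage n))))

      excess : ℕ → ℤ
      excess n = energy (stage n) ψ - + 4 * Q n * s

      4^ : ℕ → ℤ
      4^ n = + (4 ℕ.^ n)

      4^-suc : ∀ n → 4^ (suc n) ≡ + 4 * 4^ n
      4^-suc n = pos-* 4 (4 ℕ.^ n)

      module _ (s>0 : 0ℤ < s) (start : 1ℤ ≤ excess 0) where
        -- As |L| = P², the factor 4P of `excess-grows` means that the excess relative to the field
        -- order is multiplied by at least 4 in each step. `energy-bound` forbids this in the long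
        -- run.
        growth : ∀ n → 0ℤ ≤ excess n × 4^ n * Q n ≤ q * excess n
        growth zero = ≤-trans 0≤n start , ≤-trans (≤-reflexive (ℤₚ.*-comm 1ℤ q)) (≤-*ˡ {c = q} 0≤n start)
        growth (suc n) = let (X≥0 , G) = growth n ; step = excess-grows (stage n) s>0 X≥0 in
          ≤-trans (0≤* (0≤* {+ 4} {Q n} 0≤n 0≤n) X≥0) step ,
          ≤-trans (≤-via (certificate n) (0≤* (0≤* {+ 4} {Q n} 0≤n 0≤n) (diff≥0 G))) (≤-*ˡ {c = q} 0≤n step)
          where
          lem : ∀ f Q q X → q * (+ 4 * Q * X) - + 4 * f * (Q * Q) ≡ + 4 * Q * (q * X - f * Q)
          lem = solve-∀
          certificate : ∀ n → q * (+ 4 * Q n * excess n) - 4^ (suc n) * Q (suc n) ≡ + 4 * Q n * (q * excess n - 4^ n * Q n)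
          certificate n = trans (cong₂ (λ a b → q * (+ 4 * Q n * excess n) - a * b) (4^-suc n) (Q-suc n)) (lem (4^ n) (Q n) q (excess n))

        bounded : ∀ n → 4^ (suc n) ≤ q * (+ 36 * (q * q * q) * (s * s))
        bounded n = *-cancel-≤ {c = Q (suc n)} (ℤ.+<+ (ℕₚ.≤-trans (ℕₚ.n≤1+n 1) (Field.card>1 (Stage.K (stage (suc n))))))
          (≤-trans (≤-reflexive (ℤₚ.*-comm (Q (suc n)) (4^ (suc n)))) (≤-trans (proj₂ (growth (suc n)))
            (≤-trans (≤-*ˡ {c = q} 0≤n (≤-trans (≤-via (lem (energy (stage (suc n)) ψ) (Q (suc n)) s) (0≤* (0≤* {+ 4} {Q (suc n)} 0≤n 0≤n) s≥0)) (energy-bound (stage n))))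
              (≤-reflexive (arrange q (+ 36 * (q * q * q) * (s * s)) (Q (suc n)))))))
          where
          lem : ∀ A Q s → A - (A - + 4 * Q * s) ≡ + 4 * Q * s
          lem = solve-∀
          arrange : ∀ q a b → q * (a * b) ≡ b * (q * a)
          arrange = solve-∀

        absurd : ⊥
        absurd = ℕₚ.<⇒≱ (exp ℤ.∣ C ∣) (ℤₚ.drop‿+≤+ (≤-trans (bounded ℤ.∣ C ∣) (≤-reflexive (sym (ℤₚ.0≤i⇒+∣i∣≡i C≥0)))))
          where
          C = q * (+ 36 * (q * q * q) * (s * s))
          C≥0 : 0ℤ ≤ C
          C≥0 = 0≤* {q} 0≤n (0≤* {+ 36 * (q * q * q)} (0≤* {+ 36} {q * q * q} 0≤n (0≤* {q * q} {q} (0≤* {q} {q} 0≤n 0≤n) 0≤n)) (0≤sq s))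
          exp : ∀ n → n ℕ.< 4 ℕ.^ suc n
          exp n = ℕₚ.<-trans (ℕₚ.n<1+n n) (go (suc n))
            where
            go : ∀ n → n ℕ.< 4 ℕ.^ n
            go zero    = ℕ.s≤s ℕ.z≤n
            go (suc n) = ℕₚ.≤-trans (ℕ.s≤s (go n)) (ℕₚ.≤-trans (ℕₚ.+-mono-≤ (ℕₚ.m^n>0 4 n) ℕₚ.≤-refl) (ℕₚ.+-monoʳ-≤ (4 ℕ.^ n) (ℕₚ.m≤m+n (4 ℕ.^ n) _)))

    base-energy : energy base ψ ≤ + 4 * q * s
    base-energy = ≮⇒≥ λ p → by-cases p (s ℤₚ.≤? 0ℤ)
      where
      by-cases : + 4 * q * s < energy base ψ → Dec (s ≤ 0ℤ) → ⊥
      -- A positive excess is an integer, hence at least 1, which starts the growth.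
      by-cases p (no s>0) = absurd (≰⇒> s>0) (≤-via (shift (energy base ψ) (+ 4 * q * s)) (diff≥0 (<⇒1+≤ p)))
        where shift : ∀ a b → a - b - 1ℤ ≡ a - (1ℤ + b)
              shift = solve-∀
      by-cases p (yes s≤0) = <-irrefl refl (≤-<-trans (0≤* (0≤* {+ 4} {q} 0≤n 0≤n) s≥0) (<-≤-trans p (≤-reflexive (∑-zero elements λ x → trans (cong (_* 𝒦 base ψ x) (𝒦0 x)) (ℤₚ.*-zeroˡ (𝒦 base ψ x))))))
        where
        ψ0 : ∀ x → ψ x ≡ 0ℤ
        ψ0 x = ≤-antisym (≤-trans (ψ≤s x) s≤0) (subst (_≤ ψ x) refl (ℤₚ.neg-cancel-≤ (≤-trans (-ψ≤s x) s≤0)))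
        𝒦0 : ∀ x → 𝒦 base ψ x ≡ 0ℤ
        𝒦0 x = ∑-zero elements λ z → trans (cong (unit base z *_) (ψ0 (x ⊕ g base z))) (ℤₚ.*-zeroʳ (unit base z))

    weil : ⟪ ψ ∙ 𝒦 base ψ ⟫ * ⟪ ψ ∙ 𝒦 base ψ ⟫ ≤ + 4 * q * (s * s)
    weil = ≤-trans (cauchy-schwarz elements ψ (𝒦 base ψ)) (≤-trans (≤-*ˡ s≥0 base-energy) (≤-reflexive (lem q s)))
      where lem : ∀ q s → s * (+ 4 * q * s) ≡ + 4 * q * (s * s)
            lem = solve-∀

-- Projections of spheres

infix 4 _∈±_
record _∈±_ (x b : ℤ) : Set where
  constructor _,_
  field
    upper : x ≤ b
    lower : - x ≤ b

open _∈±_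

abs-≤ : ∀ {x t} → 0ℤ ≤ t → x * x ≤ t * t → x ∈± t
abs-≤ {x} {t} t≥0 p = below x p , below (- x) (≤-trans (≤-reflexive (lem x)) p)
  where
  lem : ∀ x → - x * - x ≡ x * x
  lem = solve-∀
  below : ∀ y → y * y ≤ t * t → y ≤ t
  below y p = ≮⇒≥ λ t<y → let gap = diff≥0 (<⇒1+≤ t<y) in <-irrefl refl (<-≤-trans (1+≤⇒< (≤-via (expand y t)
      (0≤+ (0≤+ (0≤* gap gap) (0≤* {+ 2} 0≤n (0≤* (0≤+ t≥0 (0≤n {1})) gap))) (0≤* {+ 2} {t} 0≤n t≥0)))) p)
    where expand : ∀ y t → y * y - (1ℤ + t * t) ≡ (y - (1ℤ + t)) * (y - (1ℤ + t)) + + 2 * ((t + 1ℤ) * (y - (1ℤ + t))) + + 2 * t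
          expand = solve-∀

±-≡ : ∀ {x y b} → x ≡ y → y ∈± b → x ∈± b
±-≡ refl p = p

±-≤ : ∀ {x b c} → b ≤ c → x ∈± b → x ∈± c
±-≤ p (u , l) = ≤-trans u p , ≤-trans l p

±-+ : ∀ {x y b c} → x ∈± b → y ∈± c → (x + y) ∈± (b + c)
±-+ {x} {y} (u , l) (u′ , l′) = ℤₚ.+-mono-≤ u u′ , ≤-trans (≤-reflexive (ℤₚ.neg-distrib-+ x y)) (ℤₚ.+-mono-≤ l l′)

±-* : ∀ {x y b c} → x ∈± b → y ∈± c → (x * y) ∈± (b * c)
±-* {x} {y} {b} {c} (u , l) (u′ , l′) = *-cancel-≤ {c = + 2} two (≤-via (lem₁ x y b c) (0≤+ (0≤* (diff≥0 u) (c+y≥0)) (0≤* b+x≥0 (diff≥0 u′)))) ,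
  *-cancel-≤ {c = + 2} two (≤-via (lem₂ x y b c) (0≤+ (0≤* (diff≥0 u) (diff≥0 u′)) (0≤* b+x≥0 c+y≥0)))
  where
  two : 0ℤ < + 2
  two = ℤ.+<+ (ℕ.s≤s ℕ.z≤n)
  c+y≥0 : 0ℤ ≤ c - - y
  c+y≥0 = diff≥0 l′
  b+x≥0 : 0ℤ ≤ b - - x
  b+x≥0 = diff≥0 l
  lem₁ : ∀ x y b c → + 2 * (b * c) - + 2 * (x * y) ≡ (b - x) * (c - - y) + (b - - x) * (c - y)
  lem₁ = solve-∀
  lem₂ : ∀ x y b c → + 2 * (b * c) - + 2 * - (x * y) ≡ (b - x) * (c - y) + (b - - x) * (c - - y)
  lem₂ = solve-∀

±-∑ : ∀ {A : Set} (xs : List A) {f g : A → ℤ} → (∀ x → f x ∈± g x) → ∑ xs f ∈± ∑ xs g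
±-∑ []       p = ≤-refl , ≤-refl
±-∑ (x ∷ xs) p = ±-+ (p x) (±-∑ xs p)

module Convolution (F : FiniteField) (2≢0 : FiniteField._+_ F (FiniteField.1# F) (FiniteField.1# F) ≢ FiniteField.0# F) where
  open Field F
  open Odd 2≢0

  ⟪_∙_⟫ : (Carrier → ℤ) → (Carrier → ℤ) → ℤ
  ⟪ f ∙ g ⟫ = ∑ elements (λ x → f x * g x)

  _⋆_ : (Carrier → ℤ) → (Carrier → ℤ) → Carrier → ℤ
  (κ ⋆ f) x = ∑ elements (λ c → κ c * f (x ⊕ c))

  -- The convolution by κ has norm at most Λ on functions of mean zero.
  record Bounded (κ : Carrier → ℤ) (Λ : ℤ) : Set where
    constructor bounded
    field bound : ∀ f → ∑ elements f ≡ 0ℤ → ⟪ f ∙ κ ⋆ f ⟫ ∈± (Λ * ⟪ f ∙ f ⟫)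

  open Bounded public

  ⟪⟫≥0 : ∀ f → 0ℤ ≤ ⟪ f ∙ f ⟫
  ⟪⟫≥0 f = ∑-≥0 elements λ x → 0≤sq (f x)

  ⟪⟫-cong : ∀ f {g h : Carrier → ℤ} → (∀ x → g x ≡ h x) → ⟪ f ∙ g ⟫ ≡ ⟪ f ∙ h ⟫
  ⟪⟫-cong f e = ∑-cong elements λ x → cong (f x *_) (e x)

  -- Convolution with a constant annihilates functions of mean zero, so the mean of a kernel is free
  -- and only its fluctuation counts.
  bounded-affine : ∀ {κ κ′ Λ} a → (∀ c → κ c ≡ a + κ′ c) → Bounded κ′ Λ → Bounded κ Λ
  bounded-affine {κ} {κ′} a e B .bound f mean = ±-≡ (⟪⟫-cong f λ x → begin
    ∑ elements (λ c → κ c * f (x ⊕ c)) ≡⟨ ∑-cong elements (λ c → trans (cong (_* f (x ⊕ c)) (e c)) (ℤₚ.*-distribʳ-+ (f (x ⊕ c)) a (κ′ c))) ⟩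
    ∑ elements (λ c → a * f (x ⊕ c) + κ′ c * f (x ⊕ c)) ≡⟨ ∑-+ elements _ _ ⟩
    ∑ elements (λ c → a * f (x ⊕ c)) + (κ′ ⋆ f) x ≡⟨ cong (_+ (κ′ ⋆ f) x) (trans (∑-* elements a _) (trans (cong (a *_) (trans (∑-cong elements λ c → cong f (+-comm x c)) (trans (∑-shift f x) mean))) (ℤₚ.*-zeroʳ a))) ⟩
    0ℤ + (κ′ ⋆ f) x ≡⟨ ℤₚ.+-identityˡ _ ⟩
    (κ′ ⋆ f) x ∎) (bound B f mean)
    where open ≡-Reasoning

  bounded-cong : ∀ {κ κ′ Λ} → (∀ c → κ c ≡ κ′ c) → Bounded κ′ Λ → Bounded κ Λ
  bounded-cong e = bounded-affine 0ℤ λ c → trans (e c) (sym (ℤₚ.+-identityˡ _))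

  bounded-scale : ∀ {κ Λ b} a → a ∈± b → Bounded κ Λ → Bounded (λ c → a * κ c) (b * Λ)
  bounded-scale {κ} {Λ} {b} a a± B .bound f mean = ±-≡ (begin
      ⟪ f ∙ (λ c → a * κ c) ⋆ f ⟫ ≡⟨ ∑-cong elements (λ x → trans (cong (f x *_) (trans (∑-cong elements λ c → ℤₚ.*-assoc a (κ c) (f (x ⊕ c))) (∑-* elements a _))) (arrange (f x) a _)) ⟩
      ∑ elements (λ x → a * (f x * (κ ⋆ f) x)) ≡⟨ ∑-* elements a _ ⟩
      a * ⟪ f ∙ κ ⋆ f ⟫ ∎)
    (subst (a * ⟪ f ∙ κ ⋆ f ⟫ ∈±_) (sym (ℤₚ.*-assoc b Λ ⟪ f ∙ f ⟫)) (±-* a± (bound B f mean)))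
    where
    open ≡-Reasoning
    arrange : ∀ x a y → x * (a * y) ≡ a * (x * y)
    arrange = solve-∀

  translate-± : ∀ f c → ⟪ f ∙ (λ x → f (x ⊕ c)) ⟫ ∈± ⟪ f ∙ f ⟫
  translate-± f c = *-cancel-≤ {c = + 2} two (≤-trans (≤-via upper′ (∑-≥0 elements λ x → 0≤sq (f x - f (x ⊕ c)))) ≤-refl) ,
                    *-cancel-≤ {c = + 2} two (≤-via lower′ (∑-≥0 elements λ x → 0≤sq (f x + f (x ⊕ c))))
    where
    open ≡-Reasoning
    two : 0ℤ < + 2
    two = ℤ.+<+ (ℕ.s≤s ℕ.z≤n)
    T = ⟪ f ∙ (λ x → f (x ⊕ c)) ⟫
    shifted : ∑ elements (λ x → f (x ⊕ c) * f (x ⊕ c)) ≡ ⟪ f ∙ f ⟫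
    shifted = ∑-shift (λ x → f x * f x) c
    double : ∀ s → s + s ≡ + 2 * s
    double = solve-∀
    neg : ∀ s t → + 2 * s - + 2 * - t ≡ + 2 * s + + 2 * t
    neg = solve-∀
    sq- : ∀ a b → (a - b) * (a - b) ≡ a * a + b * b - + 2 * (a * b)
    sq- = solve-∀
    sq+ : ∀ a b → (a + b) * (a + b) ≡ a * a + b * b + + 2 * (a * b)
    sq+ = solve-∀
    both : ∑ elements (λ x → f x * f x + f (x ⊕ c) * f (x ⊕ c)) ≡ + 2 * ⟪ f ∙ f ⟫
    both = trans (∑-+ elements _ _) (trans (cong (_+_ ⟪ f ∙ f ⟫) shifted) (double ⟪ f ∙ f ⟫))
    upper′ : + 2 * ⟪ f ∙ f ⟫ - + 2 * T ≡ ∑ elements (λ x → (f x - f (x ⊕ c)) * (f x - f (x ⊕ c)))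
    upper′ = sym (trans (∑-cong elements λ x → sq- (f x) (f (x ⊕ c))) (trans (∑-- elements _ _) (cong₂ _-_ both (∑-* elements (+ 2) _))))
    lower′ : + 2 * ⟪ f ∙ f ⟫ - + 2 * - T ≡ ∑ elements (λ x → (f x + f (x ⊕ c)) * (f x + f (x ⊕ c)))
    lower′ = trans (neg ⟪ f ∙ f ⟫ T) (sym (trans (∑-cong elements λ x → sq+ (f x) (f (x ⊕ c))) (trans (∑-+ elements _ _) (cong₂ _+_ both (∑-* elements (+ 2) _)))))

  -- The kernel is a sum of at most two translations, each of norm at most 1.
  bounded-roots : ∀ τ → Bounded (λ c → ⟦ c ⊗ c ≟ τ ⟧) (+ 2)
  bounded-roots τ .bound f mean = ±-≤ (≤-*ʳ (⟪⟫≥0 f) (ρ≤2 τ)) (±-≡ swapped (subst (∑ elements (λ c → ⟦ c ⊗ c ≟ τ ⟧ * ⟪ f ∙ (λ x → f (x ⊕ c)) ⟫) ∈±_) (∑-*ʳ elements _ ⟪ f ∙ f ⟫) (±-∑ elements term)))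
    where
    swapped : ⟪ f ∙ (λ c → ⟦ c ⊗ c ≟ τ ⟧) ⋆ f ⟫ ≡ ∑ elements (λ c → ⟦ c ⊗ c ≟ τ ⟧ * ⟪ f ∙ (λ x → f (x ⊕ c)) ⟫)
    swapped = trans (∑-cong elements λ x → sym (∑-* elements (f x) _)) (trans (∑-swap elements elements _)
      (∑-cong elements λ c → trans (∑-cong elements λ x → arrange (f x) ⟦ c ⊗ c ≟ τ ⟧ (f (x ⊕ c))) (∑-* elements ⟦ c ⊗ c ≟ τ ⟧ _)))
      where arrange : ∀ a b c → a * (b * c) ≡ b * (a * c)
            arrange = solve-∀
    term : ∀ c → (⟦ c ⊗ c ≟ τ ⟧ * ⟪ f ∙ (λ x → f (x ⊕ c)) ⟫) ∈± (⟦ c ⊗ c ≟ τ ⟧ * ⟪ f ∙ f ⟫)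
    term c = ±-* (≤-refl , ≤-trans (ℤₚ.neg-mono-≤ (⟦⟧≥0 (c ⊗ c ≟ τ))) (⟦⟧≥0 (c ⊗ c ≟ τ))) (translate-± f c)

  module _ (Λ : ℤ) (Λ≥0 : 0ℤ ≤ Λ) (4q≤Λ² : + 4 * q ≤ Λ * Λ) {D : Carrier} (D≢0 : D ≢ 𝟘) where
    private
      β : Carrier
      β = half ⊗ half ⊗ D

      β≢0 : β ≢ 𝟘
      β≢0 = ⊗-≢0 (⊗-≢0 (inv-≢0 2≢0) (inv-≢0 2≢0)) D≢0

      module W = Weil F 2≢0 β β≢0
      module W′ = Kloosterman F 2≢0 β β≢0

      quarter : β ⊕ β ⊕ (β ⊕ β) ≡ D
      quarter = trans (solve 2 (λ h D → h :* h :* D :+ h :* h :* D :+ (h :* h :* D :+ h :* h :* D) := h :* (h :* D :+ h :* D) :+ h :* (h :* D :+ h :* D)) refl half D)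
        (trans (cong (λ z → half ⊗ z ⊕ half ⊗ z) (half-double D)) (half-double D))

      -- s + β/s = c iff (2s − c)² = c² − 4β.
      quadratic : ∀ c s → W′.unit W.base s * ⟦ W′.g W.base s ≟ c ⟧ ≡ ⟦ (s ⊕ s ⊕ ⊝ c) ⊗ (s ⊕ s ⊕ ⊝ c) ≟ c ⊗ c ⊕ ⊝ D ⟧
      quadratic c s = by-cases (s ≟ 𝟘)
        where
        identity : (s ⊕ s ⊕ ⊝ c) ⊗ (s ⊕ s ⊕ ⊝ c) ⊕ ⊝ (c ⊗ c ⊕ ⊝ D) ≡ (𝟙 ⊕ 𝟙) ⊗ (𝟙 ⊕ 𝟙) ⊗ (s ⊗ s ⊕ ⊝ (c ⊗ s) ⊕ β)
        identity = trans (cong (λ d → (s ⊕ s ⊕ ⊝ c) ⊗ (s ⊕ s ⊕ ⊝ c) ⊕ ⊝ (c ⊗ c ⊕ ⊝ d)) (sym quarter))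
          (trans (solve 3 (λ s c b → (s :+ s :+ :- c) :* (s :+ s :+ :- c) :+ :- (c :* c :+ :- (b :+ b :+ (b :+ b))) := (s :* s :+ :- (c :* s) :+ b) :+ (s :* s :+ :- (c :* s) :+ b) :+ ((s :* s :+ :- (c :* s) :+ b) :+ (s :* s :+ :- (c :* s) :+ b))) refl s c β)
            (sym (four (s ⊗ s ⊕ ⊝ (c ⊗ s) ⊕ β))))
          where
          four : ∀ y → (𝟙 ⊕ 𝟙) ⊗ (𝟙 ⊕ 𝟙) ⊗ y ≡ y ⊕ y ⊕ (y ⊕ y)
          four y = trans (*-assoc _ _ y) (trans (cong ((𝟙 ⊕ 𝟙) ⊗_) (dbl y)) (dbl (y ⊕ y)))
            where dbl : ∀ y → (𝟙 ⊕ 𝟙) ⊗ y ≡ y ⊕ y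
                  dbl y = trans (distribʳ y 𝟙 𝟙) (cong₂ _⊕_ (*-identityˡ y) (*-identityˡ y))
        four≢0 : (𝟙 ⊕ 𝟙) ⊗ (𝟙 ⊕ 𝟙) ≢ 𝟘
        four≢0 = ⊗-≢0 2≢0 2≢0
        cleared : s ≢ 𝟘 → s ⊗ (s ⊕ β ⊗ inv s ⊕ ⊝ c) ≡ s ⊗ s ⊕ ⊝ (c ⊗ s) ⊕ β
        cleared s≢0 = trans (solve 4 (λ s b i c → s :* (s :+ b :* i :+ :- c) := s :* s :+ :- (c :* s) :+ b :* (s :* i)) refl s β (inv s) c)
          (cong (s ⊗ s ⊕ ⊝ (c ⊗ s) ⊕_) (trans (cong (β ⊗_) (inv-right s≢0)) (*-identityʳ β)))
        to-quadratic : (s ⊕ s ⊕ ⊝ c) ⊗ (s ⊕ s ⊕ ⊝ c) ≡ c ⊗ c ⊕ ⊝ D → s ⊗ s ⊕ ⊝ (c ⊗ s) ⊕ β ≡ 𝟘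
        to-quadratic e = domain (trans (sym identity) (≡⇒⊟≡0 e)) four≢0
        by-cases : Dec (s ≡ 𝟘) → W′.unit W.base s * ⟦ W′.g W.base s ≟ c ⟧ ≡ ⟦ (s ⊕ s ⊕ ⊝ c) ⊗ (s ⊕ s ⊕ ⊝ c) ≟ c ⊗ c ⊕ ⊝ D ⟧
        by-cases (yes p) = trans (trans (cong (_* ⟦ W′.g W.base s ≟ c ⟧) (cong (_-_ 1ℤ) (⟦⟧-yes (s ≟ 𝟘) p))) (ℤₚ.*-zeroˡ ⟦ W′.g W.base s ≟ c ⟧))
          (sym (⟦⟧-no ((s ⊕ s ⊕ ⊝ c) ⊗ (s ⊕ s ⊕ ⊝ c) ≟ c ⊗ c ⊕ ⊝ D) λ e → β≢0 (trans (sym (trans (cong (λ s → s ⊗ s ⊕ ⊝ (c ⊗ s) ⊕ β) p) (solve 2 (λ c b → con 0ℤ :* con 0ℤ :+ :- (c :* con 0ℤ) :+ b := b) refl c β))) (to-quadratic e))))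
        by-cases (no s≢0) = trans (trans (cong (_* ⟦ W′.g W.base s ≟ c ⟧) (cong (_-_ 1ℤ) (⟦⟧-no (s ≟ 𝟘) s≢0))) (ℤₚ.*-identityˡ ⟦ W′.g W.base s ≟ c ⟧))
          (⟦⟧-cong (W′.g W.base s ≟ c) ((s ⊕ s ⊕ ⊝ c) ⊗ (s ⊕ s ⊕ ⊝ c) ≟ c ⊗ c ⊕ ⊝ D)
            (λ e → ⊟≡0⇒≡ (trans identity (trans (cong ((𝟙 ⊕ 𝟙) ⊗ (𝟙 ⊕ 𝟙) ⊗_) (trans (sym (cleared s≢0)) (trans (cong (s ⊗_) (≡⇒⊟≡0 e)) (zeroʳ s)))) (zeroʳ _))))
            (λ e → ⊟≡0⇒≡ (domain (trans (cleared s≢0) (to-quadratic e)) s≢0)))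

      counted : ∀ c → ∑ elements (λ s → W′.unit W.base s * ⟦ W′.g W.base s ≟ c ⟧) ≡ ρ (c ⊗ c ⊕ ⊝ D)
      counted c = trans (∑-cong elements (quadratic c)) (trans (∑-cong elements λ s → cong (λ z → ⟦ (z ⊕ ⊝ c) ⊗ (z ⊕ ⊝ c) ≟ c ⊗ c ⊕ ⊝ D ⟧) (sym (trans (distribʳ s 𝟙 𝟙) (cong₂ _⊕_ (*-identityˡ s) (*-identityˡ s)))))
        (trans (∑-scale (λ z → ⟦ (z ⊕ ⊝ c) ⊗ (z ⊕ ⊝ c) ≟ c ⊗ c ⊕ ⊝ D ⟧) 2≢0) (∑-shift (λ y → ⟦ y ⊗ y ≟ c ⊗ c ⊕ ⊝ D ⟧) (⊝ c))))

      𝒦≡⋆ : ∀ ψ x → W′.𝒦 W.base ψ x ≡ ((λ c → ρ (c ⊗ c ⊕ ⊝ D)) ⋆ ψ) x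
      𝒦≡⋆ ψ x = sym (trans (∑-cong elements λ c → trans (cong (_* ψ (x ⊕ c)) (sym (counted c))) (sym (∑-*ʳ elements _ (ψ (x ⊕ c)))))
        (trans (∑-swap elements elements _) (∑-cong elements λ s → trans (∑-cong elements λ c → ℤₚ.*-assoc (W′.unit W.base s) ⟦ W′.g W.base s ≟ c ⟧ (ψ (x ⊕ c)))
          (trans (∑-* elements (W′.unit W.base s) _) (cong (W′.unit W.base s *_) (∑-δ′ (λ c → ψ (x ⊕ c)) (W′.g W.base s)))))))

    -- With 4β = D the kernel at c counts the solutions s of s + β/s = c, so the convolution is the
    -- Kloosterman operator over F. The integer Λ stands in for 2√q.
    bounded-kloosterman : Bounded (λ c → ρ (c ⊗ c ⊕ ⊝ D)) Λ
    bounded-kloosterman .bound f mean = ±-≡ (⟪⟫-cong f λ x → sym (𝒦≡⋆ f x)) (abs-≤ (0≤* Λ≥0 (⟪⟫≥0 f))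
        (≤-trans (W.weil f mean) (≤-trans (≤-*ʳ (0≤sq ⟪ f ∙ f ⟫) 4q≤Λ²) (≤-reflexive (lem Λ ⟪ f ∙ f ⟫)))))
      where lem : ∀ a s → a * a * (s * s) ≡ a * s * (a * s)
            lem = solve-∀

    -- The argument of ρ is -1 times that in `bounded-kloosterman`. If -1 is a square, ρ does not
    -- change; otherwise ρ(-a) = 2 - ρ(a), which changes the kernel by a sign and a constant.
    bounded-circle : Bounded (λ c → ρ (D ⊕ ⊝ (c ⊗ c))) Λ
    bounded-circle = by-cases (square? (⊝ 𝟙))
      where
      flip : ∀ c → ⊝ 𝟙 ⊗ (c ⊗ c ⊕ ⊝ D) ≡ D ⊕ ⊝ (c ⊗ c)
      flip c = trans (sym (-‿distribˡ-* 𝟙 _)) (trans (cong ⊝_ (*-identityˡ _)) (solve 2 (λ c d → :- (c :* c :+ :- d) := d :+ :- (c :* c)) refl c D))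
      by-cases : (∃[ i ] i ⊗ i ≡ ⊝ 𝟙) ⊎ (∀ y → y ⊗ y ≢ ⊝ 𝟙) → Bounded (λ c → ρ (D ⊕ ⊝ (c ⊗ c))) Λ
      by-cases (inj₁ (i , i²)) = bounded-cong (λ c → trans (cong ρ (sym (flip c))) (same (c ⊗ c ⊕ ⊝ D))) bounded-kloosterman
        where
        i≢0 : i ≢ 𝟘
        i≢0 refl = ⊝-≢0 (λ e → 0≢1 (sym e)) (trans (sym i²) (zeroˡ 𝟘))
        assoc : ∀ y → i ⊗ y ⊗ (i ⊗ y) ≡ ⊝ 𝟙 ⊗ (y ⊗ y)
        assoc y = trans (solve 2 (λ i y → i :* y :* (i :* y) := i :* i :* (y :* y)) refl i y) (cong (_⊗ (y ⊗ y)) i²)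
        same : ∀ a → ρ (⊝ 𝟙 ⊗ a) ≡ ρ a
        same a = trans (sym (∑-scale (λ y → ⟦ y ⊗ y ≟ ⊝ 𝟙 ⊗ a ⟧) i≢0)) (∑-cong elements λ y → ⟦⟧-cong (i ⊗ y ⊗ (i ⊗ y) ≟ ⊝ 𝟙 ⊗ a) (y ⊗ y ≟ a)
          (λ e → ⊗-cancelˡ (⊝-≢0 (λ e → 0≢1 (sym e))) (trans (sym (assoc y)) e)) (λ e → trans (assoc y) (cong (⊝ 𝟙 ⊗_) e)))
      by-cases (inj₂ ns) = bounded-affine (+ 2) (λ c → trans (cong ρ (sym (flip c))) (solve-for (ρ (c ⊗ c ⊕ ⊝ D)) (ρ-twist ns (c ⊗ c ⊕ ⊝ D))))
          (subst (Bounded _) (ℤₚ.*-identityˡ Λ) (bounded-scale (- 1ℤ) (ℤ.-≤+ , ≤-refl) bounded-kloosterman))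
        where
        solve-for : ∀ a {b} → a + b ≡ + 2 → b ≡ + 2 + - 1ℤ * a
        solve-for a {b} e = trans (lem a b) (cong (λ z → z + - 1ℤ * a) e)
          where lem : ∀ a b → b ≡ a + b + - 1ℤ * a
                lem = solve-∀

-- The Radon transform: from lines back to the space

module Radon (F : FiniteField) (2≢0 : FiniteField._+_ F (FiniteField.1# F) (FiniteField.1# F) ≢ FiniteField.0# F) where
  open Field F
  open Geometry F
  open Convolution F 2≢0

  private variable d : ℕ

  form : (Vec Carrier d → ℤ) → (Vec Carrier d → ℤ) → (Vec Carrier d → ℤ) → ℤ
  form {d} k f g = ∑ (allPoints d) (λ x → f x * ∑ (allPoints d) (λ z → k z * g (z +[ 𝟙 ] x)))

  inner : (Vec Carrier d → ℤ) → (Vec Carrier d → ℤ) → ℤ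
  inner {d} f g = ∑ (allPoints d) (λ x → f x * g x)

  push : Vec Carrier d → (Vec Carrier d → ℤ) → Carrier → ℤ
  push {d} m f c = ∑ (allPoints d) (λ x → ⟦ dot m x ≟ c ⟧ * f x)

  ∑-push : ∀ (m : Vec Carrier d) f (G : Carrier → ℤ) → ∑ elements (λ c → push m f c * G c) ≡ ∑ (allPoints d) (λ x → f x * G (dot m x))
  ∑-push {d} m f G = trans (∑-cong elements λ c → sym (∑-*ʳ (allPoints d) _ (G c))) (trans (∑-swap elements (allPoints d) _)
    (∑-cong (allPoints d) λ x → trans (∑-cong elements λ c → arrange ⟦ dot m x ≟ c ⟧ (f x) (G c)) (trans (∑-* elements (f x) _) (cong (f x *_) (∑-δ′ G (dot m x))))))
    where arrange : ∀ a b c → a * b * c ≡ b * (a * c)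
          arrange = solve-∀

  ∑-push-1 : ∀ (m : Vec Carrier d) f → ∑ elements (push m f) ≡ ∑ (allPoints d) f
  ∑-push-1 {d} m f = trans (∑-cong elements λ c → sym (ℤₚ.*-identityʳ (push m f c))) (trans (∑-push m f (λ _ → 1ℤ)) (∑-cong (allPoints d) λ x → ℤₚ.*-identityʳ (f x)))

  zero-dot-count : ∀ (v : Vec Carrier d) → q * ∑ (allPoints d) (λ m → ⟦ dot v m ≟ 𝟘 ⟧) ≡ q ℤ.^ d + (q - 1ℤ) * q ℤ.^ d * ⟦ v ≟ᵛ 0ᵛ ⟧
  zero-dot-count {d} v = by-cases (v ≟ᵛ 0ᵛ)
    where
    open ≡-Reasoning
    by-cases : Dec (v ≡ 0ᵛ) → q * ∑ (allPoints d) (λ m → ⟦ dot v m ≟ 𝟘 ⟧) ≡ q ℤ.^ d + (q - 1ℤ) * q ℤ.^ d * ⟦ v ≟ᵛ 0ᵛ ⟧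
    by-cases (yes refl) = begin
      q * ∑ (allPoints d) (λ m → ⟦ dot 0ᵛ m ≟ 𝟘 ⟧) ≡⟨ cong (q *_) (trans (∑-cong (allPoints d) λ m → ⟦⟧-yes (dot 0ᵛ m ≟ 𝟘) (dot-0ˡ m)) (trans (∑-vecs-const d elements 1ℤ) (ℤₚ.*-identityʳ _))) ⟩
      q * q ℤ.^ d ≡⟨ lem q (q ℤ.^ d) ⟩
      q ℤ.^ d + (q - 1ℤ) * q ℤ.^ d * 1ℤ ≡⟨ cong (λ b → q ℤ.^ d + (q - 1ℤ) * q ℤ.^ d * b) (sym (⟦⟧-yes (0ᵛ ≟ᵛ 0ᵛ {d}) refl)) ⟩
      q ℤ.^ d + (q - 1ℤ) * q ℤ.^ d * ⟦ 0ᵛ ≟ᵛ 0ᵛ ⟧ ∎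
      where lem : ∀ q Q → q * Q ≡ Q + (q - 1ℤ) * Q * 1ℤ
            lem = solve-∀
    by-cases (no v≢0) = begin
      q * ∑ (allPoints d) (λ m → ⟦ dot v m ≟ 𝟘 ⟧)
        ≡⟨ cong₂ _*_ (sym (ℤₚ.*-identityʳ q)) (∑-cong (allPoints d) λ m → ⟦⟧-cong (dot v m ≟ 𝟘) (dots (v ∷ []) m ≟ᵛ (𝟘 ∷ [])) (cong (_∷ [])) (cong Vec.head)) ⟩
      q ℤ.^ 1 * ∑ (allPoints d) (λ m → ⟦ dots (v ∷ []) m ≟ᵛ (𝟘 ∷ []) ⟧) ≡⟨ fibre-size (v ∷ []) dual (𝟘 ∷ []) ⟩
      q ℤ.^ d ≡⟨ lem (q ℤ.^ d) ((q - 1ℤ) * q ℤ.^ d) ⟩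
      q ℤ.^ d + (q - 1ℤ) * q ℤ.^ d * 0ℤ ≡⟨ cong (λ b → q ℤ.^ d + (q - 1ℤ) * q ℤ.^ d * b) (sym (⟦⟧-no (v ≟ᵛ 0ᵛ) v≢0)) ⟩
      q ℤ.^ d + (q - 1ℤ) * q ℤ.^ d * ⟦ v ≟ᵛ 0ᵛ ⟧ ∎
      where
      lem : ∀ a b → a ≡ a + b * 0ℤ
      lem = solve-∀
      f = proj₁ (dot-nondegenerate v v≢0)
      dual : Dual (v ∷ [])
      dual = f ∷ [] , λ { (c ∷ []) → cong (_∷ []) (trans (dot-+ʳ v 0ᵛ c f) (trans (cong₂ (λ a b → a ⊕ c ⊗ b) (dot-0ʳ v) (proj₂ (dot-nondegenerate v v≢0))) (trans (+-identityˡ _) (*-identityʳ c)))) }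

  module _ (k f : Vec Carrier d → ℤ) (mean : ∑ (allPoints d) f ≡ 0ℤ) where
    private
      pts : List (Vec Carrier d)
      pts = allPoints d

      slice : ∀ m → ⟪ push m f ∙ push m k ⋆ push m f ⟫ ≡ ∑ pts (λ x → ∑ pts (λ z → ∑ pts (λ y → f x * (k z * f y) * ⟦ dot (y +[ ⊝ 𝟙 ] (z +[ 𝟙 ] x)) m ≟ 𝟘 ⟧)))
      slice m = begin
        ⟪ push m f ∙ push m k ⋆ push m f ⟫ ≡⟨ ∑-push m f (push m k ⋆ push m f) ⟩
        ∑ pts (λ x → f x * ∑ elements (λ c → push m k c * push m f (dot m x ⊕ c))) ≡⟨ ∑-cong pts (λ x → cong (f x *_) (∑-push m k (λ c → push m f (dot m x ⊕ c)))) ⟩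
        ∑ pts (λ x → f x * ∑ pts (λ z → k z * push m f (dot m x ⊕ dot m z)))
          ≡⟨ ∑-cong pts (λ x → trans (sym (∑-* pts (f x) _)) (∑-cong pts λ z → trans (cong (f x *_) (sym (∑-* pts (k z) _))) (trans (sym (∑-* pts (f x) _)) (∑-cong pts λ y →
               trans (arrange (f x) (k z) ⟦ dot m y ≟ dot m x ⊕ dot m z ⟧ (f y)) (cong (f x * (k z * f y) *_) (condition x y z)))))) ⟩
        ∑ pts (λ x → ∑ pts (λ z → ∑ pts (λ y → f x * (k z * f y) * ⟦ dot (y +[ ⊝ 𝟙 ] (z +[ 𝟙 ] x)) m ≟ 𝟘 ⟧))) ∎
        where
        open ≡-Reasoning
        arrange : ∀ a b c d → a * (b * (c * d)) ≡ a * (b * d) * c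
        arrange = solve-∀
        difference : ∀ x y z → dot (y +[ ⊝ 𝟙 ] (z +[ 𝟙 ] x)) m ≡ dot m y ⊕ ⊝ (dot m x ⊕ dot m z)
        difference x y z = trans (dot-+ˡ y (⊝ 𝟙) _ m) (cong₂ _⊕_ (dot-comm y m) (trans (sym (-‿distribˡ-* 𝟙 _)) (cong ⊝_ (trans (*-identityˡ _)
          (trans (dot-+ˡ z 𝟙 x m) (trans (cong₂ _⊕_ (dot-comm z m) (trans (*-identityˡ _) (dot-comm x m))) (+-comm _ _)))))))
        condition : ∀ x y z → ⟦ dot m y ≟ dot m x ⊕ dot m z ⟧ ≡ ⟦ dot (y +[ ⊝ 𝟙 ] (z +[ 𝟙 ] x)) m ≟ 𝟘 ⟧
        condition x y z = ⟦⟧-cong (dot m y ≟ dot m x ⊕ dot m z) (dot (y +[ ⊝ 𝟙 ] (z +[ 𝟙 ] x)) m ≟ 𝟘)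
          (λ e → trans (difference x y z) (≡⇒⊟≡0 e)) (λ e → ⊟≡0⇒≡ (trans (sym (difference x y z)) e))

    -- The sum over m counts triples with m·(y - x - z) = 0. A nonzero vector is orthogonal to
    -- q^(d-1) of the m and the zero vector to all q^d. The common part is multiplied by the sum of
    -- f over y, which is 0; the surplus selects y = x + z.
    radon : q * ∑ pts (λ m → ⟪ push m f ∙ push m k ⋆ push m f ⟫) ≡ (q - 1ℤ) * q ℤ.^ d * form k f f
    radon = begin
      q * ∑ pts (λ m → ⟪ push m f ∙ push m k ⋆ push m f ⟫) ≡⟨ cong (q *_) (trans (∑-cong pts slice) (trans (∑-swap pts pts _) (∑-cong pts λ x → trans (∑-swap pts pts _) (∑-cong pts λ z → trans (∑-swap pts pts _) (∑-cong pts λ y → ∑-* pts (f x * (k z * f y)) _))))) ⟩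
      q * ∑ pts (λ x → ∑ pts (λ z → ∑ pts (λ y → f x * (k z * f y) * Z x z y)))
        ≡⟨ trans (sym (∑-* pts q _)) (∑-cong pts λ x → trans (sym (∑-* pts q _)) (∑-cong pts λ z → trans (sym (∑-* pts q _)) (∑-cong pts λ y → trans (arrange q (f x * (k z * f y)) (Z x z y)) (cong (f x * (k z * f y) *_) (zero-dot-count (y +[ ⊝ 𝟙 ] (z +[ 𝟙 ] x))))))) ⟩
      ∑ pts (λ x → ∑ pts (λ z → ∑ pts (λ y → f x * (k z * f y) * (N + C * ⟦ (y +[ ⊝ 𝟙 ] (z +[ 𝟙 ] x)) ≟ᵛ 0ᵛ ⟧))))
        ≡⟨ ∑-cong pts (λ x → ∑-cong pts λ z → trans (∑-cong pts λ y → trans (cong (λ b → f x * (k z * f y) * (N + C * b)) (condition x z y)) (expand (f x) (k z) (f y) N C _))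
             (trans (∑-+ pts _ _) (cong₂ _+_ (trans (∑-* pts (f x * k z * N) f) (trans (cong (f x * k z * N *_) mean) (ℤₚ.*-zeroʳ (f x * k z * N))))
               (trans (∑-* pts (f x * k z * C) _) (cong (f x * k z * C *_) (Sums.∑-δ (points d) f (z +[ 𝟙 ] x))))))) ⟩
      ∑ pts (λ x → ∑ pts (λ z → 0ℤ + f x * k z * C * f (z +[ 𝟙 ] x)))
        ≡⟨ ∑-cong pts (λ x → trans (∑-cong pts λ z → collect (f x) (k z) C (f (z +[ 𝟙 ] x))) (trans (∑-* pts C _) (cong (C *_) (∑-* pts (f x) _)))) ⟩
      ∑ pts (λ x → C * (f x * ∑ pts (λ z → k z * f (z +[ 𝟙 ] x)))) ≡⟨ ∑-* pts C _ ⟩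
      C * form k f f ∎
      where
      open ≡-Reasoning
      N C : ℤ
      N = q ℤ.^ d
      C = (q - 1ℤ) * q ℤ.^ d
      Z : Vec Carrier d → Vec Carrier d → Vec Carrier d → ℤ
      Z x z y = ∑ pts (λ m → ⟦ dot (y +[ ⊝ 𝟙 ] (z +[ 𝟙 ] x)) m ≟ 𝟘 ⟧)
      arrange : ∀ q a b → q * (a * b) ≡ a * (q * b)
      arrange = solve-∀
      expand : ∀ a b c N C D → a * (b * c) * (N + C * D) ≡ a * b * N * c + a * b * C * (D * c)
      expand = solve-∀
      collect : ∀ a b C c → 0ℤ + a * b * C * c ≡ C * (a * (b * c))
      collect = solve-∀
      condition : ∀ x z y → ⟦ (y +[ ⊝ 𝟙 ] (z +[ 𝟙 ] x)) ≟ᵛ 0ᵛ ⟧ ≡ ⟦ y ≟ᵛ (z +[ 𝟙 ] x) ⟧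
      condition x z y = ⟦⟧-cong ((y +[ ⊝ 𝟙 ] (z +[ 𝟙 ] x)) ≟ᵛ 0ᵛ) (y ≟ᵛ (z +[ 𝟙 ] x)) (-‿zero y (z +[ 𝟙 ] x)) (λ { refl → -‿self (z +[ 𝟙 ] x) })

  0+ᵛ : ∀ (x : Vec Carrier d) → 0ᵛ +[ 𝟙 ] x ≡ x
  0+ᵛ []      = refl
  0+ᵛ (a ∷ x) = cong₂ _∷_ (trans (+-identityˡ _) (*-identityˡ a)) (0+ᵛ x)

  -- For this kernel `radon` becomes a Plancherel formula, relating the norms of all projections of
  -- f to the norm of f.
  δ₀ : Vec Carrier d → ℤ
  δ₀ z = ⟦ z ≟ᵛ 0ᵛ ⟧

  form-δ₀ : ∀ (f : Vec Carrier d → ℤ) → form δ₀ f f ≡ inner f f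
  form-δ₀ {d} f = ∑-cong (allPoints d) λ x → cong (f x *_) (trans (Sums.∑-δ (points d) (λ z → f (z +[ 𝟙 ] x)) 0ᵛ) (cong f (0+ᵛ x)))

  push-δ₀ : ∀ (m : Vec Carrier d) f → push m δ₀ ⋆ f ≗ f
  push-δ₀ {d} m f x = trans (∑-push m δ₀ (λ c → f (x ⊕ c))) (trans (Sums.∑-δ (points d) (λ z → f (x ⊕ dot m z)) 0ᵛ) (cong f (trans (cong (x ⊕_) (dot-0ʳ m)) (+-identityʳ x))))

  -- The form is an average of the forms of the projections, and by Plancherel the same average of
  -- their norms is the norm of f. The direction m = 0 contributes nothing because the mean of f is
  -- zero.
  radon-bounded : ∀ (k : Vec Carrier d → ℤ) Λ → (∀ m → m ≢ 0ᵛ → Bounded (push m k) Λ) →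
                  ∀ f → ∑ (allPoints d) f ≡ 0ℤ → form k f f ∈± Λ * inner f f
  radon-bounded {d} k Λ B f mean = ±-cancel C>0 (±-≡ (sym (radon k f mean))
      (subst (q * ∑ pts (λ m → ⟪ push m f ∙ push m k ⋆ push m f ⟫) ∈±_) bound-total (±-* {q} {b = q} (≤-refl , ≤-trans (ℤₚ.neg-mono-≤ (0≤n {card})) (0≤n {card})) (±-∑ pts each))))
    where
    pts = allPoints d
    C = (q - 1ℤ) * q ℤ.^ d
    ±-cancel : ∀ {c a b} → 0ℤ < c → c * a ∈± c * b → a ∈± b
    ±-cancel {c} {a} c>0 (u , l) = *-cancel-≤ c>0 u , *-cancel-≤ c>0 (≤-trans (≤-reflexive (sym (ℤₚ.neg-distribʳ-* c a))) l)
    C>0 : 0ℤ < C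
    C>0 = <-≤-trans {j = 1ℤ * 1ℤ} (ℤ.+<+ (ℕ.s≤s ℕ.z≤n)) (≤-* {1ℤ} {q - 1ℤ} {1ℤ} {q ℤ.^ d} 0≤n (≤-trans 0≤n (q^≥1 d)) (≤-via (lem q) (diff≥0 {+ 2} {q} (ℤ.+≤+ card>1))) (q^≥1 d))
      where
      lem : ∀ q → q - 1ℤ - 1ℤ ≡ q - + 2
      lem = solve-∀
      q^≥1 : ∀ d → 1ℤ ≤ q ℤ.^ d
      q^≥1 zero    = ≤-refl
      q^≥1 (suc d) = ≤-* {1ℤ} {q} {1ℤ} {q ℤ.^ d} 0≤n (≤-trans 0≤n (q^≥1 d)) (ℤ.+≤+ (ℕₚ.≤-trans (ℕₚ.n≤1+n 1) card>1)) (q^≥1 d)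
    each : ∀ m → ⟪ push m f ∙ push m k ⋆ push m f ⟫ ∈± Λ * ⟪ push m f ∙ push m f ⟫
    each m = by-cases (m ≟ᵛ 0ᵛ)
      where
      by-cases : Dec (m ≡ 0ᵛ) → ⟪ push m f ∙ push m k ⋆ push m f ⟫ ∈± Λ * ⟪ push m f ∙ push m f ⟫
      by-cases (no m≢0) = bound (B m m≢0) (push m f) (trans (∑-push-1 m f) mean)
      by-cases (yes refl) = ±-≡ (vanish (push 0ᵛ k ⋆ push 0ᵛ f)) (subst (0ℤ ∈±_) (sym (trans (cong (Λ *_) (vanish (push 0ᵛ f))) (ℤₚ.*-zeroʳ Λ))) (≤-refl , ≤-refl))
        where
        push-0 : ∀ c → push (0ᵛ {d}) f c ≡ 0ℤ
        push-0 c = trans (∑-cong pts λ x → cong (λ a → ⟦ a ≟ c ⟧ * f x) (dot-0ˡ x)) (trans (∑-* pts ⟦ 𝟘 ≟ c ⟧ f) (trans (cong (⟦ 𝟘 ≟ c ⟧ *_) mean) (ℤₚ.*-zeroʳ ⟦ 𝟘 ≟ c ⟧)))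
        vanish : ∀ g → ⟪ push 0ᵛ f ∙ g ⟫ ≡ 0ℤ
        vanish g = ∑-zero elements λ c → trans (cong (_* g c) (push-0 c)) (ℤₚ.*-zeroˡ (g c))
    bound-total : q * ∑ pts (λ m → Λ * ⟪ push m f ∙ push m f ⟫) ≡ C * (Λ * inner f f)
    bound-total = begin
      q * ∑ pts (λ m → Λ * ⟪ push m f ∙ push m f ⟫) ≡⟨ cong (q *_) (∑-* pts Λ _) ⟩
      q * (Λ * ∑ pts (λ m → ⟪ push m f ∙ push m f ⟫)) ≡⟨ arrange q Λ _ ⟩
      Λ * (q * ∑ pts (λ m → ⟪ push m f ∙ push m f ⟫)) ≡⟨ cong (λ a → Λ * (q * a)) (∑-cong pts λ m → sym (⟪⟫-cong (push m f) (push-δ₀ m (push m f)))) ⟩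
      Λ * (q * ∑ pts (λ m → ⟪ push m f ∙ push m δ₀ ⋆ push m f ⟫)) ≡⟨ cong (Λ *_) (radon δ₀ f mean) ⟩
      Λ * (C * form δ₀ f f) ≡⟨ cong (λ a → Λ * (C * a)) (form-δ₀ f) ⟩
      Λ * (C * inner f f) ≡⟨ arrange Λ C (inner f f) ⟩
      C * (Λ * inner f f) ∎
      where
      open ≡-Reasoning
      arrange : ∀ a b c → a * (b * c) ≡ b * (a * c)
      arrange = solve-∀

-- Conics, and circles cut by lines

module Conics (F : FiniteField) (2≢0 : FiniteField._+_ F (FiniteField.1# F) (FiniteField.1# F) ≢ FiniteField.0# F) where
  open Field F
  open Odd 2≢0
  open Geometry F
  open Convolution F 2≢0
  open Radon F 2≢0

  pair : Carrier → Carrier → Vec Carrier 2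
  pair a b = a ∷ b ∷ []

  ∑-1 : ∀ (f : Vec Carrier 1 → ℤ) → ∑ (allPoints 1) f ≡ ∑ elements (λ a → f (a ∷ []))
  ∑-1 f = trans (∑-vecs 0 elements f) (∑-cong elements λ a → ℤₚ.+-identityʳ _)

  ∑-2 : ∀ (f : Vec Carrier 2 → ℤ) → ∑ (allPoints 2) f ≡ ∑ elements (λ a → ∑ elements (λ b → f (pair a b)))
  ∑-2 f = trans (∑-vecs 1 elements f) (∑-cong elements λ a → ∑-1 (λ v → f (a ∷ v)))

  ∑-3 : ∀ (f : Vec Carrier 3 → ℤ) → ∑ (allPoints 3) f ≡ ∑ elements (λ a → ∑ elements (λ b → ∑ elements (λ r → f (a ∷ b ∷ r ∷ []))))
  ∑-3 f = trans (∑-vecs 2 elements f) (∑-cong elements λ a → ∑-2 (λ v → f (a ∷ v)))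

  ∑-linear : ∀ p r s u → p ⊗ u ⊕ ⊝ (r ⊗ s) ≢ 𝟘 → ∀ (G : Carrier → Carrier → ℤ) →
    ∑ elements (λ a → ∑ elements (λ b → G (p ⊗ a ⊕ r ⊗ b) (s ⊗ a ⊕ u ⊗ b))) ≡ ∑ elements (λ a → ∑ elements (G a))
  ∑-linear p r s u det≢0 G = trans (sym (∑-2 (λ v → G′ (σ v)))) (trans (∑-bij (points 2) (points 2) σ τ τσ στ G′) (∑-2 G′))
    where
    det = p ⊗ u ⊕ ⊝ (r ⊗ s)
    i = inv det
    G′ : Vec Carrier 2 → ℤ
    G′ (a ∷ b ∷ []) = G a b
    σ τ : Vec Carrier 2 → Vec Carrier 2
    σ (a ∷ b ∷ []) = pair (p ⊗ a ⊕ r ⊗ b) (s ⊗ a ⊕ u ⊗ b)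
    τ (a ∷ b ∷ []) = pair (i ⊗ (u ⊗ a ⊕ ⊝ (r ⊗ b))) (i ⊗ (p ⊗ b ⊕ ⊝ (s ⊗ a)))
    cancel : ∀ {x y} → x ≡ det ⊗ i ⊗ y → x ≡ y
    cancel {x} {y} e = trans e (trans (cong (_⊗ y) (inv-right det≢0)) (*-identityˡ y))
    τσ : ∀ v → τ (σ v) ≡ v
    τσ (a ∷ b ∷ []) = cong₂ pair
      (cancel (solve 7 (λ p r s u a b i → i :* (u :* (p :* a :+ r :* b) :+ :- (r :* (s :* a :+ u :* b))) := (p :* u :+ :- (r :* s)) :* i :* a) refl p r s u a b i))
      (cancel (solve 7 (λ p r s u a b i → i :* (p :* (s :* a :+ u :* b) :+ :- (s :* (p :* a :+ r :* b))) := (p :* u :+ :- (r :* s)) :* i :* b) refl p r s u a b i))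
    στ : ∀ v → σ (τ v) ≡ v
    στ (a ∷ b ∷ []) = cong₂ pair
      (cancel (solve 7 (λ p r s u a b i → p :* (i :* (u :* a :+ :- (r :* b))) :+ r :* (i :* (p :* b :+ :- (s :* a))) := (p :* u :+ :- (r :* s)) :* i :* a) refl p r s u a b i))
      (cancel (solve 7 (λ p r s u a b i → s :* (i :* (u :* a :+ :- (r :* b))) :+ u :* (i :* (p :* b :+ :- (s :* a))) := (p :* u :+ :- (r :* s)) :* i :* b) refl p r s u a b i))

  module _ {M : Carrier} (M≢0 : M ≢ 𝟘) where
    γ : Carrier → ℤ
    γ a = ∑ elements (λ r → ∑ elements (λ y → ⟦ r ⊗ r ⊕ M ⊗ (y ⊗ y) ≟ a ⟧))

    private
      σ : Carrier → Carrier → ℤ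
      σ b x = ∑ elements (λ y → ⟦ x ⊕ M ⊗ (y ⊗ y) ≟ b ⟧)

      σ≡ρ : ∀ b x → σ b x ≡ ρ (inv M ⊗ (b ⊕ ⊝ x))
      σ≡ρ b x = ∑-cong elements λ y → ⟦⟧-cong (x ⊕ M ⊗ (y ⊗ y) ≟ b) (y ⊗ y ≟ inv M ⊗ (b ⊕ ⊝ x))
        (λ e → ⊗-cancelˡ M≢0 (trans (solve 2 (λ x m → m := x :+ m :+ :- x) refl x (M ⊗ (y ⊗ y))) (trans (cong (_⊕ ⊝ x) e) (sym (undo (b ⊕ ⊝ x))))))
        (λ e → trans (cong (λ w → x ⊕ M ⊗ w) e) (trans (cong (x ⊕_) (undo (b ⊕ ⊝ x))) (solve 2 (λ x b → x :+ (b :+ :- x) := b) refl x b)))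
        where
        undo : ∀ w → M ⊗ (inv M ⊗ w) ≡ w
        undo w = trans (sym (*-assoc M _ w)) (trans (cong (_⊗ w) (inv-right M≢0)) (*-identityˡ w))

      σ≤2 : ∀ b x → σ b x ≤ + 2
      σ≤2 b x = ≤-trans (≤-reflexive (σ≡ρ b x)) (ρ≤2 _)

      ∑σ : ∀ b → ∑ elements (σ b) ≡ q
      ∑σ b = trans (∑-cong elements (σ≡ρ b)) (trans (sym (∑-negate (λ x → ρ (inv M ⊗ (b ⊕ ⊝ x))))) (trans (sym (∑-shift (λ x → ρ (inv M ⊗ (b ⊕ ⊝ ⊝ x))) (⊝ b)))
        (trans (∑-cong elements λ x → cong (λ z → ρ (inv M ⊗ z)) (solve 2 (λ b x → b :+ :- :- (x :+ :- b) := x) refl b x)) (trans (∑-scale ρ (inv-≢0 M≢0)) ∑ρ))))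

    γ≥0 : ∀ a → 0ℤ ≤ γ a
    γ≥0 a = ∑-≥0 elements λ r → ∑-≥0 elements λ y → ⟦⟧≥0 (r ⊗ r ⊕ M ⊗ (y ⊗ y) ≟ a)

    -- Otherwise the squares and the values b − My² would be disjoint, though each set has (q+1)/2 elements.
    represented : ∀ b → b ≢ 𝟘 → ∃[ r ] ∃[ y ] r ⊗ r ⊕ M ⊗ (y ⊗ y) ≡ b
    represented b b≢0 = by-cases (Any.any? (λ r → Any.any? (λ y → r ⊗ r ⊕ M ⊗ (y ⊗ y) ≟ b) elements) elements)
      where
      by-cases : Dec (Any.Any (λ r → Any.Any (λ y → r ⊗ r ⊕ M ⊗ (y ⊗ y) ≡ b) elements) elements) → ∃[ r ] ∃[ y ] r ⊗ r ⊕ M ⊗ (y ⊗ y) ≡ b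
      by-cases (yes m) = let (r , m′) = Any.satisfied m in r , Any.satisfied m′
      by-cases (no ¬m) = contradiction (trans (sym one) (∑-vanish elements slack≥0 (≤-reflexive total) (elements-complete 𝟘))) λ ()
        where
        none : ∀ r y → r ⊗ r ⊕ M ⊗ (y ⊗ y) ≢ b
        none r y e = ¬m (lose (elements-complete r) (lose (elements-complete y) e))
        σ-square : ∀ r → σ b (r ⊗ r) ≡ 0ℤ
        σ-square r = ∑-zero elements λ y → ⟦⟧-no (r ⊗ r ⊕ M ⊗ (y ⊗ y) ≟ b) (none r y)
        slack : Carrier → ℤ
        slack x = + 2 - (ρ x + σ b x)
        slack≥0 : ∀ x → 0ℤ ≤ slack x
        slack≥0 x = diff≥0 (below (square? x))
          where
          below : (∃[ y ] y ⊗ y ≡ x) ⊎ (∀ y → y ⊗ y ≢ x) → ρ x + σ b x ≤ + 2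
          below (inj₁ (r , refl)) = ≤-trans (≤-reflexive (trans (cong (_+_ (ρ (r ⊗ r))) (σ-square r)) (ℤₚ.+-identityʳ _))) (ρ≤2 (r ⊗ r))
          below (inj₂ ns) = ≤-trans (≤-reflexive (trans (cong (_+ σ b x) (ρ-nonsquare ns)) (ℤₚ.+-identityˡ _))) (σ≤2 b x)
        total : ∑ elements slack ≡ 0ℤ
        total = trans (∑-- elements (λ _ → + 2) (λ x → ρ x + σ b x)) (trans (cong₂ _-_ (∑-const elements (+ 2)) (trans (∑-+ elements ρ (σ b)) (cong₂ _+_ ∑ρ (∑σ b)))) (lem q))
          where lem : ∀ q → q * + 2 - (q + q) ≡ 0ℤ
                lem = solve-∀
        one : slack 𝟘 ≡ 1ℤ
        one = cong₂ (λ a c → + 2 - (a + c)) ρ0 (trans (cong (σ b) (sym (zeroˡ 𝟘))) (σ-square 𝟘))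

    -- The form r² + My² is multiplicative. Multiplication by a fixed solution (r₀, y₀) for b is
    -- linear of determinant b ≠ 0 and carries solutions for 1 bijectively to solutions for b.
    γ-scale : ∀ {b} → b ≢ 𝟘 → γ b ≡ γ 𝟙
    γ-scale {b} b≢0 = sym (trans (∑-cong elements λ r → ∑-cong elements λ y → ⟦⟧-cong (r ⊗ r ⊕ M ⊗ (y ⊗ y) ≟ 𝟙) _ (λ e → trans (multiply r y) (trans (cong (_⊗ b) e) (*-identityˡ b)))
        (λ e → ⊗-cancelˡ b≢0 (trans (*-comm b _) (trans (sym (multiply r y)) (trans e (sym (*-identityʳ b)))))))
      (∑-linear r₀ (⊝ (M ⊗ y₀)) y₀ r₀ det≢0 (λ r y → ⟦ r ⊗ r ⊕ M ⊗ (y ⊗ y) ≟ b ⟧)))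
      where
      r₀ = proj₁ (represented b b≢0)
      y₀ = proj₁ (proj₂ (represented b b≢0))
      norm₀ : r₀ ⊗ r₀ ⊕ M ⊗ (y₀ ⊗ y₀) ≡ b
      norm₀ = proj₂ (proj₂ (represented b b≢0))
      det≢0 : r₀ ⊗ r₀ ⊕ ⊝ (⊝ (M ⊗ y₀) ⊗ y₀) ≢ 𝟘
      det≢0 e = b≢0 (trans (sym norm₀) (trans (solve 3 (λ r m y → r :* r :+ m :* (y :* y) := r :* r :+ :- (:- (m :* y) :* y)) refl r₀ M y₀) e))
      multiply : ∀ r y → (r₀ ⊗ r ⊕ ⊝ (M ⊗ y₀) ⊗ y) ⊗ (r₀ ⊗ r ⊕ ⊝ (M ⊗ y₀) ⊗ y) ⊕ M ⊗ ((y₀ ⊗ r ⊕ r₀ ⊗ y) ⊗ (y₀ ⊗ r ⊕ r₀ ⊗ y)) ≡ (r ⊗ r ⊕ M ⊗ (y ⊗ y)) ⊗ b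
      multiply r y = trans (solve 5 (λ r y s z m → (s :* r :+ :- (m :* z) :* y) :* (s :* r :+ :- (m :* z) :* y) :+ m :* ((z :* r :+ s :* y) :* (z :* r :+ s :* y)) := (r :* r :+ m :* (y :* y)) :* (s :* s :+ m :* (z :* z))) refl r y r₀ y₀ M)
        (cong ((r ⊗ r ⊕ M ⊗ (y ⊗ y)) ⊗_) norm₀)

    γ-split : ∀ a → γ a ≡ γ 𝟙 + (γ 𝟘 - γ 𝟙) * ⟦ a ≟ 𝟘 ⟧
    γ-split a = by-cases (a ≟ 𝟘)
      where
      lem : ∀ x y → x ≡ y + (x - y) * 1ℤ
      lem = solve-∀
      lem′ : ∀ x y → y ≡ y + (x - y) * 0ℤ
      lem′ = solve-∀
      by-cases : Dec (a ≡ 𝟘) → γ a ≡ γ 𝟙 + (γ 𝟘 - γ 𝟙) * ⟦ a ≟ 𝟘 ⟧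
      by-cases (yes p) = trans (cong γ p) (trans (lem (γ 𝟘) (γ 𝟙)) (cong (λ b → γ 𝟙 + (γ 𝟘 - γ 𝟙) * b) (sym (⟦⟧-yes (a ≟ 𝟘) p))))
      by-cases (no p) = trans (γ-scale p) (trans (lem′ (γ 𝟘) (γ 𝟙)) (cong (λ b → γ 𝟙 + (γ 𝟘 - γ 𝟙) * b) (sym (⟦⟧-no (a ≟ 𝟘) p))))

    private
      total : γ 𝟘 + (q - 1ℤ) * γ 𝟙 ≡ q * q
      total = begin
        γ 𝟘 + (q - 1ℤ) * γ 𝟙 ≡⟨ lem q (γ 𝟘) (γ 𝟙) ⟩
        q * γ 𝟙 + (γ 𝟘 - γ 𝟙) * 1ℤ ≡⟨ sym (cong₂ _+_ (∑-const elements (γ 𝟙)) (trans (∑-* elements (γ 𝟘 - γ 𝟙) _) (cong ((γ 𝟘 - γ 𝟙) *_) (∑-δ1 𝟘)))) ⟩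
        ∑ elements (λ _ → γ 𝟙) + ∑ elements (λ a → (γ 𝟘 - γ 𝟙) * ⟦ a ≟ 𝟘 ⟧) ≡⟨ sym (∑-+ elements _ _) ⟩
        ∑ elements (λ a → γ 𝟙 + (γ 𝟘 - γ 𝟙) * ⟦ a ≟ 𝟘 ⟧) ≡⟨ sym (∑-cong elements γ-split) ⟩
        ∑ elements γ ≡⟨ ∑-swap elements elements _ ⟩
        ∑ elements (λ r → ∑ elements (λ a → ∑ elements (λ y → ⟦ r ⊗ r ⊕ M ⊗ (y ⊗ y) ≟ a ⟧)))
          ≡⟨ ∑-cong elements (λ r → trans (∑-swap elements elements _) (∑-cong elements λ y → trans (∑-cong elements λ a → sym (ℤₚ.*-identityʳ _)) (∑-δ′ (λ _ → 1ℤ) _))) ⟩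
        ∑ elements (λ r → ∑ elements (λ y → 1ℤ)) ≡⟨ trans (∑-cong elements λ r → trans (∑-const elements 1ℤ) (ℤₚ.*-identityʳ q)) (∑-const elements q) ⟩
        q * q ∎
        where
        open ≡-Reasoning
        lem : ∀ q a b → a + (q - 1ℤ) * b ≡ q * b + (a - b) * 1ℤ
        lem = solve-∀

      γ0≥1 : 1ℤ ≤ γ 𝟘
      γ0≥1 = ≤-trans (≤-reflexive (sym (⟦⟧-yes (𝟘 ⊗ 𝟘 ⊕ M ⊗ (𝟘 ⊗ 𝟘) ≟ 𝟘) (trans (cong₂ _⊕_ (zeroˡ 𝟘) (trans (cong (M ⊗_) (zeroˡ 𝟘)) (zeroʳ M))) (+-identityˡ 𝟘)))))
        (≤-trans (∑-term≤ elements (λ y → ⟦⟧≥0 (𝟘 ⊗ 𝟘 ⊕ M ⊗ (y ⊗ y) ≟ 𝟘)) (elements-complete 𝟘)) (∑-term≤ elements (λ r → ∑-≥0 elements λ y → ⟦⟧≥0 (r ⊗ r ⊕ M ⊗ (y ⊗ y) ≟ 𝟘)) (elements-complete 𝟘)))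

      γ0≤ : γ 𝟘 ≤ + 2 * q - 1ℤ
      γ0≤ = ≤-via (lem (γ 𝟘) q) (diff≥0 (≤-trans (≤-reflexive (sym at-0)) (≤-trans (∑-term≤ elements (λ r → diff≥0 (σ≤2 𝟘 (r ⊗ r))) (elements-complete 𝟘)) (≤-reflexive sum))))
        where
        lem : ∀ g q → + 2 * q - 1ℤ - g ≡ q * + 2 - g - 1ℤ
        lem = solve-∀
        at-0 : + 2 - σ 𝟘 (𝟘 ⊗ 𝟘) ≡ 1ℤ
        at-0 = cong (_-_ (+ 2)) (trans (σ≡ρ 𝟘 (𝟘 ⊗ 𝟘)) (trans (cong ρ (trans (cong (inv M ⊗_) (trans (cong (λ z → 𝟘 ⊕ ⊝ z) (zeroˡ 𝟘)) (-‿inverseʳ 𝟘))) (zeroʳ _))) ρ0))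
        sum : ∑ elements (λ r → + 2 - σ 𝟘 (r ⊗ r)) ≡ q * + 2 - γ 𝟘
        sum = trans (∑-- elements (λ _ → + 2) (λ r → σ 𝟘 (r ⊗ r))) (cong (_- γ 𝟘) (∑-const elements (+ 2)))

      q-1>0 : 0ℤ < q - 1ℤ
      q-1>0 = 1+≤⇒< (≤-via (lem q) (diff≥0 {+ 2} {q} (ℤ.+≤+ card>1)))
        where lem : ∀ q → q - 1ℤ - (1ℤ + 0ℤ) ≡ q - + 2
              lem = solve-∀

    -- The possible values of (γ 𝟘, γ 𝟙) are (1, q + 1) and (2q - 1, q - 1). It suffices to know 1 ≤
    -- γ 𝟘 ≤ 2q - 1, as the total q² determines γ 𝟙 from γ 𝟘.
    γ-gap : γ 𝟘 - γ 𝟙 ∈± q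
    γ-gap = *-cancel-≤ q-1>0 (≤-via (trans lem (finish q (γ 𝟘))) (0≤* (0≤n {card}) (diff≥0 γ0≤))) ,
            *-cancel-≤ q-1>0 (≤-via (trans lem′ (finish′ q (γ 𝟘))) (0≤* (0≤n {card}) (diff≥0 γ0≥1)))
      where
      product : ∀ q a b → (q - 1ℤ) * (a - b) ≡ q * a - (a + (q - 1ℤ) * b)
      product = solve-∀
      lem : (q - 1ℤ) * q - (q - 1ℤ) * (γ 𝟘 - γ 𝟙) ≡ (q - 1ℤ) * q - (q * γ 𝟘 - q * q)
      lem = cong (_-_ ((q - 1ℤ) * q)) (trans (product q (γ 𝟘) (γ 𝟙)) (cong (_-_ (q * γ 𝟘)) total))
      finish : ∀ q g → (q - 1ℤ) * q - (q * g - q * q) ≡ q * (+ 2 * q - 1ℤ - g)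
      finish = solve-∀
      neg : ∀ q d → (q - 1ℤ) * - d ≡ - ((q - 1ℤ) * d)
      neg = solve-∀
      lem′ : (q - 1ℤ) * q - (q - 1ℤ) * - (γ 𝟘 - γ 𝟙) ≡ (q - 1ℤ) * q - - (q * γ 𝟘 - q * q)
      lem′ = cong (_-_ ((q - 1ℤ) * q)) (trans (neg q (γ 𝟘 - γ 𝟙)) (cong -_ (trans (product q (γ 𝟘) (γ 𝟙)) (cong (_-_ (q * γ 𝟘)) total))))
      finish′ : ∀ q g → (q - 1ℤ) * q - - (q * g - q * q) ≡ q * (g - 1ℤ)
      finish′ = solve-∀

    γ1≥ : q - 1ℤ ≤ γ 𝟙
    γ1≥ = *-cancel-≤ q-1>0 (≤-via (trans (lem q (γ 𝟘) (γ 𝟙)) (trans (cong (λ x → x - γ 𝟘 - (q - 1ℤ) * (q - 1ℤ)) total) (lem′ q (γ 𝟘)))) (diff≥0 γ0≤))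
      where
      lem : ∀ q a b → (q - 1ℤ) * b - (q - 1ℤ) * (q - 1ℤ) ≡ (a + (q - 1ℤ) * b) - a - (q - 1ℤ) * (q - 1ℤ)
      lem = solve-∀
      lem′ : ∀ q a → q * q - a - (q - 1ℤ) * (q - 1ℤ) ≡ + 2 * q - 1ℤ - a
      lem′ = solve-∀

    γ≤2q : ∀ a → γ a ≤ + 2 * q
    γ≤2q a = ≤-trans (∑-≤const elements λ r → σ≤2 a (r ⊗ r)) (≤-reflexive (ℤₚ.*-comm q (+ 2)))

  line-circle : Carrier → Carrier → Carrier → Carrier → ℤ
  line-circle m₁ m₂ τ c = ∑ elements (λ a → ∑ elements (λ b → ⟦ m₁ ⊗ a ⊕ m₂ ⊗ b ≟ c ⟧ * ⟦ a ⊗ a ⊕ b ⊗ b ≟ τ ⟧))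

  -- In the orthogonal coordinates x = m·p and y = m^⊥·p one has x² + y² = n‖p‖; the line fixes x =
  -- c and leaves y² = nτ - c².
  line-circle-anisotropic : ∀ {m₁ m₂} → m₁ ⊗ m₁ ⊕ m₂ ⊗ m₂ ≢ 𝟘 → ∀ τ c → line-circle m₁ m₂ τ c ≡ ρ ((m₁ ⊗ m₁ ⊕ m₂ ⊗ m₂) ⊗ τ ⊕ ⊝ (c ⊗ c))
  line-circle-anisotropic {m₁} {m₂} n≢0 τ c = begin
    line-circle m₁ m₂ τ c ≡⟨ ∑-cong elements (λ a → ∑-cong elements λ b → cong (⟦ m₁ ⊗ a ⊕ m₂ ⊗ b ≟ c ⟧ *_)
      (⟦⟧-cong (a ⊗ a ⊕ b ⊗ b ≟ τ) (y a b ⊗ y a b ≟ n ⊗ τ ⊕ ⊝ (x a b ⊗ x a b)) (to a b) (from a b))) ⟩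
    ∑ elements (λ a → ∑ elements (λ b → G (x a b) (y a b))) ≡⟨ ∑-linear m₁ m₂ (⊝ m₂) m₁ (λ e → n≢0 (trans (solve 2 (λ p r → p :* p :+ r :* r := p :* p :+ :- (r :* :- r)) refl m₁ m₂) e)) G ⟩
    ∑ elements (λ x → ∑ elements (G x)) ≡⟨ trans (∑-cong elements λ x → ∑-* elements ⟦ x ≟ c ⟧ _) (∑-δ (λ x → ρ (n ⊗ τ ⊕ ⊝ (x ⊗ x))) c) ⟩
    ρ (n ⊗ τ ⊕ ⊝ (c ⊗ c)) ∎
    where
    open ≡-Reasoning
    n = m₁ ⊗ m₁ ⊕ m₂ ⊗ m₂
    x y : Carrier → Carrier → Carrier
    x a b = m₁ ⊗ a ⊕ m₂ ⊗ b
    y a b = ⊝ m₂ ⊗ a ⊕ m₁ ⊗ b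
    G : Carrier → Carrier → ℤ
    G x y = ⟦ x ≟ c ⟧ * ⟦ y ⊗ y ≟ n ⊗ τ ⊕ ⊝ (x ⊗ x) ⟧
    identity : ∀ a b → y a b ⊗ y a b ≡ n ⊗ (a ⊗ a ⊕ b ⊗ b) ⊕ ⊝ (x a b ⊗ x a b)
    identity a b = solve 4 (λ p r a b → (:- r :* a :+ p :* b) :* (:- r :* a :+ p :* b) := (p :* p :+ r :* r) :* (a :* a :+ b :* b) :+ :- ((p :* a :+ r :* b) :* (p :* a :+ r :* b))) refl m₁ m₂ a b
    to : ∀ a b → a ⊗ a ⊕ b ⊗ b ≡ τ → y a b ⊗ y a b ≡ n ⊗ τ ⊕ ⊝ (x a b ⊗ x a b)
    to a b e = trans (identity a b) (cong (λ t → n ⊗ t ⊕ ⊝ (x a b ⊗ x a b)) e)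
    from : ∀ a b → y a b ⊗ y a b ≡ n ⊗ τ ⊕ ⊝ (x a b ⊗ x a b) → a ⊗ a ⊕ b ⊗ b ≡ τ
    from a b e = ⊗-cancelˡ n≢0 (⊕-cancelˡ {⊝ (x a b ⊗ x a b)} (trans (+-comm _ _) (trans (sym (identity a b)) (trans e (+-comm _ _)))))

  -- With u = m₁a + m₂b and v = m₁a - m₂b the circle becomes the hyperbola uv = m₁²τ, which has one
  -- point over each u ≠ 0. Writing the condition as c² = 0 gives the kernel the form of
  -- `bounded-roots`.
  line-circle-isotropic : ∀ {m₁ m₂ τ} → m₁ ≢ 𝟘 → m₁ ⊗ m₁ ⊕ m₂ ⊗ m₂ ≡ 𝟘 → τ ≢ 𝟘 → ∀ c → line-circle m₁ m₂ τ c ≡ 1ℤ - ⟦ c ⊗ c ≟ 𝟘 ⟧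
  line-circle-isotropic {m₁} {m₂} {τ} m₁≢0 n≡0 τ≢0 c = begin
    line-circle m₁ m₂ τ c ≡⟨ ∑-cong elements (λ a → ∑-cong elements λ b → cong (⟦ m₁ ⊗ a ⊕ m₂ ⊗ b ≟ c ⟧ *_)
      (⟦⟧-cong (a ⊗ a ⊕ b ⊗ b ≟ τ) (u a b ⊗ v a b ≟ m₁ ⊗ m₁ ⊗ τ) (λ e → trans (identity a b) (cong (m₁ ⊗ m₁ ⊗_) e)) (λ e → ⊗-cancelˡ (⊗-≢0 m₁≢0 m₁≢0) (trans (sym (identity a b)) e)))) ⟩
    ∑ elements (λ a → ∑ elements (λ b → G (u a b) (v a b))) ≡⟨ ∑-linear m₁ m₂ m₁ (⊝ m₂) det≢0 G ⟩
    ∑ elements (λ u → ∑ elements (G u)) ≡⟨ trans (∑-cong elements λ u → ∑-* elements ⟦ u ≟ c ⟧ _) (∑-δ (λ u → ∑ elements (λ v → ⟦ u ⊗ v ≟ m₁ ⊗ m₁ ⊗ τ ⟧)) c) ⟩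
    ∑ elements (λ v → ⟦ c ⊗ v ≟ m₁ ⊗ m₁ ⊗ τ ⟧) ≡⟨ count (c ≟ 𝟘) ⟩
    1ℤ - ⟦ c ⊗ c ≟ 𝟘 ⟧ ∎
    where
    open ≡-Reasoning
    u v : Carrier → Carrier → Carrier
    u a b = m₁ ⊗ a ⊕ m₂ ⊗ b
    v a b = m₁ ⊗ a ⊕ ⊝ m₂ ⊗ b
    G : Carrier → Carrier → ℤ
    G u v = ⟦ u ≟ c ⟧ * ⟦ u ⊗ v ≟ m₁ ⊗ m₁ ⊗ τ ⟧
    m₂² : m₂ ⊗ m₂ ≡ ⊝ (m₁ ⊗ m₁)
    m₂² = ⊕-cancelˡ (trans n≡0 (sym (-‿inverseʳ _)))
    m₂≢0 : m₂ ≢ 𝟘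
    m₂≢0 e = ⊝-≢0 (⊗-≢0 m₁≢0 m₁≢0) (trans (sym m₂²) (trans (cong (_⊗ m₂) e) (zeroˡ m₂)))
    det≢0 : m₁ ⊗ ⊝ m₂ ⊕ ⊝ (m₂ ⊗ m₁) ≢ 𝟘
    det≢0 e = double-≢0 (⊝-≢0 (⊗-≢0 m₁≢0 m₂≢0)) (trans (solve 2 (λ p r → :- (p :* r) :+ :- (p :* r) := p :* :- r :+ :- (r :* p)) refl m₁ m₂) e)
    identity : ∀ a b → u a b ⊗ v a b ≡ m₁ ⊗ m₁ ⊗ (a ⊗ a ⊕ b ⊗ b)
    identity a b = trans (solve 4 (λ p r a b → (p :* a :+ r :* b) :* (p :* a :+ :- r :* b) := p :* p :* (a :* a) :+ :- (r :* r) :* (b :* b)) refl m₁ m₂ a b)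
      (trans (cong (λ w → m₁ ⊗ m₁ ⊗ (a ⊗ a) ⊕ ⊝ w ⊗ (b ⊗ b)) m₂²) (solve 3 (λ s a b → s :* a :+ :- :- s :* b := s :* (a :+ b)) refl (m₁ ⊗ m₁) (a ⊗ a) (b ⊗ b)))
    count : Dec (c ≡ 𝟘) → ∑ elements (λ v → ⟦ c ⊗ v ≟ m₁ ⊗ m₁ ⊗ τ ⟧) ≡ 1ℤ - ⟦ c ⊗ c ≟ 𝟘 ⟧
    count (yes p) = trans (∑-zero elements λ v → ⟦⟧-no (c ⊗ v ≟ m₁ ⊗ m₁ ⊗ τ) λ e → ⊗-≢0 (⊗-≢0 m₁≢0 m₁≢0) τ≢0 (trans (sym e) (trans (cong (_⊗ v) p) (zeroˡ v))))
      (sym (cong (_-_ 1ℤ) (⟦⟧-yes (c ⊗ c ≟ 𝟘) (trans (cong (_⊗ c) p) (zeroˡ c)))))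
    count (no p) = trans (∑-scale (λ v → ⟦ v ≟ m₁ ⊗ m₁ ⊗ τ ⟧) p) (trans (∑-δ1 _) (sym (cong (_-_ 1ℤ) (⟦⟧-no (c ⊗ c ≟ 𝟘) (⊗-≢0 p p)))))

  sphere : Carrier → ∀ {d} → Vec Carrier d → ℤ
  sphere t z = ⟦ dot z z ≟ t ⟧

  bounded-≤ : ∀ {κ Λ Λ′} → Λ ≤ Λ′ → Bounded κ Λ → Bounded κ Λ′
  bounded-≤ p B .bound f mean = ±-≤ (≤-*ʳ (⟪⟫≥0 f) p) (bound B f mean)

  circle-section : ∀ t m₁ m₂ c → push (pair m₁ m₂) (sphere t) c ≡ line-circle m₁ m₂ t c
  circle-section t m₁ m₂ c = trans (∑-2 _) (∑-cong elements λ a → ∑-cong elements λ b → cong₂ (λ x y → ⟦ x ≟ c ⟧ * ⟦ y ≟ t ⟧) (cong (m₁ ⊗ a ⊕_) (+-identityʳ _)) (cong (a ⊗ a ⊕_) (+-identityʳ _)))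

  isotropic-≢0 : ∀ {m₁ m₂} → pair m₁ m₂ ≢ 0ᵛ → m₁ ⊗ m₁ ⊕ m₂ ⊗ m₂ ≡ 𝟘 → m₁ ≢ 𝟘
  isotropic-≢0 {m₁} {m₂} m≢0 n≡0 refl = m≢0 (cong (pair 𝟘) (sq≡0⇒ (trans (sym (trans (cong (_⊕ m₂ ⊗ m₂) (zeroˡ 𝟘)) (+-identityˡ _))) n≡0)))

  circle-section≤2 : ∀ {t} → t ≢ 𝟘 → ∀ (m : Vec Carrier 2) → m ≢ 0ᵛ → ∀ c → push m (sphere t) c ≤ + 2
  circle-section≤2 {t} t≢0 (m₁ ∷ m₂ ∷ []) m≢0 c = ≤-trans (≤-reflexive (circle-section t m₁ m₂ c)) (by-cases (m₁ ⊗ m₁ ⊕ m₂ ⊗ m₂ ≟ 𝟘))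
    where
    lem : ∀ a → + 2 - (1ℤ - a) ≡ 1ℤ + a
    lem = solve-∀
    by-cases : Dec (m₁ ⊗ m₁ ⊕ m₂ ⊗ m₂ ≡ 𝟘) → line-circle m₁ m₂ t c ≤ + 2
    by-cases (no n≢0)  = ≤-trans (≤-reflexive (line-circle-anisotropic n≢0 t c)) (ρ≤2 _)
    by-cases (yes n≡0) = ≤-trans (≤-reflexive (line-circle-isotropic (isotropic-≢0 m≢0 n≡0) n≡0 t≢0 c)) (≤-via (lem ⟦ c ⊗ c ≟ 𝟘 ⟧) (0≤+ (0≤n {1}) (⟦⟧≥0 (c ⊗ c ≟ 𝟘))))

  bounded-circle-projection : ∀ Λ → + 2 ≤ Λ → + 4 * q ≤ Λ * Λ → ∀ {t} → t ≢ 𝟘 →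
    ∀ (m : Vec Carrier 2) → m ≢ 0ᵛ → Bounded (push m (sphere t)) Λ
  bounded-circle-projection Λ 2≤Λ 4q≤Λ² {t} t≢0 (m₁ ∷ m₂ ∷ []) m≢0 = bounded-cong (circle-section t m₁ m₂) (by-cases (m₁ ⊗ m₁ ⊕ m₂ ⊗ m₂ ≟ 𝟘))
    where
    by-cases : Dec (m₁ ⊗ m₁ ⊕ m₂ ⊗ m₂ ≡ 𝟘) → Bounded (line-circle m₁ m₂ t) Λ
    by-cases (no n≢0) = bounded-cong (line-circle-anisotropic n≢0 t) (bounded-circle Λ (≤-trans 0≤n 2≤Λ) 4q≤Λ² (⊗-≢0 n≢0 t≢0))
    by-cases (yes n≡0) = bounded-affine 1ℤ (λ c → trans (line-circle-isotropic (isotropic-≢0 m≢0 n≡0) n≡0 t≢0 c) (lem ⟦ c ⊗ c ≟ 𝟘 ⟧))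
        (bounded-≤ 2≤Λ (bounded-scale {b = 1ℤ} (- 1ℤ) (ℤ.-≤+ , ≤-refl) (bounded-roots 𝟘)))
      where
      lem : ∀ a → 1ℤ - a ≡ 1ℤ + - 1ℤ * a
      lem = solve-∀

-- Plane sections of spheres in dimension 3

module Spheres (F : FiniteField) (2≢0 : FiniteField._+_ F (FiniteField.1# F) (FiniteField.1# F) ≢ FiniteField.0# F) where
  open Field F
  open Odd 2≢0
  open Geometry F
  open Convolution F 2≢0
  open Radon F 2≢0
  open Conics F 2≢0

  private
    bounded-split : ∀ {κ} A B τ → B ∈± q → (∀ c → κ c ≡ A + B * ⟦ c ⊗ c ≟ τ ⟧) → Bounded κ (q * + 2)
    bounded-split A B τ B± e = bounded-affine A e (bounded-scale B B± (bounded-roots τ))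

    section : Carrier → Carrier → Carrier → Carrier → Carrier → ℤ
    section m₁ m₂ m₃ t c = ∑ elements (λ a → ∑ elements (λ b → ∑ elements (λ r → ⟦ m₁ ⊗ a ⊕ (m₂ ⊗ b ⊕ m₃ ⊗ r) ≟ c ⟧ * ⟦ a ⊗ a ⊕ (b ⊗ b ⊕ r ⊗ r) ≟ t ⟧)))

    section-swap : ∀ m₁ m₂ m₃ t c → section m₁ m₂ m₃ t c ≡ section m₁ m₃ m₂ t c
    section-swap m₁ m₂ m₃ t c = ∑-cong elements λ a → trans (∑-swap elements elements _)
      (∑-cong elements λ r → ∑-cong elements λ b → cong₂ (λ x y → ⟦ m₁ ⊗ a ⊕ x ≟ c ⟧ * ⟦ a ⊗ a ⊕ y ≟ t ⟧) (+-comm _ _) (+-comm _ _))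

    section-rotate : ∀ m₁ m₂ m₃ t c → section m₁ m₂ m₃ t c ≡ section m₂ m₁ m₃ t c
    section-rotate m₁ m₂ m₃ t c = trans (∑-swap elements elements _)
      (∑-cong elements λ b → ∑-cong elements λ a → ∑-cong elements λ r → cong₂ (λ x y → ⟦ x ≟ c ⟧ * ⟦ y ≟ t ⟧) (swap₃ _ _ _) (swap₃ _ _ _))
      where swap₃ : ∀ x y z → x ⊕ (y ⊕ z) ≡ y ⊕ (x ⊕ z)
            swap₃ = solve 3 (λ x y z → x :+ (y :+ z) := y :+ (x :+ z)) refl

    module _ {m₁ m₂ : Carrier} (m₃ t : Carrier) (n≢0 : m₁ ⊗ m₁ ⊕ m₂ ⊗ m₂ ≢ 𝟘) where
      n = m₁ ⊗ m₁ ⊕ m₂ ⊗ m₂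
      M = n ⊕ m₃ ⊗ m₃

      quadratic : Carrier → Carrier → Carrier
      quadratic c r = n ⊗ (t ⊕ ⊝ (r ⊗ r)) ⊕ ⊝ ((c ⊕ ⊝ (m₃ ⊗ r)) ⊗ (c ⊕ ⊝ (m₃ ⊗ r)))

      as-quadratic : ∀ c → section m₁ m₂ m₃ t c ≡ ∑ elements (λ r → ρ (quadratic c r))
      as-quadratic c = begin
        section m₁ m₂ m₃ t c ≡⟨ ∑-cong elements (λ a → ∑-swap elements elements _) ⟩
        ∑ elements (λ a → ∑ elements (λ r → ∑ elements (λ b → ⟦ m₁ ⊗ a ⊕ (m₂ ⊗ b ⊕ m₃ ⊗ r) ≟ c ⟧ * ⟦ a ⊗ a ⊕ (b ⊗ b ⊕ r ⊗ r) ≟ t ⟧))) ≡⟨ ∑-swap elements elements _ ⟩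
        ∑ elements (λ r → ∑ elements (λ a → ∑ elements (λ b → ⟦ m₁ ⊗ a ⊕ (m₂ ⊗ b ⊕ m₃ ⊗ r) ≟ c ⟧ * ⟦ a ⊗ a ⊕ (b ⊗ b ⊕ r ⊗ r) ≟ t ⟧)))
          ≡⟨ ∑-cong elements (λ r → ∑-cong elements λ a → ∑-cong elements λ b → cong₂ _*_ (move (m₁ ⊗ a) (m₂ ⊗ b) (m₃ ⊗ r) c) (move (a ⊗ a) (b ⊗ b) (r ⊗ r) t)) ⟩
        ∑ elements (λ r → line-circle m₁ m₂ (t ⊕ ⊝ (r ⊗ r)) (c ⊕ ⊝ (m₃ ⊗ r))) ≡⟨ ∑-cong elements (λ r → line-circle-anisotropic n≢0 (t ⊕ ⊝ (r ⊗ r)) (c ⊕ ⊝ (m₃ ⊗ r))) ⟩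
        ∑ elements (λ r → ρ (quadratic c r)) ∎
        where
        open ≡-Reasoning
        move : ∀ x y z w → ⟦ x ⊕ (y ⊕ z) ≟ w ⟧ ≡ ⟦ x ⊕ y ≟ w ⊕ ⊝ z ⟧
        move x y z w = ⟦⟧-cong (x ⊕ (y ⊕ z) ≟ w) (x ⊕ y ≟ w ⊕ ⊝ z)
          (λ e → trans (solve 3 (λ x y z → x :+ y := x :+ (y :+ z) :+ :- z) refl x y z) (cong (_⊕ ⊝ z) e))
          (λ e → trans (sym (+-assoc x y z)) (trans (cong (_⊕ z) e) (solve 2 (λ w z → w :+ :- z :+ z := w) refl w z)))

      -- Completing the square turns the section into the conic (Mr - cm₃)² + My² = n(Mt - c²),
      -- whose size depends only on whether the right side vanishes.
      section-elliptic : (M≢0 : M ≢ 𝟘) → ∀ c → section m₁ m₂ m₃ t c ≡ γ M≢0 𝟙 + (γ M≢0 𝟘 - γ M≢0 𝟙) * ⟦ c ⊗ c ≟ M ⊗ t ⟧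
      section-elliptic M≢0 c = begin
        section m₁ m₂ m₃ t c ≡⟨ as-quadratic c ⟩
        ∑ elements (λ r → ρ (quadratic c r)) ≡⟨ ∑-cong elements (λ r → ∑-cong elements λ y → ⟦⟧-cong (y ⊗ y ≟ quadratic c r) ((M ⊗ r ⊕ ⊝ (c ⊗ m₃)) ⊗ (M ⊗ r ⊕ ⊝ (c ⊗ m₃)) ⊕ M ⊗ (y ⊗ y) ≟ n ⊗ (M ⊗ t ⊕ ⊝ (c ⊗ c)))
            (λ e → trans (cong (λ w → (M ⊗ r ⊕ ⊝ (c ⊗ m₃)) ⊗ (M ⊗ r ⊕ ⊝ (c ⊗ m₃)) ⊕ M ⊗ w) e) (identity r))
            (λ e → ⊗-cancelˡ M≢0 (⊕-cancelˡ (trans e (sym (identity r)))))) ⟩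
        ∑ elements (λ r → ∑ elements (λ y → ⟦ (M ⊗ r ⊕ ⊝ (c ⊗ m₃)) ⊗ (M ⊗ r ⊕ ⊝ (c ⊗ m₃)) ⊕ M ⊗ (y ⊗ y) ≟ a ⟧))
          ≡⟨ trans (∑-scale (λ r → ∑ elements (λ y → ⟦ (r ⊕ ⊝ (c ⊗ m₃)) ⊗ (r ⊕ ⊝ (c ⊗ m₃)) ⊕ M ⊗ (y ⊗ y) ≟ a ⟧)) M≢0) (∑-shift (λ r → ∑ elements (λ y → ⟦ r ⊗ r ⊕ M ⊗ (y ⊗ y) ≟ a ⟧)) (⊝ (c ⊗ m₃))) ⟩
        γ M≢0 a ≡⟨ γ-split M≢0 a ⟩
        γ M≢0 𝟙 + (γ M≢0 𝟘 - γ M≢0 𝟙) * ⟦ a ≟ 𝟘 ⟧ ≡⟨ cong (λ b → γ M≢0 𝟙 + (γ M≢0 𝟘 - γ M≢0 𝟙) * b) (⟦⟧-cong (a ≟ 𝟘) (c ⊗ c ≟ M ⊗ t) (λ e → sym (⊟≡0⇒≡ (domain e n≢0))) (λ e → trans (cong (n ⊗_) (≡⇒⊟≡0 (sym e))) (zeroʳ n))) ⟩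
        γ M≢0 𝟙 + (γ M≢0 𝟘 - γ M≢0 𝟙) * ⟦ c ⊗ c ≟ M ⊗ t ⟧ ∎
        where
        open ≡-Reasoning
        a = n ⊗ (M ⊗ t ⊕ ⊝ (c ⊗ c))
        identity : ∀ r → (M ⊗ r ⊕ ⊝ (c ⊗ m₃)) ⊗ (M ⊗ r ⊕ ⊝ (c ⊗ m₃)) ⊕ M ⊗ quadratic c r ≡ a
        identity r = solve 5 (λ n m t c r → ((n :+ m :* m) :* r :+ :- (c :* m)) :* ((n :+ m :* m) :* r :+ :- (c :* m)) :+ (n :+ m :* m) :* (n :* (t :+ :- (r :* r)) :+ :- ((c :+ :- (m :* r)) :* (c :+ :- (m :* r))))
          := n :* ((n :+ m :* m) :* t :+ :- (c :* c))) refl n m₃ t c r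

      -- If the normal vector is isotropic, the terms r² cancel and the argument of ρ is linear in r
      -- with slope 2cm₃. For c ≠ 0 it runs through the whole field; for c = 0 it is constant.
      section-parabolic : M ≡ 𝟘 → ∀ c → section m₁ m₂ m₃ t c ≡ q + q * (ρ (n ⊗ t) - 1ℤ) * ⟦ c ⊗ c ≟ 𝟘 ⟧
      section-parabolic M≡0 c = trans (as-quadratic c) (trans (∑-cong elements λ r → cong ρ (linear r)) (by-cases (c ≟ 𝟘)))
        where
        m₃≢0 : m₃ ≢ 𝟘
        m₃≢0 e = n≢0 (trans (sym (+-identityʳ n)) (trans (cong (n ⊕_) (sym (trans (cong (_⊗ m₃) e) (zeroˡ m₃)))) M≡0))
        linear : ∀ r → quadratic c r ≡ (c ⊗ m₃ ⊕ c ⊗ m₃) ⊗ r ⊕ (n ⊗ t ⊕ ⊝ (c ⊗ c))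
        linear r = trans (solve 5 (λ n m t c r → n :* (t :+ :- (r :* r)) :+ :- ((c :+ :- (m :* r)) :* (c :+ :- (m :* r))) := (c :* m :+ c :* m) :* r :+ (n :* t :+ :- (c :* c)) :+ :- ((n :+ m :* m) :* (r :* r))) refl n m₃ t c r)
          (trans (cong (λ w → (c ⊗ m₃ ⊕ c ⊗ m₃) ⊗ r ⊕ (n ⊗ t ⊕ ⊝ (c ⊗ c)) ⊕ ⊝ (w ⊗ (r ⊗ r))) M≡0) (solve 2 (λ a x → a :+ :- (con 0ℤ :* x) := a) refl _ (r ⊗ r)))
        by-cases : Dec (c ≡ 𝟘) → ∑ elements (λ r → ρ ((c ⊗ m₃ ⊕ c ⊗ m₃) ⊗ r ⊕ (n ⊗ t ⊕ ⊝ (c ⊗ c)))) ≡ q + q * (ρ (n ⊗ t) - 1ℤ) * ⟦ c ⊗ c ≟ 𝟘 ⟧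
        by-cases (yes refl) = trans (∑-cong elements λ r → cong ρ (solve 3 (λ m r x → (con 0ℤ :* m :+ con 0ℤ :* m) :* r :+ (x :+ :- (con 0ℤ :* con 0ℤ)) := x) refl m₃ r (n ⊗ t)))
          (trans (∑-const elements (ρ (n ⊗ t))) (trans (lem q (ρ (n ⊗ t))) (cong (λ b → q + q * (ρ (n ⊗ t) - 1ℤ) * b) (sym (⟦⟧-yes (𝟘 ⊗ 𝟘 ≟ 𝟘) (zeroˡ 𝟘))))))
          where lem : ∀ q a → q * a ≡ q + q * (a - 1ℤ) * 1ℤ
                lem = solve-∀
        by-cases (no c≢0) = trans (∑-scale (λ r → ρ (r ⊕ (n ⊗ t ⊕ ⊝ (c ⊗ c)))) (double-≢0 (⊗-≢0 c≢0 m₃≢0))) (trans (∑-shift ρ _) (trans ∑ρ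
          (trans (lem q (q * (ρ (n ⊗ t) - 1ℤ))) (cong (λ b → q + q * (ρ (n ⊗ t) - 1ℤ) * b) (sym (⟦⟧-no (c ⊗ c ≟ 𝟘) (⊗-≢0 c≢0 c≢0)))))))
          where lem : ∀ q a → q ≡ q + a * 0ℤ
                lem = solve-∀

      bounded-section : Bounded (section m₁ m₂ m₃ t) (q * + 2)
      bounded-section = by-cases (M ≟ 𝟘)
        where
        by-cases : Dec (M ≡ 𝟘) → Bounded (section m₁ m₂ m₃ t) (q * + 2)
        by-cases (no M≢0) = bounded-split (γ M≢0 𝟙) (γ M≢0 𝟘 - γ M≢0 𝟙) (M ⊗ t) (γ-gap M≢0) (section-elliptic M≢0)
        by-cases (yes M≡0) = bounded-split q (q * (ρ (n ⊗ t) - 1ℤ)) 𝟘 (≤-via (lem q (ρ (n ⊗ t))) (0≤* (0≤n {card}) (diff≥0 (ρ≤2 (n ⊗ t)))) , ≤-via (lem′ q (ρ (n ⊗ t))) (0≤* (0≤n {card}) (ρ≥0 (n ⊗ t)))) (section-parabolic M≡0)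
          where
          lem : ∀ q a → q - q * (a - 1ℤ) ≡ q * (+ 2 - a)
          lem = solve-∀
          lem′ : ∀ q a → q - - (q * (a - 1ℤ)) ≡ q * a
          lem′ = solve-∀

  -- Two of the three coordinates can be chosen with nonzero sum of squares: if all three such sums
  -- vanished, then 2m₁² = 0 and m would be 0. No condition is put on the radius t, since the
  -- slicing in `edges₃` produces all radii.
  bounded-sphere-projection : ∀ t (m : Vec Carrier 3) → m ≢ 0ᵛ → Bounded (push m (sphere t)) (q * + 2)
  bounded-sphere-projection t (m₁ ∷ m₂ ∷ m₃ ∷ []) m≢0 = bounded-cong as-section (by-cases (m₁ ⊗ m₁ ⊕ m₂ ⊗ m₂ ≟ 𝟘) (m₁ ⊗ m₁ ⊕ m₃ ⊗ m₃ ≟ 𝟘) (m₂ ⊗ m₂ ⊕ m₃ ⊗ m₃ ≟ 𝟘))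
    where
    as-section : ∀ c → push (m₁ ∷ m₂ ∷ m₃ ∷ []) (sphere t) c ≡ section m₁ m₂ m₃ t c
    as-section c = trans (∑-3 _) (∑-cong elements λ a → ∑-cong elements λ b → ∑-cong elements λ r →
      cong₂ (λ x y → ⟦ x ≟ c ⟧ * ⟦ y ≟ t ⟧) (cong (λ z → m₁ ⊗ a ⊕ (m₂ ⊗ b ⊕ z)) (+-identityʳ _)) (cong (λ z → a ⊗ a ⊕ (b ⊗ b ⊕ z)) (+-identityʳ _)))
    by-cases : Dec (m₁ ⊗ m₁ ⊕ m₂ ⊗ m₂ ≡ 𝟘) → Dec (m₁ ⊗ m₁ ⊕ m₃ ⊗ m₃ ≡ 𝟘) → Dec (m₂ ⊗ m₂ ⊕ m₃ ⊗ m₃ ≡ 𝟘) → Bounded (section m₁ m₂ m₃ t) (q * + 2)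
    by-cases (no p) _ _ = bounded-section m₃ t p
    by-cases (yes _) (no p) _ = bounded-cong (section-swap m₁ m₂ m₃ t) (bounded-section m₂ t p)
    by-cases (yes _) (yes _) (no p) = bounded-cong (λ c → trans (section-rotate m₁ m₂ m₃ t c) (section-swap m₂ m₁ m₃ t c)) (bounded-section m₁ t p)
    by-cases (yes p) (yes r) (yes s) = contradiction (cong₂ (λ x v → x ∷ v) m₁≡0 (cong₂ pair (other p) (other r))) m≢0
      where
      m₁≡0 : m₁ ≡ 𝟘
      m₁≡0 = sq≡0⇒ (by-contra (m₁ ⊗ m₁ ≟ 𝟘))
        where
        twice : m₁ ⊗ m₁ ⊕ m₁ ⊗ m₁ ≡ 𝟘
        twice = trans (solve 3 (λ a b c → a :+ a := (a :+ b) :+ (a :+ c) :+ :- (b :+ c)) refl (m₁ ⊗ m₁) (m₂ ⊗ m₂) (m₃ ⊗ m₃))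
          (trans (cong₂ (λ x y → x ⊕ ⊝ y) (trans (cong₂ _⊕_ p r) (+-identityˡ 𝟘)) s) (-‿inverseʳ 𝟘))
        by-contra : Dec (m₁ ⊗ m₁ ≡ 𝟘) → m₁ ⊗ m₁ ≡ 𝟘
        by-contra (yes e) = e
        by-contra (no ne) = contradiction twice (double-≢0 ne)
      other : ∀ {x} → m₁ ⊗ m₁ ⊕ x ⊗ x ≡ 𝟘 → x ≡ 𝟘
      other {x} e = sq≡0⇒ (trans (sym (trans (cong (λ z → z ⊗ z ⊕ x ⊗ x) m₁≡0) (trans (cong (_⊕ x ⊗ x) (zeroˡ 𝟘)) (+-identityˡ _)))) e)

  private
    1≢0 : 𝟙 ≢ 𝟘
    1≢0 e = 0≢1 (sym e)

  circle-size : ∀ t → ∑ (allPoints 2) (sphere t) ≡ γ 1≢0 t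
  circle-size t = trans (∑-2 _) (∑-cong elements λ a → ∑-cong elements λ b → cong (λ z → ⟦ a ⊗ a ⊕ z ≟ t ⟧) (trans (+-identityʳ _) (sym (*-identityˡ _))))

  circle-size≥ : ∀ {t} → t ≢ 𝟘 → q - 1ℤ ≤ ∑ (allPoints 2) (sphere t)
  circle-size≥ {t} t≢0 = ≤-trans (γ1≥ 1≢0) (≤-reflexive (sym (trans (circle-size t) (γ-scale 1≢0 t≢0))))

  circle-size≤ : ∀ t → ∑ (allPoints 2) (sphere t) ≤ + 2 * q
  circle-size≤ t = ≤-trans (≤-reflexive (circle-size t)) (γ≤2q 1≢0 t)

  -- Cut along the first coordinate a: each a with a² ≠ t leaves a circle of nonzero radius with at
  -- least q - 1 points, and at most two values of a are lost.
  sphere-size≥ : ∀ t → (q - 1ℤ) * (q - + 2) ≤ ∑ (allPoints 3) (sphere t)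
  sphere-size≥ t = begin
    (q - 1ℤ) * (q - + 2) ≤⟨ ≤-*ˡ q-1≥0 (≤-via (lem q (ρ t)) (diff≥0 (ρ≤2 t))) ⟩
    (q - 1ℤ) * (q - ρ t) ≡⟨ cong ((q - 1ℤ) *_) (sym (trans (∑-- elements (λ _ → 1ℤ) _) (cong (_- ρ t) (trans (∑-const elements 1ℤ) (ℤₚ.*-identityʳ q))))) ⟩
    (q - 1ℤ) * ∑ elements (λ a → 1ℤ - ⟦ a ⊗ a ≟ t ⟧) ≡⟨ sym (∑-* elements (q - 1ℤ) _) ⟩
    ∑ elements (λ a → (q - 1ℤ) * (1ℤ - ⟦ a ⊗ a ≟ t ⟧)) ≤⟨ ∑-mono elements (λ a → below a (a ⊗ a ≟ t)) ⟩
    ∑ elements (λ a → γ 1≢0 (t ⊕ ⊝ (a ⊗ a))) ≡⟨ sym (trans (∑-3 _) (∑-cong elements λ a → ∑-cong elements λ b → ∑-cong elements λ r → move a b r)) ⟩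
    ∑ (allPoints 3) (sphere t) ∎
    where
    open ℤₚ.≤-Reasoning
    q-1≥0 : 0ℤ ≤ q - 1ℤ
    q-1≥0 = diff≥0 {1ℤ} {q} (ℤ.+≤+ (ℕₚ.≤-trans (ℕₚ.n≤1+n 1) card>1))
    lem : ∀ q a → q - a - (q - + 2) ≡ + 2 - a
    lem = solve-∀
    below : ∀ a (d : Dec (a ⊗ a ≡ t)) → (q - 1ℤ) * (1ℤ - ⟦ d ⟧) ≤ γ 1≢0 (t ⊕ ⊝ (a ⊗ a))
    below a (yes _) = ≤-trans (≤-reflexive (ℤₚ.*-zeroʳ (q - 1ℤ))) (γ≥0 1≢0 _)
    below a (no p) = ≤-trans (≤-reflexive (ℤₚ.*-identityʳ (q - 1ℤ))) (≤-trans (γ1≥ 1≢0) (≤-reflexive (sym (γ-scale 1≢0 λ e → p (sym (⊟≡0⇒≡ e))))))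
    move : ∀ a b r → sphere t (a ∷ b ∷ r ∷ []) ≡ ⟦ b ⊗ b ⊕ 𝟙 ⊗ (r ⊗ r) ≟ t ⊕ ⊝ (a ⊗ a) ⟧
    move a b r = ⟦⟧-cong _ (b ⊗ b ⊕ 𝟙 ⊗ (r ⊗ r) ≟ t ⊕ ⊝ (a ⊗ a))
      (λ e → trans (cong (b ⊗ b ⊕_) (*-identityˡ _)) (trans (solve 3 (λ a b r → b :+ r := a :+ (b :+ (r :+ con 0ℤ)) :+ :- a) refl (a ⊗ a) (b ⊗ b) (r ⊗ r)) (cong (_⊕ ⊝ (a ⊗ a)) e)))
      (λ e → trans (cong (λ z → a ⊗ a ⊕ (b ⊗ b ⊕ z)) (trans (+-identityʳ _) (sym (*-identityˡ _)))) (trans (cong (a ⊗ a ⊕_) e) (solve 2 (λ a t → a :+ (t :+ :- a) := t) refl (a ⊗ a) t)))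

-- Counting pairs at distance t

module Mixing (F : FiniteField) (2≢0 : FiniteField._+_ F (FiniteField.1# F) (FiniteField.1# F) ≢ FiniteField.0# F) where
  open Field F
  open Geometry F
  open Radon F 2≢0
  open Conics F 2≢0 using (sphere; bounded-circle-projection)
  open Spheres F 2≢0

  private variable d : ℕ

  q^≥0 : ∀ d → 0ℤ ≤ q ℤ.^ d
  q^≥0 zero    = 0≤n
  q^≥0 (suc d) = 0≤* (0≤n {card}) (q^≥0 d)

  private
    form-linˡ : ∀ (k : Vec Carrier d → ℤ) a b f g h → form k (λ x → a * f x + b * g x) h ≡ a * form k f h + b * form k g h
    form-linˡ {d} k a b f g h = trans (∑-cong (allPoints d) λ x → lem a b (f x) (g x) (∑ (allPoints d) (λ z → k z * h (z +[ 𝟙 ] x))))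
      (trans (∑-+ (allPoints d) _ _) (cong₂ _+_ (∑-* (allPoints d) a _) (∑-* (allPoints d) b _)))
      where lem : ∀ a b f g s → (a * f + b * g) * s ≡ a * (f * s) + b * (g * s)
            lem = solve-∀

    form-linʳ : ∀ (k : Vec Carrier d → ℤ) a b f g h → form k h (λ x → a * f x + b * g x) ≡ a * form k h f + b * form k h g
    form-linʳ {d} k a b f g h = trans (∑-cong (allPoints d) λ x → trans (cong (h x *_) (trans (∑-cong (allPoints d) λ z → lem (k z) a b (f (z +[ 𝟙 ] x)) (g (z +[ 𝟙 ] x)))
        (trans (∑-+ (allPoints d) _ _) (cong₂ _+_ (∑-* (allPoints d) a _) (∑-* (allPoints d) b _))))) (lem (h x) a b _ _))
      (trans (∑-+ (allPoints d) _ _) (cong₂ _+_ (∑-* (allPoints d) a _) (∑-* (allPoints d) b _)))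
      where lem : ∀ k a b f g → k * (a * f + b * g) ≡ a * (k * f) + b * (k * g)
            lem = solve-∀

    inner-lin : ∀ a b (f g : Vec Carrier d → ℤ) → inner (λ x → a * f x + b * g x) (λ x → a * f x + b * g x) ≡ a * a * inner f f + + 2 * a * b * inner f g + b * b * inner g g
    inner-lin {d} a b f g = trans (∑-cong (allPoints d) λ x → lem a b (f x) (g x))
      (trans (∑-+ (allPoints d) _ _) (cong₂ _+_ (trans (∑-+ (allPoints d) _ _) (cong₂ _+_ (∑-* (allPoints d) (a * a) _) (∑-* (allPoints d) (+ 2 * a * b) _))) (∑-* (allPoints d) (b * b) _)))
      where lem : ∀ a b f g → (a * f + b * g) * (a * f + b * g) ≡ a * a * (f * f) + + 2 * a * b * (f * g) + b * b * (g * g)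
            lem = solve-∀

    +ᵛ-comm : ∀ (x y : Vec Carrier d) → x +[ 𝟙 ] y ≡ y +[ 𝟙 ] x
    +ᵛ-comm []      []      = refl
    +ᵛ-comm (a ∷ x) (b ∷ y) = cong₂ _∷_ (trans (cong (a ⊕_) (*-identityˡ b)) (trans (+-comm a b) (cong (b ⊕_) (sym (*-identityˡ a))))) (+ᵛ-comm x y)

    one : Vec Carrier d → ℤ
    one _ = 1ℤ

  module _ (k : Vec Carrier d → ℤ) (Λ : ℤ) (Λ≥0 : 0ℤ ≤ Λ) (B : ∀ f → ∑ (allPoints d) f ≡ 0ℤ → form k f f ∈± Λ * inner f f) where
    private
      pts = allPoints d
      N σ : ℤ
      N = q ℤ.^ d
      σ = ∑ pts k

      size-one : ∑ pts one ≡ N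
      size-one = trans (∑-vecs-const d elements 1ℤ) (ℤₚ.*-identityʳ N)

      form-one-one : form k one one ≡ N * σ
      form-one-one = trans (∑-cong pts λ x → trans (ℤₚ.*-identityˡ _) (∑-cong pts λ z → ℤₚ.*-identityʳ (k z))) (∑-vecs-const d elements σ)

      form-·-one : ∀ e → form k e one ≡ ∑ pts e * σ
      form-·-one e = trans (∑-cong pts λ x → cong (e x *_) (∑-cong pts λ z → ℤₚ.*-identityʳ (k z))) (∑-*ʳ pts e σ)

      form-one-· : ∀ e → form k one e ≡ ∑ pts e * σ
      form-one-· e = trans (∑-cong pts λ x → ℤₚ.*-identityˡ _) (trans (∑-swap pts pts _) (trans (∑-cong pts λ z → trans (∑-* pts (k z) _)
        (cong (k z *_) (trans (∑-cong pts λ x → cong e (+ᵛ-comm z x)) (∑-translate e 𝟙 z)))) (trans (∑-*ʳ pts k (∑ pts e)) (ℤₚ.*-comm σ (∑ pts e)))))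

      -- The deviation of e from its mean, multiplied by the number N of points to stay within the
      -- integers.
      centre : (Vec Carrier d → ℤ) → Vec Carrier d → ℤ
      centre e x = N * e x + - ∑ pts e * one x

      centre-mean : ∀ e → ∑ pts (centre e) ≡ 0ℤ
      centre-mean e = trans (∑-+ pts _ _) (trans (cong₂ _+_ (∑-* pts N e) (trans (∑-* pts (- ∑ pts e) one) (cong (- ∑ pts e *_) size-one))) (lem N (∑ pts e)))
        where lem : ∀ N n → N * n + - n * N ≡ 0ℤ
              lem = solve-∀

      form-centre : ∀ e e′ → form k (centre e) (centre e′) ≡ N * N * form k e e′ - N * σ * (∑ pts e * ∑ pts e′)
      form-centre e e′ = begin
        form k (centre e) (centre e′) ≡⟨ form-linˡ k N (- n) e one (centre e′) ⟩
        N * form k e (centre e′) + - n * form k one (centre e′) ≡⟨ cong₂ (λ a b → N * a + - n * b) (form-linʳ k N (- n′) e′ one e) (form-linʳ k N (- n′) e′ one one) ⟩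
        N * (N * form k e e′ + - n′ * form k e one) + - n * (N * form k one e′ + - n′ * form k one one)
          ≡⟨ cong₂ (λ a b → N * (N * form k e e′ + - n′ * a) + - n * b) (form-·-one e) (cong₂ (λ a b → N * a + - n′ * b) (form-one-· e′) form-one-one) ⟩
        N * (N * form k e e′ + - n′ * (n * σ)) + - n * (N * (n′ * σ) + - n′ * (N * σ)) ≡⟨ lem N (form k e e′) n n′ σ ⟩
        N * N * form k e e′ - N * σ * (n * n′) ∎
        where
        open ≡-Reasoning
        n = ∑ pts e
        n′ = ∑ pts e′
        lem : ∀ N f n m s → N * (N * f + - m * (n * s)) + - n * (N * (m * s) + - m * (N * s)) ≡ N * N * f - N * s * (n * m)
        lem = solve-∀

      inner-centre : ∀ e → (∀ x → e x * e x ≡ e x) → inner (centre e) (centre e) ≤ N * N * ∑ pts e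
      inner-centre e e² = ≤-via (trans (cong (_-_ (N * N * n)) (trans (inner-lin N (- n) e one)
          (cong₂ (λ a b → a + n′ * b) (cong₂ (λ a b → N * N * a + + 2 * N * - n * b) (∑-cong pts e²) (∑-cong pts λ x → ℤₚ.*-identityʳ (e x))) size-one))) (lem N n))
          (0≤* (q^≥0 d) (0≤sq n))
        where
        n = ∑ pts e
        n′ = - n * - n
        lem : ∀ N n → N * N * n - (N * N * n + + 2 * N * - n * n + - n * - n * N) ≡ N * (n * n)
        lem = solve-∀

      -- Polarization of the bounds for f + g and f − g.
      polar : ∀ f g → ∑ pts f ≡ 0ℤ → ∑ pts g ≡ 0ℤ → - (form k f g + form k g f) ≤ Λ * (inner f f + inner g g)
      polar f g f₀ g₀ = *-cancel-≤ {c = + 2} (ℤ.+<+ (ℕ.s≤s ℕ.z≤n)) (≤-via certificate (0≤+ (diff≥0 (_∈±_.lower (B plus plus₀))) (diff≥0 (_∈±_.upper (B minus minus₀)))))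
        where
        plus minus : Vec Carrier d → ℤ
        plus x = 1ℤ * f x + 1ℤ * g x
        minus x = 1ℤ * f x + - 1ℤ * g x
        sum₀ : ∀ b → ∑ pts (λ x → 1ℤ * f x + b * g x) ≡ 0ℤ
        sum₀ b = trans (∑-+ pts _ _) (trans (cong₂ _+_ (trans (∑-* pts 1ℤ f) (cong (1ℤ *_) f₀)) (trans (∑-* pts b g) (cong (b *_) g₀))) (trans (ℤₚ.+-identityˡ _) (ℤₚ.*-zeroʳ b)))
        plus₀ = sum₀ 1ℤ
        minus₀ = sum₀ (- 1ℤ)
        expand : ∀ b → form k (λ x → 1ℤ * f x + b * g x) (λ x → 1ℤ * f x + b * g x) ≡ 1ℤ * (1ℤ * form k f f + b * form k f g) + b * (1ℤ * form k g f + b * form k g g)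
        expand b = trans (form-linˡ k 1ℤ b f g (λ x → 1ℤ * f x + b * g x)) (cong₂ (λ x y → 1ℤ * x + b * y) (form-linʳ k 1ℤ b f g f) (form-linʳ k 1ℤ b f g g))
        lem : ∀ L ff fg gf gg iff ifg igg → + 2 * (L * (iff + igg)) - + 2 * - (fg + gf) ≡
          L * (1ℤ * 1ℤ * iff + + 2 * 1ℤ * 1ℤ * ifg + 1ℤ * 1ℤ * igg) - - (1ℤ * (1ℤ * ff + 1ℤ * fg) + 1ℤ * (1ℤ * gf + 1ℤ * gg)) +
          (L * (1ℤ * 1ℤ * iff + + 2 * 1ℤ * - 1ℤ * ifg + - 1ℤ * - 1ℤ * igg) - (1ℤ * (1ℤ * ff + - 1ℤ * fg) + - 1ℤ * (1ℤ * gf + - 1ℤ * gg)))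
        lem = solve-∀
        certificate : + 2 * (Λ * (inner f f + inner g g)) - + 2 * - (form k f g + form k g f) ≡
          Λ * inner plus plus - - form k plus plus + (Λ * inner minus minus - form k minus minus)
        certificate = trans (lem Λ (form k f f) (form k f g) (form k g f) (form k g g) (inner f f) (inner f g) (inner g g))
          (sym (cong₂ _+_ (cong₂ (λ a b → Λ * a - - b) (inner-lin 1ℤ 1ℤ f g) (expand 1ℤ)) (cong₂ (λ a b → Λ * a - b) (inner-lin 1ℤ (- 1ℤ) f g) (expand (- 1ℤ)))))

    -- The expander mixing lemma. Polarization yields the error (n + n′)/2 in place of √(nn′), so no
    -- roots occur; both orders of e and e′ appear because k is an arbitrary kernel.
    mixing : ∀ e e′ → (∀ x → e x * e x ≡ e x) → (∀ x → e′ x * e′ x ≡ e′ x) →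
      + 2 * σ * (∑ pts e * ∑ pts e′) - Λ * N * (∑ pts e + ∑ pts e′) ≤ N * (form k e e′ + form k e′ e)
    mixing e e′ e² e′² = *-cancel-≤ N>0 (≤-via (trans (lem N σ (form k e e′) (form k e′ e) n n′ Λ) (cong (_+_ (Λ * (N * N * n + N * N * n′))) (sym (cong₂ _+_ (form-centre e e′) (form-centre e′ e)))))
      (≤-trans (diff≥0 (polar (centre e) (centre e′) (centre-mean e) (centre-mean e′)))
        (≤-via (lem′ Λ (inner (centre e) (centre e) + inner (centre e′) (centre e′)) (N * N * n + N * N * n′) (form k (centre e) (centre e′) + form k (centre e′) (centre e)))
          (0≤* Λ≥0 (diff≥0 (ℤₚ.+-mono-≤ (inner-centre e e²) (inner-centre e′ e′²)))))))
      where
      n = ∑ pts e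
      n′ = ∑ pts e′
      N>0 : 0ℤ < N
      N>0 = go d
        where
        go : ∀ d → 0ℤ < q ℤ.^ d
        go zero = ℤ.+<+ (ℕ.s≤s ℕ.z≤n)
        go (suc d) = 1+≤⇒< (≤-* {1ℤ} {q} {1ℤ} {q ℤ.^ d} 0≤n (q^≥0 d) (ℤ.+≤+ (ℕₚ.≤-trans (ℕₚ.n≤1+n 1) card>1)) (<⇒1+≤ (go d)))
      lem : ∀ N s f g n m L → N * (N * (f + g)) - N * (+ 2 * s * (n * m) - L * N * (n + m)) ≡ L * (N * N * n + N * N * m) + (N * N * f - N * s * (n * m) + (N * N * g - N * s * (m * n)))
      lem = solve-∀
      lem′ : ∀ L a b c → L * b + c - (L * a - - c) ≡ L * (b - a)
      lem′ = solve-∀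

  edges : Carrier → (Vec Carrier d → ℤ) → (Vec Carrier d → ℤ) → ℤ
  edges {d} t e e′ = ∑ (allPoints d) (λ x → e x * ∑ (allPoints d) (λ y → ⟦ dist x y ≟ t ⟧ * e′ y))

  dist-translate : ∀ (x z : Vec Carrier d) → dist x (z +[ 𝟙 ] x) ≡ dot z z
  dist-translate []      []      = refl
  dist-translate (a ∷ x) (b ∷ z) = cong₂ _⊕_ (trans (cong (λ w → (a ⊕ ⊝ (b ⊕ w)) ⊗ (a ⊕ ⊝ (b ⊕ w))) (*-identityˡ a)) (solve 2 (λ a b → (a :+ :- (b :+ a)) :* (a :+ :- (b :+ a)) := b :* b) refl a b)) (dist-translate x z)

  edges≡form : ∀ t (e e′ : Vec Carrier d → ℤ) → edges t e e′ ≡ form (sphere t) e e′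
  edges≡form {d} t e e′ = ∑-cong (allPoints d) λ x → cong (e x *_) (trans (sym (∑-translate (λ y → ⟦ dist x y ≟ t ⟧ * e′ y) 𝟙 x))
    (∑-cong (allPoints d) λ z → cong (λ w → ⟦ w ≟ t ⟧ * e′ (z +[ 𝟙 ] x)) (dist-translate x z)))

  edges₂ : ∀ Λ → + 2 ≤ Λ → + 4 * q ≤ Λ * Λ → ∀ {t} → t ≢ 𝟘 → ∀ (e : Vec Carrier 2 → ℤ) → (∀ x → e x * e x ≡ e x) →
    let n = ∑ (allPoints 2) e in (q - 1ℤ) * (n * n) - Λ * (q * q) * n ≤ q * q * edges t e e
  edges₂ Λ 2≤Λ 4q≤Λ² {t} t≢0 e e² = *-cancel-≤ {c = + 2} (ℤ.+<+ (ℕ.s≤s ℕ.z≤n)) (≤-trans (≤-via (lem q σ Λ n) (0≤* {+ 2} 0≤n (0≤* (diff≥0 (circle-size≥ t≢0)) (0≤sq n))))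
    (≤-trans (mixing (sphere t) Λ (≤-trans 0≤n 2≤Λ) (radon-bounded (sphere t) Λ (bounded-circle-projection Λ 2≤Λ 4q≤Λ² t≢0)) e e e² e²)
      (≤-reflexive (trans (cong (λ x → q ℤ.^ 2 * (x + x)) (sym (edges≡form t e e))) (lem′ q (edges t e e))))))
    where
    n = ∑ (allPoints 2) e
    σ = ∑ (allPoints 2) (sphere t)
    lem : ∀ q σ L n → + 2 * σ * (n * n) - L * (q * (q * 1ℤ)) * (n + n) - + 2 * ((q - 1ℤ) * (n * n) - L * (q * q) * n) ≡ + 2 * ((σ - (q - 1ℤ)) * (n * n))
    lem = solve-∀
    lem′ : ∀ q x → q * (q * 1ℤ) * (x + x) ≡ + 2 * (q * q * x)
    lem′ = solve-∀

  private
    dist-++ : ∀ {m} (x y : Vec Carrier m) {d} (u v : Vec Carrier d) → dist (x Vec.++ u) (y Vec.++ v) ≡ dist x y ⊕ dist u v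
    dist-++ []      []      u v = sym (+-identityˡ _)
    dist-++ (a ∷ x) (b ∷ y) u v = trans (cong ((a ⊕ ⊝ b) ⊗ (a ⊕ ⊝ b) ⊕_) (dist-++ x y u v)) (sym (+-assoc _ _ _))

    ∑-++ : ∀ m {d} (f : Vec Carrier (m ℕ.+ d) → ℤ) → ∑ (allPoints (m ℕ.+ d)) f ≡ ∑ (allPoints m) (λ x → ∑ (allPoints d) (λ u → f (x Vec.++ u)))
    ∑-++ zero {d} f = sym (ℤₚ.+-identityʳ (∑ (allPoints d) f))
    ∑-++ (suc m) {d} f = trans (∑-vecs (m ℕ.+ d) elements f) (trans (∑-cong elements λ a → ∑-++ m (λ v → f (a ∷ v))) (sym (∑-vecs m elements _)))

  -- For fixed last coordinates u and v, points at distance t are points of two three-dimensional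
  -- slices at distance t - ‖u - v‖. The bound 2q holds uniformly for these radii, and the errors,
  -- proportional to the sizes of the slices, add up. The result is nontrivial for n above the order
  -- of q^(D-1), where D = 3 + d.
  edges₃ : ∀ t (e : Vec Carrier (3 ℕ.+ d) → ℤ) → (∀ x → e x * e x ≡ e x) → (∀ x → 0ℤ ≤ e x) →
    let n = ∑ (allPoints (3 ℕ.+ d)) e in
    (q - 1ℤ) * (q - + 2) * (n * n) - + 2 * (q * q * q * q) * q ℤ.^ d * n ≤ q * q * q * edges t e e
  edges₃ {d} t e e² e≥0 = *-cancel-≤ {c = + 2} (ℤ.+<+ (ℕ.s≤s ℕ.z≤n)) (begin
    + 2 * ((q - 1ℤ) * (q - + 2) * (n * n) - + 2 * (q * q * q * q) * Q * n) ≡⟨ lem q Q n ⟩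
    + 2 * S₀ * (n * n) - q * + 2 * (q * (q * (q * 1ℤ))) * (Q * n + Q * n) ≡⟨ sym sum-lower ⟩
    ∑ pts (λ u → ∑ pts (λ v → + 2 * S₀ * (size u * size v) - q * + 2 * q ℤ.^ 3 * (size u + size v))) ≤⟨ ∑-mono pts (λ u → ∑-mono pts (pointwise u)) ⟩
    ∑ pts (λ u → ∑ pts (λ v → q ℤ.^ 3 * (edges (τ u v) (at u) (at v) + edges (τ u v) (at v) (at u)))) ≡⟨ sum-upper ⟩
    + 2 * (q * q * q * edges t e e) ∎)
    where
    open ℤₚ.≤-Reasoning
    pts = allPoints d
    n = ∑ (allPoints (3 ℕ.+ d)) e
    Q S₀ : ℤ
    Q = q ℤ.^ d
    S₀ = (q - 1ℤ) * (q - + 2)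
    at : Vec Carrier d → Vec Carrier 3 → ℤ
    at u x = e (x Vec.++ u)
    size : Vec Carrier d → ℤ
    size u = ∑ (allPoints 3) (at u)
    τ : Vec Carrier d → Vec Carrier d → Carrier
    τ u v = t ⊕ ⊝ dist u v
    ∑size : ∑ pts size ≡ n
    ∑size = trans (∑-swap pts (allPoints 3) _) (sym (∑-++ 3 e))
    lem : ∀ q Q n → + 2 * ((q - 1ℤ) * (q - + 2) * (n * n) - + 2 * (q * q * q * q) * Q * n) ≡ + 2 * ((q - 1ℤ) * (q - + 2)) * (n * n) - q * + 2 * (q * (q * (q * 1ℤ))) * (Q * n + Q * n)
    lem = solve-∀
    sum-lower : ∑ pts (λ u → ∑ pts (λ v → + 2 * S₀ * (size u * size v) - q * + 2 * q ℤ.^ 3 * (size u + size v))) ≡ + 2 * S₀ * (n * n) - q * + 2 * q ℤ.^ 3 * (Q * n + Q * n)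
    sum-lower = trans (∑-cong pts λ u → ∑-- pts _ _) (trans (∑-- pts _ _) (cong₂ _-_
      (trans (∑-cong pts λ u → ∑-* pts (+ 2 * S₀) _) (trans (∑-* pts (+ 2 * S₀) _) (cong (+ 2 * S₀ *_) (trans (∑-** pts pts size size) (cong₂ _*_ ∑size ∑size)))))
      (trans (∑-cong pts λ u → ∑-* pts (q * + 2 * q ℤ.^ 3) _) (trans (∑-* pts (q * + 2 * q ℤ.^ 3) _) (cong (q * + 2 * q ℤ.^ 3 *_)
        (trans (∑-cong pts λ u → ∑-+ pts _ _) (trans (∑-+ pts _ _) (cong₂ _+_
          (trans (∑-cong pts λ u → ∑-vecs-const d elements (size u)) (trans (∑-* pts Q size) (cong (Q *_) ∑size)))
          (trans (∑-vecs-const d elements (∑ pts size)) (cong (Q *_) ∑size))))))))))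
    size≥0 : ∀ u → 0ℤ ≤ size u
    size≥0 u = ∑-≥0 (allPoints 3) λ x → e≥0 _
    pointwise : ∀ u v → + 2 * S₀ * (size u * size v) - q * + 2 * q ℤ.^ 3 * (size u + size v) ≤ q ℤ.^ 3 * (edges (τ u v) (at u) (at v) + edges (τ u v) (at v) (at u))
    pointwise u v = ≤-trans (≤-via (bigger S₀ (∑ (allPoints 3) (sphere (τ u v))) (size u * size v) (q * + 2 * q ℤ.^ 3 * (size u + size v))) (0≤* {+ 2} 0≤n (0≤* (diff≥0 (sphere-size≥ (τ u v))) (0≤* (size≥0 u) (size≥0 v)))))
      (≤-trans (mixing (sphere (τ u v)) (q * + 2) (0≤* (0≤n {card}) (0≤n {2})) (radon-bounded (sphere (τ u v)) (q * + 2) (bounded-sphere-projection (τ u v))) (at u) (at v) (λ x → e² _) (λ x → e² _))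
        (≤-reflexive (cong (q ℤ.^ 3 *_) (sym (cong₂ _+_ (edges≡form (τ u v) (at u) (at v)) (edges≡form (τ u v) (at v) (at u)))))))
      where bigger : ∀ S T a b → + 2 * T * a - b - (+ 2 * S * a - b) ≡ + 2 * ((T - S) * a)
            bigger = solve-∀
    one-way : ∑ pts (λ u → ∑ pts (λ v → edges (τ u v) (at u) (at v))) ≡ edges t e e
    one-way = sym (trans (∑-++ 3 _) (trans (∑-swap (allPoints 3) pts _) (∑-cong pts λ u → trans (∑-cong (allPoints 3) λ x → trans (cong (at u x *_) (trans (∑-++ 3 _) (∑-swap (allPoints 3) pts _))) (sym (∑-* pts (at u x) _)))
      (trans (∑-swap (allPoints 3) pts _) (∑-cong pts λ v → ∑-cong (allPoints 3) λ x → cong (at u x *_) (∑-cong (allPoints 3) λ y → cong (_* at v y)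
        (⟦⟧-cong (dist (x Vec.++ u) (y Vec.++ v) ≟ t) (dist x y ≟ τ u v)
          (λ p → trans (solve 2 (λ a b → a := a :+ b :+ :- b) refl (dist x y) (dist u v)) (cong (_⊕ ⊝ dist u v) (trans (sym (dist-++ x y u v)) p)))
          (λ p → trans (dist-++ x y u v) (trans (cong (_⊕ dist u v) p) (solve 2 (λ t b → t :+ :- b :+ b := t) refl t (dist u v)))))))))))
    other-way : ∑ pts (λ u → ∑ pts (λ v → edges (τ u v) (at v) (at u))) ≡ edges t e e
    other-way = trans (∑-swap pts pts _) (trans (∑-cong pts λ v → ∑-cong pts λ u → cong (λ s → edges (t ⊕ ⊝ s) (at v) (at u)) (dist-sym u v)) one-way)
    sum-upper : ∑ pts (λ u → ∑ pts (λ v → q ℤ.^ 3 * (edges (τ u v) (at u) (at v) + edges (τ u v) (at v) (at u)))) ≡ + 2 * (q * q * q * edges t e e)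
    sum-upper = trans (∑-cong pts λ u → trans (∑-* pts (q ℤ.^ 3) _) (cong (q ℤ.^ 3 *_) (∑-+ pts _ _))) (trans (∑-* pts (q ℤ.^ 3) _)
      (trans (cong (q ℤ.^ 3 *_) (trans (∑-+ pts _ _) (cong₂ _+_ one-way other-way))) (final q (edges t e e))))
      where final : ∀ q x → q * (q * (q * 1ℤ)) * (x + x) ≡ + 2 * (q * q * q * x)
            final = solve-∀

-- Shattered sets in the plane

pos-split : ∀ {P : Set} (d : Dec P) {y} → 0ℤ < ⟦ d ⟧ * y → P × 0ℤ < y
pos-split (yes p) {y} r = p , <-≤-trans r (≤-reflexive (ℤₚ.*-identityˡ y))
pos-split (no _)  {y} r = contradiction (<-≤-trans r (≤-reflexive (ℤₚ.*-zeroˡ y))) (<-irrefl refl)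

-- Used after `∑-exists`: if a is the indicator of an object and b counts its defects, then a strict
-- inequality leaves an actual object with no defect at all.
excluded : ∀ {a b} → 0ℤ ≤ a → 0ℤ ≤ b → a * b < a → 0ℤ < a × b ≡ 0ℤ
excluded {a} {b} a≥0 b≥0 p = a>0 , ≤-antisym (≮⇒≥ λ b>0 → <-irrefl refl (<-≤-trans p (≤-trans (≤-reflexive (sym (ℤₚ.*-identityʳ a))) (≤-*ˡ a≥0 (<⇒1+≤ b>0))))) b≥0
  where
  a>0 : 0ℤ < a
  a>0 = ≰⇒> λ a≤0 → let a≡0 = ≤-antisym a≤0 a≥0 in
    <-irrefl refl (<-≤-trans p (≤-trans (≤-reflexive a≡0) (≤-reflexive (sym (trans (cong (_* b) a≡0) (ℤₚ.*-zeroˡ b))))))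

⟦⟧-false : ∀ {P : Set} (d : Dec P) → ⟦ d ⟧ ≡ 0ℤ → ¬ P
⟦⟧-false d e p = contradiction (trans (sym (⟦⟧-yes d p)) e) λ ()

sum-zeroˡ : ∀ {a b} → 0ℤ ≤ a → 0ℤ ≤ b → a + b ≡ 0ℤ → a ≡ 0ℤ
sum-zeroˡ {a} {b} a≥0 b≥0 e = ≤-antisym (≤-via (lem a b e) b≥0) a≥0
  where lem : ∀ a b → a + b ≡ 0ℤ → 0ℤ - a ≡ b
        lem a b e = trans (cong (_- a) (sym e)) (lem′ a b)
          where lem′ : ∀ a b → a + b - a ≡ b
                lem′ = solve-∀

sum-zeroʳ : ∀ {a b} → 0ℤ ≤ a → 0ℤ ≤ b → a + b ≡ 0ℤ → b ≡ 0ℤ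
sum-zeroʳ {a} {b} a≥0 b≥0 e = sum-zeroˡ b≥0 a≥0 (trans (ℤₚ.+-comm b a) e)

module Shattering (F : FiniteField) (2≢0 : FiniteField._+_ F (FiniteField.1# F) (FiniteField.1# F) ≢ FiniteField.0# F) (t : ⟨ F ⟩) where
  open Field F
  open Odd 2≢0
  open Geometry F
  open Radon F 2≢0
  open Conics F 2≢0
  open Mixing F 2≢0

  private variable d : ℕ

  N : Vec Carrier d → Vec Carrier d → ℤ
  N x y = ⟦ dist x y ≟ t ⟧

  N≥0 : ∀ (x y : Vec Carrier d) → 0ℤ ≤ N x y
  N≥0 x y = ⟦⟧≥0 (dist x y ≟ t)

  N≤1 : ∀ (x y : Vec Carrier d) → N x y ≤ 1ℤ
  N≤1 x y = ⟦⟧≤1 (dist x y ≟ t)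

  N-sym : ∀ (x y : Vec Carrier d) → N x y ≡ N y x
  N-sym x y = cong (λ s → ⟦ s ≟ t ⟧) (dist-sym x y)

  -- The pair (u, v) realizes the constant function true. For any other pattern the pair (y, u) is
  -- taken: u is at distance t from all of C, so y alone decides, and the point x₀ with value false
  -- shows y ≠ u.
  shatter-criterion : ∀ {E C : List (Vec Carrier d)} u v → u ∈ E → v ∈ E → u ≢ v → (∀ x → x ∈ C → dist x u ≡ t × dist x v ≡ t) →
    (∀ (f : Vec Carrier d → Bool) x₀ → x₀ ∈ C → f x₀ ≡ false → ∃[ y ] (y ∈ E × ∀ x → x ∈ C → (f x ≡ true → dist x y ≡ t) × (f x ≡ false → dist x y ≢ t))) →
    Shatters F t E C
  shatter-criterion {E = E} {C} u v u∈ v∈ u≢v on exact f = by-cases (Any.any? (λ x → f x Bool.≟ false) C)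
    where
    by-cases : Dec (Any.Any (λ x → f x ≡ false) C) → ∃[ u ] ∃[ v ] (u ∈ E × v ∈ E × u ≢ v × (∀ x → x ∈ C → h F t u v x ≡ f x))
    by-cases (no none) = u , v , u∈ , v∈ , u≢v , λ x x∈ → trans (h-true⁻ {u = u} {v} {x} (proj₁ (on x x∈)) (proj₂ (on x x∈))) (sym (true! x x∈))
      where
      true! : ∀ x → x ∈ C → f x ≡ true
      true! x x∈ with f x in e
      ... | true  = refl
      ... | false = contradiction (lose x∈ e) none
    by-cases (yes some) = let (x₀ , x₀∈ , e₀) = find some ; (y , y∈ , ex) = exact f x₀ x₀∈ e₀ in
      y , u , y∈ , u∈ , (λ { refl → proj₂ (ex x₀ x₀∈) e₀ (proj₁ (on x₀ x₀∈)) }) , λ x x∈ → value x x∈ (f x) refl (ex x x∈) (proj₁ (on x x∈))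
      where
      value : ∀ {y} x → x ∈ C → ∀ b → f x ≡ b → (f x ≡ true → dist x y ≡ t) × (f x ≡ false → dist x y ≢ t) → dist x u ≡ t → h F t y u x ≡ f x
      value {y} x x∈ true  e (p , _) o = trans (h-true⁻ {u = y} {u} {x} (p e) o) (sym e)
      value {y} x x∈ false e (_ , r) o = trans (h-false⁻ {u = y} {u} {x} (λ (a , _) → r e a)) (sym e)

  module Indicator (E : List (Vec Carrier d)) (E! : Unique E) where
    open import Data.List.Membership.DecPropositional (_≟ᵛ_ {d}) using (_∈?_)

    ε : Vec Carrier d → ℤ
    ε x = ⟦ x ∈? E ⟧

    ε-idem : ∀ x → ε x * ε x ≡ ε x
    ε-idem x = ⟦⟧-idem (x ∈? E)

    ε≥0 : ∀ x → 0ℤ ≤ ε x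
    ε≥0 x = ⟦⟧≥0 (x ∈? E)

    ε≤1 : ∀ x → ε x ≤ 1ℤ
    ε≤1 x = ⟦⟧≤1 (x ∈? E)

    ε-true : ∀ {x y} → 0ℤ < ε x * y → x ∈ E × 0ℤ < y
    ε-true {x} = pos-split (x ∈? E)

    ∑ε : ∑ (allPoints d) ε ≡ + length E
    ∑ε = sym (trans (sym (ℤₚ.*-identityʳ _)) (trans (sym (∑-const E 1ℤ)) (trans (Sums.∑-fibre (points d) E id (λ _ → 1ℤ))
      (∑-cong (allPoints d) λ y → trans (ℤₚ.*-identityʳ (∑ E (λ x → ⟦ x ≟ᵛ y ⟧))) (multiplicity y (y ∈? E))))))
      where
      as-δ : ∀ y → ∑ E (λ x → ⟦ x ≟ᵛ y ⟧) ≡ ∑ E (λ x → ⟦ x ≟ᵛ y ⟧ * 1ℤ)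
      as-δ y = ∑-cong E λ x → sym (ℤₚ.*-identityʳ _)
      multiplicity : ∀ y (m : Dec (y ∈ E)) → ∑ E (λ x → ⟦ x ≟ᵛ y ⟧) ≡ ⟦ m ⟧
      multiplicity y (yes m) = trans (as-δ y) (∑-δ∈ _≟ᵛ_ E (λ _ → 1ℤ) y E! m)
      multiplicity y (no m)  = trans (as-δ y) (∑-δ∉ _≟ᵛ_ E (λ _ → 1ℤ) y m)

    deg : Vec Carrier d → ℤ
    deg x = ∑ (allPoints d) (λ y → N x y * ε y)

    deg≥0 : ∀ x → 0ℤ ≤ deg x
    deg≥0 x = ∑-≥0 (allPoints d) λ y → 0≤* (N≥0 x y) (ε≥0 y)

  -- The common neighbours of c₁, c₂ are the points of a sphere on a hyperplane orthogonal to c₂ − c₁.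
  common-neighbours : ∀ (c₁ c₂ : Vec Carrier d) → ∑ (allPoints d) (λ z → N c₁ z * N c₂ z) ≡
    push (c₂ +[ ⊝ 𝟙 ] c₁) (sphere t) (half ⊗ dot (c₂ +[ ⊝ 𝟙 ] c₁) (c₂ +[ ⊝ 𝟙 ] c₁))
  common-neighbours {d} c₁ c₂ = trans (sym (∑-translate (λ z → N c₁ z * N c₂ z) 𝟙 c₁)) (∑-cong (allPoints d) λ w →
    trans (cong (λ a → ⟦ a ≟ t ⟧ * N c₂ (w +[ 𝟙 ] c₁)) (dist-translate c₁ w)) (trans (⟦⟧-absorb (dot w w ≟ t) (λ e → ⟦⟧-cong _ (dot m w ≟ half ⊗ dot m m) (to w e) (from w e)))
      (ℤₚ.*-comm (sphere t w) ⟦ dot m w ≟ half ⊗ dot m m ⟧)))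
    where
    m = c₂ +[ ⊝ 𝟙 ] c₁
    dist-m : ∀ {d} (c₁ c₂ w : Vec Carrier d) → let m = c₂ +[ ⊝ 𝟙 ] c₁ in dist c₂ (w +[ 𝟙 ] c₁) ≡ dot m m ⊕ ⊝ (dot m w ⊕ dot m w) ⊕ dot w w
    dist-m []       []       []      = solve 0 (con 0ℤ := con 0ℤ :+ :- (con 0ℤ :+ con 0ℤ) :+ con 0ℤ) refl
    dist-m (a ∷ c₁) (b ∷ c₂) (w ∷ v) = trans (cong₂ _⊕_
      (trans (cong (λ x → (b ⊕ ⊝ (w ⊕ x)) ⊗ (b ⊕ ⊝ (w ⊕ x))) (*-identityˡ a)) (trans (solve 3 (λ a b w → (b :+ :- (w :+ a)) :* (b :+ :- (w :+ a)) := (b :+ :- a) :* (b :+ :- a) :+ :- ((b :+ :- a) :* w :+ (b :+ :- a) :* w) :+ w :* w) refl a b w)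
        (cong (λ x → (b ⊕ x) ⊗ (b ⊕ x) ⊕ ⊝ ((b ⊕ x) ⊗ w ⊕ (b ⊕ x) ⊗ w) ⊕ w ⊗ w) (trans (cong ⊝_ (sym (*-identityˡ a))) (-‿distribˡ-* 𝟙 a)))))
      (dist-m c₁ c₂ v))
      (solve 6 (λ p r s x y z → p :+ :- (r :+ r) :+ s :+ (x :+ :- (y :+ y) :+ z) := p :+ x :+ :- (r :+ y :+ (r :+ y)) :+ (s :+ z)) refl _ _ _ _ _ _)
    to : ∀ w → dot w w ≡ t → dist c₂ (w +[ 𝟙 ] c₁) ≡ t → dot m w ≡ half ⊗ dot m m
    to w e r = trans (sym (half-double (dot m w))) (trans (sym (distribˡ half _ _)) (cong (half ⊗_)
      (⊕-cancelˡ {⊝ (dot m w ⊕ dot m w)} (trans (-‿inverseˡ _) (sym (trans (+-comm _ _) (⊕-cancelˡ {dot w w} (trans (trans (+-comm _ _) (sym (dist-m c₁ c₂ w))) (trans r (trans (sym e) (sym (+-identityʳ _))))))))))))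
    from : ∀ w → dot w w ≡ t → dot m w ≡ half ⊗ dot m m → dist c₂ (w +[ 𝟙 ] c₁) ≡ t
    from w e r = trans (dist-m c₁ c₂ w) (trans (cong (λ x → dot m m ⊕ ⊝ (x ⊕ x) ⊕ dot w w) r) (trans (cong (λ x → dot m m ⊕ ⊝ x ⊕ dot w w) (half-double (dot m m)))
      (trans (cong (_⊕ dot w w) (-‿inverseʳ _)) (trans (+-identityˡ _) e))))

  sphere-count : ∀ (c : Vec Carrier d) → ∑ (allPoints d) (N c) ≡ ∑ (allPoints d) (sphere t)
  sphere-count {d} c = trans (sym (∑-translate (N c) 𝟙 c)) (∑-cong (allPoints d) λ w → cong (λ a → ⟦ a ≟ t ⟧) (dist-translate c w))

≤-drop : ∀ {a b} → 0ℤ ≤ a → b ≤ 1ℤ → a * b ≤ a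
≤-drop {a} p r = ≤-trans (≤-*ˡ p r) (≤-reflexive (ℤₚ.*-identityʳ a))

-- Rhombi x, y, a + x, a + y: for fixed a, two points x, y at distance t in the set X a = E ∩ (E − a).
module Planar (F : FiniteField) (2≢0 : FiniteField._+_ F (FiniteField.1# F) (FiniteField.1# F) ≢ FiniteField.0# F)
              (t : ⟨ F ⟩) (t≢0 : t ≢ FiniteField.0# F) (E : List (Vec ⟨ F ⟩ 2)) (E! : Unique E) where
  open Field F
  open Odd 2≢0
  open Geometry F
  open Radon F 2≢0
  open Conics F 2≢0
  open Spheres F 2≢0
  open Mixing F 2≢0
  open Shattering F 2≢0 t
  open Indicator E E!

  private
    V : Set
    V = Vec Carrier 2

    pts : List V
    pts = allPoints 2

    s : V → ℤ
    s = sphere t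

    s≥0 : ∀ a → 0ℤ ≤ s a
    s≥0 a = ⟦⟧≥0 (dot a a ≟ t)

    X : V → V → ℤ
    X a x = ε x * ε (a +[ 𝟙 ] x)

    X≥0 : ∀ a x → 0ℤ ≤ X a x
    X≥0 a x = 0≤* (ε≥0 x) (ε≥0 _)

    X≤1 : ∀ a x → X a x ≤ 1ℤ
    X≤1 a x = ≤-* {b = 1ℤ} {d = 1ℤ} (ε≥0 x) (0≤n {1}) (ε≤1 x) (ε≤1 _)

    X-idem : ∀ a x → X a x * X a x ≡ X a x
    X-idem a x = trans (lem (ε x) (ε (a +[ 𝟙 ] x))) (cong₂ _*_ (ε-idem x) (ε-idem _))
      where lem : ∀ a b → a * b * (a * b) ≡ a * a * (b * b)
            lem = solve-∀

    ξ : V → ℤ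
    ξ a = ∑ pts (X a)

    ℓ : ℤ
    ℓ = edges t ε ε

    ∑ξ : ∑ pts (λ a → s a * ξ a) ≡ ℓ
    ∑ξ = sym (trans (edges≡form t ε ε) (trans (∑-cong pts λ x → sym (∑-* pts (ε x) _)) (trans (∑-swap pts pts _)
      (∑-cong pts λ a → trans (∑-cong pts λ x → lem (ε x) (s a) (ε (a +[ 𝟙 ] x))) (∑-* pts (s a) (X a))))))
      where lem : ∀ a b c → a * (b * c) ≡ b * (a * c)
            lem = solve-∀

    -- Indicator of a rhombus in E: the sides are a and y - x, both of norm t.
    T : V → V → V → ℤ
    T a x y = s a * (X a x * (N x y * X a y))

    T≥0 : ∀ a x y → 0ℤ ≤ T a x y
    T≥0 a x y = 0≤* (s≥0 a) (0≤* (X≥0 a x) (0≤* (N≥0 x y) (X≥0 a y)))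

    ∑T : ∑ pts (λ a → ∑ pts (λ x → ∑ pts (λ y → T a x y))) ≡ ∑ pts (λ a → s a * edges t (X a) (X a))
    ∑T = ∑-cong pts λ a → trans (∑-cong pts λ x → trans (∑-* pts (s a) _) (cong (s a *_) (∑-* pts (X a x) _))) (∑-* pts (s a) _)

    dist-shift : ∀ {d} (a x y : Vec Carrier d) → dist (a +[ 𝟙 ] x) (a +[ 𝟙 ] y) ≡ dist x y
    dist-shift []      []      []      = refl
    dist-shift (a ∷ v) (x ∷ u) (y ∷ w) = cong₂ _⊕_ (trans (cong₂ (λ x y → (a ⊕ x ⊕ ⊝ (a ⊕ y)) ⊗ (a ⊕ x ⊕ ⊝ (a ⊕ y))) (*-identityˡ x) (*-identityˡ y))
      (solve 3 (λ a x y → (a :+ x :+ :- (a :+ y)) :* (a :+ x :+ :- (a :+ y)) := (x :+ :- y) :* (x :+ :- y)) refl a x y)) (dist-shift v u w)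

    +ᵛ-comm : ∀ {d} (x y : Vec Carrier d) → x +[ 𝟙 ] y ≡ y +[ 𝟙 ] x
    +ᵛ-comm []      []      = refl
    +ᵛ-comm (a ∷ x) (b ∷ y) = cong₂ _∷_ (trans (cong (a ⊕_) (*-identityˡ b)) (trans (+-comm a b) (cong (b ⊕_) (sym (*-identityˡ a))))) (+ᵛ-comm x y)

    -- Two different circles of radius t share at most two points. A point with at least three
    -- neighbours in E thus has one that is not a neighbour of a given other point.
    low : V → ℤ
    low x = ⟦ deg x ℤₚ.≤? + 2 ⟧

    low≥0 : ∀ x → 0ℤ ≤ low x
    low≥0 x = ⟦⟧≥0 (deg x ℤₚ.≤? + 2)

    low-deg : ∀ x → low x * deg x ≤ + 2
    low-deg x = go (deg x ℤₚ.≤? + 2)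
      where
      go : (d : Dec (deg x ≤ + 2)) → ⟦ d ⟧ * deg x ≤ + 2
      go (yes p) = ≤-trans (≤-reflexive (ℤₚ.*-identityˡ (deg x))) p
      go (no _)  = ≤-trans (≤-reflexive (ℤₚ.*-zeroˡ (deg x))) 0≤n

    -- The set to be shattered is {a + x, y}, with common neighbours x and a + y. The first two
    -- defects collapse one of these pairs; the last two deny a point of the set enough neighbours
    -- to be separated from the other.
    bad₁ bad₂ bad₃ bad₄ : V → V → V → ℤ
    bad₁ a x y = ⟦ y ≟ᵛ (a +[ 𝟙 ] x) ⟧
    bad₂ a x y = ⟦ x ≟ᵛ (a +[ 𝟙 ] y) ⟧
    bad₃ a x y = low (a +[ 𝟙 ] x)
    bad₄ a x y = low y

    ∑³ : (V → V → V → ℤ) → ℤ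
    ∑³ f = ∑ pts (λ a → ∑ pts (λ x → ∑ pts (f a x)))

    ∑³-mono : ∀ {f g} → (∀ a x y → f a x y ≤ g a x y) → ∑³ f ≤ ∑³ g
    ∑³-mono p = ∑-mono pts λ a → ∑-mono pts λ x → ∑-mono pts λ y → p a x y

    open ℤₚ.≤-Reasoning

    few₁ : ∑³ (λ a x y → T a x y * bad₁ a x y) ≤ ℓ
    few₁ = begin
      ∑³ (λ a x y → T a x y * bad₁ a x y) ≤⟨ ∑³-mono (λ a x y → ≤-trans (≤-reflexive (lem (s a) (X a x) (N x y) (X a y) (bad₁ a x y)))
        (≤-drop (0≤* (0≤* (s≥0 a) (X≥0 a x)) (⟦⟧≥0 (y ≟ᵛ (a +[ 𝟙 ] x)))) (≤-* {b = 1ℤ} {d = 1ℤ} (N≥0 x y) (0≤n {1}) (N≤1 x y) (X≤1 a y)))) ⟩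
      ∑³ (λ a x y → s a * X a x * bad₁ a x y) ≡⟨ ∑-cong pts (λ a → trans (∑-cong pts λ x → trans (∑-* pts (s a * X a x) _) (trans (cong (s a * X a x *_) (Sums.∑-δ1 (points 2) (a +[ 𝟙 ] x))) (ℤₚ.*-identityʳ _))) (∑-* pts (s a) (X a))) ⟩
      ∑ pts (λ a → s a * ξ a) ≡⟨ ∑ξ ⟩
      ℓ ∎
      where lem : ∀ s x n y b → s * (x * (n * y)) * b ≡ s * x * b * (n * y)
            lem = solve-∀

    few₂ : ∑³ (λ a x y → T a x y * bad₂ a x y) ≤ ℓ
    few₂ = begin
      ∑³ (λ a x y → T a x y * bad₂ a x y) ≤⟨ ∑³-mono (λ a x y → ≤-trans (≤-reflexive (lem (s a) (X a x) (N x y) (X a y) (bad₂ a x y)))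
        (≤-drop (0≤* (0≤* (s≥0 a) (X≥0 a y)) (⟦⟧≥0 (x ≟ᵛ (a +[ 𝟙 ] y)))) (≤-* {b = 1ℤ} {d = 1ℤ} (N≥0 x y) (0≤n {1}) (N≤1 x y) (X≤1 a x)))) ⟩
      ∑³ (λ a x y → s a * X a y * bad₂ a x y) ≡⟨ ∑-cong pts (λ a → trans (∑-swap pts pts _) (trans (∑-cong pts λ y → trans (∑-* pts (s a * X a y) _) (trans (cong (s a * X a y *_) (Sums.∑-δ1 (points 2) (a +[ 𝟙 ] y))) (ℤₚ.*-identityʳ _))) (∑-* pts (s a) (X a)))) ⟩
      ∑ pts (λ a → s a * ξ a) ≡⟨ ∑ξ ⟩
      ℓ ∎
      where lem : ∀ s x n y b → s * (x * (n * y)) * b ≡ s * y * b * (n * x)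
            lem = solve-∀

    -- For given a and x, the point a + y is a neighbour of a + x in E, so a low degree leaves at
    -- most two choices of y.
    few₃ : ∑³ (λ a x y → T a x y * bad₃ a x y) ≤ + 2 * ℓ
    few₃ = begin
      ∑³ (λ a x y → T a x y * bad₃ a x y) ≤⟨ ∑³-mono (λ a x y → ≤-trans (≤-reflexive (lem (s a) (X a x) (N x y) (ε y) (ε (a +[ 𝟙 ] y)) (bad₃ a x y)))
        (≤-drop (0≤* (0≤* (s≥0 a) (X≥0 a x)) (0≤* (low≥0 (a +[ 𝟙 ] x)) (0≤* (N≥0 x y) (ε≥0 _)))) (ε≤1 y))) ⟩
      ∑³ (λ a x y → s a * X a x * (low (a +[ 𝟙 ] x) * (N x y * ε (a +[ 𝟙 ] y))))
        ≡⟨ ∑-cong pts (λ a → ∑-cong pts λ x → trans (∑-* pts (s a * X a x) _) (cong (s a * X a x *_) (trans (∑-* pts (low (a +[ 𝟙 ] x)) _) (cong (low (a +[ 𝟙 ] x) *_) (degree a x))))) ⟩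
      ∑ pts (λ a → ∑ pts (λ x → s a * X a x * (low (a +[ 𝟙 ] x) * deg (a +[ 𝟙 ] x)))) ≤⟨ ∑-mono pts (λ a → ∑-mono pts λ x → ≤-*ˡ (0≤* (s≥0 a) (X≥0 a x)) (low-deg (a +[ 𝟙 ] x))) ⟩
      ∑ pts (λ a → ∑ pts (λ x → s a * X a x * + 2)) ≡⟨ trans (∑-cong pts λ a → trans (∑-*ʳ pts _ (+ 2)) (cong (_* + 2) (∑-* pts (s a) (X a)))) (trans (∑-*ʳ pts _ (+ 2)) (trans (cong (_* + 2) ∑ξ) (ℤₚ.*-comm ℓ (+ 2)))) ⟩
      + 2 * ℓ ∎
      where
      lem : ∀ s x n y y′ b → s * (x * (n * (y * y′))) * b ≡ s * x * (b * (n * y′)) * y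
      lem = solve-∀
      degree : ∀ a x → ∑ pts (λ y → N x y * ε (a +[ 𝟙 ] y)) ≡ deg (a +[ 𝟙 ] x)
      degree a x = trans (∑-cong pts λ y → cong₂ _*_ (cong (λ w → ⟦ w ≟ t ⟧) (trans (sym (dist-shift a x y)) (cong (dist (a +[ 𝟙 ] x)) (+ᵛ-comm a y)))) (cong ε (+ᵛ-comm a y)))
        (∑-translate (λ z → N (a +[ 𝟙 ] x) z * ε z) 𝟙 a)

    -- For given y, both x and a + y are neighbours of y in E and determine the rhombus, so y
    -- contributes at most its squared degree, which is at most twice the degree when y is low.
    few₄ : ∑³ (λ a x y → T a x y * bad₄ a x y) ≤ + 2 * ℓ
    few₄ = begin
      ∑³ (λ a x y → T a x y * bad₄ a x y) ≤⟨ ∑³-mono (λ a x y → ≤-trans (≤-reflexive (lem (s a) (ε x) (ε (a +[ 𝟙 ] x)) (N x y) (ε y) (ε (a +[ 𝟙 ] y)) (bad₄ a x y)))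
        (≤-drop (0≤* (0≤* (0≤* (ε≥0 y) (low≥0 y)) (0≤* (N≥0 x y) (ε≥0 x))) (0≤* (s≥0 a) (ε≥0 _))) (ε≤1 _))) ⟩
      ∑³ (λ a x y → ε y * low y * (N x y * ε x) * (s a * ε (a +[ 𝟙 ] y))) ≡⟨ trans (∑-swap pts pts _) (trans (∑-cong pts λ x → ∑-swap pts pts _) (∑-swap pts pts _)) ⟩
      ∑ pts (λ y → ∑ pts (λ x → ∑ pts (λ a → ε y * low y * (N x y * ε x) * (s a * ε (a +[ 𝟙 ] y)))))
        ≡⟨ ∑-cong pts (λ y → trans (∑-cong pts λ x → trans (∑-* pts (ε y * low y * (N x y * ε x)) _) (cong (ε y * low y * (N x y * ε x) *_) (degree y))) (trans (∑-*ʳ pts _ (deg y)) (cong (_* deg y) (trans (∑-* pts (ε y * low y) _) (cong (ε y * low y *_) (∑-cong pts λ x → cong (_* ε x) (N-sym x y))))))) ⟩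
      ∑ pts (λ y → ε y * low y * deg y * deg y) ≤⟨ ∑-mono pts (λ y → ≤-trans (≤-reflexive (assoc (ε y) (low y) (deg y))) (≤-*ˡ (0≤* (ε≥0 y) (deg≥0 y)) (low-deg y))) ⟩
      ∑ pts (λ y → ε y * deg y * + 2) ≡⟨ trans (∑-*ʳ pts _ (+ 2)) (ℤₚ.*-comm ℓ (+ 2)) ⟩
      + 2 * ℓ ∎
      where
      lem : ∀ s x x′ n y y′ b → s * (x * x′ * (n * (y * y′))) * b ≡ y * b * (n * x) * (s * y′) * x′
      lem = solve-∀
      assoc : ∀ e l d → e * l * d * d ≡ e * d * (l * d)
      assoc = solve-∀
      degree : ∀ y → ∑ pts (λ a → s a * ε (a +[ 𝟙 ] y)) ≡ deg y
      degree y = trans (∑-cong pts λ a → cong (λ w → ⟦ w ≟ t ⟧ * ε (a +[ 𝟙 ] y)) (sym (dist-translate y a))) (∑-translate (λ z → N y z * ε z) 𝟙 y)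

    bad : V → V → V → ℤ
    bad a x y = bad₁ a x y + bad₂ a x y + (bad₃ a x y + bad₄ a x y)

    few : ∑³ (λ a x y → T a x y * bad a x y) ≤ + 6 * ℓ
    few = begin
      ∑³ (λ a x y → T a x y * bad a x y) ≡⟨ ∑-cong pts (λ a → ∑-cong pts λ x → ∑-cong pts λ y → lem (T a x y) (bad₁ a x y) (bad₂ a x y) (bad₃ a x y) (bad₄ a x y)) ⟩
      ∑³ (λ a x y → f₁ a x y + f₂ a x y + (f₃ a x y + f₄ a x y)) ≡⟨ ∑³-+ (λ a x y → f₁ a x y + f₂ a x y) (λ a x y → f₃ a x y + f₄ a x y) ⟩
      ∑³ (λ a x y → f₁ a x y + f₂ a x y) + ∑³ (λ a x y → f₃ a x y + f₄ a x y) ≡⟨ cong₂ _+_ (∑³-+ f₁ f₂) (∑³-+ f₃ f₄) ⟩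
      ∑³ f₁ + ∑³ f₂ + (∑³ f₃ + ∑³ f₄) ≤⟨ ℤₚ.+-mono-≤ (ℤₚ.+-mono-≤ few₁ few₂) (ℤₚ.+-mono-≤ few₃ few₄) ⟩
      ℓ + ℓ + (+ 2 * ℓ + + 2 * ℓ) ≡⟨ total ℓ ⟩
      + 6 * ℓ ∎
      where
      f₁ f₂ f₃ f₄ : V → V → V → ℤ
      f₁ a x y = T a x y * bad₁ a x y
      f₂ a x y = T a x y * bad₂ a x y
      f₃ a x y = T a x y * bad₃ a x y
      f₄ a x y = T a x y * bad₄ a x y
      lem : ∀ t a b c d → t * (a + b + (c + d)) ≡ t * a + t * b + (t * c + t * d)
      lem = solve-∀
      total : ∀ l → l + l + (+ 2 * l + + 2 * l) ≡ + 6 * l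
      total = solve-∀
      ∑³-+ : ∀ f g → ∑³ (λ a x y → f a x y + g a x y) ≡ ∑³ f + ∑³ g
      ∑³-+ f g = trans (∑-cong pts λ a → trans (∑-cong pts λ x → ∑-+ pts (f a x) (g a x)) (∑-+ pts _ _)) (∑-+ pts _ _)

  module _ (Λ : ℤ) (7≤Λ : + 7 ≤ Λ) (4q≤Λ² : + 4 * q ≤ Λ * Λ) (many : + 8 * (q * q) * Λ ≤ ℓ) where
    private
      Λ≥0 : 0ℤ ≤ Λ
      Λ≥0 = ≤-trans 0≤n 7≤Λ

      q≥0 : 0ℤ ≤ q
      q≥0 = 0≤n

      q-2≥0 : 0ℤ ≤ q - + 2
      q-2≥0 = diff≥0 {+ 2} {q} (ℤ.+≤+ card>1)

      ℓ>0 : 0ℤ < ℓ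
      ℓ>0 = <-≤-trans (<-≤-trans {j = + 8 * (+ 1 * + 1) * + 7} (ℤ.+<+ (ℕ.s≤s ℕ.z≤n)) (≤-* {+ 8 * (+ 1 * + 1)} {+ 8 * (q * q)} {+ 7} {Λ} 0≤n Λ≥0 (≤-*ˡ {+ 1 * + 1} {q * q} {+ 8} 0≤n (≤-* {+ 1} {q} {+ 1} {q} 0≤n q≥0 q≥1 q≥1)) 7≤Λ)) many
        where
        q≥1 : 1ℤ ≤ q
        q≥1 = ℤ.+≤+ (ℕₚ.≤-trans (ℕₚ.n≤1+n 1) card>1)

      R σ b : ℤ
      R = ∑³ T
      σ = ∑ pts s
      -- A lower bound for the mean ℓ/σ of ξ over the circle, as ℓ ≥ 8q²Λ and σ ≤ 2q. The tangent
      -- 2bξ - b² of ξ² at this point replaces a second use of Cauchy-Schwarz.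
      b = + 4 * q * Λ

      rhombi : (q - 1ℤ) * (+ 2 * b * ℓ - b * b * σ) - Λ * (q * q) * ℓ ≤ q * q * R
      rhombi = begin
        (q - 1ℤ) * (+ 2 * b * ℓ - b * b * σ) - Λ * (q * q) * ℓ ≡⟨ cong (λ l → (q - 1ℤ) * (+ 2 * b * l - b * b * σ) - Λ * (q * q) * l) (sym ∑ξ) ⟩
        (q - 1ℤ) * (+ 2 * b * S₁ - b * b * σ) - Λ * (q * q) * S₁ ≡⟨ lem (q - 1ℤ) b S₁ σ (Λ * (q * q)) ⟩
        ((q - 1ℤ) * (+ 2 * b) - Λ * (q * q)) * S₁ + - ((q - 1ℤ) * (b * b)) * σ
          ≡⟨ sym (trans (∑-+ pts _ _) (cong₂ _+_ (∑-* pts ((q - 1ℤ) * (+ 2 * b) - Λ * (q * q)) _) (∑-* pts (- ((q - 1ℤ) * (b * b))) s))) ⟩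
        ∑ pts (λ a → ((q - 1ℤ) * (+ 2 * b) - Λ * (q * q)) * (s a * ξ a) + - ((q - 1ℤ) * (b * b)) * s a) ≤⟨ ∑-mono pts pointwise ⟩
        ∑ pts (λ a → q * q * (s a * edges t (X a) (X a))) ≡⟨ trans (∑-* pts (q * q) _) (cong (q * q *_) (sym ∑T)) ⟩
        q * q * R ∎
        where
        S₁ = ∑ pts (λ a → s a * ξ a)
        lem : ∀ p b l σ c → p * (+ 2 * b * l - b * b * σ) - c * l ≡ (p * (+ 2 * b) - c) * l + - (p * (b * b)) * σ
        lem = solve-∀
        square : ∀ q s x b L e → q * q * (s * e) - (((q - 1ℤ) * (+ 2 * b) - L * (q * q)) * (s * x) + - ((q - 1ℤ) * (b * b)) * s) ≡
          s * (q * q * e - ((q - 1ℤ) * (x * x) - L * (q * q) * x)) + s * (q - + 2 + 1ℤ) * ((x - b) * (x - b))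
        square = solve-∀
        pointwise : ∀ a → ((q - 1ℤ) * (+ 2 * b) - Λ * (q * q)) * (s a * ξ a) + - ((q - 1ℤ) * (b * b)) * s a ≤ q * q * (s a * edges t (X a) (X a))
        pointwise a = ≤-via (square q (s a) (ξ a) b Λ (edges t (X a) (X a)))
          (0≤+ (0≤* (s≥0 a) (diff≥0 (edges₂ Λ (≤-trans (ℤ.+≤+ (ℕ.s≤s (ℕ.s≤s ℕ.z≤n))) 7≤Λ) 4q≤Λ² t≢0 (X a) (X-idem a)))) (0≤* (0≤* (s≥0 a) (0≤+ q-2≥0 (0≤n {1}))) (0≤sq (ξ a - b))))

      A : ℤ
      A = + 2 * b * ℓ - b * b * σ

      A≥ : + 4 * q * Λ * ℓ ≤ A
      A≥ = ≤-via (lem q Λ ℓ σ) (0≤+ (0≤* (0≤sq b) (diff≥0 (circle-size≤ t))) (0≤* (0≤* {+ 4 * q} (0≤* {+ 4} {q} 0≤n q≥0) Λ≥0) (diff≥0 many)))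
        where lem : ∀ q L l σ → + 2 * (+ 4 * q * L) * l - + 4 * q * L * (+ 4 * q * L) * σ - + 4 * q * L * l ≡ + 4 * q * L * (+ 4 * q * L) * (+ 2 * q - σ) + + 4 * q * L * (l - + 8 * (q * q) * L)
              lem = solve-∀

      -- Since 2(q - 1) = q + (q - 2), the main term (q - 1)A is at least qA/2 ≥ 2q²Λℓ, and half of
      -- this pays for the error q²Λℓ.
      R≥ : Λ * ℓ ≤ R
      R≥ = *-cancel-≤ {c = + 2 * (q * q)} q²>0 (≤-via (lem q Λ ℓ A R) (0≤+ (0≤+ (0≤* {+ 2} 0≤n (diff≥0 rhombi)) (0≤* q-2≥0 A≥0)) (0≤* q≥0 (diff≥0 A≥))))
        where
        q²>0 : 0ℤ < + 2 * (q * q)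
        q²>0 = <-≤-trans {j = + 2 * (+ 1 * + 1)} (ℤ.+<+ (ℕ.s≤s ℕ.z≤n)) (≤-*ˡ {+ 1 * + 1} {q * q} {+ 2} 0≤n (≤-* {+ 1} {q} {+ 1} {q} 0≤n q≥0 q≥1 q≥1))
          where q≥1 : 1ℤ ≤ q
                q≥1 = ℤ.+≤+ (ℕₚ.≤-trans (ℕₚ.n≤1+n 1) card>1)
        A≥0 : 0ℤ ≤ A
        A≥0 = ≤-trans (0≤* (0≤* {+ 4 * q} (0≤* {+ 4} {q} 0≤n q≥0) Λ≥0) (<⇒≤ ℓ>0)) A≥
        lem : ∀ q L l A R → + 2 * (q * q) * R - + 2 * (q * q) * (L * l) ≡ + 2 * (q * q * R - ((q - 1ℤ) * A - L * (q * q) * l)) + (q - + 2) * A + q * (A - + 4 * q * L * l)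
        lem = solve-∀

      -- At least Λℓ rhombi face at most 6ℓ defects; this is where 7 ≤ Λ comes from.
      more : ∑³ (λ a x y → T a x y * bad a x y) < R
      more = ≤-<-trans few (<-≤-trans (1+≤⇒< (≤-via (lem ℓ) (diff≥0 (<⇒1+≤ ℓ>0)))) (≤-trans (≤-*ʳ (<⇒≤ ℓ>0) 7≤Λ) R≥))
        where lem : ∀ l → + 7 * l - (1ℤ + + 6 * l) ≡ l - (1ℤ + 0ℤ)
              lem = solve-∀

      bad≥0 : ∀ a x y → 0ℤ ≤ bad a x y
      bad≥0 a x y = 0≤+ (0≤+ (⟦⟧≥0 (y ≟ᵛ (a +[ 𝟙 ] x))) (⟦⟧≥0 (x ≟ᵛ (a +[ 𝟙 ] y)))) (0≤+ (low≥0 (a +[ 𝟙 ] x)) (low≥0 y))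

      n : ℤ
      n = ∑ pts ε

      -- Degrees are at most 2q, so 8q²Λ ≤ ℓ ≤ 2qn.
      n>4q : + 4 * q < n
      n>4q = ≰⇒> λ n≤ → <-irrefl refl (<-≤-trans (<-≤-trans gap many) (≤-trans ℓ≤ (≤-*ʳ {n} {+ 4 * q} {+ 2 * q} (0≤* {+ 2} {q} 0≤n q≥0) n≤)))
        where
        ℓ≤ : ℓ ≤ n * (+ 2 * q)
        ℓ≤ = ≤-trans (∑-mono pts λ x → ≤-*ˡ (ε≥0 x) (≤-trans (∑-mono pts λ y → ≤-drop (N≥0 x y) (ε≤1 y)) (≤-trans (≤-reflexive (sphere-count x)) (circle-size≤ t)))) (≤-reflexive (∑-*ʳ pts ε (+ 2 * q)))
        q≥1 : 1ℤ ≤ q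
        q≥1 = ℤ.+≤+ (ℕₚ.≤-trans (ℕₚ.n≤1+n 1) card>1)
        gap : + 4 * q * (+ 2 * q) < + 8 * (q * q) * Λ
        gap = <-≤-trans (1+≤⇒< (≤-via (lem q) (0≤+ (0≤* {+ 8} 0≤n (diff≥0 (≤-* {1ℤ} {q} {1ℤ} {q} 0≤n q≥0 q≥1 q≥1))) (0≤n {7})))) (≤-*ˡ {+ 2} {Λ} {+ 8 * (q * q)} (0≤* {+ 8} 0≤n (0≤sq q)) (≤-trans (ℤ.+≤+ (ℕ.s≤s (ℕ.s≤s ℕ.z≤n))) 7≤Λ))
          where lem : ∀ q → + 8 * (q * q) * + 2 - (1ℤ + + 4 * q * (+ 2 * q)) ≡ + 8 * (q * q - 1ℤ * 1ℤ) + + 7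
                lem = solve-∀

      -- The degree of c exceeds 2, and by `circle-section≤2` at most two of its neighbours are
      -- shared with c′.
      only : ∀ c c′ → c ≢ c′ → ¬ (deg c ≤ + 2) → ∃[ z ] (z ∈ E × dist c z ≡ t × dist c′ z ≢ t)
      only c c′ c≢c′ high = extract (∑-exists pts (λ z → N c z * ε z * N c′ z) (λ z → N c z * ε z) (≤-<-trans shared (≰⇒> high)))
        where
        shared : ∑ pts (λ z → N c z * ε z * N c′ z) ≤ + 2
        shared = begin
          ∑ pts (λ z → N c z * ε z * N c′ z) ≤⟨ ∑-mono pts (λ z → ≤-trans (≤-reflexive (lem (N c z) (ε z) (N c′ z))) (≤-drop (0≤* (N≥0 c z) (N≥0 c′ z)) (ε≤1 z))) ⟩
          ∑ pts (λ z → N c z * N c′ z) ≡⟨ common-neighbours c c′ ⟩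
          push (c′ +[ ⊝ 𝟙 ] c) (sphere t) (half ⊗ dot (c′ +[ ⊝ 𝟙 ] c) (c′ +[ ⊝ 𝟙 ] c)) ≤⟨ circle-section≤2 t≢0 (c′ +[ ⊝ 𝟙 ] c) (λ e → c≢c′ (sym (-‿zero c′ c e))) _ ⟩
          + 2 ∎
          where lem : ∀ a e b → a * e * b ≡ a * b * e
                lem = solve-∀
        extract : ∃[ z ] (z ∈ pts × N c z * ε z * N c′ z < N c z * ε z) → ∃[ z ] (z ∈ E × dist c z ≡ t × dist c′ z ≢ t)
        extract (z , _ , p) = let (pos , none) = excluded (0≤* (N≥0 c z) (ε≥0 z)) (N≥0 c′ z) p
                                  (on , pos′) = pos-split (dist c z ≟ t) {ε z} pos
                                  (z∈ , _) = ε-true {z} {1ℤ} (<-≤-trans pos′ (≤-reflexive (sym (ℤₚ.*-identityʳ (ε z)))))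
                              in z , z∈ , on , ⟦⟧-false (dist c′ z ≟ t) none

      -- The two circles have at most 2q points each, so they cannot cover E.
      neither : ∀ c c′ → ∃[ z ] (z ∈ E × dist c z ≢ t × dist c′ z ≢ t)
      neither c c′ = extract (∑-exists pts (λ z → ε z * (N c z + N c′ z)) ε (≤-<-trans shared n>4q))
        where
        shared : ∑ pts (λ z → ε z * (N c z + N c′ z)) ≤ + 4 * q
        shared = begin
          ∑ pts (λ z → ε z * (N c z + N c′ z)) ≤⟨ ∑-mono pts (λ z → ≤-trans (≤-reflexive (ℤₚ.*-comm (ε z) _)) (≤-drop (0≤+ (N≥0 c z) (N≥0 c′ z)) (ε≤1 z))) ⟩
          ∑ pts (λ z → N c z + N c′ z) ≡⟨ trans (∑-+ pts (N c) (N c′)) (cong₂ _+_ (sphere-count c) (sphere-count c′)) ⟩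
          σ + σ ≤⟨ ℤₚ.+-mono-≤ (circle-size≤ t) (circle-size≤ t) ⟩
          + 2 * q + + 2 * q ≡⟨ lem q ⟩
          + 4 * q ∎
          where lem : ∀ q → + 2 * q + + 2 * q ≡ + 4 * q
                lem = solve-∀
        extract : ∃[ z ] (z ∈ pts × ε z * (N c z + N c′ z) < ε z) → ∃[ z ] (z ∈ E × dist c z ≢ t × dist c′ z ≢ t)
        extract (z , _ , p) = let (pos , none) = excluded (ε≥0 z) (0≤+ (N≥0 c z) (N≥0 c′ z)) p
                                  (z∈ , _) = ε-true {z} {1ℤ} (<-≤-trans pos (≤-reflexive (sym (ℤₚ.*-identityʳ (ε z)))))
                              in z , z∈ , ⟦⟧-false (dist c z ≟ t) (sum-zeroˡ (N≥0 c z) (N≥0 c′ z) none) , ⟦⟧-false (dist c′ z ≟ t) (sum-zeroʳ (N≥0 c z) (N≥0 c′ z) none)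

      Goal : Set
      Goal = ∃[ C ] (SubsetOf F E C × Shatters F t E C × length C ≡ 2)

      rhombus : ∀ {a x y} → T a x y * bad a x y < T a x y → Goal
      rhombus {a} {x} {y} p =
        let (pos , none)   = excluded (T≥0 a x y) (bad≥0 a x y) p
            (on-a , pos₁)  = pos-split (dot a a ≟ t) {X a x * (N x y * X a y)} pos
            (x∈ , pos₂)    = ε-true {x} (<-≤-trans pos₁ (≤-reflexive (ℤₚ.*-assoc (ε x) (ε (a +[ 𝟙 ] x)) _)))
            (ax∈ , pos₃)   = ε-true {a +[ 𝟙 ] x} pos₂
            (on-xy , pos₄) = pos-split (dist x y ≟ t) {X a y} pos₃
            (y∈ , pos₅)    = ε-true {y} pos₄
            (ay∈ , _)      = ε-true {a +[ 𝟙 ] y} {1ℤ} (<-≤-trans pos₅ (≤-reflexive (sym (ℤₚ.*-identityʳ (ε (a +[ 𝟙 ] y))))))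
            b₁≥0 = ⟦⟧≥0 (y ≟ᵛ (a +[ 𝟙 ] x))
            b₂≥0 = ⟦⟧≥0 (x ≟ᵛ (a +[ 𝟙 ] y))
            b₃≥0 = low≥0 (a +[ 𝟙 ] x)
            b₁₂ = sum-zeroˡ (0≤+ b₁≥0 b₂≥0) (0≤+ b₃≥0 (low≥0 y)) none
            b₃₄ = sum-zeroʳ (0≤+ b₁≥0 b₂≥0) (0≤+ b₃≥0 (low≥0 y)) none
        in conclude (a +[ 𝟙 ] x) y x (a +[ 𝟙 ] y) ax∈ y∈ x∈ ay∈
             (λ e → ⟦⟧-false (y ≟ᵛ (a +[ 𝟙 ] x)) (sum-zeroˡ b₁≥0 b₂≥0 b₁₂) (sym e))
             (⟦⟧-false (x ≟ᵛ (a +[ 𝟙 ] y)) (sum-zeroʳ b₁≥0 b₂≥0 b₁₂))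
             (⟦⟧-false (deg (a +[ 𝟙 ] x) ℤₚ.≤? + 2) (sum-zeroˡ b₃≥0 (low≥0 y) b₃₄))
             (⟦⟧-false (deg y ℤₚ.≤? + 2) (sum-zeroʳ b₃≥0 (low≥0 y) b₃₄))
             (trans (dist-sym _ x) (trans (dist-translate x a) on-a)) (trans (dist-shift a x y) on-xy)
             (trans (dist-sym y x) on-xy) (trans (dist-translate y a) on-a)
        where
        conclude : ∀ c₁ c₂ u v → c₁ ∈ E → c₂ ∈ E → u ∈ E → v ∈ E → c₁ ≢ c₂ → u ≢ v → ¬ (deg c₁ ≤ + 2) → ¬ (deg c₂ ≤ + 2) →
                   dist c₁ u ≡ t → dist c₁ v ≡ t → dist c₂ u ≡ t → dist c₂ v ≡ t → Goal
        conclude c₁ c₂ u v c₁∈ c₂∈ u∈ v∈ c₁≢c₂ u≢v high₁ high₂ u₁ v₁ u₂ v₂ =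
          c₁ ∷ c₂ ∷ [] , (((c₁≢c₂ All.∷ All.[]) AllPairs.∷ (All.[] AllPairs.∷ AllPairs.[])) , λ { _ (here refl) → c₁∈ ; _ (there (here refl)) → c₂∈ }) ,
          shatter-criterion u v u∈ v∈ u≢v (λ { _ (here refl) → u₁ , v₁ ; _ (there (here refl)) → u₂ , v₂ })
            (λ f x₀ x₀∈ e₀ → exact f (f c₁) (f c₂) refl refl x₀ x₀∈ e₀) , refl
          where
          Exact : (V → Bool) → Set
          Exact f = ∃[ y ] (y ∈ E × ∀ x → x ∈ c₁ ∷ c₂ ∷ [] → (f x ≡ true → dist x y ≡ t) × (f x ≡ false → dist x y ≢ t))
          yes-at : ∀ {b : Bool} {P : Set} → b ≡ true → P → (b ≡ true → P) × (b ≡ false → ¬ P)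
          yes-at refl p = (λ _ → p) , λ ()
          no-at : ∀ {b : Bool} {P : Set} → b ≡ false → ¬ P → (b ≡ true → P) × (b ≡ false → ¬ P)
          no-at refl p = (λ ()) , λ _ → p
          exact : ∀ f b₁ b₂ → f c₁ ≡ b₁ → f c₂ ≡ b₂ → ∀ x₀ → x₀ ∈ c₁ ∷ c₂ ∷ [] → f x₀ ≡ false → Exact f
          exact f true true e₁ e₂ _ (here refl) e₀ = contradiction (trans (sym e₁) e₀) λ ()
          exact f true true e₁ e₂ _ (there (here refl)) e₀ = contradiction (trans (sym e₂) e₀) λ ()
          exact f true false e₁ e₂ _ _ _ = let (z , z∈ , on , off) = only c₁ c₂ c₁≢c₂ high₁ in
            z , z∈ , λ { _ (here refl) → yes-at e₁ on ; _ (there (here refl)) → no-at e₂ off }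
          exact f false true e₁ e₂ _ _ _ = let (z , z∈ , on , off) = only c₂ c₁ (c₁≢c₂ ∘ sym) high₂ in
            z , z∈ , λ { _ (here refl) → no-at e₁ off ; _ (there (here refl)) → yes-at e₂ on }
          exact f false false e₁ e₂ _ _ _ = let (z , z∈ , off₁ , off₂) = neither c₁ c₂ in
            z , z∈ , λ { _ (here refl) → no-at e₁ off₁ ; _ (there (here refl)) → no-at e₂ off₂ }

    planar : ∃[ C ] (SubsetOf F E C × Shatters F t E C × length C ≡ 2)
    planar = let (a , _ , p) = ∑-exists pts _ _ more
                 (x , _ , p′) = ∑-exists pts _ _ p
                 (y , _ , p″) = ∑-exists pts _ _ p′
             in rhombus {a} {x} {y} p″

-- Shattered sets in dimension at least three

module SphereIntersections (F : FiniteField) (2≢0 : FiniteField._+_ F (FiniteField.1# F) (FiniteField.1# F) ≢ FiniteField.0# F) where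
  open Field F
  open Odd 2≢0
  open Geometry F

  private variable d k : ℕ

  infixl 6 _∸ᵛ_
  _∸ᵛ_ : Vec Carrier d → Vec Carrier d → Vec Carrier d
  x ∸ᵛ u = x +[ ⊝ 𝟙 ] u

  private
    minus-one : ∀ x y → x ⊕ ⊝ 𝟙 ⊗ y ≡ x ⊕ ⊝ y
    minus-one x y = cong (x ⊕_) (trans (sym (-‿distribˡ-* 𝟙 y)) (cong ⊝_ (*-identityˡ y)))

  dist-difference : ∀ (x u : Vec Carrier d) → dist x u ≡ dot (x ∸ᵛ u) (x ∸ᵛ u)
  dist-difference []      []      = refl
  dist-difference (a ∷ x) (b ∷ u) = cong₂ _⊕_ (sym (cong (λ z → z ⊗ z) (minus-one a b))) (dist-difference x u)

  dist-line : ∀ (x u z : Vec Carrier d) c → dist (x +[ c ] z) u ≡ dist x u ⊕ c ⊗ (dot z (x ∸ᵛ u) ⊕ dot z (x ∸ᵛ u) ⊕ c ⊗ dot z z)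
  dist-line []      []      []      c = solve 1 (λ c → con 0ℤ := con 0ℤ :+ c :* (con 0ℤ :+ con 0ℤ :+ c :* con 0ℤ)) refl c
  dist-line (a ∷ x) (b ∷ u) (e ∷ z) c = trans (cong ((a ⊕ c ⊗ e ⊕ ⊝ b) ⊗ (a ⊕ c ⊗ e ⊕ ⊝ b) ⊕_) (dist-line x u z c))
    (trans (solve 7 (λ a b c e p r s → (a :+ c :* e :+ :- b) :* (a :+ c :* e :+ :- b) :+ (p :+ c :* (r :+ r :+ c :* s)) :=
      (a :+ :- b) :* (a :+ :- b) :+ p :+ c :* (e :* (a :+ :- b) :+ r :+ (e :* (a :+ :- b) :+ r) :+ c :* (e :* e :+ s))) refl a b c e (dist x u) (dot z (x ∸ᵛ u)) (dot z z))
      (cong (λ y → (a ⊕ ⊝ b) ⊗ (a ⊕ ⊝ b) ⊕ dist x u ⊕ c ⊗ (e ⊗ y ⊕ dot z (x ∸ᵛ u) ⊕ (e ⊗ y ⊕ dot z (x ∸ᵛ u)) ⊕ c ⊗ (e ⊗ e ⊕ dot z z))) (sym (minus-one a b))))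

  dist-centre : ∀ (x u v : Vec Carrier d) → dist x v ≡ dist x u ⊕ dot (v ∸ᵛ u) (v ∸ᵛ u) ⊕ ⊝ (dot (v ∸ᵛ u) (x ∸ᵛ u) ⊕ dot (v ∸ᵛ u) (x ∸ᵛ u))
  dist-centre []      []      []      = solve 0 (con 0ℤ := con 0ℤ :+ con 0ℤ :+ :- (con 0ℤ :+ con 0ℤ)) refl
  dist-centre (a ∷ x) (b ∷ u) (e ∷ v) = trans (cong ((a ⊕ ⊝ e) ⊗ (a ⊕ ⊝ e) ⊕_) (dist-centre x u v))
    (trans (solve 6 (λ a b e p r s → (a :+ :- e) :* (a :+ :- e) :+ (p :+ r :+ :- (s :+ s)) := (a :+ :- b) :* (a :+ :- b) :+ p :+ ((e :+ :- b) :* (e :+ :- b) :+ r) :+ :- ((e :+ :- b) :* (a :+ :- b) :+ s :+ ((e :+ :- b) :* (a :+ :- b) :+ s))) refl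
        a b e (dist x u) (dot (v ∸ᵛ u) (v ∸ᵛ u)) (dot (v ∸ᵛ u) (x ∸ᵛ u)))
      (cong₂ (λ y z → (a ⊕ ⊝ b) ⊗ (a ⊕ ⊝ b) ⊕ dist x u ⊕ (y ⊗ y ⊕ dot (v ∸ᵛ u) (v ∸ᵛ u)) ⊕ ⊝ (y ⊗ z ⊕ dot (v ∸ᵛ u) (x ∸ᵛ u) ⊕ (y ⊗ z ⊕ dot (v ∸ᵛ u) (x ∸ᵛ u)))) (sym (minus-one e b)) (sym (minus-one a b))))

  -- If no line in the direction z lies on the set, then each such line meets it at most twice.
  few-on-lines : ∀ {S : Vec Carrier d → Set} (S? : ∀ x → Dec (S x)) (ws : Vec (Vec Carrier d) k) (c : Vec Carrier k) (u z : Vec Carrier d) (r : Carrier) →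
    Dual ws → dots ws z ≡ 0ᵛ → (∀ x → S x → dots ws x ≡ c) → (∀ x → S x → dist x u ≡ r) →
    (∀ x → S x → ¬ (dot z z ≡ 𝟘 × dot z (x ∸ᵛ u) ≡ 𝟘)) →
    q ℤ.^ suc k * ∑ (allPoints d) (λ x → ⟦ S? x ⟧) ≤ + 2 * q ℤ.^ d
  few-on-lines {d} {k} {S} S? ws c u z r dual ws⊥z flat on-sphere transversal = begin
    q ℤ.^ suc k * ∑ pts (λ x → ⟦ S? x ⟧) ≡⟨ arrange q (q ℤ.^ k) (∑ pts (λ x → ⟦ S? x ⟧)) ⟩
    q ℤ.^ k * (q * ∑ pts (λ x → ⟦ S? x ⟧)) ≡⟨ cong (q ℤ.^ k *_) (trans (sym (∑-const elements _)) (trans (∑-cong elements λ a → sym (∑-translate (λ x → ⟦ S? x ⟧) a z)) (∑-swap elements pts _))) ⟩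
    q ℤ.^ k * ∑ pts (λ x → ∑ elements (λ a → ⟦ S? (x +[ a ] z) ⟧)) ≤⟨ ≤-*ˡ (0≤^ k) (∑-mono pts λ x → per-line x (Any.any? (λ a → S? (x +[ a ] z)) elements)) ⟩
    q ℤ.^ k * ∑ pts (λ x → + 2 * ⟦ dots ws x ≟ᵛ c ⟧) ≡⟨ trans (cong (q ℤ.^ k *_) (∑-* pts (+ 2) _)) (arrange′ (q ℤ.^ k) (∑ pts (λ x → ⟦ dots ws x ≟ᵛ c ⟧))) ⟩
    + 2 * (q ℤ.^ k * ∑ pts (λ x → ⟦ dots ws x ≟ᵛ c ⟧)) ≡⟨ cong (+ 2 *_) (fibre-size ws dual c) ⟩
    + 2 * q ℤ.^ d ∎
    where
    open ℤₚ.≤-Reasoning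
    pts = allPoints d
    0≤^ : ∀ k → 0ℤ ≤ q ℤ.^ k
    0≤^ zero    = 0≤n
    0≤^ (suc k) = 0≤* (0≤n {card}) (0≤^ k)
    arrange : ∀ a b c → a * b * c ≡ b * (a * c)
    arrange = solve-∀
    arrange′ : ∀ a b → a * (+ 2 * b) ≡ + 2 * (a * b)
    arrange′ = solve-∀
    per-line : ∀ x → Dec (Any.Any (λ a → S (x +[ a ] z)) elements) → ∑ elements (λ a → ⟦ S? (x +[ a ] z) ⟧) ≤ + 2 * ⟦ dots ws x ≟ᵛ c ⟧
    per-line x (no none) = ≤-trans (≤-reflexive (∑-zero elements λ a → ⟦⟧-no (S? (x +[ a ] z)) λ s → none (lose (elements-complete a) s))) (0≤* {+ 2} 0≤n (⟦⟧≥0 (dots ws x ≟ᵛ c)))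
    per-line x (yes some) = ≤-trans (∑-mono elements λ a → two a (S? (x +[ a ] z)))
        (≤-reflexive (trans (∑-+ elements (λ a → ⟦ a ≟ a₀ ⟧) (λ a → ⟦ a ≟ a₀ ⊕ other ⟧)) (trans (cong₂ _+_ (∑-δ1 a₀) (∑-δ1 (a₀ ⊕ other))) (cong (+ 2 *_) (sym (⟦⟧-yes (dots ws x ≟ᵛ c) on-flat))))))
      where
      a₀ : Carrier
      a₀ = proj₁ (Any.satisfied some)
      x₀ : Vec Carrier d
      x₀ = x +[ a₀ ] z
      S₀ : S x₀
      S₀ = proj₂ (Any.satisfied some)
      on-flat : dots ws x ≡ c
      on-flat = trans (sym (trans (dots-+ ws x a₀ z) (trans (cong (dots ws x +[ a₀ ]_) ws⊥z) (+[]-0 _ a₀)))) (flat x₀ S₀)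
      B Z other : Carrier
      B = dot z (x₀ ∸ᵛ u)
      Z = dot z z
      other = inv Z ⊗ ⊝ (B ⊕ B)
      root : ∀ a → S (x +[ a ] z) → (a ⊕ ⊝ a₀) ⊗ (B ⊕ B ⊕ (a ⊕ ⊝ a₀) ⊗ Z) ≡ 𝟘
      root a s = ⊕-cancelˡ {dist x₀ u} (trans (sym (dist-line x₀ u z (a ⊕ ⊝ a₀))) (trans (cong (λ v → dist v u) (trans (+[]-assoc x a₀ (a ⊕ ⊝ a₀) z) (cong (x +[_] z) (solve 2 (λ a b → b :+ (a :+ :- b) := a) refl a a₀))))
        (trans (on-sphere _ s) (trans (sym (on-sphere x₀ S₀)) (sym (+-identityʳ _))))))
      second : ∀ a → a ≢ a₀ → S (x +[ a ] z) → a ≡ a₀ ⊕ other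
      second a a≢a₀ s = by-cases (Z ≟ 𝟘)
        where
        linear : B ⊕ B ⊕ (a ⊕ ⊝ a₀) ⊗ Z ≡ 𝟘
        linear = domain (root a s) (λ e → a≢a₀ (⊟≡0⇒≡ e))
        by-cases : Dec (Z ≡ 𝟘) → a ≡ a₀ ⊕ other
        by-cases (yes Z≡0) = contradiction (Z≡0 , half-zero (trans (sym (trans (cong (λ y → B ⊕ B ⊕ (a ⊕ ⊝ a₀) ⊗ y) Z≡0) (trans (cong (B ⊕ B ⊕_) (zeroʳ _)) (+-identityʳ _)))) linear)) (transversal x₀ S₀)
          where
          half-zero : B ⊕ B ≡ 𝟘 → B ≡ 𝟘
          half-zero e = trans (sym (half-double B)) (trans (sym (distribˡ half B B)) (trans (cong (half ⊗_) e) (zeroʳ half)))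
        by-cases (no Z≢0) = trans (solve 2 (λ a b → a := b :+ (a :+ :- b)) refl a a₀) (cong (a₀ ⊕_) (⊗-cancelˡ Z≢0 (trans
          (trans (solve 3 (λ Z e B → Z :* e := (B :+ B :+ e :* Z) :+ :- (B :+ B)) refl Z (a ⊕ ⊝ a₀) B) (trans (cong (_⊕ ⊝ (B ⊕ B)) linear) (+-identityˡ _)))
          (sym (trans (sym (*-assoc Z (inv Z) _)) (trans (cong (_⊗ ⊝ (B ⊕ B)) (inv-right Z≢0)) (*-identityˡ _)))))))
      two : ∀ a (s : Dec (S (x +[ a ] z))) → ⟦ s ⟧ ≤ ⟦ a ≟ a₀ ⟧ + ⟦ a ≟ a₀ ⊕ other ⟧
      two a (no _)  = 0≤+ (⟦⟧≥0 (a ≟ a₀)) (⟦⟧≥0 (a ≟ a₀ ⊕ other))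
      two a (yes s) = by-cases (a ≟ a₀)
        where
        by-cases : (e : Dec (a ≡ a₀)) → 1ℤ ≤ ⟦ e ⟧ + ⟦ a ≟ a₀ ⊕ other ⟧
        by-cases (yes _) = ℤₚ.+-mono-≤ (≤-refl {1ℤ}) (⟦⟧≥0 (a ≟ a₀ ⊕ other))
        by-cases (no p)  = ≤-trans (≤-reflexive (sym (⟦⟧-yes (a ≟ a₀ ⊕ other) (second a p s)))) (≤-reflexive (sym (ℤₚ.+-identityˡ _)))

  private
    self-dot : ∀ (z e : Vec Carrier d) → dot (z +[ 𝟙 ] e) (z +[ 𝟙 ] e) ≡ dot z z ⊕ (dot z e ⊕ dot z e) ⊕ dot e e
    self-dot []      []      = solve 0 (con 0ℤ := con 0ℤ :+ (con 0ℤ :+ con 0ℤ) :+ con 0ℤ) refl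
    self-dot (a ∷ z) (b ∷ e) = trans (cong₂ (λ x y → x ⊗ x ⊕ y) (cong (a ⊕_) (*-identityˡ b)) (self-dot z e))
      (solve 5 (λ a b p r s → (a :+ b) :* (a :+ b) :+ (p :+ (r :+ r) :+ s) := a :* a :+ p :+ (a :* b :+ r :+ (a :* b :+ r)) :+ (b :* b :+ s)) refl a b (dot z z) (dot z e) (dot e e))

  -- A vector z ⊥ ws outside span ws has e ⊥ ws with z·e = 1; then z, e or z + e is anisotropic.
  anisotropic : ∀ (ws : Vec (Vec Carrier d) k) (e : Vec Carrier d) → suc k ℕ.< d →
    (∀ z c a → dots ws z ≡ 0ᵛ → dot e z ≡ 𝟘 → lincomb c ws +[ a ] z ≡ 0ᵛ → c ≡ 0ᵛ) →
    ∃[ z ] (dots ws z ≡ 0ᵛ × dot z z ≢ 𝟘)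
  anisotropic {d} {k} ws e k<d independent = from-orthogonal (orthogonal (e ∷ ws) k<d)
    where
    Result : Set
    Result = ∃[ z ] (dots ws z ≡ 0ᵛ × dot z z ≢ 𝟘)
    from-orthogonal : ∃[ z ] (z ≢ 0ᵛ × dots (e ∷ ws) z ≡ 0ᵛ) → Result
    from-orthogonal (z , z≢0 , ⊥) = split (dependent-or-dual (z ∷ ws))
      where
      ws⊥z : dots ws z ≡ 0ᵛ
      ws⊥z = cong Vec.tail ⊥
      split : Dependent (z ∷ ws) ⊎ Dual (z ∷ ws) → Result
      split (inj₁ (a ∷ c , nontrivial , rel)) = contradiction (cong₂ (λ x v → x ∷ v) a≡0 c≡0) nontrivial
        where
        c≡0 : c ≡ 0ᵛ
        c≡0 = independent z c a ws⊥z (cong Vec.head ⊥) rel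
        lincomb-0 : ∀ {k} (ws : Vec (Vec Carrier d) k) → lincomb 0ᵛ ws ≡ 0ᵛ
        lincomb-0 []       = refl
        lincomb-0 (w ∷ ws) = trans (+[0] _ w) (lincomb-0 ws)
        a≡0 : a ≡ 𝟘
        a≡0 = by-cases (a ≟ 𝟘)
          where
          by-cases : Dec (a ≡ 𝟘) → a ≡ 𝟘
          by-cases (yes p) = p
          by-cases (no p)  = contradiction (0+[]-zero z p (trans (cong (_+[ a ] z) (sym (trans (cong (λ v → lincomb v ws) c≡0) (lincomb-0 ws)))) rel)) z≢0
      split (inj₂ (es , dual)) = choose (dot z z ≟ 𝟘) (dot f f ≟ 𝟘)
        where
        f : Vec Carrier d
        f = lincomb (𝟙 ∷ 0ᵛ) es
        ws⊥f : dots ws f ≡ 0ᵛ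
        ws⊥f = cong Vec.tail (dual (𝟙 ∷ 0ᵛ))
        choose : Dec (dot z z ≡ 𝟘) → Dec (dot f f ≡ 𝟘) → Result
        choose (no p) _ = z , ws⊥z , p
        choose (yes _) (no p) = f , ws⊥f , p
        choose (yes p) (yes r) = z +[ 𝟙 ] f , trans (dots-+ ws z 𝟙 f) (trans (cong₂ (λ x y → x +[ 𝟙 ] y) ws⊥z ws⊥f) (+[]-0 0ᵛ 𝟙)) ,
          λ s → 2≢0 (trans (sym (trans (self-dot z f) (trans (cong₂ (λ x y → x ⊕ (dot z f ⊕ dot z f) ⊕ y) p r) (trans (+-identityʳ _) (trans (+-identityˡ _) (cong (λ y → y ⊕ y) (cong Vec.head (dual (𝟙 ∷ 0ᵛ))))))))) s)

  dist-zero : ∀ (x : Vec Carrier d) → dist x x ≡ 𝟘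
  dist-zero []      = refl
  dist-zero (a ∷ x) = trans (cong₂ _⊕_ (trans (cong (λ z → z ⊗ z) (-‿inverseʳ a)) (zeroˡ 𝟘)) (dist-zero x)) (+-identityˡ 𝟘)

  private
    hyperplane : ∀ {u v x : Vec Carrier d} {r s} → dist x u ≡ r → dist x v ≡ s → dot (v ∸ᵛ u) x ≡ half ⊗ (r ⊕ dot (v ∸ᵛ u) (v ∸ᵛ u) ⊕ ⊝ s) ⊕ dot (v ∸ᵛ u) u
    hyperplane {d} {u} {v} {x} {r} {s} p e = trans (solve 2 (λ a b → a := a :+ :- b :+ b) refl (dot w x) (dot w u)) (cong (_⊕ dot w u) (trans (sym difference) (trans (sym (half-double b)) (trans (sym (distribˡ half b b)) (cong (half ⊗_) doubled)))))
      where
      w = v ∸ᵛ u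
      b = dot w (x ∸ᵛ u)
      difference : b ≡ dot w x ⊕ ⊝ dot w u
      difference = trans (dot-+ʳ w x (⊝ 𝟙) u) (minus-one _ _)
      doubled : b ⊕ b ≡ r ⊕ dot w w ⊕ ⊝ s
      doubled = trans (solve 2 (λ b y → b := y :+ :- (y :+ :- b)) refl (b ⊕ b) (r ⊕ dot w w)) (cong (λ y → r ⊕ dot w w ⊕ ⊝ y) (trans (cong (λ y → y ⊕ dot w w ⊕ ⊝ (b ⊕ b)) (sym p)) (trans (sym (dist-centre x u v)) e)))

    dual-1 : ∀ (w : Vec Carrier d) → w ≢ 0ᵛ → Dual (w ∷ [])
    dual-1 {d} w w≢0 = split (dependent-or-dual (w ∷ []))
      where
      split : Dependent (w ∷ []) ⊎ Dual (w ∷ []) → Dual (w ∷ [])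
      split (inj₂ D) = D
      split (inj₁ (a ∷ [] , nontrivial , rel)) = contradiction (0+[]-zero w (λ { refl → nontrivial refl }) rel) w≢0

  -- The intersection lies in a hyperplane orthogonal to w = v - u. In dimension at least 3 there is
  -- an anisotropic z ⊥ w, and lines in the direction of such a z meet a sphere at most twice.
  two-spheres : ∀ {d} (u v : Vec Carrier (3 ℕ.+ d)) r s → u ≢ v →
    q * q * ∑ (allPoints (3 ℕ.+ d)) (λ x → ⟦ dist x u ≟ r ⟧ * ⟦ dist x v ≟ s ⟧) ≤ + 2 * q ℤ.^ (3 ℕ.+ d)
  two-spheres {d} u v r s u≢v = ≤-trans (≤-reflexive (cong₂ _*_ (cong (q *_) (sym (ℤₚ.*-identityʳ q))) (∑-cong (allPoints (3 ℕ.+ d)) λ x → sym (⟦⟧-× (dist x u ≟ r) (dist x v ≟ s)))))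
    (few-on-lines (λ x → (dist x u ≟ r) ×-dec (dist x v ≟ s)) (w ∷ []) _ u (proj₁ direction) r dual (proj₁ (proj₂ direction))
      (λ x (p , e) → cong (_∷ []) (hyperplane {x = x} p e)) (λ x → proj₁) (λ x _ (p , _) → proj₂ (proj₂ direction) p))
    where
    w = v ∸ᵛ u
    w≢0 : w ≢ 0ᵛ
    w≢0 e = u≢v (sym (-‿zero v u e))
    dual : Dual (w ∷ [])
    dual = dual-1 w w≢0
    f : Vec Carrier (3 ℕ.+ d)
    f = lincomb (𝟙 ∷ []) (proj₁ dual)
    w·f : dot w f ≡ 𝟙
    w·f = cong Vec.head (proj₂ dual (𝟙 ∷ []))
    direction : ∃[ z ] (dots (w ∷ []) z ≡ 0ᵛ × dot z z ≢ 𝟘)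
    -- Pairing a relation cw + az = 0 with f, where w·f = 1 and z·f = 0, isolates c.
    direction = anisotropic (w ∷ []) f (ℕ.s≤s (ℕ.s≤s (ℕ.s≤s ℕ.z≤n))) λ { z (c ∷ []) a _ f⊥z rel → cong (_∷ []) (begin
      c ≡⟨ solve 2 (λ c a → c := con 0ℤ :+ c :+ a :* con 0ℤ) refl c a ⟩
      𝟘 ⊕ c ⊕ a ⊗ 𝟘 ≡⟨ cong₂ (λ x y → x ⊕ a ⊗ y) (trans (cong₂ _⊕_ (sym (dot-0ˡ f)) (trans (sym (*-identityʳ c)) (cong (c ⊗_) (sym w·f)))) (sym (dot-+ˡ 0ᵛ c w f))) (trans (sym f⊥z) (dot-comm f z)) ⟩
      dot (0ᵛ +[ c ] w) f ⊕ a ⊗ dot z f ≡⟨ sym (dot-+ˡ (0ᵛ +[ c ] w) a z f) ⟩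
      dot (0ᵛ +[ c ] w +[ a ] z) f ≡⟨ cong (λ y → dot y f) rel ⟩
      dot 0ᵛ f ≡⟨ dot-0ˡ f ⟩
      𝟘 ∎) }
      where open ≡-Reasoning

  private
    -- The Gram matrix of v - u and x - u has entries a, b, b, t with 2b = a, hence determinant a(4t
    -- - a)/4. This is the origin of the two excluded values 0 and 4t of ‖u - v‖.
    gram : ∀ {a b t} → b ⊕ b ≡ a → a ≢ 𝟘 → a ≢ t ⊕ t ⊕ (t ⊕ t) → ∀ {c₁ c₂} → c₁ ⊗ a ⊕ c₂ ⊗ b ≡ 𝟘 → c₁ ⊗ b ⊕ c₂ ⊗ t ≡ 𝟘 → c₁ ≡ 𝟘 × c₂ ≡ 𝟘
    gram {a} {b} {t} 2b≡a a≢0 a≢4t {c₁} {c₂} e₁ e₂ = c₁≡0 , c₂≡0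
      where
      b≢0 : b ≢ 𝟘
      b≢0 refl = a≢0 (trans (sym 2b≡a) (+-identityˡ 𝟘))
      c₂≡ : c₁ ⊕ c₁ ⊕ c₂ ≡ 𝟘
      c₂≡ = domain (trans (solve 3 (λ b x y → b :* (x :+ x :+ y) := x :* (b :+ b) :+ y :* b) refl b c₁ c₂) (trans (cong (λ z → c₁ ⊗ z ⊕ c₂ ⊗ b) 2b≡a) e₁)) b≢0
      c₁≡0 : c₁ ≡ 𝟘
      c₁≡0 = domain (trans (*-comm _ _) (trans (cong (λ z → c₁ ⊗ (z ⊕ ⊝ (t ⊕ t ⊕ (t ⊕ t)))) (sym 2b≡a)) (trans
        (solve 4 (λ x y b t → x :* (b :+ b :+ :- (t :+ t :+ (t :+ t))) := (x :* b :+ y :* t) :+ (x :* b :+ y :* t) :+ :- (t :* (x :+ x :+ y) :+ t :* (x :+ x :+ y))) refl c₁ c₂ b t)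
        (trans (cong₂ (λ p r → p ⊕ p ⊕ ⊝ (t ⊗ r ⊕ t ⊗ r)) e₂ c₂≡) (solve 1 (λ t → con 0ℤ :+ con 0ℤ :+ :- (t :* con 0ℤ :+ t :* con 0ℤ) := con 0ℤ) refl t))))) (λ e → a≢4t (⊟≡0⇒≡ e))
      c₂≡0 : c₂ ≡ 𝟘
      c₂≡0 = trans (sym (trans (cong (λ z → z ⊕ z ⊕ c₂) c₁≡0) (trans (cong (_⊕ c₂) (+-identityˡ 𝟘)) (+-identityˡ c₂)))) c₂≡

  module ThreeSpheres {d} (t : Carrier) (u v : Vec Carrier (3 ℕ.+ d)) (uv≢0 : dist v u ≢ 𝟘) (uv≢4t : dist v u ≢ t ⊕ t ⊕ (t ⊕ t)) where
    private
      P : Set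
      P = Vec Carrier (3 ℕ.+ d)

      w₁ : P
      w₁ = v ∸ᵛ u

      w₁w₁ : dot w₁ w₁ ≢ 𝟘
      w₁w₁ e = uv≢0 (trans (dist-difference v u) e)

      bisector : ∀ x → dist x u ≡ t → dist x v ≡ t → dot w₁ (x ∸ᵛ u) ⊕ dot w₁ (x ∸ᵛ u) ≡ dot w₁ w₁
      bisector x p r = ⊕-cancelˡ {⊝ (dot w₁ (x ∸ᵛ u) ⊕ dot w₁ (x ∸ᵛ u))} (trans (-‿inverseˡ _) (sym (trans (+-comm _ _) (⊕-cancelˡ {t} (trans (trans (sym (+-assoc t _ _)) (cong (λ y → y ⊕ dot w₁ w₁ ⊕ ⊝ (dot w₁ (x ∸ᵛ u) ⊕ dot w₁ (x ∸ᵛ u))) (sym p)))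
        (trans (sym (dist-centre x u v)) (trans r (sym (+-identityʳ t)))))))))

      0+-dot : ∀ (a : Carrier) (w x : P) → dot (0ᵛ +[ a ] w) x ≡ a ⊗ dot w x
      0+-dot a w x = trans (dot-+ˡ 0ᵛ a w x) (trans (cong (_⊕ a ⊗ dot w x) (dot-0ˡ x)) (+-identityˡ _))

      module _ (y : P) (y≢u : y ≢ u) (y≢v : y ≢ v) (x₀ : P) (on-u : dist x₀ u ≡ t) (on-v : dist x₀ v ≡ t) (on-y : dist x₀ y ≡ t) where
        w₂ : P
        w₂ = y ∸ᵛ u

        r₀ : P
        r₀ = x₀ ∸ᵛ u

        -- y on the line uv would be a third point of that line on the sphere around x₀.
        dual : Dual (w₁ ∷ w₂ ∷ [])
        dual = split (dependent-or-dual (w₁ ∷ w₂ ∷ []))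
          where
          split : Dependent (w₁ ∷ w₂ ∷ []) ⊎ Dual (w₁ ∷ w₂ ∷ []) → Dual (w₁ ∷ w₂ ∷ [])
          split (inj₂ D) = D
          split (inj₁ (a ∷ b ∷ [] , nontrivial , rel)) = ⊥-elim (by-cases (b ≟ 𝟘))
            where
            by-cases : Dec (b ≡ 𝟘) → ⊥
            by-cases (yes refl) = w₁w₁ (trans (cong (λ w → dot w w) (0+[]-zero w₁ (λ { refl → nontrivial refl }) (trans (cong (_+[ a ] w₁) (sym (+[0] 0ᵛ w₂))) rel))) (dot-0ˡ {3 ℕ.+ d} 0ᵛ))
            by-cases (no b≢0) = position (c ≟ 𝟘)
              where
              c : Carrier
              c = ⊝ (inv b ⊗ a)
              on-line : ∀ {m} (w₁ w₂ : Vec Carrier m) → 0ᵛ +[ b ] w₂ +[ a ] w₁ ≡ 0ᵛ → w₂ ≡ 0ᵛ +[ c ] w₁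
              on-line [] [] _ = refl
              on-line (p ∷ w) (r ∷ w′) e = cong₂ _∷_ (⊗-cancelˡ b≢0 (trans (trans (solve 4 (λ a b p r → b :* r := (con 0ℤ :+ b :* r :+ a :* p) :+ :- (a :* p)) refl a b p r) (trans (cong (_⊕ ⊝ (a ⊗ p)) (cong Vec.head e)) (+-identityˡ _)))
                (sym (trans (solve 4 (λ a b p i → b :* (con 0ℤ :+ :- (i :* a) :* p) := :- (b :* i :* (a :* p))) refl a b p (inv b)) (cong ⊝_ (trans (cong (_⊗ (a ⊗ p)) (inv-right b≢0)) (*-identityˡ _))))))) (on-line w w′ (cong Vec.tail e))
              w₂≡ : w₂ ≡ 0ᵛ +[ c ] w₁
              w₂≡ = on-line w₁ w₂ rel
              w₂w₂ : dot w₂ w₂ ≡ c ⊗ (c ⊗ dot w₁ w₁)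
              w₂w₂ = trans (cong (λ w → dot w w) w₂≡) (trans (0+-dot c w₁ _) (cong (c ⊗_) (trans (dot-comm w₁ _) (0+-dot c w₁ w₁))))
              w₂r₀ : dot w₂ r₀ ≡ c ⊗ dot w₁ r₀
              w₂r₀ = trans (cong (λ w → dot w r₀) w₂≡) (0+-dot c w₁ r₀)
              quadratic : c ⊗ ((c ⊕ ⊝ 𝟙) ⊗ dot w₁ w₁) ≡ 𝟘
              quadratic = begin
                c ⊗ ((c ⊕ ⊝ 𝟙) ⊗ dot w₁ w₁) ≡⟨ cong (c ⊗_) (trans (distribʳ _ c (⊝ 𝟙)) (cong (c ⊗ dot w₁ w₁ ⊕_) (trans (sym (-‿distribˡ-* 𝟙 _)) (cong ⊝_ (trans (*-identityˡ _) (sym (bisector x₀ on-u on-v))))))) ⟩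
                c ⊗ (c ⊗ dot w₁ w₁ ⊕ ⊝ (dot w₁ r₀ ⊕ dot w₁ r₀)) ≡⟨ solve 3 (λ c p b → c :* (c :* p :+ :- (b :+ b)) := c :* (c :* p) :+ :- (c :* b :+ c :* b)) refl c (dot w₁ w₁) (dot w₁ r₀) ⟩
                c ⊗ (c ⊗ dot w₁ w₁) ⊕ ⊝ (c ⊗ dot w₁ r₀ ⊕ c ⊗ dot w₁ r₀) ≡⟨ cong₂ (λ x z → x ⊕ ⊝ (z ⊕ z)) (sym w₂w₂) (sym w₂r₀) ⟩
                dot w₂ w₂ ⊕ ⊝ (dot w₂ r₀ ⊕ dot w₂ r₀) ≡⟨ ⊕-cancelˡ {t} (trans (sym (+-assoc t _ _)) (trans (cong (λ z → z ⊕ dot w₂ w₂ ⊕ ⊝ (dot w₂ r₀ ⊕ dot w₂ r₀)) (sym on-u)) (trans (sym (dist-centre x₀ u y)) (trans on-y (sym (+-identityʳ t)))))) ⟩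
                𝟘 ∎
                where open ≡-Reasoning
              position : Dec (c ≡ 𝟘) → ⊥
              position (yes c≡0) = y≢u (-‿zero y u (trans w₂≡ (trans (cong (0ᵛ +[_] w₁) c≡0) (+[0] 0ᵛ w₁))))
              position (no c≢0) = y≢v (trans (sym (+[]-cancel′ y 𝟙 u)) (trans (cong (_+[ 𝟙 ] u) (trans w₂≡ (trans (cong (0ᵛ +[_] w₁) c≡1) (0+ᵛ w₁)))) (+[]-cancel′ v 𝟙 u)))
                where
                c≡1 : c ≡ 𝟙
                c≡1 = ⊟≡0⇒≡ (domain (trans (*-comm _ _) (domain quadratic c≢0)) w₁w₁)
                0+ᵛ : ∀ {m} (x : Vec Carrier m) → 0ᵛ +[ 𝟙 ] x ≡ x
                0+ᵛ []      = refl
                0+ᵛ (a ∷ x) = cong₂ _∷_ (trans (+-identityˡ _) (*-identityˡ a)) (0+ᵛ x)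

        -- By `dist-line` the excluded case is the one in which the line through x in direction z
        -- stays on the sphere around u. Anisotropy of z would be too much to ask in dimension 3,
        -- where the vectors orthogonal to w₁ and w₂ form a single line that may be isotropic.
        Transversal : P → Set
        Transversal z = ∀ x → dist x u ≡ t → dist x v ≡ t → ¬ (dot z z ≡ 𝟘 × dot z (x ∸ᵛ u) ≡ 𝟘)

        direction : ∃[ z ] (dots (w₁ ∷ w₂ ∷ []) z ≡ 0ᵛ × Transversal z)
        direction = by-dimension (3 ℕ.<? 3 ℕ.+ d)
          where
          open ≡-Reasoning
          ws : Vec P 2
          ws = w₁ ∷ w₂ ∷ []
          e₂ : P
          e₂ = lincomb (𝟘 ∷ 𝟙 ∷ []) (proj₁ dual)
          ws·e₂ : dots ws e₂ ≡ 𝟘 ∷ 𝟙 ∷ []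
          ws·e₂ = proj₂ dual (𝟘 ∷ 𝟙 ∷ [])
          -- Pairing with e₂, which is orthogonal to w₁ and z and has w₂·e₂ = 1, kills c₂; then
          -- pairing with w₁ kills c₁, as z ⊥ w₁ and w₁ is anisotropic.
          independent : ∀ z c a → dots ws z ≡ 0ᵛ → dot e₂ z ≡ 𝟘 → lincomb c ws +[ a ] z ≡ 0ᵛ → c ≡ 0ᵛ
          independent z (c₁ ∷ c₂ ∷ []) a ws⊥z e₂⊥z rel = cong₂ (λ x y → x ∷ y ∷ []) c₁≡0 c₂≡0
            where
            paired : ∀ y → c₂ ⊗ dot w₂ y ⊕ c₁ ⊗ dot w₁ y ⊕ a ⊗ dot z y ≡ 𝟘
            paired y = begin
              c₂ ⊗ dot w₂ y ⊕ c₁ ⊗ dot w₁ y ⊕ a ⊗ dot z y ≡⟨ cong (λ x → x ⊕ c₁ ⊗ dot w₁ y ⊕ a ⊗ dot z y) (sym (0+-dot c₂ w₂ y)) ⟩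
              dot (0ᵛ +[ c₂ ] w₂) y ⊕ c₁ ⊗ dot w₁ y ⊕ a ⊗ dot z y ≡⟨ cong (_⊕ a ⊗ dot z y) (sym (dot-+ˡ (0ᵛ +[ c₂ ] w₂) c₁ w₁ y)) ⟩
              dot (0ᵛ +[ c₂ ] w₂ +[ c₁ ] w₁) y ⊕ a ⊗ dot z y ≡⟨ sym (dot-+ˡ (0ᵛ +[ c₂ ] w₂ +[ c₁ ] w₁) a z y) ⟩
              dot (lincomb (c₁ ∷ c₂ ∷ []) ws +[ a ] z) y ≡⟨ trans (cong (λ x → dot x y) rel) (dot-0ˡ y) ⟩
              𝟘 ∎
            c₂≡0 : c₂ ≡ 𝟘
            c₂≡0 = trans (solve 3 (λ c₁ c₂ a → c₂ := c₂ :+ c₁ :* con 0ℤ :+ a :* con 0ℤ) refl c₁ c₂ a) (trans (cong₂ _⊕_ (cong₂ _⊕_ (trans (sym (*-identityʳ c₂)) (cong (c₂ ⊗_) (sym (cong (λ v → Vec.head (Vec.tail v)) ws·e₂)))) (cong (c₁ ⊗_) (sym (cong Vec.head ws·e₂)))) (cong (a ⊗_) (trans (sym e₂⊥z) (dot-comm e₂ z)))) (paired e₂))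
            c₁≡0 : c₁ ≡ 𝟘
            c₁≡0 = domain (trans (*-comm _ c₁) (trans (solve 4 (λ x c a y → x := con 0ℤ :* c :+ x :+ a :* con 0ℤ) refl (c₁ ⊗ dot w₁ w₁) (dot w₂ w₁) a 𝟘)
              (trans (cong₂ (λ x y → x ⊗ dot w₂ w₁ ⊕ c₁ ⊗ dot w₁ w₁ ⊕ a ⊗ y) (sym c₂≡0) (trans (sym (cong Vec.head ws⊥z)) (dot-comm w₁ z))) (paired w₁)))) w₁w₁
          -- In dimension 3 an isotropic z ⊥ w₁, x − u would be orthogonal to the basis w₁, x − u, z.
          transversal₃ : 3 ℕ.+ d ℕ.≤ 3 → ∀ z → z ≢ 0ᵛ → dots ws z ≡ 0ᵛ → Transversal z
          transversal₃ d≤ z z≢0 ws⊥z x p r (zz , zr) = impossible (dependent-⊥ (w₁ ∷ r₁ ∷ z ∷ []) z z≢0 (cong₂ (λ a v → a ∷ v) w₁z (cong₂ (λ a b → a ∷ b ∷ []) (trans (dot-comm r₁ z) zr) zz)) d≤)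
            where
            r₁ : P
            r₁ = x ∸ᵛ u
            w₁z : dot w₁ z ≡ 𝟘
            w₁z = cong Vec.head ws⊥z
            impossible : ¬ Dependent (w₁ ∷ r₁ ∷ z ∷ [])
            impossible (c₁ ∷ c₂ ∷ c₃ ∷ [] , nontrivial , rel) = nontrivial (cong₂ (λ a v → a ∷ v) (proj₁ both) (cong₂ (λ a b → a ∷ b ∷ []) (proj₂ both) c₃≡0))
              where
              paired : ∀ y → dot z y ≡ 𝟘 → c₁ ⊗ dot w₁ y ⊕ c₂ ⊗ dot r₁ y ≡ 𝟘
              paired y zy = begin
                c₁ ⊗ dot w₁ y ⊕ c₂ ⊗ dot r₁ y ≡⟨ solve 3 (λ a b c → a :+ b := c :* con 0ℤ :+ b :+ a) refl _ _ c₃ ⟩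
                c₃ ⊗ 𝟘 ⊕ c₂ ⊗ dot r₁ y ⊕ c₁ ⊗ dot w₁ y ≡⟨ cong (λ a → a ⊕ c₂ ⊗ dot r₁ y ⊕ c₁ ⊗ dot w₁ y) (trans (cong (c₃ ⊗_) (sym zy)) (sym (0+-dot c₃ z y))) ⟩
                dot (0ᵛ +[ c₃ ] z) y ⊕ c₂ ⊗ dot r₁ y ⊕ c₁ ⊗ dot w₁ y ≡⟨ cong (_⊕ c₁ ⊗ dot w₁ y) (sym (dot-+ˡ (0ᵛ +[ c₃ ] z) c₂ r₁ y)) ⟩
                dot (0ᵛ +[ c₃ ] z +[ c₂ ] r₁) y ⊕ c₁ ⊗ dot w₁ y ≡⟨ sym (dot-+ˡ (0ᵛ +[ c₃ ] z +[ c₂ ] r₁) c₁ w₁ y) ⟩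
                dot (lincomb (c₁ ∷ c₂ ∷ c₃ ∷ []) (w₁ ∷ r₁ ∷ z ∷ [])) y ≡⟨ trans (cong (λ a → dot a y) rel) (dot-0ˡ y) ⟩
                𝟘 ∎
              both : c₁ ≡ 𝟘 × c₂ ≡ 𝟘
              both = gram (bisector x p r) w₁w₁ (λ e → uv≢4t (trans (dist-difference v u) e))
                (trans (cong (λ a → c₁ ⊗ dot w₁ w₁ ⊕ c₂ ⊗ a) (dot-comm w₁ r₁)) (paired w₁ (trans (dot-comm z w₁) w₁z)))
                (trans (cong (λ a → c₁ ⊗ dot w₁ r₁ ⊕ c₂ ⊗ a) (trans (sym p) (dist-difference x u))) (paired r₁ zr))
              c₃≡0 : c₃ ≡ 𝟘
              c₃≡0 = by-cases (c₃ ≟ 𝟘)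
                where
                by-cases : Dec (c₃ ≡ 𝟘) → c₃ ≡ 𝟘
                by-cases (yes e) = e
                by-cases (no n)  = contradiction (0+[]-zero z n (trans (sym (trans (cong₂ (λ a b → 0ᵛ +[ c₃ ] z +[ a ] r₁ +[ b ] w₁) (proj₂ both) (proj₁ both)) (trans (+[0] _ w₁) (+[0] _ r₁)))) rel)) z≢0
          by-dimension : Dec (3 ℕ.< 3 ℕ.+ d) → ∃[ z ] (dots ws z ≡ 0ᵛ × Transversal z)
          by-dimension (yes d>) = let (z , ⊥ , aniso) = anisotropic ws e₂ d> independent in z , ⊥ , λ _ _ _ (e , _) → aniso e
          by-dimension (no ¬d>) = let (z , z≢0 , ⊥) = orthogonal ws (ℕ.s≤s (ℕ.s≤s (ℕ.s≤s ℕ.z≤n))) in z , ⊥ , transversal₃ (ℕₚ.≮⇒≥ ¬d>) z z≢0 ⊥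

    module _ (y : P) (y≢u : y ≢ u) (y≢v : y ≢ v) where
      private
        On : P → Set
        On x = dist x u ≡ t × (dist x v ≡ t × dist x y ≡ t)

        On? : ∀ x → Dec (On x)
        On? x = (dist x u ≟ t) ×-dec ((dist x v ≟ t) ×-dec (dist x y ≟ t))

        pts : List P
        pts = allPoints (3 ℕ.+ d)

        -- The independence of the two hyperplanes is deduced from a point of the intersection, so
        -- the empty intersection is a separate case.
        bounded-count : Dec (Any.Any On pts) → q ℤ.^ 3 * ∑ pts (λ x → ⟦ On? x ⟧) ≤ + 2 * q ℤ.^ (3 ℕ.+ d)
        bounded-count (no none) = ≤-trans (≤-reflexive (trans (cong (q ℤ.^ 3 *_) (∑-zero pts λ x → ⟦⟧-no (On? x) λ o → none (lose (Enum.complete (points (3 ℕ.+ d)) x) o))) (ℤₚ.*-zeroʳ (q ℤ.^ 3)))) (0≤* {+ 2} 0≤n (0≤^ (3 ℕ.+ d)))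
          where
          0≤^ : ∀ k → 0ℤ ≤ q ℤ.^ k
          0≤^ zero    = 0≤n
          0≤^ (suc k) = 0≤* (0≤n {card}) (0≤^ k)
        bounded-count (yes some) = let (x₀ , o₁ , o₂ , o₃) = Any.satisfied some
                                       (z , ⊥ , transversal) = direction y y≢u y≢v x₀ o₁ o₂ o₃
          in few-on-lines On? (w₁ ∷ w₂ y y≢u y≢v x₀ o₁ o₂ o₃ ∷ []) (half ⊗ (t ⊕ dot w₁ w₁ ⊕ ⊝ t) ⊕ dot w₁ u ∷ half ⊗ (t ⊕ dot (y ∸ᵛ u) (y ∸ᵛ u) ⊕ ⊝ t) ⊕ dot (y ∸ᵛ u) u ∷ []) u z t
               (dual y y≢u y≢v x₀ o₁ o₂ o₃) ⊥ (λ x (p , r , s) → cong₂ (λ a b → a ∷ b ∷ []) (hyperplane {x = x} p r) (hyperplane {x = x} p s)) (λ x → proj₁) (λ x (p , r , _) → transversal x p r)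

      three-spheres : q ℤ.^ 3 * ∑ pts (λ x → ⟦ dist x u ≟ t ⟧ * (⟦ dist x v ≟ t ⟧ * ⟦ dist x y ≟ t ⟧)) ≤ + 2 * q ℤ.^ (3 ℕ.+ d)
      three-spheres = ≤-trans (≤-reflexive (cong (q ℤ.^ 3 *_) (∑-cong pts λ x → sym (trans (⟦⟧-× (dist x u ≟ t) ((dist x v ≟ t) ×-dec (dist x y ≟ t))) (cong (⟦ dist x u ≟ t ⟧ *_) (⟦⟧-× (dist x v ≟ t) (dist x y ≟ t)))))))
        (bounded-count (Any.any? On? pts))

-- Random tuples of common neighbours

∏ : ∀ {A : Set} {m} → (A → ℤ) → Vec A m → ℤ
∏ f []       = 1ℤ
∏ f (x ∷ xs) = f x * ∏ f xs

∏≥0 : ∀ {A : Set} {f : A → ℤ} → (∀ x → 0ℤ ≤ f x) → ∀ {m} (xs : Vec A m) → 0ℤ ≤ ∏ f xs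
∏≥0 p []       = 0≤n
∏≥0 p (x ∷ xs) = 0≤* (p x) (∏≥0 p xs)

∏-* : ∀ {A : Set} (f g : A → ℤ) {m} (xs : Vec A m) → ∏ (λ x → f x * g x) xs ≡ ∏ f xs * ∏ g xs
∏-* f g []       = refl
∏-* f g (x ∷ xs) = trans (cong (f x * g x *_) (∏-* f g xs)) (lem (f x) (g x) (∏ f xs) (∏ g xs))
  where lem : ∀ a b c d → a * b * (c * d) ≡ a * c * (b * d)
        lem = solve-∀

∏-insert : ∀ {A : Set} (f : A → ℤ) {m} (xs : Vec A m) j z → ∏ f (Vec.insertAt xs j z) ≡ f z * ∏ f xs
∏-insert f xs       zero    z = refl
∏-insert f (x ∷ xs) (suc j) z = trans (cong (f x *_) (∏-insert f xs j z)) (lem (f x) (f z) (∏ f xs))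
  where lem : ∀ a b c → a * (b * c) ≡ b * (a * c)
        lem = solve-∀

∏-pos : ∀ {A : Set} {P : A → Set} (f : A → ℤ) → (∀ x {y} → 0ℤ < f x * y → P x × 0ℤ < y) → ∀ {m} (xs : Vec A m) → 0ℤ < ∏ f xs → ∀ i → P (Vec.lookup xs i)
∏-pos f split (x ∷ xs) p zero    = proj₁ (split x p)
∏-pos f split (x ∷ xs) p (suc i) = ∏-pos f split xs (proj₂ (split x p)) i

∑-∏ : ∀ {A : Set} (xs : List A) (f : A → ℤ) m → ∑ (vecs m xs) (∏ f) ≡ ∑ xs f ℤ.^ m
∑-∏ xs f zero    = refl
∑-∏ xs f (suc m) = trans (∑-vecs m xs _) (trans (∑-** xs (vecs m xs) f (∏ f)) (cong (∑ xs f *_) (∑-∏ xs f m)))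

boolEnum : Enum Bool
boolEnum = record
  { elems = true ∷ false ∷ []
  ; unique = ((λ ()) All.∷ All.[]) AllPairs.∷ (All.[] AllPairs.∷ AllPairs.[])
  ; complete = λ { true → here refl ; false → there (here refl) }
  ; _≟_ = Bool._≟_ }

fins : ∀ m → List (Fin m)
fins m = List.allFin m

length-fins : ∀ m → length (fins m) ≡ m
length-fins m = Listₚ.length-tabulate {n = m} id

module Tuples (F : FiniteField) (2≢0 : FiniteField._+_ F (FiniteField.1# F) (FiniteField.1# F) ≢ FiniteField.0# F)
              (t : ⟨ F ⟩) {d : ℕ} (E : List (Vec ⟨ F ⟩ (3 ℕ.+ d))) (E! : Unique E) where
  open Field F
  open Geometry F
  open Radon F 2≢0
  open Mixing F 2≢0
  open SphereIntersections F 2≢0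
  open Shattering F 2≢0 t
  open Indicator E E!

  D k : ℕ
  D = 3 ℕ.+ d
  k = 2 ℕ.+ d

  V : Set
  V = Vec Carrier D

  pts : List V
  pts = allPoints D

  -- An entry false imposes no condition. Exact patterns are obtained afterwards, by discarding the
  -- points that are adjacent to an entry marked false.
  adj : ∀ {m} → Vec Bool m → Vec V m → V → ℤ
  adj []          []       y = 1ℤ
  adj (true ∷ b)  (x ∷ xs) y = N x y * adj b xs y
  adj (false ∷ b) (x ∷ xs) y = adj b xs y

  degree : ∀ {m} → Vec Bool m → Vec V m → ℤ
  degree b xs = ∑ pts (λ y → ε y * adj b xs y)

  all : ∀ m → Vec Bool m
  all m = Vec.replicate m true

  adj≥0 : ∀ {m} (b : Vec Bool m) xs y → 0ℤ ≤ adj b xs y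
  adj≥0 []          []       y = 0≤n
  adj≥0 (true ∷ b)  (x ∷ xs) y = 0≤* (N≥0 x y) (adj≥0 b xs y)
  adj≥0 (false ∷ b) (x ∷ xs) y = adj≥0 b xs y

  adj≤1 : ∀ {m} (b : Vec Bool m) xs y → adj b xs y ≤ 1ℤ
  adj≤1 []          []       y = ≤-refl
  adj≤1 (true ∷ b)  (x ∷ xs) y = ≤-trans (≤-drop (N≥0 x y) (adj≤1 b xs y)) (N≤1 x y)
  adj≤1 (false ∷ b) (x ∷ xs) y = adj≤1 b xs y

  adj-all≤ : ∀ {m} (b : Vec Bool m) xs y → adj (all m) xs y ≤ adj b xs y
  adj-all≤ []          []       y = ≤-refl
  adj-all≤ (true ∷ b)  (x ∷ xs) y = ≤-*ˡ (N≥0 x y) (adj-all≤ b xs y)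
  adj-all≤ {suc m} (false ∷ b) (x ∷ xs) y = ≤-trans (≤-reflexive (ℤₚ.*-comm (N x y) (adj (all m) xs y))) (≤-trans (≤-drop (adj≥0 (all m) xs y) (N≤1 x y)) (adj-all≤ b xs y))

  adj-all : ∀ {m} (xs : Vec V m) y → adj (all m) xs y ≡ ∏ (λ x → N x y) xs
  adj-all []       y = refl
  adj-all (x ∷ xs) y = cong (N x y *_) (adj-all xs y)

  adj-remove : ∀ {m} (b : Vec Bool (suc m)) xs j y → Vec.lookup b j ≡ false → adj (Vec.removeAt b j) (Vec.removeAt xs j) y ≡ adj b xs y
  adj-remove (false ∷ b)     (x ∷ xs)      zero    y e = refl
  adj-remove (true ∷ b)      (x ∷ xs)      zero    y ()
  adj-remove {suc m} (true ∷ b@(_ ∷ _))  (x ∷ xs@(_ ∷ _))  (suc j) y e = cong (N x y *_) (adj-remove b xs j y e)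
  adj-remove {suc m} (false ∷ b@(_ ∷ _)) (x ∷ xs@(_ ∷ _)) (suc j) y e = adj-remove b xs j y e

  adj-pos : ∀ {m} (b : Vec Bool m) xs y → 0ℤ < adj b xs y → ∀ i → Vec.lookup b i ≡ true → dist (Vec.lookup xs i) y ≡ t
  adj-pos (true ∷ b)  (x ∷ xs) y p zero    e = proj₁ (pos-split (dist x y ≟ t) p)
  adj-pos (true ∷ b)  (x ∷ xs) y p (suc i) e = adj-pos b xs y (proj₂ (pos-split (dist x y ≟ t) p)) i e
  adj-pos (false ∷ b) (x ∷ xs) y p (suc i) e = adj-pos b xs y p i e

  meet : ∀ {m} → Vec Bool m → Vec V m → V → ℤ
  meet b xs z = ∑ pts (λ y → ε y * adj b xs y * N z y)

  meet≥0 : ∀ {m} (b : Vec Bool m) xs z → 0ℤ ≤ meet b xs z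
  meet≥0 b xs z = ∑-≥0 pts λ y → 0≤* (0≤* (ε≥0 y) (adj≥0 b xs y)) (N≥0 z y)

  module Select (K′ : ℤ) (K′>0 : 0ℤ < K′) (K′≥ : + 4 * (+ D * (+ 2) ℤ.^ k) ≤ K′) where
    -- A tuple counts as rich from K common neighbours on. The factor 4D is consumed in
    -- `few-overlaps`.
    K : ℤ
    K = + 4 * + D * K′

    poor : Vec V k → ℤ
    poor xs = ⟦ degree (all k) xs ℤₚ.<? K ⟧

    -- The bad event that z is adjacent to at least the fraction 1/D of the points that match the
    -- mask b. It is counted for rich tuples alone, because poor ones are defective already.
    separable : Vec Bool k → Vec V k → V → ℤ
    separable b xs z = ⟦ K ℤₚ.≤? degree (all k) xs ⟧ * ⟦ degree b xs ℤₚ.≤? + D * meet b xs z ⟧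

    masks : List (Vec Bool k)
    masks = vecs k (true ∷ false ∷ [])

    defect : Vec V k → V → ℤ
    defect xs z = poor xs + ∑ masks (λ b → separable b xs z)

    separable≥0 : ∀ b xs z → 0ℤ ≤ separable b xs z
    separable≥0 b xs z = 0≤* (⟦⟧≥0 (K ℤₚ.≤? degree (all k) xs)) (⟦⟧≥0 (degree b xs ℤₚ.≤? + D * meet b xs z))

    defect≥0 : ∀ xs z → 0ℤ ≤ defect xs z
    defect≥0 xs z = 0≤+ (⟦⟧≥0 (degree (all k) xs ℤₚ.<? K)) (∑-≥0 masks λ b → separable≥0 b xs z)

    defects : Vec V D → ℤ
    defects xs = ∑ (fins D) (λ j → defect (Vec.removeAt xs j) (Vec.lookup xs j))

    Goal : Set
    Goal = ∃[ C ] (SubsetOf F E C × Shatters F t E C × length C ≡ D)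

    module _ (xs : Vec V D) (perfect : defects xs ≡ 0ℤ) where
      private
        clean : ∀ j → defect (Vec.removeAt xs j) (Vec.lookup xs j) ≡ 0ℤ
        clean j = ∑-vanish (fins D) (λ j → defect≥0 (Vec.removeAt xs j) (Vec.lookup xs j)) (≤-reflexive perfect) (∈-allFin j)

        rich : ∀ j → K ≤ degree (all k) (Vec.removeAt xs j)
        rich j = ≮⇒≥ (⟦⟧-false (degree (all k) (Vec.removeAt xs j) ℤₚ.<? K) (sum-zeroˡ (⟦⟧≥0 (degree (all k) (Vec.removeAt xs j) ℤₚ.<? K))
          (∑-≥0 masks λ b → separable≥0 b (Vec.removeAt xs j) (Vec.lookup xs j)) (clean j)))

        separated : ∀ j b → + D * meet b (Vec.removeAt xs j) (Vec.lookup xs j) < degree b (Vec.removeAt xs j)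
        separated j b = ≰⇒> (⟦⟧-false (degree b x′ ℤₚ.≤? + D * meet b x′ z) (trans (sym (ℤₚ.*-identityˡ _)) (trans (cong (_* ⟦ degree b x′ ℤₚ.≤? + D * meet b x′ z ⟧) (sym (⟦⟧-yes (K ℤₚ.≤? degree (all k) x′) (rich j))))
          (∑-vanish masks (λ b → separable≥0 b x′ z) (≤-reflexive (sum-zeroʳ (⟦⟧≥0 (degree (all k) x′ ℤₚ.<? K)) (∑-≥0 masks λ b → separable≥0 b x′ z) (clean j))) (Enum.complete (vecEnum boolEnum k) b)))))
          where
          x′ = Vec.removeAt xs j
          z = Vec.lookup xs j

      -- A union bound. Of the M points matching the entries true, each entry false spoils fewer
      -- than M/D, as removing this entry from tuple and mask leaves the matching points unchanged.
      -- With at most D such entries some matching point survives.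
      separate : ∀ (b : Vec Bool D) j₀ → Vec.lookup b j₀ ≡ false →
        ∃[ y ] (y ∈ E × ∀ i → (Vec.lookup b i ≡ true → dist (Vec.lookup xs i) y ≡ t) × (Vec.lookup b i ≡ false → dist (Vec.lookup xs i) y ≢ t))
      separate b j₀ e₀ = extract (∑-exists pts (λ y → φ y * hits y) φ fewer)
        where
        φ : V → ℤ
        φ y = ε y * adj b xs y
        φ≥0 : ∀ y → 0ℤ ≤ φ y
        φ≥0 y = 0≤* (ε≥0 y) (adj≥0 b xs y)
        hit : V → Fin D → ℤ
        hit y j = ⟦ Vec.lookup b j Bool.≟ false ⟧ * N (Vec.lookup xs j) y
        hit≥0 : ∀ y j → 0ℤ ≤ hit y j
        hit≥0 y j = 0≤* (⟦⟧≥0 (Vec.lookup b j Bool.≟ false)) (N≥0 (Vec.lookup xs j) y)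
        hits : V → ℤ
        hits y = ∑ (fins D) (hit y)
        M : ℤ
        M = ∑ pts φ
        r : Fin D → ℤ
        r j = ∑ pts (λ y → φ y * hit y j)
        removed : ∀ j → Vec.lookup b j ≡ false → + D * r j < M
        removed j e = ≤-<-trans (≤-reflexive (cong (+ D *_) (∑-cong pts λ y → trans (cong (φ y *_) (trans (cong (_* N (Vec.lookup xs j) y) (⟦⟧-yes (Vec.lookup b j Bool.≟ false) e)) (ℤₚ.*-identityˡ (N (Vec.lookup xs j) y))))
            (cong (λ a → ε y * a * N (Vec.lookup xs j) y) (sym (adj-remove b xs j y e))))))
          (<-≤-trans (separated j (Vec.removeAt b j)) (≤-reflexive (∑-cong pts λ y → cong (ε y *_) (adj-remove b xs j y e))))
        M>0 : 0ℤ < M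
        M>0 = ≤-<-trans (0≤* {+ D} 0≤n (∑-≥0 pts λ y → 0≤* (φ≥0 y) (hit≥0 y j₀))) (removed j₀ e₀)
        -- The strict bound is weakened to M - 1 so that it also covers the entries true, which
        -- spoil nothing; then all D entries can be summed alike.
        each : ∀ j (e : Dec (Vec.lookup b j ≡ false)) → + D * r j ≤ M - 1ℤ
        each j (yes e) = ≤-via (lem M (+ D * r j)) (diff≥0 (<⇒1+≤ (removed j e)))
          where lem : ∀ m x → m - 1ℤ - x ≡ m - (1ℤ + x)
                lem = solve-∀
        each j (no ¬e) = ≤-trans (≤-reflexive (trans (cong (+ D *_) (∑-zero pts λ y → trans (cong (λ a → φ y * (a * N (Vec.lookup xs j) y)) (⟦⟧-no (Vec.lookup b j Bool.≟ false) ¬e)) (trans (cong (φ y *_) (ℤₚ.*-zeroˡ (N (Vec.lookup xs j) y))) (ℤₚ.*-zeroʳ (φ y))))) (ℤₚ.*-zeroʳ (+ D))))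
          (≤-via (lem M) (diff≥0 (<⇒1+≤ M>0)))
          where lem : ∀ m → m - 1ℤ - 0ℤ ≡ m - (1ℤ + 0ℤ)
                lem = solve-∀
        fewer′ : ∑ pts (λ y → φ y * hits y) ≡ ∑ (fins D) r
        fewer′ = trans (∑-cong pts λ y → sym (∑-* (fins D) (φ y) _)) (∑-swap pts (fins D) _)
        fewer : ∑ pts (λ y → φ y * hits y) < M
        fewer = ≤-<-trans (≤-reflexive fewer′) (1+≤⇒< (*-cancel-≤ {c = + D} (ℤ.+<+ (ℕ.s≤s ℕ.z≤n)) (≤-via (lem (+ D) M (∑ (fins D) r)) (diff≥0 total))))
          where
          lem : ∀ D M s → D * M - D * (1ℤ + s) ≡ D * (M - 1ℤ) - D * s
          lem = solve-∀
          total : + D * ∑ (fins D) r ≤ + D * (M - 1ℤ)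
          total = ≤-trans (≤-reflexive (sym (∑-* (fins D) (+ D) r))) (≤-trans (∑-≤const (fins D) λ j → each j (Vec.lookup b j Bool.≟ false)) (≤-reflexive (cong (λ a → + a * (M - 1ℤ)) (length-fins D))))
        extract : ∃[ y ] (y ∈ pts × φ y * hits y < φ y) → _
        extract (y , _ , p) = let (pos , none) = excluded (φ≥0 y) (∑-≥0 (fins D) (hit≥0 y)) p ; (y∈ , pos′) = ε-true {y} pos in
          y , y∈ , λ i → adj-pos b xs y pos′ i , λ e → ⟦⟧-false (dist (Vec.lookup xs i) y ≟ t)
            (trans (sym (ℤₚ.*-identityˡ _)) (trans (cong (_* N (Vec.lookup xs i) y) (sym (⟦⟧-yes (Vec.lookup b i Bool.≟ false) e))) (∑-vanish (fins D) (hit≥0 y) (≤-reflexive none) (∈-allFin i))))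

module Pair (F : FiniteField) (2≢0 : FiniteField._+_ F (FiniteField.1# F) (FiniteField.1# F) ≢ FiniteField.0# F)
            (t : ⟨ F ⟩) {d : ℕ} (E : List (Vec ⟨ F ⟩ (3 ℕ.+ d))) (E! : Unique E)
            (K′ : ℤ) (K′>0 : 0ℤ < K′) (K′≥ : + 4 * (+ (3 ℕ.+ d) * (+ 2) ℤ.^ (2 ℕ.+ d)) ≤ K′) where
  open Field F
  open Geometry F
  open Mixing F 2≢0
  open SphereIntersections F 2≢0
  open Shattering F 2≢0 t
  open Indicator E E!
  open Tuples F 2≢0 t E E!
  open Select K′ K′>0 K′≥

  ξ : V → V → V → ℤ
  ξ u v x = ε x * (N x u * N x v)

  ξ≥0 : ∀ u v x → 0ℤ ≤ ξ u v x
  ξ≥0 u v x = 0≤* (ε≥0 x) (0≤* (N≥0 x u) (N≥0 x v))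

  codegree scarcity : V → V → ℤ
  codegree u v = ∑ pts (ξ u v)
  scarcity u v = ∑ (vecs k pts) (λ xs → ∏ (ξ u v) xs * poor xs)

  module _ {u v : V} (u∈ : u ∈ E) (v∈ : v ∈ E) (uv≢0 : dist v u ≢ 𝟘) (uv≢4t : dist v u ≢ t ⊕ t ⊕ (t ⊕ t))
           (rich : + 4 * + D * K′ * q ℤ.^ d ≤ codegree u v) (X>0 : 0ℤ < codegree u v) (few-poor : + 4 * + D * scarcity u v ≤ codegree u v ℤ.^ k) where
    open ThreeSpheres t u v uv≢0 uv≢4t using (three-spheres)
    private
      X Q′ : ℤ
      X = codegree u v
      Q′ = q ℤ.^ d

      X≥0 : 0ℤ ≤ X
      X≥0 = <⇒≤ X>0

      w : V → ℤ
      w = ξ u v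

      w≥0 : ∀ x → 0ℤ ≤ w x
      w≥0 = ξ≥0 u v

      pencil : V → ℤ
      pencil y = ∑ pts (λ z → w z * N z y)

      pencil≤X : ∀ y → pencil y ≤ X
      pencil≤X y = ∑-mono pts λ z → ≤-drop (w≥0 z) (N≤1 z y)

      -- Three spheres meet in at most 2q^d points; the two exceptional centres u and v are adjacent
      -- to all X common neighbours.
      pencil≤ : ∀ y → pencil y ≤ + 2 * Q′ + (⟦ y ≟ᵛ u ⟧ * X + ⟦ y ≟ᵛ v ⟧ * X)
      pencil≤ y = by-cases (y ≟ᵛ u) (y ≟ᵛ v)
        where
        δ≥0 : ∀ {P : Set} (e : Dec P) → 0ℤ ≤ ⟦ e ⟧ * X
        δ≥0 e = 0≤* (⟦⟧≥0 e) X≥0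
        by-cases : (e : Dec (y ≡ u)) (e′ : Dec (y ≡ v)) → pencil y ≤ + 2 * Q′ + (⟦ e ⟧ * X + ⟦ e′ ⟧ * X)
        by-cases (yes _) e′ = ≤-trans (pencil≤X y) (≤-via (lem X (+ 2 * Q′) (⟦ e′ ⟧ * X)) (0≤+ (0≤* {+ 2} 0≤n (q^≥0 d)) (δ≥0 e′)))
          where lem : ∀ x a b → a + (1ℤ * x + b) - x ≡ a + b
                lem = solve-∀
        by-cases (no n) (yes _) = ≤-trans (pencil≤X y) (≤-via (lem X (+ 2 * Q′)) (0≤* {+ 2} 0≤n (q^≥0 d)))
          where lem : ∀ x a → a + (0ℤ * x + 1ℤ * x) - x ≡ a
                lem = solve-∀
        by-cases (no n) (no n′) = ≤-trans (*-cancel-≤ {c = q ℤ.^ 3} q³>0 (≤-trans (≤-*ˡ (q^≥0 3) (∑-mono pts λ z →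
            ≤-trans (≤-reflexive (lem (ε z) (N z u) (N z v) (N z y))) (≤-drop (0≤* (N≥0 z u) (0≤* (N≥0 z v) (N≥0 z y))) (ε≤1 z))))
            (≤-trans (three-spheres y n n′) (≤-reflexive (lem′ q Q′)))))
            (≤-via (lem″ X (+ 2 * Q′)) (≤-refl {0ℤ}))
          where
          lem : ∀ e a b c → e * (a * b) * c ≡ a * (b * c) * e
          lem = solve-∀
          lem′ : ∀ q Q → + 2 * (q * (q * (q * Q))) ≡ q * (q * (q * 1ℤ)) * (+ 2 * Q)
          lem′ = solve-∀
          lem″ : ∀ x a → a + (0ℤ * x + 0ℤ * x) - a ≡ 0ℤ
          lem″ = solve-∀
          q³>0 : 0ℤ < q ℤ.^ 3
          q³>0 = ^>0 (ℤ.+<+ (ℕₚ.≤-trans (ℕₚ.n≤1+n 1) card>1)) 3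

      overlaps : Vec Bool k → Vec V k → ℤ
      overlaps b xs = ∑ pts (λ z → w z * ⟦ degree b xs ℤₚ.≤? + D * meet b xs z ⟧)

      -- Double counting of adjacent pairs gives M·overlaps ≤ D(2q^d·M + 2X), the term 2X coming
      -- from y = u and y = v. Each of the two summands is at most MX/(2K′): the first because X ≥
      -- 4DK′q^d, the second because M ≥ K = 4DK′.
      few-overlaps : ∀ b xs → K ≤ degree (all k) xs → K′ * overlaps b xs ≤ X
      few-overlaps b xs K≤ = *-cancel-≤ {c = + 2 * M} 2M>0 (≤-via (lem K′ M (overlaps b xs) (+ D) X Q′) (0≤+ (0≤* {+ 2 * K′} (0≤* {+ 2} 0≤n (<⇒≤ K′>0)) (diff≥0 weighted)) (0≤+ (0≤* X≥0 (diff≥0 K≤M)) (0≤* M≥0 (diff≥0 rich)))))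
        where
        M : ℤ
        M = degree b xs
        φ : V → ℤ
        φ y = ε y * adj b xs y
        φ≥0 : ∀ y → 0ℤ ≤ φ y
        φ≥0 y = 0≤* (ε≥0 y) (adj≥0 b xs y)
        φ≤1 : ∀ y → φ y ≤ 1ℤ
        φ≤1 y = ≤-trans (≤-drop (ε≥0 y) (adj≤1 b xs y)) (ε≤1 y)
        K≤M : K ≤ M
        K≤M = ≤-trans K≤ (∑-mono pts λ y → ≤-*ˡ (ε≥0 y) (adj-all≤ b xs y))
        M≥0 : 0ℤ ≤ M
        M≥0 = ∑-≥0 pts φ≥0
        2M>0 : 0ℤ < + 2 * M
        2M>0 = <-≤-trans K′>0 (≤-via (lem₀ M K′ (+ d)) (0≤+ (0≤* {+ 2} 0≤n (diff≥0 K≤M)) (0≤* (0≤+ {+ 8 * + d} {+ 23} (0≤* {+ 8} {+ d} 0≤n 0≤n) 0≤n) (<⇒≤ K′>0))))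
          where lem₀ : ∀ m k d → + 2 * m - k ≡ + 2 * (m - + 4 * (+ 3 + d) * k) + (+ 8 * d + + 23) * k
                lem₀ = solve-∀
        at : ∀ c → ∑ pts (λ y → φ y * (⟦ y ≟ᵛ c ⟧ * X)) ≤ X
        at c = ≤-trans (≤-reflexive (trans (∑-cong pts λ y → swap (φ y) ⟦ y ≟ᵛ c ⟧ X) (Sums.∑-δ (points D) (λ y → φ y * X) c)))
          (≤-trans (≤-*ʳ X≥0 (φ≤1 c)) (≤-reflexive (ℤₚ.*-identityˡ X)))
          where swap : ∀ a b c → a * (b * c) ≡ b * (a * c)
                swap = solve-∀
        ⟦≤⟧ : ∀ {a b} (e : Dec (a ≤ b)) → 0ℤ ≤ b → a * ⟦ e ⟧ ≤ b
        ⟦≤⟧ {a} (yes p) _ = ≤-trans (≤-reflexive (ℤₚ.*-identityʳ a)) p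
        ⟦≤⟧ {a} (no _)  p = ≤-trans (≤-reflexive (ℤₚ.*-zeroʳ a)) p
        open ℤₚ.≤-Reasoning
        double-count : ∑ pts (λ z → w z * meet b xs z) ≡ ∑ pts (λ y → φ y * pencil y)
        double-count = trans (∑-cong pts λ z → trans (sym (∑-* pts (w z) _)) (∑-cong pts λ y → swap (w z) (φ y) (N z y)))
          (trans (∑-swap pts pts _) (∑-cong pts λ y → ∑-* pts (φ y) _))
          where swap : ∀ a b c → a * (b * c) ≡ b * (a * c)
                swap = solve-∀
        weighted : M * overlaps b xs ≤ + D * (+ 2 * Q′ * M + (X + X))
        weighted = begin
          M * overlaps b xs ≡⟨ sym (∑-* pts M _) ⟩
          ∑ pts (λ z → M * (w z * ⟦ M ℤₚ.≤? + D * meet b xs z ⟧)) ≤⟨ ∑-mono pts (λ z → ≤-trans (≤-reflexive (swap M (w z) ⟦ M ℤₚ.≤? + D * meet b xs z ⟧))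
            (≤-*ˡ (w≥0 z) (⟦≤⟧ (M ℤₚ.≤? + D * meet b xs z) (0≤* {+ D} 0≤n (meet≥0 b xs z))))) ⟩
          ∑ pts (λ z → w z * (+ D * meet b xs z)) ≡⟨ trans (∑-cong pts λ z → swap (w z) (+ D) (meet b xs z)) (trans (∑-* pts (+ D) _) (cong (+ D *_) double-count)) ⟩
          + D * ∑ pts (λ y → φ y * pencil y) ≤⟨ ≤-*ˡ {c = + D} 0≤n (∑-mono pts λ y → ≤-*ˡ (φ≥0 y) (pencil≤ y)) ⟩
          + D * ∑ pts (λ y → φ y * (+ 2 * Q′ + (⟦ y ≟ᵛ u ⟧ * X + ⟦ y ≟ᵛ v ⟧ * X)))
            ≡⟨ cong (+ D *_) (trans (∑-cong pts λ y → spread (φ y) (+ 2 * Q′) (⟦ y ≟ᵛ u ⟧ * X) (⟦ y ≟ᵛ v ⟧ * X)) (trans (∑-+ pts _ _) (cong₂ _+_ (∑-* pts (+ 2 * Q′) φ) (∑-+ pts _ _)))) ⟩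
          + D * (+ 2 * Q′ * M + (∑ pts (λ y → φ y * (⟦ y ≟ᵛ u ⟧ * X)) + ∑ pts (λ y → φ y * (⟦ y ≟ᵛ v ⟧ * X)))) ≤⟨ ≤-*ˡ {c = + D} 0≤n (ℤₚ.+-monoʳ-≤ (+ 2 * Q′ * M) (ℤₚ.+-mono-≤ (at u) (at v))) ⟩
          + D * (+ 2 * Q′ * M + (X + X)) ∎
          where
          swap : ∀ a b c → a * (b * c) ≡ b * (a * c)
          swap = solve-∀
          spread : ∀ p a b c → p * (a + (b + c)) ≡ a * p + (p * b + p * c)
          spread = solve-∀
        lem : ∀ k m s D x Q → + 2 * m * x - + 2 * m * (k * s) ≡ + 2 * k * (D * (+ 2 * Q * m + (x + x)) - m * s) + (x * (m - + 4 * D * k) + m * (x - + 4 * D * k * Q))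
        lem = solve-∀

      few-defects : ∀ xs → K′ * ∑ pts (λ z → w z * defect xs z) ≤ K′ * poor xs * X + (+ 2) ℤ.^ k * X
      few-defects xs = begin
        K′ * ∑ pts (λ z → w z * defect xs z) ≡⟨ cong (K′ *_) (trans (∑-cong pts λ z → ℤₚ.*-distribˡ-+ (w z) (poor xs) _) (trans (∑-+ pts _ _) (cong₂ _+_ (∑-*ʳ pts w (poor xs)) (trans (∑-cong pts λ z → sym (∑-* masks (w z) _)) (∑-swap pts masks _))))) ⟩
        K′ * (X * poor xs + ∑ masks (λ b → ∑ pts (λ z → w z * separable b xs z))) ≡⟨ trans (spread K′ X (poor xs) _) (cong (_+_ (K′ * poor xs * X)) (sym (∑-* masks K′ _))) ⟩
        K′ * poor xs * X + ∑ masks (λ b → K′ * ∑ pts (λ z → w z * separable b xs z)) ≤⟨ ℤₚ.+-monoʳ-≤ (K′ * poor xs * X) (∑-mono masks λ b → per-mask b (K ℤₚ.≤? degree (all k) xs)) ⟩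
        K′ * poor xs * X + ∑ masks (λ _ → X) ≡⟨ cong (_+_ (K′ * poor xs * X)) (∑-vecs-const k (true ∷ false ∷ []) X) ⟩
        K′ * poor xs * X + (+ 2) ℤ.^ k * X ∎
        where
        open ℤₚ.≤-Reasoning
        spread : ∀ k x p s → k * (x * p + s) ≡ k * p * x + k * s
        spread = solve-∀
        per-mask : ∀ b (e : Dec (K ≤ degree (all k) xs)) → K′ * ∑ pts (λ z → w z * (⟦ e ⟧ * ⟦ degree b xs ℤₚ.≤? + D * meet b xs z ⟧)) ≤ X
        per-mask b (yes p) = ≤-trans (≤-reflexive (cong (K′ *_) (∑-cong pts λ z → cong (w z *_) (ℤₚ.*-identityˡ ⟦ degree b xs ℤₚ.≤? + D * meet b xs z ⟧)))) (few-overlaps b xs p)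
        per-mask b (no _)  = ≤-trans (≤-reflexive (trans (cong (K′ *_) (∑-zero pts λ z → trans (cong (w z *_) (ℤₚ.*-zeroˡ ⟦ degree b xs ℤₚ.≤? + D * meet b xs z ⟧)) (ℤₚ.*-zeroʳ (w z)))) (ℤₚ.*-zeroʳ K′))) X≥0

      total : ℤ
      total = ∑ (vecs D pts) (λ xs → ∏ w xs * defects xs)

      total≡ : total ≡ + D * ∑ (vecs k pts) (λ xs → ∏ w xs * ∑ pts (λ z → w z * defect xs z))
      total≡ = trans (∑-cong (vecs D pts) λ xs → sym (∑-* (fins D) (∏ w xs) (at xs))) (trans (∑-swap (vecs D pts) (fins D) (λ xs j → ∏ w xs * at xs j))
        (trans (∑-cong (fins D) λ j → trans (∑-insert pts j (λ xs → ∏ w xs * at xs j)) (∑-cong (vecs k pts) λ xs → trans (∑-cong pts λ z → trans (cong₂ _*_ (∏-insert w xs j z) (cong₂ defect (Vecₚ.removeAt-insertAt xs j z) (Vecₚ.insertAt-lookup xs j z))) (swap (w z) (∏ w xs) (defect xs z))) (∑-* pts (∏ w xs) _)))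
        (trans (∑-const (fins D) (∑ (vecs k pts) (λ xs → ∏ w xs * ∑ pts (λ z → w z * defect xs z)))) (cong (λ n → + n * ∑ (vecs k pts) (λ xs → ∏ w xs * ∑ pts (λ z → w z * defect xs z))) (length-fins D)))))
        where at : Vec V D → Fin D → ℤ
              at xs j = defect (Vec.removeAt xs j) (Vec.lookup xs j)
              swap : ∀ a b c → a * b * c ≡ b * (a * c)
              swap = solve-∀

      total≤ : K′ * total ≤ + D * (K′ * X * scarcity u v + (+ 2) ℤ.^ k * X * X ℤ.^ k)
      total≤ = begin
        K′ * total ≡⟨ trans (cong (K′ *_) total≡) (trans (swap K′ (+ D) _) (cong (+ D *_) (trans (sym (∑-* (vecs k pts) K′ _)) (∑-cong (vecs k pts) λ xs → swap K′ (∏ w xs) _)))) ⟩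
        + D * ∑ (vecs k pts) (λ xs → ∏ w xs * (K′ * ∑ pts (λ z → w z * defect xs z))) ≤⟨ ≤-*ˡ {c = + D} 0≤n (∑-mono (vecs k pts) λ xs → ≤-*ˡ (∏≥0 w≥0 xs) (few-defects xs)) ⟩
        + D * ∑ (vecs k pts) (λ xs → ∏ w xs * (K′ * poor xs * X + (+ 2) ℤ.^ k * X))
          ≡⟨ cong (+ D *_) (trans (∑-cong (vecs k pts) λ xs → spread (∏ w xs) K′ (poor xs) X ((+ 2) ℤ.^ k)) (trans (∑-+ (vecs k pts) _ _) (cong₂ _+_ (∑-* (vecs k pts) (K′ * X) _) (trans (∑-* (vecs k pts) ((+ 2) ℤ.^ k * X) _) (cong ((+ 2) ℤ.^ k * X *_) (∑-∏ pts w k)))))) ⟩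
        + D * (K′ * X * scarcity u v + (+ 2) ℤ.^ k * X * X ℤ.^ k) ∎
        where
        open ℤₚ.≤-Reasoning
        swap : ∀ a b c → a * (b * c) ≡ b * (a * c)
        swap = solve-∀
        spread : ∀ p k o x t → p * (k * o * x + t * x) ≡ k * x * (p * o) + t * x * p
        spread = solve-∀

      -- The poor tuples and the overlaps contribute at most a quarter of X^D each, by `few-poor`
      -- and by K′ ≥ 4D·2^k. So the average number of defects of a tuple is at most 1/2.
      total< : total < ∑ (vecs D pts) (∏ w)
      total< = ≰⇒> λ ≤total → <-irrefl refl (<-≤-trans X^D>0 (≤-trans (≤-via (lem₀ (X ℤ.^ D)) (<⇒≤ X^D>0)) (half-of (≤-trans (≤-reflexive (sym (∑-∏ pts w D))) ≤total))))
        where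
        X^D>0 = ^>0 X>0 D
        lem₀ : ∀ x → x + x - x ≡ x
        lem₀ = solve-∀
        half-of : X ℤ.^ D ≤ total → X ℤ.^ D + X ℤ.^ D ≤ 0ℤ
        half-of p = *-cancel-≤ {c = K′} K′>0 (≤-via (lem K′ X (X ℤ.^ k) total (+ D) (scarcity u v) ((+ 2) ℤ.^ k)) (0≤+ (0≤* {+ 4} 0≤n (diff≥0 total≤)) (0≤+ (0≤* {+ 4 * K′} (0≤* {+ 4} 0≤n (<⇒≤ K′>0)) (diff≥0 p))
          (0≤+ (0≤* (0≤* (<⇒≤ K′>0) X≥0) (diff≥0 few-poor)) (0≤* (0≤* X≥0 (<⇒≤ (^>0 X>0 k))) (diff≥0 K′≥))))))
          where lem : ∀ k x y t D a m → k * 0ℤ - k * (x * y + x * y) ≡ + 4 * (D * (k * x * a + m * x * y) - k * t) + (+ 4 * k * (t - x * y) + (k * x * (y - + 4 * D * a) + x * y * (k - + 4 * (D * m))))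
                lem = solve-∀

      Adjacent : V → Set
      Adjacent x = x ∈ E × dist x u ≡ t × dist x v ≡ t

      conclude : ∀ xs → 0ℤ < ∏ w xs → defects xs ≡ 0ℤ → Goal
      conclude xs pos perfect = C , (Uniqueₚ.tabulate⁺ (λ {i} {j} → distinct i j), λ x x∈ → let (i , e) = index x∈ in subst (_∈ E) (sym e) (proj₁ (member i))) ,
          shatter-criterion u v u∈ v∈ (λ e → uv≢0 (trans (cong (dist v) e) (dist-zero v))) (λ x x∈ → let (i , e) = index x∈ in subst (λ x → dist x u ≡ t × dist x v ≡ t) (sym e) (proj₂ (member i))) exact ,
          Listₚ.length-tabulate (Vec.lookup xs)
        where
        C : List V
        C = List.tabulate (Vec.lookup xs)
        index : ∀ {x} → x ∈ C → ∃[ i ] x ≡ Vec.lookup xs i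
        index = ∈-tabulate⁻ {f = Vec.lookup xs}
        split : ∀ x {y} → 0ℤ < w x * y → Adjacent x × 0ℤ < y
        split x {y} p = let (x∈ , p₁) = ε-true {x} (<-≤-trans p (≤-reflexive (assoc (ε x) (N x u) (N x v) y)))
                            (on-u , p₂) = pos-split (dist x u ≟ t) p₁
                            (on-v , p₃) = pos-split (dist x v ≟ t) p₂
                        in (x∈ , on-u , on-v) , p₃
          where assoc : ∀ a b c d → a * (b * c) * d ≡ a * (b * (c * d))
                assoc = solve-∀
        member : ∀ i → Adjacent (Vec.lookup xs i)
        member = ∏-pos w split xs pos
        -- Take the mask that is false at j alone. For i ≠ j the point realizing it is at distance t
        -- from entry i but not from entry j, so these entries differ.
        distinct : ∀ i j → Vec.lookup xs i ≡ Vec.lookup xs j → i ≡ j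
        distinct i j e = by-cases (i Fin.≟ j)
          where
          mask : Fin D → Bool
          mask l = not ⌊ l Fin.≟ j ⌋
          b : Vec Bool D
          b = Vec.tabulate mask
          off : ∀ {l} (e : Dec (l ≡ j)) → l ≡ j → not ⌊ e ⌋ ≡ false
          off (yes _) _ = refl
          off (no n)  p = contradiction p n
          on : ∀ {l} (e : Dec (l ≡ j)) → l ≢ j → not ⌊ e ⌋ ≡ true
          on (yes p) n = contradiction p n
          on (no _)  _ = refl
          b-off : Vec.lookup b j ≡ false
          b-off = trans (Vecₚ.lookup∘tabulate mask j) (off (j Fin.≟ j) refl)
          by-cases : Dec (i ≡ j) → i ≡ j
          by-cases (yes p) = p
          by-cases (no n)  = let (y , _ , pattern-y) = separate xs perfect b j b-off in
            contradiction (trans (cong (λ x → dist x y) (sym e)) (proj₁ (pattern-y i) (trans (Vecₚ.lookup∘tabulate mask i) (on (i Fin.≟ j) n)))) (proj₂ (pattern-y j) b-off)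
        exact : ∀ (f : V → Bool) x₀ → x₀ ∈ C → f x₀ ≡ false → ∃[ y ] (y ∈ E × ∀ x → x ∈ C → (f x ≡ true → dist x y ≡ t) × (f x ≡ false → dist x y ≢ t))
        exact f x₀ x₀∈ e₀ = let (j , e) = index x₀∈
                                (y , y∈ , pattern-y) = separate xs perfect (Vec.map f xs) j (trans (Vecₚ.lookup-map j f xs) (trans (cong f (sym e)) e₀))
                            in y , y∈ , λ x x∈ → let (i , e′) = index x∈ ; value = λ {b} (p : f x ≡ b) → trans (Vecₚ.lookup-map i f xs) (trans (cong f (sym e′)) p) in
                              (λ p → trans (cong (λ x → dist x y) e′) (proj₁ (pattern-y i) (value p))) , λ p r → proj₂ (pattern-y i) (value p) (trans (cong (λ x → dist x y) (sym e′)) r)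

    pair-shatters : Goal
    pair-shatters = extract (∑-exists (vecs D pts) (λ xs → ∏ w xs * defects xs) (∏ w) total<)
      where
      extract : ∃[ xs ] (xs ∈ vecs D pts × ∏ w xs * defects xs < ∏ w xs) → Goal
      extract (xs , _ , p) = let (pos , none) = excluded (∏≥0 w≥0 xs) (∑-≥0 (fins D) λ j → defect≥0 (Vec.removeAt xs j) (Vec.lookup xs j)) p in conclude xs pos none

-- Choice of a pair with many common neighbours

^-≥0 : ∀ {a} → 0ℤ ≤ a → ∀ m → 0ℤ ≤ a ℤ.^ m
^-≥0 a≥0 zero    = 0≤n
^-≥0 a≥0 (suc m) = 0≤* a≥0 (^-≥0 a≥0 m)

^-mono : ∀ {a b} → 0ℤ ≤ a → a ≤ b → ∀ m → a ℤ.^ m ≤ b ℤ.^ m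
^-mono a≥0 p zero    = ≤-refl
^-mono a≥0 p (suc m) = ≤-* a≥0 (^-≥0 (≤-trans a≥0 p) m) p (^-mono a≥0 p m)

^-* : ∀ a b m → (a * b) ℤ.^ m ≡ a ℤ.^ m * b ℤ.^ m
^-* a b zero    = refl
^-* a b (suc m) = trans (cong (a * b *_) (^-* a b m)) (lem a b (a ℤ.^ m) (b ℤ.^ m))
  where lem : ∀ a b c d → a * b * (c * d) ≡ a * c * (b * d)
        lem = solve-∀

^-product : ∀ m a q Q d → (m * a * (q * q) * Q) ℤ.^ d ≡ m ℤ.^ d * a ℤ.^ d * (q ℤ.^ d * q ℤ.^ d) * Q ℤ.^ d
^-product m a q Q d = trans (^-* (m * a * (q * q)) Q d) (cong (_* Q ℤ.^ d) (trans (^-* (m * a) (q * q) d) (cong₂ _*_ (^-* m a d) (^-* q q d))))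

-- A linear lower bound in c for the power, which replaces Hölder's inequality: for c ≥ a the bound
-- c·a^m ≤ c·c^m suffices, and for c < a the left side is not positive.
^-tangent : ∀ {a c} → 0ℤ ≤ a → 0ℤ ≤ c → ∀ m → c * a ℤ.^ m - a ℤ.^ suc m ≤ c ℤ.^ suc m
^-tangent {a} {c} a≥0 c≥0 m = by-cases (a ℤₚ.≤? c)
  where
  by-cases : Dec (a ≤ c) → c * a ℤ.^ m - a ℤ.^ suc m ≤ c ℤ.^ suc m
  by-cases (yes p) = ≤-via (lem c (a ℤ.^ m) (a * a ℤ.^ m) (c ℤ.^ m)) (0≤+ (0≤* c≥0 (diff≥0 (^-mono a≥0 p m))) (^-≥0 a≥0 (suc m)))
    where lem : ∀ c x y z → c * z - (c * x - y) ≡ c * (z - x) + y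
          lem = solve-∀
  by-cases (no ¬p) = ≤-via (lem c a (a ℤ.^ m) (c * c ℤ.^ m)) (0≤+ (0≤* (diff≥0 (<⇒≤ (≰⇒> ¬p))) (^-≥0 a≥0 m)) (^-≥0 c≥0 (suc m)))
    where lem : ∀ c a x z → z - (c * x - a * x) ≡ (a - c) * x + z
          lem = solve-∀

-- The letters stand for the factors of n^k and A^k. For n proportional to q^(D-1) and A
-- proportional to q^d both n^d and A^k carry the same power of q, so a comparison of constants
-- decides.
balance : ∀ {a Q n D K c x y a′ n′} → a′ ≡ x * y → n′ ≡ c * x * (Q * Q) * y → 0ℤ ≤ x * y → + 4 * D * (K * K) * c ≤ + 2 * (a * a) →
  + 4 * D * (K * K * (n * (n * n′))) ≤ + 2 * (a * Q * (a * Q * a′) * (n * n))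
balance {a} {Q} {n} {D} {K} {c} {x} {y} refl refl xy≥0 p = ≤-via (lem a Q n D K c x y) (0≤* (0≤* (0≤sq n) (0≤* (0≤sq Q) xy≥0)) (diff≥0 p))
  where lem : ∀ a Q n D K c x y → + 2 * (a * Q * (a * Q * (x * y)) * (n * n)) - + 4 * D * (K * K * (n * (n * (c * x * (Q * Q) * y)))) ≡ n * n * (Q * Q * (x * y)) * (+ 2 * (a * a) - + 4 * D * (K * K) * c)
        lem = solve-∀

module Spatial (F : FiniteField) (2≢0 : FiniteField._+_ F (FiniteField.1# F) (FiniteField.1# F) ≢ FiniteField.0# F)
               (t : ⟨ F ⟩) (t≢0 : t ≢ FiniteField.0# F) {d : ℕ} (E : List (Vec ⟨ F ⟩ (3 ℕ.+ d))) (E! : Unique E)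
               (K′ : ℤ) (K′>0 : 0ℤ < K′) (K′≥ : + 4 * (+ (3 ℕ.+ d) * (+ 2) ℤ.^ (2 ℕ.+ d)) ≤ K′)
               (A₀ : ℤ) (A₀≥K : + 4 * + (3 ℕ.+ d) * K′ ≤ A₀)
               (A₀²≥ : + 4 * + (3 ℕ.+ d) * ((+ 4 * + (3 ℕ.+ d) * K′) * (+ 4 * + (3 ℕ.+ d) * K′)) * (+ 96) ℤ.^ d ≤ + 2 * (A₀ * A₀)) where
  open Field F
  open Geometry F
  open Mixing F 2≢0
  open SphereIntersections F 2≢0
  open Shattering F 2≢0 t
  open Indicator E E!
  open Tuples F 2≢0 t E E!
  open Select K′ K′>0 K′≥
  open Pair F 2≢0 t E E! K′ K′>0 K′≥

  private
    abstract
      n : ℤ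
      n = + 96 * A₀ * (q * q) * q ℤ.^ d

      n≡ : n ≡ + 96 * A₀ * (q * q) * q ℤ.^ d
      n≡ = refl

    -- Typical points have degree at least D₀, typical good pairs have at least A common neighbours.
    Q′ ℓ A D₀ : ℤ
    Q′ = q ℤ.^ d
    ℓ = edges t ε ε
    A = A₀ * Q′
    D₀ = + 24 * A₀ * q * Q′

    4t : Carrier
    4t = t ⊕ t ⊕ (t ⊕ t)

    q≥0 : 0ℤ ≤ q
    q≥0 = 0≤n

    Q′≥0 : 0ℤ ≤ Q′
    Q′≥0 = q^≥0 d

    K>0 : 0ℤ < K
    K>0 = <-≤-trans K′>0 (≤-via (lem (+ d) K′) (0≤* {+ 4 * + d + + 11} (0≤+ {+ 4 * + d} (0≤* {+ 4} {+ d} 0≤n 0≤n) (0≤n {11})) (<⇒≤ K′>0)))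
      where lem : ∀ d k → + 4 * (+ 3 + d) * k - k ≡ (+ 4 * d + + 11) * k
            lem = solve-∀

    A₀>0 : 0ℤ < A₀
    A₀>0 = <-≤-trans K>0 A₀≥K

    A₀≥0 : 0ℤ ≤ A₀
    A₀≥0 = <⇒≤ A₀>0

    q>0 : 0ℤ < q
    q>0 = ℤ.+<+ (ℕₚ.≤-trans (ℕₚ.n≤1+n 1) card>1)

    Q′>0 : 0ℤ < Q′
    Q′>0 = ^>0 q>0 d

    A≥0 : 0ℤ ≤ A
    A≥0 = 0≤* A₀≥0 Q′≥0

    A>0 : 0ℤ < A
    A>0 = *>0 A₀>0 Q′>0

    n>0 : 0ℤ < n
    n>0 = <-≤-trans (*>0 (*>0 (*>0 {+ 96} (ℤ.+<+ (ℕ.s≤s ℕ.z≤n)) A₀>0) (*>0 q>0 q>0)) Q′>0) (≤-reflexive (sym n≡))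

    n≥0 : 0ℤ ≤ n
    n≥0 = <⇒≤ n>0

    D₀≥0 : 0ℤ ≤ D₀
    D₀≥0 = 0≤* (0≤* (0≤* {+ 24} 0≤n A₀≥0) q≥0) Q′≥0

    X≥0 : ∀ u v → 0ℤ ≤ codegree u v
    X≥0 u v = ∑-≥0 pts (ξ≥0 u v)

  module _ (size : + length E ≡ + 96 * A₀ * (q * q) * q ℤ.^ d) where
    private
      ∑ε≡n : ∑ pts ε ≡ n
      ∑ε≡n = trans ∑ε (trans size (sym n≡))

      -- The set fits into the q^D points of the space, so 96·A₀ ≤ q. Small fields are thereby
      -- excluded.
      q≥96 : + 96 ≤ q
      q≥96 = ≤-trans (≤-trans (≤-*ˡ {1ℤ} {A₀} {+ 96} 0≤n (<⇒1+≤ A₀>0)) (*-cancel-≤ (*>0 (*>0 q>0 q>0) Q′>0) (≤-trans (≤-reflexive (trans (lem A₀ q Q′) (sym (trans ∑ε size)))) n≤))) ≤-refl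
        where
        lem : ∀ a q Q → q * q * Q * (+ 96 * a) ≡ + 96 * a * (q * q) * Q
        lem = solve-∀
        lem′ : ∀ q Q → q * (q * (q * Q)) * 1ℤ ≡ q * q * Q * q
        lem′ = solve-∀
        n≤ : ∑ pts ε ≤ q * q * Q′ * q
        n≤ = ≤-trans (∑-mono pts ε≤1) (≤-reflexive (trans (∑-vecs-const D elements 1ℤ) (lem′ q Q′)))

      -- About n²/q = 4nD₀ is expected; the factor 4 absorbs the error term and the difference
      -- between (q - 1)(q - 2) and q².
      many-edges : n * D₀ ≤ ℓ
      many-edges = *-cancel-≤ {c = q * q * q} (*>0 (*>0 q>0 q>0) q>0) (≤-trans (≤-via (lem q n Q′ A₀) (0≤* n≥0
          (≤-trans (0≤* (0≤* (0≤sq q) Q′≥0) (0≤+ (0≤* {A₀} A₀≥0 (0≤+ (0≤* {+ 70 * q} (0≤* {+ 70} 0≤n q≥0) (diff≥0 q≥96)) (0≤+ (0≤* {+ 6432} {q} 0≤n q≥0) (0≤n {192})))) (0≤* {+ 2 * (q * q)} (0≤* {+ 2} 0≤n (0≤sq q)) (diff≥0 (<⇒1+≤ A₀>0))))) (≤-reflexive (trans (lem′ q Q′ A₀) (cong (λ m → (q - 1ℤ) * (q - + 2) * m - (+ 2 + + 24 * A₀) * (q * q * (q * q)) * Q′) (sym n≡))))))) bound)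
        where
        bound : (q - 1ℤ) * (q - + 2) * (n * n) - + 2 * (q * q * q * q) * Q′ * n ≤ q * q * q * ℓ
        bound = subst (λ n → (q - 1ℤ) * (q - + 2) * (n * n) - + 2 * (q * q * q * q) * Q′ * n ≤ q * q * q * ℓ) ∑ε≡n (edges₃ {d} t ε ε-idem ε≥0)
        lem : ∀ q n Q a → (q - 1ℤ) * (q - + 2) * (n * n) - + 2 * (q * q * q * q) * Q * n - q * q * q * (n * (+ 24 * a * q * Q)) ≡ n * ((q - 1ℤ) * (q - + 2) * n - (+ 2 + + 24 * a) * (q * q * (q * q)) * Q)
        lem = solve-∀
        lem′ : ∀ q Q a → q * q * Q * (a * (+ 70 * q * (q - + 96) + (+ 6432 * q + + 192)) + + 2 * (q * q) * (a - (1ℤ + 0ℤ))) ≡ (q - 1ℤ) * (q - + 2) * (+ 96 * a * (q * q) * Q) - (+ 2 + + 24 * a) * (q * q * (q * q)) * Q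
        lem′ = solve-∀

      good? : ∀ (u v : V) → Dec (dist v u ≢ 𝟘 × dist v u ≢ 4t)
      good? u v = ¬? (dist v u ≟ 𝟘) ×-dec ¬? (dist v u ≟ 4t)

      -- The pairs to which `three-spheres` does not apply. The pairs u = v are among them, as their
      -- distance is 0.
      degenerate : V → V → ℤ
      degenerate u v = ⟦ dist v u ≟ 𝟘 ⟧ + ⟦ dist v u ≟ 4t ⟧

      g : V → V → ℤ
      g u v = ε u * ε v * ⟦ good? u v ⟧

      -- Paths u - x - v with weight β, regrouped by the middle point x.
      gather : ∀ (β : V → V → ℤ) → ∑ pts (λ u → ∑ pts (λ v → ε u * ε v * β u v * codegree u v)) ≡ ∑ pts (λ x → ε x * ∑ pts (λ u → N x u * ε u * ∑ pts (λ v → N x v * ε v * β u v)))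
      gather β = begin
        ∑ pts (λ u → ∑ pts (λ v → ε u * ε v * β u v * codegree u v)) ≡⟨ ∑-cong pts (λ u → trans (∑-cong pts λ v → trans (sym (∑-* pts (ε u * ε v * β u v) _)) (∑-cong pts λ x → lem (ε u) (ε v) (β u v) (ε x) (N x u) (N x v))) (∑-swap pts pts _)) ⟩
        ∑ pts (λ u → ∑ pts (λ x → ∑ pts (λ v → ε x * (N x u * ε u * (N x v * ε v * β u v))))) ≡⟨ ∑-swap pts pts _ ⟩
        ∑ pts (λ x → ∑ pts (λ u → ∑ pts (λ v → ε x * (N x u * ε u * (N x v * ε v * β u v))))) ≡⟨ ∑-cong pts (λ x → trans (∑-cong pts λ u → trans (∑-* pts (ε x) _) (cong (ε x *_) (∑-* pts (N x u * ε u) _))) (∑-* pts (ε x) _)) ⟩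
        ∑ pts (λ x → ε x * ∑ pts (λ u → N x u * ε u * ∑ pts (λ v → N x v * ε v * β u v))) ∎
        where
        open ≡-Reasoning
        lem : ∀ a b c e m n → a * b * c * (e * (m * n)) ≡ e * (m * a * (n * b * c))
        lem = solve-∀

      -- For an edge xu the point v lies on the sphere around x and on one of two spheres around u,
      -- of radius 0 or 4t. As t ≠ 0 gives x ≠ u, each intersection has at most 2q^(d+1) points.
      few-degenerate : ∀ x u → N x u * ∑ pts (λ v → N x v * ε v * degenerate u v) ≤ N x u * (+ 4 * q * Q′)
      few-degenerate x u = by-cases (dist x u ≟ t)
        where
        section : ∀ s → x ≢ u → ∑ pts (λ v → ⟦ dist v x ≟ t ⟧ * ⟦ dist v u ≟ s ⟧) ≤ + 2 * q * Q′
        section s x≢u = *-cancel-≤ {c = q * q} (*>0 q>0 q>0) (≤-trans (two-spheres x u t s x≢u) (≤-reflexive (lem q Q′)))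
          where lem : ∀ q Q → + 2 * (q * (q * (q * Q))) ≡ q * q * (+ 2 * q * Q)
                lem = solve-∀
        by-cases : (e : Dec (dist x u ≡ t)) → ⟦ e ⟧ * ∑ pts (λ v → N x v * ε v * degenerate u v) ≤ ⟦ e ⟧ * (+ 4 * q * Q′)
        by-cases (no _)  = ≤-reflexive (trans (ℤₚ.*-zeroˡ (∑ pts (λ v → N x v * ε v * degenerate u v))) (sym (ℤₚ.*-zeroˡ (+ 4 * q * Q′))))
        by-cases (yes p) = ≤-*ˡ {c = 1ℤ} 0≤n (begin
          ∑ pts (λ v → N x v * ε v * degenerate u v) ≤⟨ ∑-mono pts (λ v → ≤-trans (≤-reflexive (lem (N x v) (ε v) (degenerate u v))) (≤-drop (0≤* (N≥0 x v) (0≤+ (⟦⟧≥0 (dist v u ≟ 𝟘)) (⟦⟧≥0 (dist v u ≟ 4t)))) (ε≤1 v))) ⟩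
          ∑ pts (λ v → N x v * degenerate u v) ≡⟨ trans (∑-cong pts λ v → trans (cong (_* degenerate u v) (N-sym x v)) (ℤₚ.*-distribˡ-+ (N v x) ⟦ dist v u ≟ 𝟘 ⟧ ⟦ dist v u ≟ 4t ⟧)) (∑-+ pts _ _) ⟩
          ∑ pts (λ v → N v x * ⟦ dist v u ≟ 𝟘 ⟧) + ∑ pts (λ v → N v x * ⟦ dist v u ≟ 4t ⟧) ≤⟨ ℤₚ.+-mono-≤ (section 𝟘 x≢u) (section 4t x≢u) ⟩
          + 2 * q * Q′ + + 2 * q * Q′ ≡⟨ lem′ q Q′ ⟩
          + 4 * q * Q′ ∎)
          where
          open ℤₚ.≤-Reasoning
          lem : ∀ a e b → a * e * b ≡ a * b * e
          lem = solve-∀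
          lem′ : ∀ q Q → + 2 * q * Q + + 2 * q * Q ≡ + 4 * q * Q
          lem′ = solve-∀
          x≢u : x ≢ u
          x≢u refl = t≢0 (trans (sym p) (dist-zero x))

      good-sum : ℤ
      good-sum = ∑ pts (λ u → ∑ pts (λ v → g u v * codegree u v))

      -- The paths number Σ deg², bounded below by the tangents 2D₀·deg - D₀². The degenerate ones
      -- are at most 4q^(d+1) per edge, the first edge of a path being counted.
      many-paths : D₀ * ℓ ≤ good-sum + + 4 * q * Q′ * ℓ
      many-paths = begin
        D₀ * ℓ ≤⟨ ≤-via (lem D₀ ℓ n) (0≤* D₀≥0 (diff≥0 many-edges)) ⟩
        + 2 * D₀ * ℓ + - (D₀ * D₀) * n ≡⟨ sym (trans (∑-cong pts λ x → tangent (ε x) (deg x) D₀) (trans (∑-+ pts _ _) (cong₂ _+_ (∑-* pts (+ 2 * D₀) _) (trans (∑-* pts (- (D₀ * D₀)) ε) (cong (- (D₀ * D₀) *_) ∑ε≡n))))) ⟩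
        ∑ pts (λ x → ε x * (+ 2 * D₀ * deg x - D₀ * D₀)) ≤⟨ ∑-mono pts (λ x → ≤-*ˡ (ε≥0 x) (≤-via (square (deg x) D₀) (0≤sq (deg x - D₀)))) ⟩
        ∑ pts (λ x → ε x * (deg x * deg x)) ≡⟨ sym (trans (gather (λ _ _ → 1ℤ)) (∑-cong pts λ x → cong (ε x *_) (trans (∑-cong pts λ u → cong (N x u * ε u *_) (∑-cong pts λ v → ℤₚ.*-identityʳ (N x v * ε v))) (∑-*ʳ pts (λ u → N x u * ε u) (deg x))))) ⟩
        ∑ pts (λ u → ∑ pts (λ v → ε u * ε v * 1ℤ * codegree u v)) ≤⟨ ∑-mono pts (λ u → ∑-mono pts λ v → ≤-*ʳ (X≥0 u v) (≤-*ˡ (0≤* (ε≥0 u) (ε≥0 v)) (covers (dist v u ≟ 𝟘) (dist v u ≟ 4t)))) ⟩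
        ∑ pts (λ u → ∑ pts (λ v → ε u * ε v * (⟦ good? u v ⟧ + degenerate u v) * codegree u v))
          ≡⟨ trans (∑-cong pts λ u → trans (∑-cong pts λ v → spread (ε u * ε v) ⟦ good? u v ⟧ (degenerate u v) (codegree u v)) (∑-+ pts _ _)) (∑-+ pts _ _) ⟩
        good-sum + ∑ pts (λ u → ∑ pts (λ v → ε u * ε v * degenerate u v * codegree u v)) ≡⟨ cong (_+_ good-sum) (gather degenerate) ⟩
        good-sum + ∑ pts (λ x → ε x * ∑ pts (λ u → N x u * ε u * ∑ pts (λ v → N x v * ε v * degenerate u v)))
          ≤⟨ ℤₚ.+-monoʳ-≤ good-sum (∑-mono pts λ x → ≤-*ˡ (ε≥0 x) (∑-mono pts λ u → ≤-trans (≤-reflexive (swap (N x u) (ε u) _)) (≤-*ˡ (ε≥0 u) (few-degenerate x u)))) ⟩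
        good-sum + ∑ pts (λ x → ε x * ∑ pts (λ u → ε u * (N x u * (+ 4 * q * Q′))))
          ≡⟨ cong (_+_ good-sum) (trans (∑-cong pts λ x → trans (cong (ε x *_) (trans (∑-cong pts λ u → rotate (ε u) (N x u) (+ 4 * q * Q′)) (∑-* pts (+ 4 * q * Q′) _))) (move (ε x) (+ 4 * q * Q′) (deg x))) (∑-* pts (+ 4 * q * Q′) _)) ⟩
        good-sum + + 4 * q * Q′ * ℓ ∎
        where
        open ℤₚ.≤-Reasoning
        lem : ∀ a l n → + 2 * a * l + - (a * a) * n - a * l ≡ a * (l - n * a)
        lem = solve-∀
        tangent : ∀ e x a → e * (+ 2 * a * x - a * a) ≡ + 2 * a * (e * x) + - (a * a) * e
        tangent = solve-∀
        square : ∀ x a → x * x - (+ 2 * a * x - a * a) ≡ (x - a) * (x - a)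
        square = solve-∀
        spread : ∀ e a b c → e * (a + b) * c ≡ e * a * c + e * b * c
        spread = solve-∀
        swap : ∀ a b c → a * b * c ≡ b * (a * c)
        swap = solve-∀
        rotate : ∀ a b c → a * (b * c) ≡ c * (b * a)
        rotate = solve-∀
        move : ∀ a b c → a * (b * c) ≡ b * (a * c)
        move = solve-∀
        covers : ∀ {P R : Set} (p : Dec P) (r : Dec R) → 1ℤ ≤ ⟦ ¬? p ×-dec ¬? r ⟧ + (⟦ p ⟧ + ⟦ r ⟧)
        covers (yes _) r      = ≤-trans (ℤₚ.+-mono-≤ {1ℤ} {1ℤ} {0ℤ} ≤-refl (⟦⟧≥0 r)) (≤-reflexive (sym (ℤₚ.+-identityˡ (1ℤ + ⟦ r ⟧))))
        covers (no _) (yes _) = ≤-refl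
        covers (no _) (no _)  = ≤-refl

      -- From many-paths the factor of q^(d+1)·ℓ is at least 24A₀ - 4 ≥ 20A₀; then ℓ ≥ nD₀ and 20·24
      -- = 5·96 give the constant 5.
      good-sum-large : + 5 * A * (n * n) ≤ good-sum
      good-sum-large = ≤-via (trans (cong (λ m → good-sum - + 5 * A * (n * m)) n≡) (lem A₀ q Q′ n ℓ good-sum)) (0≤+ (0≤+ (diff≥0 many-paths) (0≤* {+ 4 * q * Q′} (0≤* {+ 4 * q} (0≤* {+ 4} {q} 0≤n q≥0) Q′≥0) (0≤* (diff≥0 (<⇒1+≤ A₀>0)) ℓ≥0)))
          (0≤* {+ 20 * A₀ * q * Q′} (0≤* (0≤* (0≤* {+ 20} 0≤n A₀≥0) q≥0) Q′≥0) (diff≥0 many-edges)))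
        where
        ℓ≥0 : 0ℤ ≤ ℓ
        ℓ≥0 = ≤-trans (0≤* n≥0 D₀≥0) many-edges
        lem : ∀ a q Q n l G → G - + 5 * (a * Q) * (n * (+ 96 * a * (q * q) * Q)) ≡ G + + 4 * q * Q * l - + 24 * a * q * Q * l + + 4 * q * Q * ((a - (1ℤ + 0ℤ)) * l) + + 20 * a * q * Q * (l - n * (+ 24 * a * q * Q))
        lem = solve-∀

      g≥0 : ∀ u v → 0ℤ ≤ g u v
      g≥0 u v = 0≤* (0≤* (ε≥0 u) (ε≥0 v)) (⟦⟧≥0 (good? u v))

      g≤ : ∀ u v → g u v ≤ ε u * ε v
      g≤ u v = ≤-drop (0≤* (ε≥0 u) (ε≥0 v)) (⟦⟧≤1 (good? u v))

      scarcity≥0 : ∀ u v → 0ℤ ≤ scarcity u v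
      scarcity≥0 u v = ∑-≥0 (vecs k pts) λ xs → 0≤* (∏≥0 (ξ≥0 u v) xs) (⟦⟧≥0 (degree (all k) xs ℤₚ.<? K))

      -- Exchange of summation: a poor tuple has fewer than K common neighbours in E, so fewer than
      -- K² pairs (u, v) have it among their common neighbours.
      total-scarcity : ∑ pts (λ u → ∑ pts (λ v → g u v * scarcity u v)) ≤ K * K * n ℤ.^ k
      total-scarcity = begin
        ∑ pts (λ u → ∑ pts (λ v → g u v * scarcity u v)) ≤⟨ ∑-mono pts (λ u → ∑-mono pts λ v → ≤-*ʳ (scarcity≥0 u v) (g≤ u v)) ⟩
        ∑ pts (λ u → ∑ pts (λ v → ε u * ε v * scarcity u v))
          ≡⟨ ∑-cong pts (λ u → trans (∑-cong pts λ v → trans (sym (∑-* (vecs k pts) (ε u * ε v) _)) (∑-cong (vecs k pts) λ xs → regroup u v xs)) (∑-swap pts (vecs k pts) _)) ⟩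
        ∑ pts (λ u → ∑ (vecs k pts) (λ xs → ∑ pts (λ v → ∏ ε xs * poor xs * (ε u * adj (all k) xs u * (ε v * adj (all k) xs v))))) ≡⟨ ∑-swap pts (vecs k pts) _ ⟩
        ∑ (vecs k pts) (λ xs → ∑ pts (λ u → ∑ pts (λ v → ∏ ε xs * poor xs * (ε u * adj (all k) xs u * (ε v * adj (all k) xs v)))))
          ≡⟨ ∑-cong (vecs k pts) (λ xs → trans (∑-cong pts λ u → ∑-* pts (∏ ε xs * poor xs) _) (trans (∑-* pts (∏ ε xs * poor xs) _) (cong (∏ ε xs * poor xs *_) (∑-** pts pts (λ u → ε u * adj (all k) xs u) (λ v → ε v * adj (all k) xs v))))) ⟩
        ∑ (vecs k pts) (λ xs → ∏ ε xs * poor xs * (degree (all k) xs * degree (all k) xs)) ≤⟨ ∑-mono (vecs k pts) (λ xs → ≤-trans (≤-reflexive (ℤₚ.*-assoc (∏ ε xs) (poor xs) _)) (≤-*ˡ (∏≥0 ε≥0 xs) (small (degree≥0 xs) (degree (all k) xs ℤₚ.<? K)))) ⟩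
        ∑ (vecs k pts) (λ xs → ∏ ε xs * (K * K)) ≡⟨ trans (∑-*ʳ (vecs k pts) (∏ ε) (K * K)) (trans (cong (_* (K * K)) (trans (∑-∏ pts ε k) (cong (ℤ._^ k) ∑ε≡n))) (ℤₚ.*-comm (n ℤ.^ k) (K * K))) ⟩
        K * K * n ℤ.^ k ∎
        where
        open ℤₚ.≤-Reasoning
        regroup : ∀ u v xs → ε u * ε v * (∏ (ξ u v) xs * poor xs) ≡ ∏ ε xs * poor xs * (ε u * adj (all k) xs u * (ε v * adj (all k) xs v))
        regroup u v xs = trans (cong (λ p → ε u * ε v * (p * poor xs)) (trans (∏-* ε (λ x → N x u * N x v) xs) (cong (∏ ε xs *_) (trans (∏-* (λ x → N x u) (λ x → N x v) xs) (sym (cong₂ _*_ (adj-all xs u) (adj-all xs v)))))))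
          (lem (ε u) (ε v) (∏ ε xs) (adj (all k) xs u) (adj (all k) xs v) (poor xs))
          where lem : ∀ a b e x y p → a * b * (e * (x * y) * p) ≡ e * p * (a * x * (b * y))
                lem = solve-∀
        degree≥0 : ∀ xs → 0ℤ ≤ degree (all k) xs
        degree≥0 xs = ∑-≥0 pts λ y → 0≤* (ε≥0 y) (adj≥0 (all k) xs y)
        small : ∀ {x} → 0ℤ ≤ x → (e : Dec (x < K)) → ⟦ e ⟧ * (x * x) ≤ K * K
        small {x} x≥0 (yes p) = ≤-trans (≤-reflexive (ℤₚ.*-identityˡ (x * x))) (≤-* x≥0 (<⇒≤ K>0) (<⇒≤ p) (<⇒≤ p))
        small {x} x≥0 (no _)  = ≤-trans (≤-reflexive (ℤₚ.*-zeroˡ (x * x))) (0≤sq K)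

      ∑g≤ : ∑ pts (λ u → ∑ pts (g u)) ≤ n * n
      ∑g≤ = ≤-trans (∑-mono pts λ u → ∑-mono pts λ v → g≤ u v) (≤-reflexive (trans (∑-** pts pts ε ε) (cong₂ _*_ ∑ε≡n ∑ε≡n)))

      n^d : n ℤ.^ d ≡ (+ 96) ℤ.^ d * A₀ ℤ.^ d * (Q′ * Q′) * Q′ ℤ.^ d
      n^d = trans (cong (ℤ._^ d) n≡) (^-product (+ 96) A₀ q Q′ d)

      scarce : + 4 * + D * (K * K * n ℤ.^ k) ≤ + 2 * (A ℤ.^ k * (n * n))
      scarce = balance {A₀} {Q′} {n} {+ D} {K} (^-* A₀ Q′ d) n^d (0≤* (^-≥0 A₀≥0 d) (^-≥0 Q′≥0 d)) A₀²≥

      -- Both requirements on a pair in one number: a cost below X^k bounds the scarcity by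
      -- X^k/(4D), and it forces X > A.
      cost : V → V → ℤ
      cost u v = + 4 * + D * scarcity u v + A ℤ.^ k

      -- In units of A^k·n² the costs are at most 2 + 1, by `scarce` and `∑g≤`, while `^-tangent`
      -- turns the large sum of codegrees into a gain of at least 5 - 1.
      selection : ∑ pts (λ u → ∑ pts (λ v → g u v * cost u v)) < ∑ pts (λ u → ∑ pts (λ v → g u v * codegree u v ℤ.^ k))
      selection = ≤-<-trans costs (<-≤-trans gap gains)
        where
        S Σg B : ℤ
        S = ∑ pts (λ u → ∑ pts (λ v → g u v * scarcity u v))
        Σg = ∑ pts (λ u → ∑ pts (g u))
        B = A ℤ.^ (1 ℕ.+ d)
        B≥0 : 0ℤ ≤ B
        B≥0 = ^-≥0 A≥0 (1 ℕ.+ d)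
        costs : ∑ pts (λ u → ∑ pts (λ v → g u v * cost u v)) ≤ + 2 * (A * B * (n * n)) + A * B * (n * n)
        costs = ≤-trans (≤-reflexive (trans (∑-cong pts λ u → trans (∑-cong pts λ v → spread (g u v) (+ 4 * + D) (scarcity u v) (A * B)) (trans (∑-+ pts _ _) (cong₂ _+_ (∑-* pts (+ 4 * + D) _) (∑-* pts (A * B) (g u)))))
            (trans (∑-+ pts _ _) (cong₂ _+_ (∑-* pts (+ 4 * + D) _) (∑-* pts (A * B) _)))))
          (ℤₚ.+-mono-≤ (≤-trans (≤-*ˡ {c = + 4 * + D} (0≤* {+ 4} {+ D} 0≤n 0≤n) total-scarcity) scarce) (≤-*ˡ (0≤* A≥0 B≥0) ∑g≤))
          where spread : ∀ g c s b → g * (c * s + b) ≡ c * (g * s) + b * g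
                spread = solve-∀
        gap : + 2 * (A * B * (n * n)) + A * B * (n * n) < + 5 * A * (n * n) * B - A * B * (n * n)
        gap = 1+≤⇒< (≤-via (lem A B (n * n)) (diff≥0 (<⇒1+≤ (*>0 (*>0 A>0 (^>0 A>0 (1 ℕ.+ d))) (*>0 n>0 n>0)))))
          where lem : ∀ a b m → + 5 * a * m * b - a * b * m - (1ℤ + (+ 2 * (a * b * m) + a * b * m)) ≡ a * b * m - (1ℤ + 0ℤ)
                lem = solve-∀
        gains : + 5 * A * (n * n) * B - A * B * (n * n) ≤ ∑ pts (λ u → ∑ pts (λ v → g u v * codegree u v ℤ.^ k))
        gains = ≤-trans (≤-trans (≤-via (lem (+ 5 * A * (n * n)) B good-sum (A * B) (n * n) Σg) (0≤+ (0≤* (diff≥0 good-sum-large) B≥0) (0≤* (0≤* A≥0 B≥0) (diff≥0 ∑g≤))))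
            (≤-reflexive (sym (trans (∑-cong pts λ u → trans (∑-cong pts λ v → spread (g u v) (codegree u v) B (A * B)) (trans (∑-+ pts _ _) (cong₂ _+_ (∑-* pts B _) (∑-* pts (- (A * B)) (g u)))))
              (trans (∑-+ pts _ _) (cong₂ _+_ (∑-* pts B _) (∑-* pts (- (A * B)) _)))))))
          (∑-mono pts λ u → ∑-mono pts λ v → ≤-*ˡ (g≥0 u v) (^-tangent A≥0 (X≥0 u v) (1 ℕ.+ d)))
          where lem : ∀ a b s c m w → b * s + - c * w - (a * b - c * m) ≡ (s - a) * b + c * (m - w)
                lem = solve-∀
                spread : ∀ g x b c → g * (x * b - c) ≡ b * (g * x) + - c * g
                spread = solve-∀

      select : ∀ {u v} → g u v * cost u v < g u v * codegree u v ℤ.^ k → Goal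
      select {u} {v} p = pair-shatters {u} {v} (proj₁ u-split) (proj₁ v-split) (proj₁ good) (proj₂ good) rich′ (≤-<-trans A≥0 A<X) few-poor′
        where
        X = codegree u v
        cheap : cost u v < X ℤ.^ k
        cheap = ≰⇒> λ r → <-irrefl refl (<-≤-trans p (≤-*ˡ (g≥0 u v) r))
        g>0 : 0ℤ < g u v
        g>0 = ≰⇒> λ r → let e = ≤-antisym r (g≥0 u v) in <-irrefl (trans (trans (cong (_* cost u v) e) (ℤₚ.*-zeroˡ (cost u v))) (sym (trans (cong (_* X ℤ.^ k) e) (ℤₚ.*-zeroˡ (X ℤ.^ k))))) p
        u-split : u ∈ E × 0ℤ < ε v * (⟦ good? u v ⟧ * 1ℤ)
        u-split = ε-true {u} (<-≤-trans g>0 (≤-reflexive (lem (ε u) (ε v) ⟦ good? u v ⟧)))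
          where lem : ∀ a b c → a * b * c ≡ a * (b * (c * 1ℤ))
                lem = solve-∀
        v-split : v ∈ E × 0ℤ < ⟦ good? u v ⟧ * 1ℤ
        v-split = ε-true {v} (proj₂ u-split)
        good : dist v u ≢ 𝟘 × dist v u ≢ 4t
        good = proj₁ (pos-split (good? u v) (proj₂ v-split))
        A<X : A < X
        A<X = ≰⇒> λ X≤A → <-irrefl refl (<-≤-trans cheap (≤-trans (^-mono (X≥0 u v) X≤A k) (≤-via (lem (+ 4 * + D * scarcity u v) (A ℤ.^ k)) (0≤* {+ 4 * + D} (0≤* {+ 4} {+ D} 0≤n 0≤n) (scarcity≥0 u v)))))
          where lem : ∀ s a → s + a - a ≡ s
                lem = solve-∀
        rich′ : K * Q′ ≤ X
        rich′ = ≤-trans (≤-*ʳ Q′≥0 A₀≥K) (<⇒≤ A<X)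
        few-poor′ : + 4 * + D * scarcity u v ≤ X ℤ.^ k
        few-poor′ = ≤-trans (≤-via (lem (+ 4 * + D * scarcity u v) (A ℤ.^ k)) (^-≥0 A≥0 k)) (<⇒≤ cheap)
          where lem : ∀ s a → s + a - s ≡ a
                lem = solve-∀

    spatial : Goal
    spatial = let (u , _ , p) = ∑-exists pts _ _ selection
                  (v , _ , r) = ∑-exists pts _ _ p
              in select {u} {v} r

-- The size conditions

pos-^ : ∀ m k → + (m ℕ.^ k) ≡ (+ m) ℤ.^ k
pos-^ m zero    = refl
pos-^ m (suc k) = trans (pos-* m (m ℕ.^ k)) (cong (+ m *_) (pos-^ m k))

square-cancel : ∀ {a b} → 0ℤ ≤ b → a * a ≤ b * b → a ≤ b
square-cancel {a} {b} b≥0 p = ≮⇒≥ λ b<a → <-irrefl refl (<-≤-trans (1+≤⇒< (≤-via (lem a b) (0≤+ (0≤* b≥0 (diff≥0 (<⇒1+≤ b<a))) (0≤+ (0≤* (≤-trans b≥0 (<⇒≤ b<a)) (diff≥0 (<⇒1+≤ b<a))) (0≤+ b≥0 (diff≥0 (<⇒1+≤ (≤-<-trans b≥0 b<a)))))))) p)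
  where lem : ∀ a b → a * a - (1ℤ + b * b) ≡ b * (a - (1ℤ + b)) + (a * (a - (1ℤ + b)) + (b + (a - (1ℤ + 0ℤ))))
        lem = solve-∀

root-cancel : ∀ m .{{_ : ℕ.NonZero m}} {x n} → x ℕ.^ m ℕ.≤ n ℕ.^ m → x ℕ.≤ n
root-cancel m p = ℕₚ.≮⇒≥ λ n<x → ℕₚ.<-irrefl refl (ℕₚ.<-≤-trans (ℕₚ.^-monoˡ-< m n<x) p)

ℕ-^-* : ∀ a b m → (a ℕ.* b) ℕ.^ m ≡ a ℕ.^ m ℕ.* b ℕ.^ m
ℕ-^-* a b zero    = refl
ℕ-^-* a b (suc m) = trans (cong (a ℕ.* b ℕ.*_) (ℕ-^-* a b m)) (lem a b (a ℕ.^ m) (b ℕ.^ m))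
  where lem : ∀ a b c d → a ℕ.* b ℕ.* (c ℕ.* d) ≡ a ℕ.* c ℕ.* (b ℕ.* d)
        lem = ℕSolver.solve-∀

size-root : ∀ m .{{_ : ℕ.NonZero m}} {C q r n} s → 1 ℕ.≤ q → s ℕ.* m ℕ.≤ r → C ℕ.^ m ℕ.* q ℕ.^ r ℕ.≤ n ℕ.^ m → C ℕ.* q ℕ.^ s ℕ.≤ n
size-root m {C} {q} {r} {n} s q≥1 s≤ p = root-cancel m (begin
  (C ℕ.* q ℕ.^ s) ℕ.^ m ≡⟨ ℕ-^-* C (q ℕ.^ s) m ⟩
  C ℕ.^ m ℕ.* (q ℕ.^ s) ℕ.^ m ≡⟨ cong (C ℕ.^ m ℕ.*_) (ℕₚ.^-*-assoc q s m) ⟩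
  C ℕ.^ m ℕ.* q ℕ.^ (s ℕ.* m) ≤⟨ ℕₚ.*-monoʳ-≤ (C ℕ.^ m) (ℕₚ.^-monoʳ-≤ q {{ℕ.>-nonZero q≥1}} s≤) ⟩
  C ℕ.^ m ℕ.* q ℕ.^ r ≤⟨ p ⟩
  n ℕ.^ m ∎)
  where open ℕₚ.≤-Reasoning

-- The root is raised by one only when the lower bound fails. The upper bound then survives because
-- (1 + r)² ≤ 2r² + 2.
approximate-root : ∀ m → ∃[ r ] (0ℤ ≤ r × + suc m ≤ r * r × r * r ≤ + 4 * + suc m)
approximate-root zero    = 1ℤ , 0≤n , ≤-refl , ℤ.+≤+ (ℕ.s≤s ℕ.z≤n)
approximate-root (suc m) = let (r , r≥0 , lower , upper) = approximate-root m in step r r≥0 lower upper (+ suc (suc m) ℤₚ.≤? r * r)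
  where
  step : ∀ r → 0ℤ ≤ r → + suc m ≤ r * r → r * r ≤ + 4 * + suc m → Dec (+ suc (suc m) ≤ r * r) → ∃[ r ] (0ℤ ≤ r × + suc (suc m) ≤ r * r × r * r ≤ + 4 * + suc (suc m))
  step r r≥0 lower upper (yes p) = r , r≥0 , p , ≤-trans upper (≤-*ˡ {c = + 4} 0≤n (ℤ.+≤+ (ℕₚ.n≤1+n (suc m))))
  step r r≥0 lower upper (no ¬p) = 1ℤ + r , 0≤+ {1ℤ} 0≤n r≥0 ,
      ≤-via (lem r (+ suc m)) (0≤+ (diff≥0 lower) (0≤* {+ 2} 0≤n r≥0)) ,
      ≤-via (lem′ r (+ suc m)) (0≤+ (0≤* {+ 2} 0≤n (diff≥0 (ℤₚ.i<j⇒i≤pred[j] (≰⇒> ¬p)))) (0≤+ (0≤* {+ 2} {+ suc m} 0≤n 0≤n) (0≤+ (0≤sq (r - 1ℤ)) (0≤n {2}))))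
    where
    lem : ∀ r m → (1ℤ + r) * (1ℤ + r) - (1ℤ + m) ≡ r * r - m + + 2 * r
    lem = solve-∀
    lem′ : ∀ r m → + 4 * (1ℤ + m) - (1ℤ + r) * (1ℤ + r) ≡ + 2 * (- 1ℤ + (1ℤ + m) - r * r) + (+ 2 * m + ((r - 1ℤ) * (r - 1ℤ) + + 2))
    lem′ = solve-∀

module PlanarSize {c q n Λ : ℤ} (c≥16 : + 16 ≤ c) (q≥2 : + 2 ≤ q) (n≥0 : 0ℤ ≤ n) (n≤q² : n ≤ q * q) (Λ≥0 : 0ℤ ≤ Λ) (Λ²≥ : + 4 * q ≤ Λ * Λ) (Λ²≤ : Λ * Λ ≤ + 4 * (+ 4 * q))
                  (large : (+ 2 * c) ℤ.^ 4 * q ℤ.^ 7 ≤ n ℤ.^ 4) where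
  private
    q≥0 : 0ℤ ≤ q
    q≥0 = ≤-trans 0≤n q≥2

    c≥0 : 0ℤ ≤ c
    c≥0 = ≤-trans 0≤n c≥16

    q>0 : 0ℤ < q
    q>0 = <-≤-trans (ℤ.+<+ (ℕ.s≤s ℕ.z≤n)) q≥2

    -- Since n ≤ q², the hypothesis reads (2c)⁴q⁷ ≤ n⁴ ≤ q⁸, which excludes small fields.
    q≥16 : + 16 ≤ q
    q≥16 = ≤-trans (^-mono {+ 2} {+ 2 * c} 0≤n (≤-*ˡ {1ℤ} {c} {+ 2} 0≤n (≤-trans (ℤ.+≤+ (ℕ.s≤s ℕ.z≤n)) c≥16)) 4) (*-cancel-≤ {c = q ℤ.^ 7} (^>0 q>0 7)
      (≤-trans (≤-reflexive (ℤₚ.*-comm (q ℤ.^ 7) ((+ 2 * c) ℤ.^ 4))) (≤-trans large (≤-trans (^-mono n≥0 n≤q² 4) (≤-reflexive (lem q))))))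
      where lem : ∀ q → q * q * (q * q * (q * q * (q * q * 1ℤ))) ≡ q * (q * (q * (q * (q * (q * (q * 1ℤ)))))) * q
            lem = solve-∀

    c²≥ : + 256 ≤ c * c
    c²≥ = ≤-* {+ 16} {c} {+ 16} {c} 0≤n c≥0 c≥16 c≥16

  Λ≥7 : + 7 ≤ Λ
  Λ≥7 = ≮⇒≥ λ Λ<7 → <-irrefl refl (<-≤-trans {+ 36} {+ 64} (ℤ.+<+ (ℕₚ.m≤m+n 37 27)) (≤-trans (≤-*ˡ {+ 16} {q} {+ 4} 0≤n q≥16) (≤-trans Λ²≥ (≤-* {Λ} {+ 6} {Λ} {+ 6} Λ≥0 0≤n (ℤₚ.i<j⇒i≤pred[j] Λ<7) (ℤₚ.i<j⇒i≤pred[j] Λ<7)))))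

  private
    -- The hypothesis n ≥ 2c·q^(7/4) with q^(1/4) replaced by √Λ/2: the factor 2⁴ in (2c)⁴ pays for
    -- Λ² ≤ 16q.
    n²≥ : c * c * (q * q * q) * Λ ≤ n * n
    n²≥ = square-cancel (0≤sq n) (≤-via (lem c q n Λ) (0≤+ (diff≥0 large) (0≤* (0≤* (0≤sq (c * c)) (0≤sq (q * q * q))) (diff≥0 Λ²≤))))
      where lem : ∀ c q n L → n * n * (n * n) - c * c * (q * q * q) * L * (c * c * (q * q * q) * L) ≡
                    n * (n * (n * (n * 1ℤ))) - + 2 * c * (+ 2 * c * (+ 2 * c * (+ 2 * c * 1ℤ))) * (q * (q * (q * (q * (q * (q * (q * 1ℤ))))))) + c * c * (c * c) * (q * q * q * (q * q * q)) * (+ 4 * (+ 4 * q) - L * L)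
            lem = solve-∀

    q³≥0 : 0ℤ ≤ q * q * q
    q³≥0 = 0≤* (0≤sq q) q≥0

    n≥ : + 4 * q * Λ ≤ n
    n≥ = square-cancel n≥0 (≤-via (lem c q n Λ) (0≤+ (0≤+ (diff≥0 n²≥) (0≤* {+ 16 * (q * q)} (0≤* {+ 16} 0≤n (0≤sq q)) (diff≥0 Λ²≤)))
        (0≤+ (0≤* q³≥0 (0≤* Λ≥0 (diff≥0 c²≥))) (0≤* {+ 256} 0≤n (0≤* q³≥0 (diff≥0 {1ℤ} {Λ} (≤-trans (ℤ.+≤+ (ℕ.s≤s ℕ.z≤n)) Λ≥7)))))))
      where lem : ∀ c q n L → n * n - + 4 * q * L * (+ 4 * q * L) ≡ n * n - c * c * (q * q * q) * L + + 16 * (q * q) * (+ 4 * (+ 4 * q) - L * L) + (q * q * q * (L * (c * c - + 256)) + + 256 * (q * q * q * (L - 1ℤ)))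
            lem = solve-∀

  many : ∀ {ℓ} → (q - 1ℤ) * (n * n) - Λ * (q * q) * n ≤ q * q * ℓ → + 8 * (q * q) * Λ ≤ ℓ
  many {ℓ} p = *-cancel-≤ {c = + 4 * (q * q)} (*>0 {+ 4} (ℤ.+<+ (ℕ.s≤s ℕ.z≤n)) (*>0 q>0 q>0)) (≤-via (lem c q n Λ ℓ) (0≤+ (0≤+ (0≤* {+ 4} 0≤n (diff≥0 p)) (0≤* (0≤* {+ 2} 0≤n (diff≥0 q≥2)) (0≤sq n)))
      (0≤+ (0≤* q≥0 (0≤* n≥0 (diff≥0 n≥))) (0≤* q≥0 (0≤+ (diff≥0 n²≥) (0≤* (0≤* q³≥0 Λ≥0) (0≤+ (diff≥0 c²≥) (0≤n {224}))))))))
    where lem : ∀ c q n L l → + 4 * (q * q) * l - + 4 * (q * q) * (+ 8 * (q * q) * L) ≡ + 4 * (q * q * l - ((q - 1ℤ) * (n * n) - L * (q * q) * n)) + + 2 * (q - + 2) * (n * n) +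
                (q * (n * (n - + 4 * q * L)) + q * (n * n - c * c * (q * q * q) * L + q * q * q * L * (c * c - + 256 + + 224)))
          lem = solve-∀

abstract
  -- This is K′: one factor for the D coordinates of a tuple, one for its 2^k masks, and 4 to keep
  -- the expected number of such defects below 1/4.
  maskConstant : ℕ → ℕ
  maskConstant d = 4 ℕ.* ((3 ℕ.+ d) ℕ.* 2 ℕ.^ (2 ℕ.+ d))

  mask-bound : ∀ d → + 4 * (+ (3 ℕ.+ d) * (+ 2) ℤ.^ (2 ℕ.+ d)) ≤ + maskConstant d
  mask-bound d = ≤-reflexive (sym (trans (pos-* 4 ((3 ℕ.+ d) ℕ.* 2 ℕ.^ (2 ℕ.+ d))) (cong (+ 4 *_) (trans (pos-* (3 ℕ.+ d) (2 ℕ.^ (2 ℕ.+ d))) (cong (+ (3 ℕ.+ d) *_) (pos-^ 2 (2 ℕ.+ d)))))))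

  mask-pos : ∀ d → 0ℤ < + maskConstant d
  mask-pos d = ℤ.+<+ (ℕₚ.≤-trans (ℕₚ.m^n>0 2 (2 ℕ.+ d)) (ℕₚ.≤-trans (ℕₚ.m≤n*m (2 ℕ.^ (2 ℕ.+ d)) (3 ℕ.+ d)) (ℕₚ.m≤n*m ((3 ℕ.+ d) ℕ.* 2 ℕ.^ (2 ℕ.+ d)) 4)))

  -- This is A₀ = 4D·K·96^d, large enough for K ≤ A₀ and, squared, for 4D·K²·96^d ≤ 2A₀², where 96^d
  -- comes from n^d.
  spatialConstant : ℕ → ℕ
  spatialConstant d = 4 ℕ.* (3 ℕ.+ d) ℕ.* (4 ℕ.* (3 ℕ.+ d) ℕ.* maskConstant d) ℕ.* 96 ℕ.^ d

  spatialConstant≡ : ∀ d → + spatialConstant d ≡ + 4 * + (3 ℕ.+ d) * (+ 4 * + (3 ℕ.+ d) * + maskConstant d) * (+ 96) ℤ.^ d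
  spatialConstant≡ d = factor 4 (3 ℕ.+ d) (maskConstant d) 96
    where
    factor : ∀ a D k b → + (a ℕ.* D ℕ.* (a ℕ.* D ℕ.* k) ℕ.* b ℕ.^ d) ≡ + a * + D * (+ a * + D * + k) * (+ b) ℤ.^ d
    factor a D k b = trans (pos-* (a ℕ.* D ℕ.* (a ℕ.* D ℕ.* k)) (b ℕ.^ d)) (cong₂ _*_ (trans (pos-* (a ℕ.* D) (a ℕ.* D ℕ.* k)) (cong₂ _*_ (pos-* a D) (trans (pos-* (a ℕ.* D) k) (cong (_* + k) (pos-* a D))))) (pos-^ b d))

module _ (d : ℕ) where
  private
    K c : ℤ
    K = + 4 * + (3 ℕ.+ d) * + maskConstant d
    c = (+ 96) ℤ.^ d

  private
    K≥0 : 0ℤ ≤ K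
    K≥0 = 0≤* {+ 4 * + (3 ℕ.+ d)} {+ maskConstant d} (0≤* {+ 4} {+ (3 ℕ.+ d)} 0≤n 0≤n) 0≤n

    c≥1 : 1ℤ ≤ c
    c≥1 = ≤-trans (≤-reflexive (sym (ℤₚ.^-zeroˡ d))) (^-mono {1ℤ} {+ 96} 0≤n (ℤ.+≤+ (ℕ.s≤s ℕ.z≤n)) d)

    D≥0 : 0ℤ ≤ + d
    D≥0 = 0≤n

  degree-bound : K ≤ + spatialConstant d
  degree-bound = ≤-trans (≤-via (lem K (+ d) c) (0≤* K≥0 (0≤+ (0≤* {+ 12 + + 4 * + d} (0≤+ {+ 12} 0≤n (0≤* {+ 4} 0≤n D≥0)) (diff≥0 c≥1)) (0≤+ {+ 11} 0≤n (0≤* {+ 4} 0≤n D≥0))))) (≤-reflexive (sym (spatialConstant≡ d)))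
    where lem : ∀ K d c → + 4 * (+ 3 + d) * K * c - K ≡ K * ((+ 12 + + 4 * d) * (c - 1ℤ) + (+ 11 + + 4 * d))
          lem = solve-∀

  scarcity-bound : + 4 * + (3 ℕ.+ d) * (K * K) * c ≤ + 2 * (+ spatialConstant d * + spatialConstant d)
  scarcity-bound = ≤-via (trans (cong (λ a → + 2 * (a * a) - + 4 * + (3 ℕ.+ d) * (K * K) * c) (spatialConstant≡ d)) (lem K (+ d) c)) (0≤* {+ 4 * + (3 ℕ.+ d)} (0≤* {+ 4} {+ (3 ℕ.+ d)} 0≤n 0≤n) (0≤* (0≤sq K) (0≤* (≤-trans (0≤n {1}) c≥1)
      (0≤+ (0≤* {+ 24 + + 8 * + d} (0≤+ {+ 24} 0≤n (0≤* {+ 8} 0≤n D≥0)) (diff≥0 c≥1)) (0≤+ {+ 23} 0≤n (0≤* {+ 8} 0≤n D≥0))))))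
    where lem : ∀ K d c → + 2 * (+ 4 * (+ 3 + d) * K * c * (+ 4 * (+ 3 + d) * K * c)) - + 4 * (+ 3 + d) * (K * K) * c ≡ + 4 * (+ 3 + d) * (K * K * (c * ((+ 24 + + 8 * d) * (c - 1ℤ) + (+ 23 + + 8 * d))))
          lem = solve-∀

-- The plane and the higher dimensions assembled

module _ (F : FiniteField) (odd : ¬ (2 ∣ order F)) (t : ⟨ F ⟩) (t≢0 : t ≢ FiniteField.0# F) where
  open Field F
  open Geometry F

  private
    2≢0 : 𝟙 ⊕ 𝟙 ≢ 𝟘
    2≢0 = odd⇒2≢0 odd

  Shattered : ∀ {d} → List (Vec Carrier d) → Set
  Shattered {d} E = ∃[ C ] (SubsetOf F E C × Shatters F t E C × length C ≡ d)

  Shattered-mono : ∀ {d} {E E′ : List (Vec Carrier d)} → (∀ {x} → x ∈ E → x ∈ E′) → Shattered E → Shattered E′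
  Shattered-mono E⊆ (C , (C! , C⊆) , shatters , size) = C , (C! , λ x x∈ → E⊆ (C⊆ x x∈)) , (λ f → let (u , v , u∈ , v∈ , rest) = shatters f in u , v , E⊆ u∈ , E⊆ v∈ , rest) , size

  vc≡ : ∀ {d} {E : List (Vec Carrier d)} → Shattered E → VCdim≡ F t E d
  vc≡ s = s , UpperBound.vc≤ 2≢0 t

  planar-case : (E : List (Vec Carrier 2)) → Unique E → SizeCondition 2 32 card (length E) → Shattered E
  -- The predecessor appears because `approximate-root m` approximates the root of m + 1; what is
  -- wanted is the root of 4q.
  planar-case E E! large = from-root (approximate-root (ℕ.pred (4 ℕ.* card)))
    where
    open Radon F 2≢0
    open Mixing F 2≢0
    open Shattering F 2≢0 t
    open Indicator E E!
    n : ℤ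
    n = + length E
    large′ : (+ 2 * + 16) ℤ.^ 4 * q ℤ.^ 7 ≤ n ℤ.^ 4
    large′ = ≤-trans (≤-reflexive (sym (trans (pos-* (32 ℕ.^ 4) (card ℕ.^ 7)) (cong₂ _*_ (pos-^ 32 4) (pos-^ card 7))))) (≤-trans (ℤ.+≤+ large) (≤-reflexive (pos-^ (length E) 4)))
    n≤q² : n ≤ q * q
    n≤q² = ≤-trans (≤-reflexive (sym ∑ε)) (≤-trans (∑-mono (allPoints 2) ε≤1) (≤-reflexive (trans (∑-vecs-const 2 elements 1ℤ) (lem q))))
      where lem : ∀ q → q * (q * 1ℤ) * 1ℤ ≡ q * q
            lem = solve-∀
    4q : + suc (ℕ.pred (4 ℕ.* card)) ≡ + 4 * q
    4q = trans (cong +_ (ℕₚ.suc-pred (4 ℕ.* card) {{ℕ.>-nonZero (ℕₚ.≤-trans (ℕₚ.≤-trans (ℕₚ.n≤1+n 1) card>1) (ℕₚ.m≤n*m card 4))}})) (pos-* 4 card)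
    from-root : ∃[ r ] (0ℤ ≤ r × + suc (ℕ.pred (4 ℕ.* card)) ≤ r * r × r * r ≤ + 4 * + suc (ℕ.pred (4 ℕ.* card))) → Shattered E
    from-root (Λ , Λ≥0 , lower , upper) = Planar.planar F 2≢0 t t≢0 E E! Λ Λ≥7 Λ²≥ (many (subst (λ n → (q - 1ℤ) * (n * n) - Λ * (q * q) * n ≤ q * q * edges t ε ε) ∑ε (edges₂ Λ (≤-trans (ℤ.+≤+ (ℕ.s≤s (ℕ.s≤s ℕ.z≤n))) Λ≥7) Λ²≥ t≢0 ε ε-idem)))
      where
      Λ²≥ : + 4 * q ≤ Λ * Λ
      Λ²≥ = ≤-trans (≤-reflexive (sym 4q)) lower
      open PlanarSize {+ 16} {q} {n} {Λ} ≤-refl (ℤ.+≤+ card>1) 0≤n n≤q² Λ≥0 Λ²≥ (≤-trans upper (≤-reflexive (cong (+ 4 *_) 4q))) large′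

  spatial-case : ∀ {d} (E : List (Vec Carrier (3 ℕ.+ d))) → Unique E → 96 ℕ.* spatialConstant d ℕ.* card ℕ.^ (2 ℕ.+ d) ℕ.≤ length E → Shattered E
  -- Only the first m points of E are kept, since `balance` needs the size exactly. Centres found
  -- among them lie in E as well, and a shattered set of size d stays shattered when E grows.
  spatial-case {d} E E! large = Shattered-mono (λ x∈ → subst (_ ∈_) (Listₚ.take++drop≡id m E) (∈-++⁺ˡ x∈))
      (Spatial.spatial F 2≢0 t t≢0 (List.take m E) (Uniqueₚ.take⁺ m E!) (+ maskConstant d) (mask-pos d) (mask-bound d) (+ spatialConstant d) (degree-bound d) (scarcity-bound d) size)
    where
    m : ℕ
    m = 96 ℕ.* spatialConstant d ℕ.* card ℕ.^ (2 ℕ.+ d)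
    size : + length (List.take m E) ≡ + 96 * + spatialConstant d * (q * q) * q ℤ.^ d
    size = begin
      + length (List.take m E) ≡⟨ cong +_ (trans (Listₚ.length-take m E) (ℕₚ.m≤n⇒m⊓n≡m large)) ⟩
      + m ≡⟨ trans (pos-* (96 ℕ.* spatialConstant d) (card ℕ.^ (2 ℕ.+ d))) (cong₂ _*_ (pos-* 96 (spatialConstant d)) (pos-^ card (2 ℕ.+ d))) ⟩
      + 96 * + spatialConstant d * q ℤ.^ (2 ℕ.+ d) ≡⟨ lem (+ 96 * + spatialConstant d) q (q ℤ.^ d) ⟩
      + 96 * + spatialConstant d * (q * q) * q ℤ.^ d ∎
      where
      open ≡-Reasoning
      lem : ∀ a q x → a * (q * (q * x)) ≡ a * (q * q) * x
      lem = solve-∀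

  card≥1 : 1 ℕ.≤ card
  card≥1 = ℕₚ.≤-trans (ℕₚ.n≤1+n 1) card>1

theorem1 : (d : ℕ) → 2 ℕ.≤ d →
  ∃[ C ] ((F : FiniteField) → ¬ (2 ∣ order F) →
    (t : ⟨ F ⟩) → t ≢ FiniteField.0# F →
    (E : List (Point F d)) → Unique E →
    SizeCondition d C (order F) (length E) →
    VCdim≡ F t E d)
theorem1 0 ()
theorem1 1 (ℕ.s≤s ())
theorem1 2 _ = 32 , λ F odd t t≢0 E E! large → vc≡ F odd t t≢0 (planar-case F odd t t≢0 E E! large)
-- The root of the size condition is taken with the integral exponent d - 1, which lies below 7/3
-- for d = 3 and below d - 1/(d-1) for d ≥ 4.
theorem1 3 _ = 96 ℕ.* spatialConstant 0 , λ F odd t t≢0 E E! large → vc≡ F odd t t≢0 (spatial-case F odd t t≢0 E E!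
  (size-root 3 {96 ℕ.* spatialConstant 0} 2 (card≥1 F odd t t≢0) (ℕₚ.n≤1+n 6) large))
theorem1 (suc (suc (suc (suc d)))) _ = 96 ℕ.* spatialConstant (suc d) , λ F odd t t≢0 E E! large → vc≡ F odd t t≢0 (spatial-case F odd t t≢0 E E!
  (size-root (3 ℕ.+ d) {96 ℕ.* spatialConstant (suc d)} (3 ℕ.+ d) (card≥1 F odd t t≢0) (ℕₚ.m≤n+m ((3 ℕ.+ d) ℕ.* (3 ℕ.+ d)) (2 ℕ.+ d)) large))
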